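{- For $(i,j,k)\in\mathbf{N}^3\setminus\{(3,3,4),(4,4,4)\}$, there is a planar graph $G$ with $(\mathrm{ch}_{sep}(G),\mathrm{ch}_{ad}(G),\chi_{\nleftrightarrow}(G))=(i,j,k)$ if and only if $$(i,j,k)\in\{(1,1,1),(2,2,2),(2,3,3),(3,3,3),(3,4,4)\}.$$
   Context: Graphs are finite, simple and have at least one vertex; $\mathbf{N}$ is the set of positive integers. $\mathrm{ch}_{sep}(G)$ (separation choosability) is the smallest $k$ such that for every assignment of lists $L(v)$ of $k$ colors to the vertices with $|L(x)\cap L(y)|\le 1$ for every edge $xy$, there is a proper coloring $\varphi$ of $G$ with $\varphi(v)\in L(v)$ for all $v$. Given an edge coloring $f$ of $G$ (an arbitrary map from edges to colors, not necessarily proper), a vertex coloring $c$ (not necessarily proper) is adapted to $f$ if no edge $xy$ satisfies $c(x)=c(y)=f(xy)$. $\mathrm{ch}_{ad}(G)$ (adaptable choosability) is the smallest $k$ such that for every edge coloring $f$ and every assignment of lists $L(v)$ of $k$ colors to the vertices, there is a coloring $c$ adapted to $f$ with $c(v)\in L(v)$ for all $v$. A local $k$-partition of $G$ is a collection $\{c_v\}_{v\in V(G)}$ of maps $c_v : E(v)\to\{1,\dots,k\}$, where $E(v)$ is the set of edges incident with $v$. $G$ is conflict $\{c_v\}$-colorable if there is a map $\varphi : V(G)\to\{1,\dots,k\}$ such that no edge $e=xy$ satisfies both $\varphi(x)=c_x(e)$ and $\varphi(y)=c_y(e)$. $\chi_{\nleftrightarrow}(G)$ (single conflict chromatic number) is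 the smallest $k$ such that $G$ is conflict $\{c_v\}$-colorable for every local $k$-partition. -}

module Defs where

open import Data.Bool using (Bool; false; T)
open import Data.Empty using (⊥)
open import Data.Fin using (Fin; _<_)
open import Data.List using (List; []; _∷_; _++_; length; filter)
open import Data.List.Membership.Propositional using (_∈_)
import Data.List.Membership.DecPropositional as DecMembership
open import Data.List.Relation.Unary.Unique.Propositional using (Unique)
open import Data.Nat using (ℕ; NonZero; _≤_)
import Data.Nat.Properties as ℕₚ
open import Data.Product using (Σ-syntax; ∃-syntax; _×_; _,_)
open import Data.Rational using (ℚ; 0ℚ; 1ℚ; _+_; _*_; _-_) renaming (_≤_ to _≤ℚ_)
open import Data.Sum using (_⊎_; inj₁; inj₂)
open import Data.Unit using (⊤)
open import Relation.Binary.PropositionalEquality using (_≡_; _≢_; refl)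
open import Relation.Nullary using (¬_)

open DecMembership ℕₚ._≟_ using (_∈?_)

record Graph : Set where
  field
    order     : ℕ
    {{nonEmpty}} : NonZero order
    adj       : Fin order → Fin order → Bool
    adj-sym   : ∀ x y → adj x y ≡ adj y x
    adj-irrefl : ∀ x → adj x x ≡ false

  Vertex : Set
  Vertex = Fin order

  -- Each undirected edge is represented exactly once, by listing its smaller
  -- end first; this order carries no meaning.
  record Edge : Set where
    constructor edge
    field
      end₁ end₂ : Vertex
      ordered   : end₁ < end₂
      adjacent  : T (adj end₁ end₂)

  open Edge public

  _∈ᵉ_ : Vertex → Edge → Set
  v ∈ᵉ e = v ≡ end₁ e ⊎ v ≡ end₂ e

  -- E(v)
  EdgesAt : Vertex → Set
  EdgesAt v = Σ[ e ∈ Edge ] v ∈ᵉ e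

  at-end₁ : (e : Edge) → EdgesAt (end₁ e)
  at-end₁ e = e , inj₁ refl

  at-end₂ : (e : Edge) → EdgesAt (end₂ e)
  at-end₂ e = e , inj₂ refl

-- Planarity: edges are drawn as simple polygonal arcs.  Every planar graph has
-- such a drawing, and its vertices and bends can be moved to rational points.
-- Disjointness may be tested on rational points only: two segments with
-- rational ends that meet at all meet in a rational point, and if they have
-- more than one common point they have more than one rational one.

Point : Set
Point = ℚ × ℚ

OnSegment : Point → Point → Point → Set
OnSegment (x₁ , y₁) (x₂ , y₂) p =
  ∃[ t ] 0ℚ ≤ℚ t × t ≤ℚ 1ℚ ×
    p ≡ ((1ℚ - t) * x₁ + t * x₂ , (1ℚ - t) * y₁ + t * y₂)

-- A list of points stands for the polygonal path through them in order.

OnPath : List Point → Point → Set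
OnPath []          p = ⊥
OnPath (a ∷ [])    p = p ≡ a
OnPath (a ∷ b ∷ l) p = OnSegment a b p ⊎ OnPath (b ∷ l) p

-- The path is an arc: no degenerate segment and no self-intersection.
SimplePath : List Point → Set
SimplePath []          = ⊤
SimplePath (a ∷ [])    = ⊤
SimplePath (a ∷ b ∷ l) =
  a ≢ b ×
  (∀ p → OnSegment a b p → OnPath (b ∷ l) p → p ≡ b) ×
  SimplePath (b ∷ l)

record PlaneDrawing (G : Graph) : Set where
  open Graph G
  field
    pos   : Vertex → Point
    bends : Edge → List Point

  arc : Edge → List Point
  arc e = pos (end₁ e) ∷ bends e ++ pos (end₂ e) ∷ []

  field
    pos-injective : ∀ {x y} → pos x ≡ pos y → x ≡ y
    arc-simple    : ∀ e → SimplePath (arc e)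
    vertex-on-arc : ∀ e v → OnPath (arc e) (pos v) → v ∈ᵉ e
    arcs-meet     : ∀ e f → e ≢ f → ∀ p → OnPath (arc e) p → OnPath (arc f) p →
                    ∃[ v ] v ∈ᵉ e × v ∈ᵉ f × p ≡ pos v

Planar : Graph → Set
Planar = PlaneDrawing

-- The colours are natural numbers; since the graphs are finite, only the
-- infinitude of the set of colours matters.

Colour : Set
Colour = ℕ

-- A k-element set of colours.
IsKSet : ℕ → List Colour → Set
IsKSet k l = Unique l × length l ≡ k

-- The size of the intersection of two duplicate-free lists.
∣_∩_∣ : List Colour → List Colour → ℕ
∣ l ∩ m ∣ = length (filter (_∈? m) l)

-- Minimality is among positive integers.  For k = 0 a graph with an edge has
-- no local k-partition at all, so 0 would qualify vacuously in the definition
-- of the single conflict chromatic number.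
IsLeastPositive : (ℕ → Set) → ℕ → Set
IsLeastPositive P k = 1 ≤ k × P k × (∀ m → 1 ≤ m → P m → k ≤ m)

module _ (G : Graph) where
  open Graph G

  ListAssignment : ℕ → (Vertex → List Colour) → Set
  ListAssignment k L = ∀ v → IsKSet k (L v)

  ListColouring : (Vertex → List Colour) → (Vertex → Colour) → Set
  ListColouring L c = ∀ v → c v ∈ L v

  Proper : (Vertex → Colour) → Set
  Proper c = ∀ e → c (end₁ e) ≢ c (end₂ e)

  Separated : (Vertex → List Colour) → Set
  Separated L = ∀ e → ∣ L (end₁ e) ∩ L (end₂ e) ∣ ≤ 1

  SepChoosable : ℕ → Set
  SepChoosable k =
    ∀ L → ListAssignment k L → Separated L → ∃[ c ] Proper c × ListColouring L c

  Adapted : (Edge → Colour) → (Vertex → Colour) → Set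
  Adapted f c = ∀ e → ¬ (c (end₁ e) ≡ c (end₂ e) × c (end₂ e) ≡ f e)

  AdaptablyChoosable : ℕ → Set
  AdaptablyChoosable k =
    ∀ f L → ListAssignment k L → ∃[ c ] Adapted f c × ListColouring L c

  LocalPartition : ℕ → Set
  LocalPartition k = ∀ v → EdgesAt v → Fin k

  ConflictColouring : ∀ {k} → LocalPartition k → (Vertex → Fin k) → Set
  ConflictColouring c φ =
    ∀ e → ¬ (φ (end₁ e) ≡ c (end₁ e) (at-end₁ e) ×
             φ (end₂ e) ≡ c (end₂ e) (at-end₂ e))

  ConflictColourable : ℕ → Set
  ConflictColourable k = ∀ (c : LocalPartition k) → ∃[ φ ] ConflictColouring c φ

  -- ch_sep(G) = k, ch_ad(G) = k and χ_↮(G) = k.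

  IsSepChoosability : ℕ → Set
  IsSepChoosability = IsLeastPositive SepChoosable

  IsAdaptableChoosability : ℕ → Set
  IsAdaptableChoosability = IsLeastPositive AdaptablyChoosable

  IsSingleConflictNumber : ℕ → Set
  IsSingleConflictNumber = IsLeastPositive ConflictColourable

-- Always ch_sep ≤ ch_ad ≤ χ_↮, and the five triples are attained by small
-- graphs consisting of one or two hubs and spokes joined in pairs.  Beyond that:
--
-- If the edges can be oriented with out-degrees at most d, then d + 1 classes
-- suffice, each vertex avoiding its out-edges.  By Hakimi's theorem there is no
-- such orientation only if some set R of vertices spans more than d |R| edges.
-- In a planar graph E ≤ 3 V, so k ≤ 4.  This bound is linear algebra over GF(2):
-- every edge of an even subgraph separates a face inside it from a face outside
-- (inside meaning an odd number of edges below), but with more than 3 V edges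
-- some nonempty even subgraph would have no face inside.
--
-- If j = 2, the graph contains no figure eight, dumbbell, quadruple edge or K₄,
-- up to subdivision, since these have bad lists of size 2.  Removing leaves and
-- cycles then reduces it to theta graphs, where conflicts between two classes
-- are resolved directly, so k = 2.
--
-- If i = 2 but no orientation has out-degrees at most 2, take R with more than
-- 2 |R| edges.  Adding vertices of R one at a time to the side opposite to most
-- of their neighbours (as in Edwards' bound on cuts) gives a connected bipartite
-- graph with two more edges than vertices.  It contains one of the four
-- subdivisions, which as a bipartite graph also has bad lists that are separated.
-- Hence k ≤ 3.

module Submission where

open import Defs
open import Data.Bool using (Bool; true; false; not; _∧_; _xor_; if_then_else_; _∨_)
import Data.Bool as Bool
open import Data.Bool.Properties using (xor-same; xor-assoc; xor-comm; xor-identityʳ; ∧-distribˡ-xor; ∧-distribʳ-xor; ∧-zeroʳ; ∧-assoc; ∧-comm; ¬-not; T-irrelevant; T-≡; ∨-comm)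
open import Data.Empty using (⊥; ⊥-elim)
import Data.Fin as Fin
import Data.Fin.Properties as Finₚ
import Data.Integer as ℤ
import Data.Integer.Properties as ℤₚ
open import Data.List using (List; _++_; length; map; lookup; cartesianProduct; allFin; filter; concatMap)
import Data.List.Membership.DecPropositional as DecMembership
open import Data.List.Membership.Propositional using (_∈_; _∉_; lose)
open import Data.List.Membership.Propositional.Properties using (∈-∃++; ∈-cartesianProduct⁺; ∈-allFin; ∈-lookup; ∈-filter⁺; ∈-filter⁻; ∈-++⁺ʳ; ∈-concatMap⁺; ∈-map⁺; ∈-map⁻; ∈-++⁺ˡ; ∈-++⁻)
open import Data.List.Properties using (length-++; length-map; ++-assoc; unfold-reverse; ++-identityʳ; ∷ʳ-injectiveʳ; length-reverse; map-++; filter-accept; filter-reject)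
open import Data.List.Relation.Binary.Permutation.Propositional using (_↭_; ↭-refl; ↭-trans; ↭-sym; ↭⇒↭ₛ)
open import Data.List.Relation.Binary.Permutation.Propositional.Properties using (++-commutativeMonoid; ↭-reverse; ++⁺)
import Data.List.Relation.Binary.Permutation.Setoid.Properties as ↭ₛ
import Data.List.Relation.Unary.AllPairs.Properties as AllPairsₚ
open import Data.List.Relation.Unary.Any as Any using (Any; here; there; any?; index)
open import Data.List.Relation.Unary.Any.Properties using (lookup-index)
open import Data.List.Relation.Unary.Unique.Propositional using (Unique)
import Data.List.Relation.Unary.Unique.Propositional.Properties as Uniqueₚ
open import Data.Maybe using (just; is-just)
import Data.Nat as ℕ
import Data.Nat.Coprimality as Coprimality
import Data.Nat.Properties as ℕₚ
open import Data.Product using (_×_; _,_; ∃-syntax; proj₁; proj₂)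
import Data.Product.Properties as ×ₚ
open import Data.Sum as Sum using (_⊎_; inj₁; inj₂; [_,_]′)
open import Function using (_∘_; Injective; Equivalence)
open import Function.Bundles using (_⇔_; mk⇔)
open import Relation.Binary using (Tri; tri<; tri≈; tri>)
open import Relation.Binary.PropositionalEquality
open import Relation.Nullary using (¬_; Dec; yes; no; does)
open import Relation.Nullary.Decidable using (⌊_⌋; dec⇒maybe; _×-dec_; ¬?; _⊎-dec_; dec-true; dec-false)
open import Tactic.RingSolver using (solve-∀)
open import Tactic.RingSolver.Core.AlmostCommutativeRing using (AlmostCommutativeRing; fromCommutativeRing)

-- No face is ever constructed and no Jordan curve theorem is used. A face is known only through the
-- corners between consecutive darts of a vertex: the parity of the chosen edges that a ray from the
-- corner straight down meets. Evenness costs V equations over GF(2). The parity is constant along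
-- d, φ d, φ² d, three distinct darts, so among the 2 E darts at most 2 E / 3 more equations make it
-- vanish everywhere. If E > V + 2 E / 3, a nonzero solution is left, contradicting that the parity
-- differs across each of its edges; hence the bound 3 V.
--
-- The obstacle in the separated case is that lists must be separated along every edge of the graph,
-- not only along the subdivision found. Fresh colours keep most lists apart. Equal lists threaten
-- only near branch vertices, and bipartiteness rules this out except for one subdivision of K₄, the
-- cube without a vertex; there either the equal lists can be put on two vertices that are not
-- adjacent, or further edges of the graph yield a figure eight.
--
-- In the adapted case every edge gets the largest colour common to its lists, which the bad lists
-- arrange to be the colour in conflict.

-- Parity bookkeeping for two rational segments that do not cross.

module Segments where

  open import Data.Rational using (ℚ; 0ℚ; 1ℚ; _+_; _*_; _-_; -_; 1/_; _<_; _≤_; positive; >-nonZero)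
  open import Data.Rational.Properties

  ℚ-ring : AlmostCommutativeRing _ _
  ℚ-ring = fromCommutativeRing +-*-commutativeRing λ x → dec⇒maybe (0ℚ ≟ x)

  0<- : ∀ {x y} → x < y → 0ℚ < y - x
  0<- {x} {y} x<y = subst (_< y - x) (+-inverseʳ x) (+-monoˡ-< (- x) x<y)

  0<-⁻¹ : ∀ {x y} → 0ℚ < y - x → x < y
  0<-⁻¹ {x} {y} 0<y-x = subst₂ _<_ (+-identityʳ x) (lem x y) (+-monoʳ-< x 0<y-x)
    where
    lem : ∀ x y → x + (y - x) ≡ y
    lem = solve-∀ ℚ-ring

  *-pos : ∀ {x y} → 0ℚ < x → 0ℚ < y → 0ℚ < x * y
  *-pos {x} {y} 0<x 0<y = positive⁻¹ (x * y) {{pos*pos⇒pos x {{positive 0<x}} y {{positive 0<y}}}}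

  reciprocal : ∀ {x} → 0ℚ < x → ∃[ r ] (0ℚ < r × x * r ≡ 1ℚ)
  reciprocal {x} 0<x =
    (1/ x) {{nz}} , positive⁻¹ _ {{1/pos⇒pos x {{positive 0<x}}}} , *-inverseʳ x {{nz}}
    where nz = >-nonZero 0<x

  <⇒≱ : ∀ {x y} → x < y → ¬ (y ≤ x)
  <⇒≱ x<y y≤x = <-irrefl refl (<-≤-trans x<y y≤x)

  abstract
    compare : ∀ x y → Tri (x < y) (x ≡ y) (y < x)
    compare = <-cmp

    lt le eq : ℚ → ℚ → Bool
    lt x y = ⌊ x <? y ⌋
    le x y = ⌊ x ≤? y ⌋
    eq x y = ⌊ x ≟ y ⌋

    lt-yes : ∀ {x y} → x < y → lt x y ≡ true
    lt-yes {x} {y} p = cong (λ d → ⌊ d ⌋) (proj₂ (dec-yes′ (x <? y) p))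
      where
      dec-yes′ : ∀ {A : Set} (d : Dec A) → A → ∃[ a ] d ≡ yes a
      dec-yes′ (yes a) _ = a , refl
      dec-yes′ (no ¬a) a = ⊥-elim (¬a a)
    lt-no : ∀ {x y} → y ≤ x → lt x y ≡ false
    lt-no {x} {y} p with x <? y
    ... | yes q = ⊥-elim (<⇒≱ q p)
    ... | no _ = refl
    le-yes : ∀ {x y} → x ≤ y → le x y ≡ true
    le-yes {x} {y} p with x ≤? y
    ... | yes _ = refl
    ... | no q = ⊥-elim (q p)
    le-no : ∀ {x y} → y < x → le x y ≡ false
    le-no {x} {y} p with x ≤? y
    ... | yes q = ⊥-elim (<⇒≱ p q)
    ... | no _ = refl
    eq-yes : ∀ {x y} → x ≡ y → eq x y ≡ true
    eq-yes {x} {y} p with x ≟ y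
    ... | yes _ = refl
    ... | no q = ⊥-elim (q p)
    eq-no : ∀ {x y} → x ≢ y → eq x y ≡ false
    eq-no {x} {y} p with x ≟ y
    ... | yes q = ⊥-elim (p q)
    ... | no _ = refl

  cmp : Bool → ℚ → ℚ → Bool
  cmp true  = le
  cmp false = lt

  cmp-< : ∀ b {x y} → x < y → cmp b x y ≡ true
  cmp-< true  p = le-yes (<⇒≤ p)
  cmp-< false p = lt-yes p
  cmp-> : ∀ b {x y} → y < x → cmp b x y ≡ false
  cmp-> true  p = le-no p
  cmp-> false p = lt-no (<⇒≤ p)
  cmp-≡ : ∀ b {x y} → x ≡ y → cmp b x y ≡ b
  cmp-≡ true  p = le-yes (≤-reflexive p)
  cmp-≡ false p = lt-no (≤-reflexive (sym p))

  -- The graph of x ↦ slope * x + icept over [lo , hi].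
  record Segment : Set where
    constructor seg
    field
      lo hi slope icept : ℚ

    ht : ℚ → ℚ
    ht x = slope * x + icept

  open Segment public

  -- The gap between two lines grows in proportion to the difference of their slopes; `ht-below` and
  -- `ht-same` only read off signs from this.
  ht-diff : ∀ s z l r →
    (ht s r - ht z r) - (ht s l - ht z l) ≡ (slope s - slope z) * (r - l)
  ht-diff (seg _ _ m c) (seg _ _ n d) l r = lem m c n d l r
    where
    lem : ∀ m c n d l r → ((m * r + c) - (n * r + d)) - ((m * l + c) - (n * l + d)) ≡ (m - n) * (r - l)
    lem = solve-∀ ℚ-ring

  ≡⇒-≡0 : ∀ {x y} → x ≡ y → x - y ≡ 0ℚ
  ≡⇒-≡0 {x} refl = +-inverseʳ x

  -≡0⇒≡ : ∀ {x y} → x - y ≡ 0ℚ → x ≡ y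
  -≡0⇒≡ {x} {y} e = trans (lem x y) (trans (cong (_+ y) e) (+-identityˡ y))
    where
    lem : ∀ x y → x ≡ (x - y) + y
    lem = solve-∀ ℚ-ring

  ht-below : ∀ s z {l r} → l < r → slope z < slope s →
    ht z l ≤ ht s l → ht z r < ht s r
  ht-below s z {l} {r} l<r p q =
    0<-⁻¹ (subst (0ℚ <_) (trans (cong (_+ (ht s l - ht z l)) (sym (ht-diff s z l r))) (lem _ _))
       (+-mono-<-≤ (*-pos (0<- p) (0<- l<r)) (subst (_≤ ht s l - ht z l) (+-inverseʳ (ht z l)) (+-monoˡ-≤ (- ht z l) q))))
    where
    lem : ∀ a b → (a - b) + b ≡ a
    lem = solve-∀ ℚ-ring

  ht-same : ∀ s z {l r} → slope z ≡ slope s → ht z l ≡ ht s l → ht z r ≡ ht s r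
  ht-same s z {l} {r} p q = sym (-≡0⇒≡ (begin
    ht s r - ht z r ≡⟨ lem (ht s r - ht z r) (ht s l - ht z l) ⟨
    ((ht s r - ht z r) - (ht s l - ht z l)) + (ht s l - ht z l)
      ≡⟨ cong₂ _+_ (trans (ht-diff s z l r) (cong (_* (r - l)) (≡⇒-≡0 (sym p)))) (≡⇒-≡0 (sym q)) ⟩
    0ℚ * (r - l) + 0ℚ ≡⟨ trans (+-identityʳ (0ℚ * (r - l))) (*-zeroˡ (r - l)) ⟩
    0ℚ ∎))
    where
    open ≡-Reasoning
    lem : ∀ a b → (a - b) + b ≡ a
    lem = solve-∀ ℚ-ring

  -- The intermediate value theorem in explicit form: with gaps `a` at `l` and `b` at `r`, the lines
  -- meet at the fraction a / (a + b) of the way, which is again rational.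
  ht-crossing : ∀ s z {l r} → l < r → ht z l < ht s l → ht s r < ht z r →
    ∃[ x ] (l < x × x < r × ht s x ≡ ht z x)
  ht-crossing s z {l} {r} l<r p q = x , l<x , x<r , -≡0⇒≡ fx≡0
    where
    a = ht s l - ht z l
    b = ht z r - ht s r
    0<a = 0<- p
    0<b = 0<- q
    0<a+b : 0ℚ < a + b
    0<a+b = subst (_< a + b) (+-identityʳ 0ℚ) (+-mono-< 0<a 0<b)
    inv = reciprocal 0<a+b
    i = proj₁ inv
    0<i = proj₁ (proj₂ inv)
    t = a * i
    x = l + t * (r - l)
    1-t : b * i ≡ 1ℚ - t
    1-t = trans (lem a b i) (cong (_- t) (proj₂ (proj₂ inv)))
      where
      lem : ∀ a b i → b * i ≡ (a + b) * i - a * i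
      lem = solve-∀ ℚ-ring
    l<x : l < x
    l<x = 0<-⁻¹ (subst (0ℚ <_) (lem l (t * (r - l))) (*-pos (*-pos 0<a 0<i) (0<- l<r)))
      where
      lem : ∀ l d → d ≡ l + d - l
      lem = solve-∀ ℚ-ring
    x<r : x < r
    x<r = 0<-⁻¹ (subst (0ℚ <_) (trans (cong (_* (r - l)) 1-t) (lem l r t)) (*-pos (*-pos 0<b 0<i) (0<- l<r)))
      where
      lem : ∀ l r t → (1ℚ - t) * (r - l) ≡ r - (l + t * (r - l))
      lem = solve-∀ ℚ-ring
    open ≡-Reasoning
    fx≡0 : ht s x - ht z x ≡ 0ℚ
    fx≡0 = begin
      ht s x - ht z x ≡⟨ lem₁ (slope s) (icept s) (slope z) (icept z) l r t ⟩
      (1ℚ - t) * a - t * b ≡⟨ cong (λ u → u * a - t * b) 1-t ⟨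
      b * i * a - a * i * b ≡⟨ lem₂ a b i ⟩
      0ℚ ∎
      where
      lem₁ : ∀ m c n d l r t → (m * (l + t * (r - l)) + c) - (n * (l + t * (r - l)) + d) ≡
        (1ℚ - t) * ((m * l + c) - (n * l + d)) - t * ((n * r + d) - (m * r + c))
      lem₁ = solve-∀ ℚ-ring
      lem₂ : ∀ a b i → b * i * a - a * i * b ≡ 0ℚ
      lem₂ = solve-∀ ℚ-ring

  abstract
    -- An opaque copy of `ht`: the boolean case analyses below treat heights as atoms and never
    -- compute with rationals.
    height : Segment → ℚ → ℚ
    height = ht

    height-def : ∀ s x → height s x ≡ slope s * x + icept s
    height-def s x = refl

    slope-below⇒ : ∀ s z {l r} → l < r → slope z < slope s →
      height z l ≤ height s l → height z r < height s r
    slope-below⇒ = ht-below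

    slope-same⇒ : ∀ s z {l r} → slope z ≡ slope s → height z l ≡ height s l → height z r ≡ height s r
    slope-same⇒ = ht-same

    crossing : ∀ s z {l r} → l < r → height z l < height s l → height s r < height z r →
      ∃[ x ] (l < x × x < r × height s x ≡ height z x)
    crossing = ht-crossing

  -- How z lies relative to s next to an end x of their common range, depending
  -- on whether they meet there; b is the value for coinciding segments.
  data Reading (s z : Segment) (x : ℚ) (bySlope : Bool) : Bool → Set where
    apart : height s x ≢ height z x → Reading s z x bySlope (lt (height z x) (height s x))
    meet  : height s x ≡ height z x → Reading s z x bySlope bySlope

  -- Without an inner crossing the order of the two lines cannot change between `l` and `r`. Where
  -- they meet at an end it is read from the slopes, oppositely at the two ends: just right of a
  -- common point the line of smaller slope is the lower one, just left of it the higher one. The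
  -- flag is negated at the right end so that coinciding segments read `b` at both.
  readings-agree : ∀ s z b {l r u v} → l < r →
    (∀ x → l < x → x < r → height s x ≢ height z x) →
    Reading s z l (cmp b (slope z) (slope s)) u →
    Reading s z r (not (cmp (not b) (slope z) (slope s))) v →
    u ≡ v
  readings-agree s z b {l} {r} l<r nc (apart p) (apart q)
    with compare (height z l) (height s l) | compare (height z r) (height s r)
  ... | tri≈ _ e _ | _ = ⊥-elim (p (sym e))
  ... | _ | tri≈ _ e _ = ⊥-elim (q (sym e))
  ... | tri< x _ _ | tri< y _ _ = trans (lt-yes x) (sym (lt-yes y))
  ... | tri> _ _ x | tri> _ _ y = trans (lt-no (<⇒≤ x)) (sym (lt-no (<⇒≤ y)))
  ... | tri< x _ _ | tri> _ _ y with crossing s z l<r x y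
  ...   | t , l<t , t<r , e = ⊥-elim (nc t l<t t<r e)
  readings-agree s z b {l} {r} l<r nc (apart p) (apart q)
      | tri> _ _ x | tri< y _ _ with crossing z s l<r x y
  ...   | t , l<t , t<r , e = ⊥-elim (nc t l<t t<r (sym e))
  readings-agree s z b {l} {r} l<r nc (meet p) (apart q) with compare (slope z) (slope s)
  ... | tri< x _ _ = trans (cmp-< b x) (sym (lt-yes (slope-below⇒ s z l<r x (≤-reflexive (sym p)))))
  ... | tri≈ _ x _ = ⊥-elim (q (sym (slope-same⇒ s z x (sym p))))
  ... | tri> _ _ x = trans (cmp-> b x) (sym (lt-no (<⇒≤ (slope-below⇒ z s l<r x (≤-reflexive p)))))
  readings-agree s z b {l} {r} l<r nc (apart p) (meet q) with compare (slope z) (slope s)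
  ... | tri≈ _ x _ = ⊥-elim (p (sym (slope-same⇒ s z x (sym q))))
  ... | tri< x _ _ = trans (lt-no (≮⇒≥ λ y → <-irrefl (sym q) (slope-below⇒ s z l<r x (<⇒≤ y)))) (sym (cong not (cmp-< (not b) x)))
  ... | tri> _ _ x = trans (lt-yes (≰⇒> λ y → <-irrefl q (slope-below⇒ z s l<r x y))) (sym (cong not (cmp-> (not b) x)))
  readings-agree s z b {l} {r} l<r nc (meet p) (meet q) with compare (slope z) (slope s)
  ... | tri< x _ _ = ⊥-elim (<-irrefl (sym q) (slope-below⇒ s z l<r x (≤-reflexive (sym p))))
  ... | tri≈ _ x _ = trans (cmp-≡ b x) (trans (notnot b) (sym (cong not (cmp-≡ (not b) x))))
    where
    notnot : ∀ b → b ≡ not (not b)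
    notnot true = refl
    notnot false = refl
  ... | tri> _ _ x = ⊥-elim (<-irrefl q (slope-below⇒ z s l<r x (≤-reflexive p)))

  -- Membership of segment ends at abscissa x below (or on, if b) the segment s
  -- that has an end there, in counterclockwise order from straight down.
  turn : Bool → ℚ → Segment → Segment → Bool
  turn b x s z =
    if eq x (lo z) then (if eq x (lo s) then cmp b (slope z) (slope s) else true)
    else if eq x (hi z) then (if eq x (lo s) then false else cmp b (slope z) (slope s))
    else false

  under : Segment → ℚ → ℚ → Bool
  under z x y = lt (lo z) x ∧ lt x (hi z) ∧ lt (height z x) y

  -- The part below `s` in its open range, together with the whole vertical through its right end.
  -- There `s` points left, and among leftward darts those above `s` come first in counterclockwise
  -- order; the extra bit complements `turn` for them and cancels it for darts going right.
  region : Segment → ℚ → ℚ → Bool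
  region s x y = (lt (lo s) x ∧ lt x (hi s) ∧ lt y (height s x)) xor eq x (hi s)

  private
    xor-medial : ∀ x y e f → x xor (y xor (e xor f)) ≡ (x xor e) xor (y xor f)
    xor-medial false false false false = refl
    xor-medial false false false true = refl
    xor-medial false false true false = refl
    xor-medial false false true true = refl
    xor-medial false true false false = refl
    xor-medial false true false true = refl
    xor-medial false true true false = refl
    xor-medial false true true true = refl
    xor-medial true false false false = refl
    xor-medial true false false true = refl
    xor-medial true false true false = refl
    xor-medial true false true true = refl
    xor-medial true true false false = refl
    xor-medial true true false true = refl
    xor-medial true true true false = refl
    xor-medial true true true true = refl

    regroup : ∀ a b c d e f → (a xor b xor e) ≡ (c xor d xor f) →
      (a xor b) xor (c xor d) xor (e xor f) ≡ false
    regroup a b c d e f eq = trans (xor-medial (a xor b) (c xor d) e f)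
      (trans (cong₂ _xor_ (trans (xor-assoc a b e) eq) (xor-assoc c d f)) (xor-same (c xor d xor f)))

  <⇒≢′ : ∀ {x y} → x < y → y ≢ x
  <⇒≢′ p q = <⇒≢ p (sym q)

  -- Clipping z to the range of s leaves nothing, or a segment whose two ends
  -- both lie below s or both above it.
  clip-parity : ∀ b s z → lo s < hi s → lo z < hi z →
    (∀ x → lo s ≤ x → x ≤ hi s → lo z ≤ x → x ≤ hi z → height s x ≡ height z x →
      (x ≡ lo s ⊎ x ≡ hi s) × (x ≡ lo z ⊎ x ≡ hi z)) →
    (lo z ≡ lo s → height s (lo s) ≡ height z (lo s)) →
    (hi z ≡ hi s → height s (hi s) ≡ height z (hi s)) →
    (under z (lo s) (height s (lo s)) xor turn b (lo s) s z) xor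
    (under z (hi s) (height s (hi s)) xor turn (not b) (hi s) s z) xor
    (region s (lo z) (height z (lo z)) xor region s (hi z) (height z (hi z))) ≡ false
  -- Ranges that are disjoint or merely touch are settled by evaluating every flag.
  clip-parity b s z p<q a<d nc genˡ genʳ with compare (lo z) (hi s) | compare (lo s) (hi z)
  ... | tri> _ _ q<a | _
    rewrite lt-no (<⇒≤ (<-trans p<q q<a)) | eq-no (<⇒≢ (<-trans p<q q<a)) | eq-no (<⇒≢ (<-trans p<q (<-trans q<a a<d)))
    | lt-no (<⇒≤ q<a) | eq-no (<⇒≢ q<a) | eq-no (<⇒≢ (<-trans q<a a<d))
    | lt-yes (<-trans p<q q<a) | eq-no (<⇒≢′ q<a)
    | lt-yes (<-trans p<q (<-trans q<a a<d)) | lt-no (<⇒≤ (<-trans q<a a<d)) | eq-no (<⇒≢′ (<-trans q<a a<d)) = refl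
  ... | tri≈ _ refl _ | _
    rewrite lt-no (<⇒≤ p<q) | eq-no (<⇒≢ p<q) | eq-no (<⇒≢ (<-trans p<q a<d))
    | lt-no (≤-refl {lo z}) | eq-yes (refl {x = lo z}) | eq-no (<⇒≢′ p<q)
    | lt-yes p<q
    | lt-yes (<-trans p<q a<d) | lt-no (<⇒≤ a<d) | eq-no (<⇒≢′ a<d) = refl
  ... | tri< _ _ _ | tri> _ _ d<p
    rewrite lt-yes (<-trans a<d d<p) | lt-no (<⇒≤ d<p) | eq-no (<⇒≢′ (<-trans a<d d<p)) | eq-no (<⇒≢′ d<p)
    | lt-yes (<-trans (<-trans a<d d<p) p<q) | lt-no (<⇒≤ (<-trans d<p p<q)) | eq-no (<⇒≢′ (<-trans (<-trans a<d d<p) p<q))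
    | eq-no (<⇒≢′ (<-trans d<p p<q)) | lt-no (<⇒≤ (<-trans a<d d<p)) | eq-no (<⇒≢ (<-trans (<-trans a<d d<p) p<q))
    | eq-no (<⇒≢ (<-trans d<p p<q)) = refl
  ... | tri< _ _ _ | tri≈ _ refl _
    rewrite lt-yes a<d | lt-no (≤-refl {lo s}) | eq-no (<⇒≢′ a<d) | eq-yes (refl {x = lo s})
    | lt-yes (<-trans a<d p<q) | lt-no (<⇒≤ p<q) | eq-no (<⇒≢′ (<-trans a<d p<q))
    | eq-no (<⇒≢′ p<q) | lt-no (<⇒≤ a<d) | eq-no (<⇒≢ (<-trans a<d p<q)) | eq-no (<⇒≢ p<q) = refl
  ... | tri< a<q _ _ | tri< p<d _ _ =
    regroup (under z (lo s) (height s (lo s))) (turn b (lo s) s z)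
      (under z (hi s) (height s (hi s))) (turn (not b) (hi s) s z)
      (region s (lo z) (height z (lo z))) (region s (hi z) (height z (hi z)))
      (readings (compare (lo z) (lo s)) (compare (hi z) (hi s)))
    where
    -- The terms of `L` concern the left end of the common range and those of `R` its right end.
    -- Each group collapses to a single reading there.
    L : Bool
    L = under z (lo s) (height s (lo s)) xor turn b (lo s) s z xor region s (lo z) (height z (lo z))
    R : Bool
    R = under z (hi s) (height s (hi s)) xor turn (not b) (hi s) s z xor region s (hi z) (height z (hi z))

    LR : ℚ → Set
    LR x = Reading s z x (cmp b (slope z) (slope s)) L
    RR : ℚ → Set
    RR x = Reading s z x (not (cmp (not b) (slope z) (slope s))) R

    xor-f : ∀ u → (u xor false) ≡ u
    xor-f true = refl
    xor-f false = refl

    left< : lo z < lo s → LR (lo s)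
    left< a<p = subst (Reading s z (lo s) _) (sym eqn) (apart λ e →
      case₂ (proj₂ (nc (lo s) ≤-refl (<⇒≤ p<q) (<⇒≤ a<p) (<⇒≤ p<d) e)))
      where
      case₂ : lo s ≡ lo z ⊎ lo s ≡ hi z → ⊥
      case₂ (inj₁ e) = <⇒≢′ a<p e
      case₂ (inj₂ e) = <⇒≢ p<d e
      eqn : L ≡ lt (height z (lo s)) (height s (lo s))
      eqn rewrite lt-yes a<p | lt-yes p<d | eq-no (<⇒≢′ a<p) | eq-no (<⇒≢ p<d) | lt-no (<⇒≤ a<p) | eq-no (<⇒≢ a<q) = xor-f _
    left≡ : lo z ≡ lo s → LR (lo s)
    left≡ a≡p = subst (Reading s z (lo s) _) (sym eqn) (meet (genˡ a≡p))
      where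
      eqn : L ≡ cmp b (slope z) (slope s)
      eqn rewrite lt-no (≤-reflexive (sym a≡p)) | eq-yes (sym a≡p) | eq-yes (refl {x = lo s}) | lt-no (≤-reflexive a≡p) | eq-no (<⇒≢ a<q) = xor-f _
    left> : lo s < lo z → LR (lo z)
    left> p<a = subst (Reading s z (lo z) _) (sym eqn) (apart λ e →
      case₂ (proj₁ (nc (lo z) (<⇒≤ p<a) (<⇒≤ a<q) ≤-refl (<⇒≤ a<d) e)))
      where
      case₂ : lo z ≡ lo s ⊎ lo z ≡ hi s → ⊥
      case₂ (inj₁ e) = <⇒≢′ p<a e
      case₂ (inj₂ e) = <⇒≢ a<q e
      eqn : L ≡ lt (height z (lo z)) (height s (lo z))
      eqn rewrite lt-no (<⇒≤ p<a) | eq-no (<⇒≢ p<a) | eq-no (<⇒≢ p<d) | lt-yes p<a | lt-yes a<q | eq-no (<⇒≢ a<q) = xor-f _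
    right> : hi s < hi z → RR (hi s)
    right> q<d = subst (Reading s z (hi s) _) (sym eqn) (apart λ e →
      case₂ (proj₂ (nc (hi s) (<⇒≤ p<q) ≤-refl (<⇒≤ a<q) (<⇒≤ q<d) e)))
      where
      case₂ : hi s ≡ lo z ⊎ hi s ≡ hi z → ⊥
      case₂ (inj₁ e) = <⇒≢′ a<q e
      case₂ (inj₂ e) = <⇒≢ q<d e
      eqn : R ≡ lt (height z (hi s)) (height s (hi s))
      eqn rewrite lt-yes a<q | lt-yes q<d | eq-no (<⇒≢′ a<q) | eq-no (<⇒≢ q<d) | lt-yes p<d | lt-no (<⇒≤ q<d) | eq-no (<⇒≢′ q<d) = xor-f _
    right≡ : hi z ≡ hi s → RR (hi s)
    right≡ d≡q = subst (Reading s z (hi s) _) (sym eqn) (meet (genʳ d≡q))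
      where
      xor-t : ∀ u → (u xor true) ≡ not u
      xor-t true = refl
      xor-t false = refl
      eqn : R ≡ not (cmp (not b) (slope z) (slope s))
      eqn rewrite lt-yes a<q | lt-no (≤-reflexive d≡q) | eq-no (<⇒≢′ a<q) | eq-yes (sym d≡q) | eq-no (<⇒≢′ p<q) | lt-yes p<d | lt-no (≤-reflexive (sym d≡q)) | eq-yes d≡q = xor-t _
    right< : hi z < hi s → RR (hi z)
    right< d<q = subst (Reading s z (hi z) _) (sym eqn) (apart λ e →
      case₂ (proj₁ (nc (hi z) (<⇒≤ p<d) (<⇒≤ d<q) (<⇒≤ a<d) ≤-refl e)))
      where
      case₂ : hi z ≡ lo s ⊎ hi z ≡ hi s → ⊥
      case₂ (inj₁ e) = <⇒≢′ p<d e
      case₂ (inj₂ e) = <⇒≢ d<q e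
      eqn : R ≡ lt (height z (hi z)) (height s (hi z))
      eqn rewrite lt-yes a<q | lt-no (<⇒≤ d<q) | eq-no (<⇒≢′ a<q) | eq-no (<⇒≢′ d<q) | lt-yes p<d | lt-yes d<q | eq-no (<⇒≢ d<q) = xor-f _

    agree : ∀ {l r} → l < r → lo s ≤ l → r ≤ hi s → lo z ≤ l → r ≤ hi z → LR l → RR r → L ≡ R
    -- By `nc`, an inner meeting point would have to be an end of `s`.
    agree l<r p≤l r≤q a≤l r≤d = readings-agree s z b l<r λ x l<x x<r e →
      case₂ (proj₁ (nc x (≤-trans p≤l (<⇒≤ l<x)) (≤-trans (<⇒≤ x<r) r≤q) (≤-trans a≤l (<⇒≤ l<x)) (≤-trans (<⇒≤ x<r) r≤d) e))
        (≤-<-trans p≤l l<x) (<-≤-trans x<r r≤q)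
      where
      case₂ : ∀ {x} → x ≡ lo s ⊎ x ≡ hi s → lo s < x → x < hi s → ⊥
      case₂ (inj₁ e) u v = <⇒≢′ u e
      case₂ (inj₂ e) u v = <⇒≢ v e

    readings : _ → _ → L ≡ R
    readings (tri< x _ _) (tri< y _ _) = agree p<d ≤-refl (<⇒≤ y) (<⇒≤ x) ≤-refl (left< x) (right< y)
    readings (tri< x _ _) (tri≈ _ y _) = agree p<q ≤-refl ≤-refl (<⇒≤ x) (≤-reflexive (sym y)) (left< x) (right≡ y)
    readings (tri< x _ _) (tri> _ _ y) = agree p<q ≤-refl ≤-refl (<⇒≤ x) (<⇒≤ y) (left< x) (right> y)
    readings (tri≈ _ x _) (tri< y _ _) = agree p<d ≤-refl (<⇒≤ y) (≤-reflexive x) ≤-refl (left≡ x) (right< y)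
    readings (tri≈ _ x _) (tri≈ _ y _) = agree p<q ≤-refl ≤-refl (≤-reflexive x) (≤-reflexive (sym y)) (left≡ x) (right≡ y)
    readings (tri≈ _ x _) (tri> _ _ y) = agree p<q ≤-refl ≤-refl (≤-reflexive x) (<⇒≤ y) (left≡ x) (right> y)
    readings (tri> _ _ x) (tri< y _ _) = agree a<d (<⇒≤ x) (<⇒≤ y) ≤-refl ≤-refl (left> x) (right< y)
    readings (tri> _ _ x) (tri≈ _ y _) = agree a<q (<⇒≤ x) ≤-refl ≤-refl (≤-reflexive (sym y)) (left> x) (right≡ y)
    readings (tri> _ _ x) (tri> _ _ y) = agree a<q (<⇒≤ x) ≤-refl ≤-refl (<⇒≤ y) (left> x) (right> y)

-- Linear algebra over GF(2) and the edge bound for plane graphs.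

module Darts where

  open import Data.Fin using (Fin; zero; suc; combine)
  open import Data.List using ([]; _∷_)
  open import Data.List.Relation.Unary.All as All using (All; []; _∷_)
  open import Data.List.Relation.Unary.AllPairs using ([]; _∷_)
  open import Data.Nat as ℕ using (ℕ; zero; suc)
  open import Data.Nat.Tactic.RingSolver using () renaming (solve-∀ to ℕ-solve-∀)

  ⊕ : ∀ {n} → (Fin n → Bool) → Bool
  ⊕ {zero}  f = false
  ⊕ {suc n} f = f zero xor ⊕ (f ∘ suc)

  ⊕ᴸ : {A : Set} → (A → Bool) → List A → Bool
  ⊕ᴸ f []       = false
  ⊕ᴸ f (x ∷ xs) = f x xor ⊕ᴸ f xs

  xor-interchange : ∀ a b c d → (a xor b) xor (c xor d) ≡ (a xor c) xor (b xor d)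
  xor-interchange a b c d = trans (xor-assoc a b (c xor d)) (trans (cong (a xor_)
    (trans (sym (xor-assoc b c d)) (trans (cong (_xor d) (xor-comm b c)) (xor-assoc c b d)))) (sym (xor-assoc a c (b xor d))))

  ⊕-cong : ∀ {n} {f g : Fin n → Bool} → (∀ i → f i ≡ g i) → ⊕ f ≡ ⊕ g
  ⊕-cong {zero} e = refl
  ⊕-cong {suc n} e = cong₂ _xor_ (e zero) (⊕-cong (e ∘ suc))

  ⊕-false : ∀ {n} {f : Fin n → Bool} → (∀ i → f i ≡ false) → ⊕ f ≡ false
  ⊕-false {zero} e = refl
  ⊕-false {suc n} e = cong₂ _xor_ (e zero) (⊕-false (e ∘ suc))

  ⊕-xor : ∀ {n} (f g : Fin n → Bool) → ⊕ (λ i → f i xor g i) ≡ ⊕ f xor ⊕ g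
  ⊕-xor {zero} f g = refl
  ⊕-xor {suc n} f g = trans (cong ((f zero xor g zero) xor_) (⊕-xor (f ∘ suc) (g ∘ suc))) (xor-interchange (f zero) (g zero) _ _)

  ⊕-∧ : ∀ {n} a (f : Fin n → Bool) → ⊕ (λ i → a ∧ f i) ≡ a ∧ ⊕ f
  ⊕-∧ {zero} a f = sym (∧-zeroʳ a)
  ⊕-∧ {suc n} a f = trans (cong ((a ∧ f zero) xor_) (⊕-∧ a (f ∘ suc))) (sym (∧-distribˡ-xor a _ _))

  ⊕-single : ∀ {n} {f : Fin n → Bool} k → (∀ i → i ≢ k → f i ≡ false) → ⊕ f ≡ f k
  ⊕-single {suc n} {f} zero e = trans (cong (f zero xor_) (⊕-false λ i → e (suc i) λ ())) (xor-identityʳ _)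
  ⊕-single {suc n} {f} (suc k) e = cong₂ _xor_ (e zero λ ()) (⊕-single k λ i i≢k → e (suc i) (i≢k ∘ Finₚ.suc-injective))

  ⊕ᴸ-cong : ∀ {A : Set} {f g : A → Bool} xs → (∀ {x} → x ∈ xs → f x ≡ g x) → ⊕ᴸ f xs ≡ ⊕ᴸ g xs
  ⊕ᴸ-cong [] e = refl
  ⊕ᴸ-cong (x ∷ xs) e = cong₂ _xor_ (e (here refl)) (⊕ᴸ-cong xs (e ∘ there))

  ⊕ᴸ-false : ∀ {A : Set} {f : A → Bool} xs → (∀ {x} → x ∈ xs → f x ≡ false) → ⊕ᴸ f xs ≡ false
  ⊕ᴸ-false [] e = refl
  ⊕ᴸ-false (x ∷ xs) e = cong₂ _xor_ (e (here refl)) (⊕ᴸ-false xs (e ∘ there))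

  ⊕ᴸ-xor : ∀ {A : Set} (f g : A → Bool) xs → ⊕ᴸ (λ x → f x xor g x) xs ≡ ⊕ᴸ f xs xor ⊕ᴸ g xs
  ⊕ᴸ-xor f g [] = refl
  ⊕ᴸ-xor f g (x ∷ xs) = trans (cong ((f x xor g x) xor_) (⊕ᴸ-xor f g xs)) (xor-interchange (f x) (g x) _ _)

  ⊕ᴸ-single : ∀ {A : Set} {f : A → Bool} {xs y} → Unique xs → y ∈ xs →
    (∀ {x} → x ∈ xs → x ≢ y → f x ≡ false) → ⊕ᴸ f xs ≡ f y
  ⊕ᴸ-single {f = f} {x ∷ xs} (x∉ ∷ u) (here refl) e =
    trans (cong (f x xor_) (⊕ᴸ-false xs λ {z} z∈ → e (there z∈) λ { refl → All.lookup x∉ z∈ refl })) (xor-identityʳ _)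
  ⊕ᴸ-single {f = f} {x ∷ xs} (x∉ ∷ u) (there y∈) e =
    cong₂ _xor_ (e (here refl) (All.lookup x∉ y∈)) (⊕ᴸ-single u y∈ (e ∘ there))

  ⊕-⊕ᴸ-swap : ∀ {A : Set} {n} (f : Fin n → A → Bool) xs → ⊕ (λ i → ⊕ᴸ (f i) xs) ≡ ⊕ᴸ (λ x → ⊕ (λ i → f i x)) xs
  ⊕-⊕ᴸ-swap {n = n} f [] = ⊕-false {n} {λ _ → false} λ _ → refl
  ⊕-⊕ᴸ-swap f (x ∷ xs) = trans (⊕-xor (λ i → f i x) (λ i → ⊕ᴸ (f i) xs)) (cong (⊕ (λ i → f i x) xor_) (⊕-⊕ᴸ-swap f xs))

  infix 7 _∙_
  _∙_ : ∀ {n} → (Fin n → Bool) → (Fin n → Bool) → Bool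
  r ∙ z = ⊕ λ i → r i ∧ z i

  cons : ∀ {n} → Bool → (Fin n → Bool) → Fin (suc n) → Bool
  cons b z zero    = b
  cons b z (suc i) = z i

  -- Gaussian elimination. If no row involves the first unknown, it alone is set to `true`.
  -- Otherwise a row `p` that involves it clears it from the other rows, and at the end determines
  -- it from the remaining unknowns.
  kernel-nontrivial : ∀ {n} (rows : List (Fin n → Bool)) → length rows ℕ.< n →
    ∃[ z ] ((∃[ j ] z j ≡ true) × (∀ {r} → r ∈ rows → r ∙ z ≡ false))
  kernel-nontrivial {suc n} rows len with any? (λ r → r zero Bool.≟ true) rows
  ... | no none = cons true (λ _ → false) , (zero , refl) , λ {r} r∈ →
    cong₂ _xor_ (trans (cong (_∧ true) (head-false r∈)) refl) (⊕-false λ i → ∧-zeroʳ (r (suc i)))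
    where
    head-false : ∀ {r} → r ∈ rows → r zero ≡ false
    head-false {r} r∈ with r zero in eq
    ... | false = refl
    ... | true = ⊥-elim (none (Data.List.Relation.Unary.Any.map (λ { refl → eq }) r∈))
      where import Data.List.Relation.Unary.Any
  ... | yes some = cons z₀ z , (suc j , zj) , kills
    where
    open import Data.List.Membership.Propositional using (find)
    pivot = find some
    p = proj₁ pivot
    p₀ : p zero ≡ true
    p₀ = proj₂ (proj₂ pivot)
    split = ∈-∃++ (proj₁ (proj₂ pivot))
    xs = proj₁ split
    ys = proj₁ (proj₂ split)
    rows≡ : rows ≡ xs ++ p ∷ ys
    rows≡ = proj₂ (proj₂ split)
    elim : (Fin (suc n) → Bool) → Fin n → Bool
    elim r i = r (suc i) xor (r zero ∧ p (suc i))
    len′ : length (map elim (xs ++ ys)) ℕ.< n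
    len′ = ℕₚ.≤-pred (subst (ℕ._< suc n) (begin
      length rows ≡⟨ cong length rows≡ ⟩
      length (xs ++ p ∷ ys) ≡⟨ length-++ xs ⟩
      length xs ℕ.+ suc (length ys) ≡⟨ ℕₚ.+-suc _ _ ⟩
      suc (length xs ℕ.+ length ys) ≡⟨ cong suc (length-++ xs) ⟨
      suc (length (xs ++ ys)) ≡⟨ cong suc (length-map elim (xs ++ ys)) ⟨
      suc (length (map elim (xs ++ ys))) ∎) len)
      where open ≡-Reasoning
    rec = kernel-nontrivial (map elim (xs ++ ys)) len′
    z = proj₁ rec
    j = proj₁ (proj₁ (proj₂ rec))
    zj = proj₂ (proj₁ (proj₂ rec))
    z₀ = (p ∘ suc) ∙ z
    elim-kills : ∀ r → elim r ∙ z ≡ false → r ∙ cons z₀ z ≡ false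
    elim-kills r e = begin
      (r zero ∧ z₀) xor ((r ∘ suc) ∙ z) ≡⟨ xor-comm (r zero ∧ z₀) _ ⟩
      ((r ∘ suc) ∙ z) xor (r zero ∧ z₀) ≡⟨ cong (((r ∘ suc) ∙ z) xor_) (sym (⊕-∧ (r zero) (λ i → p (suc i) ∧ z i))) ⟩
      ((r ∘ suc) ∙ z) xor ⊕ (λ i → r zero ∧ (p (suc i) ∧ z i)) ≡⟨ ⊕-xor (λ i → r (suc i) ∧ z i) (λ i → r zero ∧ (p (suc i) ∧ z i)) ⟨
      ⊕ (λ i → (r (suc i) ∧ z i) xor (r zero ∧ (p (suc i) ∧ z i)))
        ≡⟨ ⊕-cong (λ i → trans (cong ((r (suc i) ∧ z i) xor_) (sym (∧-assoc (r zero) _ _))) (sym (∧-distribʳ-xor (z i) (r (suc i)) _))) ⟩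
      elim r ∙ z ≡⟨ e ⟩
      false ∎
      where open ≡-Reasoning
    open import Data.List.Membership.Propositional.Properties using (∈-map⁺; ∈-++⁺ˡ; ∈-++⁺ʳ; ∈-++⁻)
    kills : ∀ {r} → r ∈ rows → r ∙ cons z₀ z ≡ false
    kills {r} r∈ with ∈-++⁻ xs (subst (r ∈_) rows≡ r∈)
    ... | inj₁ r∈xs = elim-kills r (proj₂ (proj₂ rec) (∈-map⁺ elim (∈-++⁺ˡ r∈xs)))
    ... | inj₂ (here refl) = trans (cong (λ b → (b ∧ z₀) xor z₀) p₀) (xor-same z₀)
    ... | inj₂ (there r∈ys) = elim-kills r (proj₂ (proj₂ rec) (∈-map⁺ elim (∈-++⁺ʳ xs r∈ys)))

  lookup-injective : ∀ {A : Set} {xs : List A} → Unique xs → ∀ i j → lookup xs i ≡ lookup xs j → i ≡ j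
  lookup-injective (x∉ ∷ u) zero zero e = refl
  lookup-injective (x∉ ∷ u) zero (suc j) e = ⊥-elim (All.lookup x∉ (∈-lookup j) e)
  lookup-injective (x∉ ∷ u) (suc i) zero e = ⊥-elim (All.lookup x∉ (∈-lookup i) (sym e))
  lookup-injective (x∉ ∷ u) (suc i) (suc j) e = cong suc (lookup-injective u i j e)

  unique-length : ∀ {m} {A : Set} (f : A → Fin m) → Injective _≡_ _≡_ f → ∀ {xs} → Unique xs → length xs ℕ.≤ m
  unique-length f f-inj {xs} u = Finₚ.injective⇒≤ {f = f ∘ lookup xs} (lookup-injective u _ _ ∘ f-inj)

  Dart : ℕ → Set
  Dart n = Fin n × Bool

  reverse : ∀ {n} → Dart n → Dart n
  reverse (i , b) = i , not b

  _≟ᴰ_ : ∀ {n} (d e : Dart n) → Dec (d ≡ e)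
  _≟ᴰ_ = ×ₚ.≡-dec Finₚ._≟_ Bool._≟_

  dart-index : ∀ {n} → Dart n → Fin (n ℕ.* 2)
  dart-index (i , b) = combine i (if b then zero else suc zero)

  dart-index-injective : ∀ {n} → Injective _≡_ _≡_ (dart-index {n})
  dart-index-injective {n} {i , b} {j , c} e with Finₚ.combine-injective i _ j _ e
  dart-index-injective {n} {i , true} {j , true} e | refl , _ = refl
  dart-index-injective {n} {i , false} {j , false} e | refl , _ = refl

  all-darts : ∀ n → List (Dart n)
  all-darts n = cartesianProduct (allFin n) (true ∷ false ∷ [])

  ∈-all-darts : ∀ {n} (d : Dart n) → d ∈ all-darts n
  ∈-all-darts (i , true)  = ∈-cartesianProduct⁺ (∈-allFin i) (here refl)
  ∈-all-darts (i , false) = ∈-cartesianProduct⁺ (∈-allFin i) (there (here refl))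

  module _ {n} (φ : Dart n → Dart n)
    (φ≢  : ∀ d → φ d ≢ d)
    (φφ≢ : ∀ d → φ (φ d) ≢ d) where

    open DecMembership (_≟ᴰ_ {n}) using (_∈?_)

    Invariant : (Dart n → Bool) → Set
    Invariant f = ∀ d → f (φ d) ≡ f d

    -- A maximal family of disjoint triples d, φ d, φ² d.
    record Triples (ds : List (Dart n)) : Set where
      field
        reps covered : List (Dart n)
        unique  : Unique covered
        size    : length covered ≡ 3 ℕ.* length reps
        spanned : ∀ {f} → Invariant f → (∀ {d} → d ∈ reps → f d ≡ false) → ∀ {d} → d ∈ covered → f d ≡ false
        maximal : ∀ {d} → d ∈ ds → d ∈ covered ⊎ φ d ∈ covered ⊎ φ (φ d) ∈ covered

    triples : ∀ ds → Triples ds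
    triples [] = record { reps = [] ; covered = [] ; unique = [] ; size = refl ; spanned = λ _ _ () ; maximal = λ () }
    triples (d ∷ ds) = extend (d ∈? covered) (φ d ∈? covered) (φ (φ d) ∈? covered)
      where
      open Triples (triples ds)
      add : d ∈ covered ⊎ φ d ∈ covered ⊎ φ (φ d) ∈ covered → Triples (d ∷ ds)
      add meets = record
        { reps = reps ; covered = covered ; unique = unique ; size = size ; spanned = spanned
        ; maximal = λ { (here refl) → meets ; (there e) → maximal e } }
      fresh : ∀ {x} → x ∉ covered → All (x ≢_) covered
      fresh x∉ = All.tabulate λ y∈ → λ { refl → x∉ y∈ }
      extend : Dec (d ∈ covered) → Dec (φ d ∈ covered) → Dec (φ (φ d) ∈ covered) → Triples (d ∷ ds)
      extend (yes p) _ _ = add (inj₁ p)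
      extend _ (yes p) _ = add (inj₂ (inj₁ p))
      extend _ _ (yes p) = add (inj₂ (inj₂ p))
      extend (no p) (no q) (no r) = record
        { reps = d ∷ reps
        ; covered = d ∷ φ d ∷ φ (φ d) ∷ covered
        ; unique = (≢-sym (φ≢ d) ∷ ≢-sym (φφ≢ d) ∷ fresh p) ∷ (≢-sym (φ≢ (φ d)) ∷ fresh q) ∷ fresh r ∷ unique
        ; size = trans (cong (3 ℕ.+_) size) (lem (length reps))
        ; spanned = λ inv zeros →
            λ { (here refl) → zeros (here refl)
              ; (there (here refl)) → trans (inv d) (zeros (here refl))
              ; (there (there (here refl))) → trans (inv _) (trans (inv d) (zeros (here refl)))
              ; (there (there (there e))) → spanned inv (zeros ∘ there) e }
        ; maximal = λ { (here refl) → inj₁ (here refl) ; (there e) → Sum.map up (Sum.map up up) (maximal e) }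
        }
        where
        up : ∀ {x a b c} → x ∈ covered → x ∈ a ∷ b ∷ c ∷ covered
        up = there ∘ there ∘ there
        lem : ∀ r → 3 ℕ.+ 3 ℕ.* r ≡ 3 ℕ.* suc r
        lem = ℕ-solve-∀

    open Triples

    -- The triples are disjoint sets of three among 2 n darts.
    triples-size : ∀ {ds} (t : Triples ds) → 3 ℕ.* length (reps t) ℕ.≤ n ℕ.* 2
    triples-size t = subst (ℕ._≤ n ℕ.* 2) (size t) (unique-length dart-index dart-index-injective (unique t))

    -- By maximality one of d, φ d, φ² d is covered, and an invariant function takes the same value
    -- on all three.
    triples-span : ∀ (t : Triples (all-darts n)) {f} → Invariant f → (∀ {d} → d ∈ reps t → f d ≡ false) → ∀ d → f d ≡ false
    triples-span t inv zeros d with maximal t (∈-all-darts d)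
    ... | inj₁ p = spanned t inv zeros p
    ... | inj₂ (inj₁ p) = trans (sym (inv d)) (spanned t inv zeros p)
    ... | inj₂ (inj₂ p) = trans (sym (trans (inv (φ d)) (inv d))) (spanned t inv zeros p)

  -- A plane graph with n edges, origin d being the vertex where the dart d
  -- starts and φ d the dart that follows d around the face to its right. The
  -- parity w · d · z tells whether that face lies inside the even subgraph z.
  module _ {N n} (origin : Dart n → Fin N) (R : List (Fin N)) (R! : Unique R)
    (origin∈R : ∀ d → origin d ∈ R)
    (φ : Dart n → Dart n)
    (loopless : ∀ d → origin d ≢ origin (reverse d))
    (simple : ∀ d e → origin d ≡ origin e → origin (reverse d) ≡ origin (reverse e) → d ≡ e)
    (φ-origin : ∀ d → origin (φ d) ≡ origin (reverse d))
    (φ-turns : ∀ d → φ d ≢ reverse d)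
    (w : Dart n → Fin n → Bool)
    where

    private
      reverse² : ∀ (d : Dart n) → reverse (reverse d) ≡ d
      reverse² (i , true) = refl
      reverse² (i , false) = refl

      φ≢ : ∀ d → φ d ≢ d
      φ≢ d e = loopless d (trans (cong origin (sym e)) (φ-origin d))

      -- A face with two sides would consist of two parallel edges, or of one edge traversed back
      -- and forth.
      φφ≢ : ∀ d → φ (φ d) ≢ d
      φφ≢ d e = φ-turns d (simple (φ d) (reverse d) (φ-origin d)
        (trans (sym (φ-origin (φ d))) (trans (cong origin e) (cong origin (sym (reverse² d))))))

    -- Even degrees in dual form: orthogonality to the coboundary of every function on the vertices.
    -- This is the form that telescopes along polygonal arcs.
    EvenSubgraph : (Fin n → Bool) → Set
    EvenSubgraph z = ∀ (ω : Fin N → Bool) → ⊕ (λ i → z i ∧ (ω (origin (i , false)) xor ω (origin (i , true)))) ≡ false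

    module _
      (w-invariant : ∀ {z} → EvenSubgraph z → ∀ d → w (φ d) ∙ z ≡ w d ∙ z)
      (w-sides : ∀ {z} → EvenSubgraph z → ∀ d → (w d ∙ z) xor (w (reverse d) ∙ z) ≡ z (proj₁ d))
      where

      private
        δ : Fin N → Fin N → Bool
        δ u v = ⌊ u Finₚ.≟ v ⌋
        δ-refl : ∀ v → δ v v ≡ true
        δ-refl v with v Finₚ.≟ v
        ... | yes _ = refl
        ... | no ¬p = ⊥-elim (¬p refl)
        δ-≢ : ∀ {u v} → u ≢ v → δ u v ≡ false
        δ-≢ {u} {v} p with u Finₚ.≟ v
        ... | yes q = ⊥-elim (p q)
        ... | no _ = refl
        a b : Fin n → Fin N
        a i = origin (i , false)
        b i = origin (i , true)
        incidence : Fin N → Fin n → Bool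
        incidence v i = δ v (a i) xor δ v (b i)

        -- It is enough to test the vertices of `R`, where all darts originate: ω is expanded in
        -- their indicator functions.
        even : ∀ {z} → (∀ {v} → v ∈ R → incidence v ∙ z ≡ false) → EvenSubgraph z
        even {z} p ω = begin
          ⊕ (λ i → z i ∧ (ω (a i) xor ω (b i)))
            ≡⟨ ⊕-cong (λ i → trans (cong (z i ∧_) (cong₂ _xor_ (expand (origin∈R (i , false))) (expand (origin∈R (i , true)))))
                 (trans (cong (z i ∧_) (sym (⊕ᴸ-xor _ _ R))) (inside i))) ⟩
          ⊕ (λ i → ⊕ᴸ (λ v → ω v ∧ (incidence v i ∧ z i)) R) ≡⟨ ⊕-⊕ᴸ-swap (λ i v → ω v ∧ (incidence v i ∧ z i)) R ⟩
          ⊕ᴸ (λ v → ⊕ (λ i → ω v ∧ (incidence v i ∧ z i))) R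
            ≡⟨ ⊕ᴸ-false R (λ {v} v∈ → trans (⊕-∧ (ω v) (λ i → incidence v i ∧ z i)) (trans (cong (ω v ∧_) (p v∈)) (∧-zeroʳ (ω v)))) ⟩
          false ∎
          where
          open ≡-Reasoning
          expand : ∀ {x} → x ∈ R → ω x ≡ ⊕ᴸ (λ v → ω v ∧ δ v x) R
          expand {x} x∈ = sym (trans (⊕ᴸ-single R! x∈ (λ {v} _ v≢ → trans (cong (ω v ∧_) (δ-≢ v≢)) (∧-zeroʳ (ω v))))
                                     (trans (cong (ω x ∧_) (δ-refl x)) (∧-true (ω x))))
            where
            ∧-true : ∀ u → u ∧ true ≡ u
            ∧-true true = refl
            ∧-true false = refl
          ⊕ᴸ-∧ : ∀ c (f : Fin N → Bool) xs → c ∧ ⊕ᴸ f xs ≡ ⊕ᴸ (λ x → c ∧ f x) xs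
          ⊕ᴸ-∧ c f [] = ∧-zeroʳ c
          ⊕ᴸ-∧ c f (x ∷ xs) = trans (∧-distribˡ-xor c _ _) (cong ((c ∧ f x) xor_) (⊕ᴸ-∧ c f xs))
          shuffle : ∀ z o u v → z ∧ ((o ∧ u) xor (o ∧ v)) ≡ o ∧ ((u xor v) ∧ z)
          shuffle z o u v = trans (cong (z ∧_) (sym (∧-distribˡ-xor o u v)))
            (trans (∧-comm z _) (∧-assoc o (u xor v) z))
          inside : ∀ i → z i ∧ ⊕ᴸ (λ v → (ω v ∧ δ v (a i)) xor (ω v ∧ δ v (b i))) R ≡ ⊕ᴸ (λ v → ω v ∧ (incidence v i ∧ z i)) R
          inside i = trans (⊕ᴸ-∧ (z i) _ R) (⊕ᴸ-cong R λ {v} _ → shuffle (z i) (ω v) _ _)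

      open Triples

      -- If n > 3 |R|, then |R| incidence conditions and at most 2 n / 3 face conditions are fewer
      -- than n and have a nonzero common solution z. The parity of z vanishes on all darts,
      -- although it must differ across each edge of z.
      euler-bound : n ℕ.≤ 3 ℕ.* length R
      euler-bound with n ℕₚ.≤? 3 ℕ.* length R
      ... | yes p = p
      ... | no ¬p = ⊥-elim (true≢false (trans (sym zj) (trans (sym (w-sides {z} zeven (j , true)))
          (cong₂ _xor_ (w-zero (j , true)) (w-zero (j , false))))))
        where
        true≢false : true ≢ false
        true≢false ()
        T = triples φ φ≢ φφ≢ (all-darts n)
        rows = map incidence R ++ map w (reps T)
        few : length rows ℕ.< n
        few = ℕₚ.*-cancelˡ-< 3 _ _ (begin-strict
          3 ℕ.* length rows ≡⟨ cong (3 ℕ.*_) (trans (length-++ (map incidence R)) (cong₂ ℕ._+_ (length-map incidence R) (length-map w (reps T)))) ⟩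
          3 ℕ.* (length R ℕ.+ length (reps T)) ≡⟨ ℕₚ.*-distribˡ-+ 3 (length R) _ ⟩
          3 ℕ.* length R ℕ.+ 3 ℕ.* length (reps T) <⟨ ℕₚ.+-mono-<-≤ (ℕₚ.≰⇒> ¬p) (triples-size φ φ≢ φφ≢ T) ⟩
          n ℕ.+ n ℕ.* 2 ≡⟨ lem n ⟩
          3 ℕ.* n ∎)
          where
          open ℕₚ.≤-Reasoning
          lem : ∀ n → n ℕ.+ n ℕ.* 2 ≡ 3 ℕ.* n
          lem = ℕ-solve-∀
        open import Data.List.Membership.Propositional.Properties using (∈-map⁺; ∈-++⁺ˡ; ∈-++⁺ʳ)
        sol = kernel-nontrivial rows few
        z = proj₁ sol
        j = proj₁ (proj₁ (proj₂ sol))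
        zj = proj₂ (proj₁ (proj₂ sol))
        zeven : EvenSubgraph z
        zeven = even {z} λ v∈ → proj₂ (proj₂ sol) (∈-++⁺ˡ (∈-map⁺ incidence v∈))
        w-zero : ∀ d → w d ∙ z ≡ false
        w-zero = triples-span φ φ≢ φφ≢ T (λ d → w-invariant {z} zeven d)
          (λ d∈ → proj₂ (proj₂ sol) (∈-++⁺ʳ (map incidence R) (∈-map⁺ w d∈)))

-- Sheared coordinates, and segments as graphs over the new abscissa.

module Shear where

  open Segments
  open import Data.Rational using (ℚ; 0ℚ; 1ℚ; _+_; _*_; _-_; -_; _<_; _≤_; nonNegative)
  open import Data.Rational.Properties

  End : Point → Point × Point → Set
  End p (a , b) = p ≡ a ⊎ p ≡ b

  Y : Point → ℚ
  Y = proj₂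

  through : ∀ {x y : ℚ} → x < y → ℚ → ℚ → Segment
  through {x} {y} x<y u v = seg x y m (u - m * x)
    where m = (v - u) * proj₁ (reciprocal (0<- x<y))

  through-lo : ∀ {x y} (x<y : x < y) u v → ht (through x<y u v) x ≡ u
  through-lo {x} {y} x<y u v = lem ((v - u) * proj₁ (reciprocal (0<- x<y))) x u
    where
    lem : ∀ m x u → m * x + (u - m * x) ≡ u
    lem = solve-∀ ℚ-ring

  through-hi : ∀ {x y} (x<y : x < y) u v → ht (through x<y u v) y ≡ v
  through-hi {x} {y} x<y u v = trans (lem (v - u) r x y u)
    (trans (cong (λ t → (v - u) * t + u) (proj₂ (proj₂ (reciprocal (0<- x<y))))) (lem′ u v))
    where
    r = proj₁ (reciprocal (0<- x<y))
    lem : ∀ d r x y u → d * r * y + (u - d * r * x) ≡ d * ((y - x) * r) + u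
    lem = solve-∀ ℚ-ring
    lem′ : ∀ u v → (v - u) * 1ℚ + u ≡ v
    lem′ = solve-∀ ℚ-ring

  *-nonNeg : ∀ {x y} → 0ℚ ≤ x → 0ℚ ≤ y → 0ℚ ≤ x * y
  *-nonNeg {x} {y} 0≤x 0≤y = nonNegative⁻¹ (x * y) {{nonNeg*nonNeg⇒nonNeg x {{nonNegative 0≤x}} y {{nonNegative 0≤y}}}}

  0≤- : ∀ {x y} → x ≤ y → 0ℚ ≤ y - x
  0≤- {x} {y} x≤y = subst (_≤ y - x) (+-inverseʳ x) (+-monoˡ-≤ (- x) x≤y)

  0≤-⁻¹ : ∀ {x y} → 0ℚ ≤ y - x → x ≤ y
  0≤-⁻¹ {x} {y} 0≤y-x = subst₂ _≤_ (+-identityʳ x) (lem x y) (+-monoʳ-≤ x 0≤y-x)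
    where
    lem : ∀ x y → x + (y - x) ≡ y
    lem = solve-∀ ℚ-ring

  OnSegment-sym : ∀ a b p → OnSegment a b p → OnSegment b a p
  OnSegment-sym (x₁ , y₁) (x₂ , y₂) p (t , 0≤t , t≤1 , e) =
    1ℚ - t , 0≤- t≤1 , 0≤-⁻¹ (subst (0ℚ ≤_) (lem₁ t) 0≤t) , trans e (cong₂ _,_ (lem₂ t x₁ x₂) (lem₂ t y₁ y₂))
    where
    lem₁ : ∀ t → t ≡ 1ℚ - (1ℚ - t)
    lem₁ = solve-∀ ℚ-ring
    lem₂ : ∀ t x₁ x₂ → (1ℚ - t) * x₁ + t * x₂ ≡ (1ℚ - (1ℚ - t)) * x₂ + (1ℚ - t) * x₁
    lem₂ = solve-∀ ℚ-ring

  -- Abscissae are taken after the shear (x , y) ↦ (x + ε y , y).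
  module Sheared (ε : ℚ) where

    shear : Point → ℚ
    shear (x , y) = x + ε * y

    shear-injective : ∀ {p q} → shear p ≡ shear q → Y p ≡ Y q → p ≡ q
    shear-injective {x , y} {x′ , _} e refl = cong (_, y) (trans (lem x (ε * y)) (trans (cong (_- ε * y) e) (sym (lem x′ (ε * y)))))
      where
      lem : ∀ x d → x ≡ (x + d) - d
      lem = solve-∀ ℚ-ring

    sheared-on-line : ∀ a b (a<b : shear a < shear b) x → shear a ≤ x → x ≤ shear b →
      ∃[ p ] (OnSegment a b p × shear p ≡ x × Y p ≡ ht (through a<b (Y a) (Y b)) x)
    sheared-on-line a@(x₁ , y₁) b@(x₂ , y₂) a<b x a≤x x≤b =
      ((1ℚ - t) * x₁ + t * x₂ , (1ℚ - t) * y₁ + t * y₂) , (t , *-nonNeg (0≤- a≤x) (<⇒≤ 0<r) , 0≤-⁻¹ (subst (0ℚ ≤_) 1-t (*-nonNeg (0≤- x≤b) (<⇒≤ 0<r))) , refl) ,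
      trans (lem₁ t x₁ x₂ y₁ y₂ ε) (trans (cong (shear a +_) (trans (lem₂ (x - shear a) r (shear b - shear a)) (trans (cong ((x - shear a) *_) dr) (*-identityʳ (x - shear a))))) (lem₃ (shear a) x)) ,
      lem₄ x (shear a) r y₁ y₂
      where
      r = proj₁ (reciprocal (0<- a<b))
      0<r = proj₁ (proj₂ (reciprocal (0<- a<b)))
      dr : (shear b - shear a) * r ≡ 1ℚ
      dr = proj₂ (proj₂ (reciprocal (0<- a<b)))
      t = (x - shear a) * r
      1-t : (shear b - x) * r ≡ 1ℚ - t
      1-t = trans (lem (shear a) (shear b) x r) (cong (_- t) dr)
        where
        lem : ∀ a b x r → (b - x) * r ≡ (b - a) * r - (x - a) * r
        lem = solve-∀ ℚ-ring
      lem₁ : ∀ t x₁ x₂ y₁ y₂ ε → ((1ℚ - t) * x₁ + t * x₂) + ε * ((1ℚ - t) * y₁ + t * y₂) ≡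
        (x₁ + ε * y₁) + t * ((x₂ + ε * y₂) - (x₁ + ε * y₁))
      lem₁ = solve-∀ ℚ-ring
      lem₂ : ∀ u r d → u * r * d ≡ u * (d * r)
      lem₂ = solve-∀ ℚ-ring
      lem₃ : ∀ a x → a + (x - a) ≡ x
      lem₃ = solve-∀ ℚ-ring
      lem₄ : ∀ x a r y₁ y₂ → (1ℚ - (x - a) * r) * y₁ + (x - a) * r * y₂ ≡ (y₂ - y₁) * r * x + (y₁ - (y₂ - y₁) * r * a)
      lem₄ = solve-∀ ℚ-ring

    abstract
      X : Point → ℚ
      X = shear

      X-def : ∀ p → X p ≡ shear p
      X-def p = refl

      XY-injective : ∀ {p q} → X p ≡ X q → Y p ≡ Y q → p ≡ q
      XY-injective = shear-injective

      on-line : ∀ a b (a<b : X a < X b) x → X a ≤ x → x ≤ X b →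
        ∃[ p ] (OnSegment a b p × X p ≡ x × Y p ≡ ht (through a<b (Y a) (Y b)) x)
      on-line = sheared-on-line

    -- The segment is read from left to right whichever way it is directed. The vertical case is a
    -- dummy value, excluded by the hypothesis of `orient`.
    line-by : ∀ a b → Tri (X a < X b) (X a ≡ X b) (X b < X a) → Segment
    line-by a b (tri< a<b _ _) = through a<b (Y a) (Y b)
    line-by a b (tri≈ _ _ _)   = seg 0ℚ 0ℚ 0ℚ 0ℚ
    line-by a b (tri> _ _ b<a) = through b<a (Y b) (Y a)

    abstract
      line : Point × Point → Segment
      line (a , b) = line-by a b (compare (X a) (X b))

    record OrientedBy (s : Point × Point) (l : Segment) : Set where
      field
        left right : Point
        ends  : s ≡ (left , right) ⊎ s ≡ (right , left)
        lo≡   : lo l ≡ X left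
        hi≡   : hi l ≡ X right
        left-height  : height l (lo l) ≡ Y left
        right-height : height l (hi l) ≡ Y right
        lo<hi : lo l < hi l
        point-at : ∀ x → lo l ≤ x → x ≤ hi l →
          ∃[ p ] (OnSegment (proj₁ s) (proj₂ s) p × X p ≡ x × Y p ≡ height l x)

    orient-by : ∀ a b t → X a ≢ X b → OrientedBy (a , b) (line-by a b t)
    orient-by a b (tri< a<b _ _) a≢b = record
      { left = a ; right = b ; ends = inj₁ refl ; lo≡ = refl ; hi≡ = refl
      ; left-height = trans (height-def _ _) (through-lo a<b (Y a) (Y b))
      ; right-height = trans (height-def _ _) (through-hi a<b (Y a) (Y b))
      ; lo<hi = a<b
      ; point-at = λ x p q → let (r , on , e , f) = on-line a b a<b x p q in r , on , e , trans f (sym (height-def _ _)) }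
    orient-by a b (tri≈ _ e _) a≢b = ⊥-elim (a≢b e)
    orient-by a b (tri> _ _ b<a) a≢b = record
      { left = b ; right = a ; ends = inj₂ refl ; lo≡ = refl ; hi≡ = refl
      ; left-height = trans (height-def _ _) (through-lo b<a (Y b) (Y a))
      ; right-height = trans (height-def _ _) (through-hi b<a (Y b) (Y a))
      ; lo<hi = b<a
      ; point-at = λ x p q → let (r , on , e , f) = on-line b a b<a x p q in r , OnSegment-sym b a r on , e , trans f (sym (height-def _ _)) }

    Oriented : Point × Point → Set
    Oriented s = OrientedBy s (line s)

    abstract
      orient : ∀ {a b} → X a ≢ X b → Oriented (a , b)
      orient {a} {b} = orient-by a b (compare (X a) (X b))

-- Cyclic order of darts, and the parity below each corner of a drawing.

module Sweep where

  open Segments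
  open Shear
  open Darts
  open import Data.Fin using (Fin)
  open import Data.List using ([]; _∷_)
  open import Data.Rational using (ℚ; _<_; _≤_)
  open import Data.Rational.Properties using (_≟_; ≤-refl; <⇒≤; <-trans; <⇒≢; <-irrefl; <-dense)

  module CyclicSuccessor {A K : Set} (κ : A → K) (_≺_ : K → K → Set)
    (≺-trans : ∀ {x y z} → x ≺ y → y ≺ z → x ≺ z)
    (≺-cmp : ∀ x y → x ≺ y ⊎ x ≡ y ⊎ y ≺ x)
    (≺-irrefl : ∀ {x} → ¬ (x ≺ x)) where

    _≼_ : K → K → Set
    x ≼ y = x ≺ y ⊎ x ≡ y

    ≼-trans : ∀ {x y z} → x ≼ y → y ≼ z → x ≼ z
    ≼-trans (inj₁ p) (inj₁ q) = inj₁ (≺-trans p q)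
    ≼-trans (inj₁ p) (inj₂ refl) = inj₁ p
    ≼-trans (inj₂ refl) q = q

    minimum : ∀ x xs → ∃[ t ] (t ∈ x ∷ xs × (∀ {z} → z ∈ x ∷ xs → κ t ≼ κ z))
    minimum x [] = x , here refl , λ { (here refl) → inj₂ refl }
    minimum x (y ∷ ys) with minimum y ys
    ... | t , t∈ , le with ≺-cmp (κ x) (κ t)
    ...   | inj₁ p = x , here refl , λ { (here refl) → inj₂ refl ; (there z∈) → ≼-trans (inj₁ p) (le z∈) }
    ...   | inj₂ (inj₁ p) = x , here refl , λ { (here refl) → inj₂ refl ; (there z∈) → ≼-trans (inj₂ p) (le z∈) }
    ...   | inj₂ (inj₂ p) = t , there t∈ , λ { (here refl) → inj₁ p ; (there z∈) → le z∈ }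

    -- Cyclic succession: either `t` comes next after `s`, or `s` is last and `t` is first. It is
    -- spelled out for every member of the list because the corner between `s` and `t` is compared
    -- with each dart separately.
    Follows : List A → A → A → Set
    Follows ds s t =
      (∀ {z} → z ∈ ds → (κ z ≼ κ s × κ z ≺ κ t) ⊎ (κ s ≺ κ z × κ t ≼ κ z)) ⊎
      (∀ {z} → z ∈ ds → κ z ≼ κ s × κ t ≼ κ z)

    -- The least of the later elements, or the least of all if there are none.
    successor : ∀ {ds s} → s ∈ ds → ∃[ t ] (t ∈ ds × Follows ds s t)
    successor {ds} {s} s∈ = go ds s∈ (filter later? ds) refl
      where
      later? : ∀ z → Dec (κ s ≺ κ z)
      later? z with ≺-cmp (κ s) (κ z)
      ... | inj₁ p = yes p
      ... | inj₂ (inj₁ p) = no λ q → ≺-irrefl (subst (_≺ κ z) p q)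
      ... | inj₂ (inj₂ p) = no λ q → ≺-irrefl (≺-trans p q)
      go : ∀ ds → s ∈ ds → ∀ es → filter later? ds ≡ es → ∃[ t ] (t ∈ ds × Follows ds s t)
      go (d ∷ ds′) s∈ [] eq with minimum d ds′
      ... | t , t∈ , le = t , t∈ , inj₂ λ {z} z∈ → ≼s z∈ , le z∈
        where
        ≼s : ∀ {z} → z ∈ d ∷ ds′ → κ z ≼ κ s
        ≼s {z} z∈ with ≺-cmp (κ s) (κ z)
        ... | inj₂ (inj₁ p) = inj₂ (sym p)
        ... | inj₂ (inj₂ p) = inj₁ p
        ... | inj₁ p with subst (z ∈_) eq (∈-filter⁺ later? {xs = d ∷ ds′} z∈ p)
        ...   | ()
      go ds s∈ (e ∷ es) eq with minimum e es
      ... | t , t∈ , le = t , proj₁ t∈′ , inj₁ split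
        where
        t∈′ = ∈-filter⁻ later? {xs = ds} (subst (t ∈_) (sym eq) t∈)
        split : ∀ {z} → z ∈ ds → (κ z ≼ κ s × κ z ≺ κ t) ⊎ (κ s ≺ κ z × κ t ≼ κ z)
        split {z} z∈ with ≺-cmp (κ s) (κ z)
        ... | inj₁ p = inj₂ (p , le (subst (z ∈_) eq (∈-filter⁺ later? z∈ p)))
        ... | inj₂ (inj₁ p) = inj₁ (inj₂ (sym p) , subst (_≺ κ t) p (proj₂ t∈′))
        ... | inj₂ (inj₂ p) = inj₁ (inj₁ p , ≺-trans p (proj₂ t∈′))

  -- Darts leaving a point, counterclockwise from straight down: first those
  -- going right, then those going left, each by increasing slope.
  Direction : Set
  Direction = Bool × ℚ

  precedes : Bool → Direction → Direction → Bool
  precedes b (true  , m) (true  , m′) = cmp b m m′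
  precedes b (true  , m) (false , m′) = true
  precedes b (false , m) (true  , m′) = false
  precedes b (false , m) (false , m′) = cmp b m m′

  data _≺_ : Direction → Direction → Set where
    same   : ∀ {r m m′} → m < m′ → (r , m) ≺ (r , m′)
    across : ∀ {m m′} → (true , m) ≺ (false , m′)

  ≺-trans : ∀ {x y z} → x ≺ y → y ≺ z → x ≺ z
  ≺-trans (same p) (same q) = same (<-trans p q)
  ≺-trans (same p) across = across
  ≺-trans across (same q) = across

  ≺-irrefl : ∀ {x} → ¬ (x ≺ x)
  ≺-irrefl (same p) = <-irrefl refl p

  ≺-cmp : ∀ x y → x ≺ y ⊎ x ≡ y ⊎ y ≺ x
  ≺-cmp (true , m) (false , m′) = inj₁ across
  ≺-cmp (false , m) (true , m′) = inj₂ (inj₂ across)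
  ≺-cmp (true , m) (true , m′) with compare m m′
  ... | tri< p _ _ = inj₁ (same p)
  ... | tri≈ _ p _ = inj₂ (inj₁ (cong (true ,_) p))
  ... | tri> _ _ p = inj₂ (inj₂ (same p))
  ≺-cmp (false , m) (false , m′) with compare m m′
  ... | tri< p _ _ = inj₁ (same p)
  ... | tri≈ _ p _ = inj₂ (inj₁ (cong (false ,_) p))
  ... | tri> _ _ p = inj₂ (inj₂ (same p))

  precedes-≺ : ∀ b {x y} → x ≺ y → precedes b x y ≡ true
  precedes-≺ b (same {true} p) = cmp-< b p
  precedes-≺ b (same {false} p) = cmp-< b p
  precedes-≺ b across = refl

  precedes-≻ : ∀ b {x y} → y ≺ x → precedes b x y ≡ false
  precedes-≻ b (same {true} p) = cmp-> b p
  precedes-≻ b (same {false} p) = cmp-> b p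
  precedes-≻ b across = refl

  precedes-≡ : ∀ b {x y} → x ≡ y → precedes b x y ≡ b
  precedes-≡ b {true , m} refl = cmp-≡ b refl
  precedes-≡ b {false , m} refl = cmp-≡ b refl

  direction : ℚ → Segment → Direction
  direction x z = eq x (lo z) , slope z

  EndAt : ℚ → Segment → Set
  EndAt x z = x ≡ lo z ⊎ x ≡ hi z

  -- At an end of both segments, the conditionals of `turn` amount to the cyclic order of
  -- directions, cut open straight down.
  turn-precedes : ∀ b x s z → EndAt x s → EndAt x z → turn b x s z ≡ precedes b (direction x z) (direction x s)
  turn-precedes b x s z p q with eq x (lo z) in ez | eq x (lo s)
  ... | true | true = refl
  ... | true | false = refl
  ... | false | true with eq x (hi z)
  ...   | true = refl
  ...   | false = refl
  turn-precedes b x s z p (inj₁ e) | false | false with trans (sym ez) (eq-yes e)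
  ... | ()
  turn-precedes b x s z p (inj₂ e) | false | false rewrite eq-yes e = refl

  turn-elsewhere : ∀ b x s z → ¬ EndAt x z → turn b x s z ≡ false
  turn-elsewhere b x s z p rewrite eq-no (p ∘ inj₁) | eq-no (p ∘ inj₂) = refl

  segments : Point → List Point → Point → List (Point × Point)
  segments a []      z = (a , z) ∷ []
  segments a (b ∷ l) z = (a , b) ∷ segments b l z

  first-segment last-segment : Point → List Point → Point → Point × Point
  first-segment a []      z = a , z
  first-segment a (b ∷ l) z = a , b
  last-segment a []      z = a , z
  last-segment a (b ∷ l) z = last-segment b l z

  last∈segments : ∀ a l z → last-segment a l z ∈ segments a l z
  last∈segments a [] z = here refl
  last∈segments a (b ∷ l) z = there (last∈segments b l z)

  first∈segments : ∀ a l z → first-segment a l z ∈ segments a l z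
  first∈segments a [] z = here refl
  first∈segments a (b ∷ l) z = here refl

  last-end : ∀ a l z → proj₂ (last-segment a l z) ≡ z
  last-end a [] z = refl
  last-end a (b ∷ l) z = last-end b l z

  first-start : ∀ a l z → proj₁ (first-segment a l z) ≡ a
  first-start a [] z = refl
  first-start a (b ∷ l) z = refl

  -- Every bend occurs twice and cancels over GF(2).
  telescope : ∀ (ω : Point → Bool) a l z →
    ⊕ᴸ (λ s → ω (proj₁ s) xor ω (proj₂ s)) (segments a l z) ≡ ω a xor ω z
  telescope ω a [] z = xor-identityʳ _
  telescope ω a (b ∷ l) z = trans (cong ((ω a xor ω b) xor_) (telescope ω b l z)) (lem (ω a) (ω b) (ω z))
    where
    lem : ∀ x y z → (x xor y) xor (y xor z) ≡ x xor z
    lem x y z = trans (xor-assoc x y (y xor z)) (cong (x xor_) (trans (sym (xor-assoc y y z)) (cong (_xor z) (xor-same y))))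

  ×-≟ : (s t : Point × Point) → Dec (s ≡ t)
  ×-≟ = ×ₚ.≡-dec (×ₚ.≡-dec _≟_ _≟_) (×ₚ.≡-dec _≟_ _≟_)

  module Arcs (ε : ℚ) {n N} (pos : Fin N → Point) (origin : Dart n → Fin N) (bends : Fin n → List Point) where

    open Sheared ε public

    st fin : Fin n → Point
    st i = pos (origin (i , false))
    fin i = pos (origin (i , true))

    S : Fin n → List (Point × Point)
    S i = segments (st i) (bends i) (fin i)

    segment-at : Dart n → Point × Point
    segment-at (i , false) = first-segment (st i) (bends i) (fin i)
    segment-at (i , true)  = last-segment (st i) (bends i) (fin i)

    place : Dart n → Point
    place d = pos (origin d)

    record Plane : Set where
      field
        distinct-ends : ∀ {i a b} → (a , b) ∈ S i → X a ≢ X b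
        general : ∀ {i j s z p q} → s ∈ S i → z ∈ S j → End p s → End q z → X p ≡ X q → p ≡ q
        meets : ∀ {i j s z} → s ∈ S i → z ∈ S j → ∀ p → OnSegment (proj₁ s) (proj₂ s) p → OnSegment (proj₁ z) (proj₂ z) p →
          (i ≡ j × s ≡ z) ⊎ (End p s × End p z)
        vertex-end : ∀ {j z v} → z ∈ S j → End (pos v) z → ∃[ b ] (origin (j , b) ≡ v × z ≡ segment-at (j , b))
        bend-end : ∀ {i j pre a q c post z} → S i ≡ pre ++ (a , q) ∷ (q , c) ∷ post → z ∈ S j → End q z → z ≡ (a , q) ⊎ z ≡ (q , c)
        segments-unique : ∀ i → Unique (S i)
        dart-segment : ∀ i → st i ≢ fin i

    module _ (plane : Plane) where
      open Plane plane

      orientation : ∀ {i s} → s ∈ S i → Oriented s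
      orientation s∈ = orient (distinct-ends s∈)

      total : (Point × Point → Bool) → (Fin n → Bool) → Bool
      total f z = (λ i → ⊕ᴸ f (S i)) ∙ z

      total-cong : ∀ {f g} z → (∀ {i s} → s ∈ S i → f s ≡ g s) → total f z ≡ total g z
      total-cong z e = ⊕-cong λ i → cong (_∧ z i) (⊕ᴸ-cong (S i) e)

      total-xor : ∀ f g z → total (λ s → f s xor g s) z ≡ total f z xor total g z
      total-xor f g z = trans (⊕-cong λ i → trans (cong (_∧ z i) (⊕ᴸ-xor f g (S i))) (∧-distribʳ-xor (z i) (⊕ᴸ f (S i)) (⊕ᴸ g (S i))))
        (⊕-xor (λ i → ⊕ᴸ f (S i) ∧ z i) (λ i → ⊕ᴸ g (S i) ∧ z i))

      total-zero : ∀ z → total (λ _ → false) z ≡ false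
      total-zero z = ⊕-false {n} λ i → cong (_∧ z i) (⊕ᴸ-false (S i) λ _ → refl)

      Even : (Fin n → Bool) → Set
      Even z = ∀ (ω : Fin N → Bool) → ⊕ (λ i → z i ∧ (ω (origin (i , false)) xor ω (origin (i , true)))) ≡ false

      -- An even subgraph has no boundary: values cancel along each arc, and those left at the
      -- vertices cancel by evenness. Applied to the region below a segment, this disposes of all
      -- ends lying in it.
      total-boundary : ∀ {z} → Even z → ∀ (ω : Point → Bool) → total (λ s → ω (proj₁ s) xor ω (proj₂ s)) z ≡ false
      total-boundary {z} ev ω = trans (⊕-cong λ i → trans (cong (_∧ z i) (telescope ω (st i) (bends i) (fin i))) (∧-comm _ (z i))) (ev (ω ∘ pos))

      -- One segment's share in the crossings of a ray that starts close to `p`, in the corner just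
      -- after `s` counterclockwise if `b` is `true` and just before it otherwise: passing below
      -- `p`, or being a dart at `p` between straight down and that corner.
      tn : Bool → Point → Point × Point → Point × Point → Bool
      tn b p s z = under (line z) (X p) (Y p) xor turn b (X p) (line s) (line z)

      side : Bool → Point → Point × Point → (Fin n → Bool) → Bool
      side b p s z = total (tn b p s) z

      ends-of : ∀ {s} (o : Oriented s) → End (OrientedBy.left o) s × End (OrientedBy.right o) s
      ends-of o with OrientedBy.ends o
      ... | inj₁ refl = inj₁ refl , inj₂ refl
      ... | inj₂ refl = inj₂ refl , inj₁ refl

      end-at : ∀ {i s p} → s ∈ S i → End p s → EndAt (X p) (line s)
      end-at {s = s} s∈ e with orientation s∈
      ... | o with OrientedBy.ends o | e
      ...   | inj₁ refl | inj₁ refl = inj₁ (sym (OrientedBy.lo≡ o))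
      ...   | inj₁ refl | inj₂ refl = inj₂ (sym (OrientedBy.hi≡ o))
      ...   | inj₂ refl | inj₁ refl = inj₂ (sym (OrientedBy.hi≡ o))
      ...   | inj₂ refl | inj₂ refl = inj₁ (sym (OrientedBy.lo≡ o))

      at-end : ∀ {i j s z p} → s ∈ S i → End p s → z ∈ S j → EndAt (X p) (line z) → End p z
      at-end s∈ e z∈ f with orientation z∈
      ... | o with ends-of o
      at-end s∈ e z∈ (inj₁ f) | o | l , r = subst (λ p → End p _) (sym (general s∈ z∈ e l (trans f (OrientedBy.lo≡ o)))) l
      at-end s∈ e z∈ (inj₂ f) | o | l , r = subst (λ p → End p _) (sym (general s∈ z∈ e r (trans f (OrientedBy.hi≡ o)))) r

      module Transport {i s} (s∈ : s ∈ S i) where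
        o = orientation s∈
        open OrientedBy o
        L = line s

        ω : Point → Bool
        ω p = region L (X p) (Y p)

        local : ∀ b {j z} → z ∈ S j →
          tn b left s z xor tn (not b) right s z xor (ω (proj₁ z) xor ω (proj₂ z)) ≡ false
        local b {j} {z} z∈ = trans (cong₂ _xor_ (cong₂ _xor_ (cong₂ (under M) (sym lo≡) (sym left-height)) (cong (λ x → turn b x L M) (sym lo≡)))
            (cong₂ _xor_ (cong₂ _xor_ (cong₂ (under M) (sym hi≡) (sym right-height)) (cong (λ x → turn (not b) x L M) (sym hi≡))) boundary))
          core
          where
          oz = orientation z∈
          module Z = OrientedBy oz
          M = line z
          boundary : ω (proj₁ z) xor ω (proj₂ z) ≡ region L (lo M) (height M (lo M)) xor region L (hi M) (height M (hi M))
          boundary with Z.ends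
          ... | inj₁ e = trans (cong (λ z → ω (proj₁ z) xor ω (proj₂ z)) e)
                (cong₂ _xor_ (cong₂ (region L) (sym Z.lo≡) (sym Z.left-height)) (cong₂ (region L) (sym Z.hi≡) (sym Z.right-height)))
          ... | inj₂ e = trans (cong (λ z → ω (proj₁ z) xor ω (proj₂ z)) e) (trans (xor-comm (ω Z.right) (ω Z.left))
                (cong₂ _xor_ (cong₂ (region L) (sym Z.lo≡) (sym Z.left-height)) (cong₂ (region L) (sym Z.hi≡) (sym Z.right-height))))
          Core : Segment → Set
          Core M = (under M (lo L) (height L (lo L)) xor turn b (lo L) L M) xor
            (under M (hi L) (height L (hi L)) xor turn (not b) (hi L) L M) xor
            (region L (lo M) (height M (lo M)) xor region L (hi M) (height M (hi M))) ≡ false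
          -- Against itself, only its two turns and its right end count: b + not b + 1 = 0.
          self : Core L
          self rewrite lt-no (≤-refl {lo L}) | lt-no (≤-refl {hi L}) | lt-yes lo<hi | eq-yes (refl {x = lo L}) | eq-yes (refl {x = hi L})
            | cmp-≡ b (refl {x = slope L}) | cmp-≡ (not b) (refl {x = slope L}) | eq-no (<⇒≢′ lo<hi) | eq-no (<⇒≢ lo<hi) = bool b
            where
            bool : ∀ b → b xor not b xor true ≡ false
            bool true = refl
            bool false = refl
          different : ¬ (i ≡ j × s ≡ z) → Core M
          different differ = clip-parity b L M lo<hi Z.lo<hi crossings
            (λ e → trans left-height (trans (cong Y (general s∈ z∈ (proj₁ (ends-of o)) (proj₁ (ends-of oz)) (trans (sym lo≡) (trans (sym e) Z.lo≡))))
               (trans (sym Z.left-height) (cong (height M) e))))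
            (λ e → trans right-height (trans (cong Y (general s∈ z∈ (proj₂ (ends-of o)) (proj₂ (ends-of oz)) (trans (sym hi≡) (trans (sym e) Z.hi≡))))
               (trans (sym Z.right-height) (cong (height M) e))))
            where
            crossings : ∀ x → lo L ≤ x → x ≤ hi L → lo M ≤ x → x ≤ hi M → height L x ≡ height M x →
              (x ≡ lo L ⊎ x ≡ hi L) × (x ≡ lo M ⊎ x ≡ hi M)
            crossings x p q p′ q′ e with point-at x p q | Z.point-at x p′ q′
            ... | r , on , rx , ry | r′ , on′ , rx′ , ry′ with XY-injective (trans rx (sym rx′)) (trans ry (trans e (sym ry′)))
            ...   | refl with meets s∈ z∈ r on on′
            ...     | inj₁ eq = ⊥-elim (differ eq)
            ...     | inj₂ (e₁ , e₂) = subst (λ x → EndAt x L) rx (end-at s∈ e₁) , subst (λ x → EndAt x M) rx (end-at z∈ e₂)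
          core : Core M
          core with i Finₚ.≟ j | ×-≟ s z
          ... | yes refl | yes refl = self
          ... | no i≢j | _ = different λ { (e , _) → i≢j e }
          ... | _ | no s≢z = different λ { (_ , e) → s≢z e }

        -- Summing `local` over the segments of `z`, the region terms form a boundary and vanish.
        -- The rest says that the parity stays the same along one side of `s`; that side is after
        -- `s` at one end and before it at the other, hence `not b`.
        across-segment : ∀ {z} → Even z → ∀ b → side b left s z ≡ side (not b) right s z
        across-segment {z} ev b = xor-cancel (begin
          side b left s z xor side (not b) right s z
            ≡⟨ cong (side b left s z xor_) (xor-identityʳ _) ⟨
          side b left s z xor (side (not b) right s z xor false)
            ≡⟨ cong (λ t → side b left s z xor (side (not b) right s z xor t)) (total-boundary {z} ev ω) ⟨
          side b left s z xor (side (not b) right s z xor total bdy z)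
            ≡⟨ cong (side b left s z xor_) (total-xor (tn (not b) right s) bdy z) ⟨
          side b left s z xor total (λ z → tn (not b) right s z xor bdy z) z
            ≡⟨ total-xor (tn b left s) (λ z → tn (not b) right s z xor bdy z) z ⟨
          total (λ z → tn b left s z xor (tn (not b) right s z xor bdy z)) z
            ≡⟨ total-cong z (local b) ⟩
          total (λ _ → false) z ≡⟨ total-zero z ⟩
          false ∎)
          where
          open ≡-Reasoning
          bdy : Point × Point → Bool
          bdy z = ω (proj₁ z) xor ω (proj₂ z)
          xor-cancel : ∀ {x y} → x xor y ≡ false → x ≡ y
          xor-cancel {true} {true} _ = refl
          xor-cancel {false} {false} _ = refl

      not² : ∀ b → not (not b) ≡ b
      not² true = refl
      not² false = refl

      transport : ∀ {i a c} → (a , c) ∈ S i → ∀ {z} → Even z → ∀ b → side b a (a , c) z ≡ side (not b) c (a , c) z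
      transport s∈ {z} ev b with OrientedBy.ends (Transport.o s∈) | Transport.across-segment s∈ {z} ev
      ... | inj₁ q | e = trans (cong (λ p → side b p _ z) (cong proj₁ q)) (trans (e b) (cong (λ p → side (not b) p _ z) (sym (cong proj₂ q))))
      ... | inj₂ q | e = trans (cong (λ p → side b p _ z) (cong proj₁ q)) (trans (sym (cong (λ b → side b _ _ z) (not² b)))
        (trans (sym (e (not b))) (cong (λ p → side (not b) p _ z) (sym (cong proj₂ q)))))

      dir : Point → Point × Point → Direction
      dir p z = direction (X p) (line z)

      -- Two segments leaving p in the same direction have further common points.
      overlapping : ∀ {i j s z p} → s ∈ S i → z ∈ S j → End p s → End p z → dir p s ≡ dir p z → i ≡ j × s ≡ z
      overlapping {i} {j} {s} {z} {p} s∈ z∈ e f d = cases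
        where
        o = orientation s∈
        oz = orientation z∈
        module O = OrientedBy o
        module Z = OrientedBy oz
        L = line s
        M = line z
        slopes : slope M ≡ slope L
        slopes = sym (cong proj₂ d)
        height-at : ∀ {i s} (s∈ : s ∈ S i) → End p s → height (line s) (X p) ≡ Y p
        height-at {s = s} s∈ e with orientation s∈
        ... | o with OrientedBy.ends o | e
        ...   | inj₁ refl | inj₁ refl = trans (cong (height (line s)) (sym (OrientedBy.lo≡ o))) (OrientedBy.left-height o)
        ...   | inj₁ refl | inj₂ refl = trans (cong (height (line s)) (sym (OrientedBy.hi≡ o))) (OrientedBy.right-height o)
        ...   | inj₂ refl | inj₁ refl = trans (cong (height (line s)) (sym (OrientedBy.hi≡ o))) (OrientedBy.right-height o)
        ...   | inj₂ refl | inj₂ refl = trans (cong (height (line s)) (sym (OrientedBy.lo≡ o))) (OrientedBy.left-height o)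
        heights : ∀ x → height M x ≡ height L x
        heights x = slope-same⇒ L M {X p} {x} slopes (trans (height-at z∈ f) (sym (height-at s∈ e)))
        common : ∀ x → lo L < x → x < hi L → lo M < x → x < hi M → i ≡ j × s ≡ z
        common x a b c d with O.point-at x (<⇒≤ a) (<⇒≤ b) | Z.point-at x (<⇒≤ c) (<⇒≤ d)
        ... | r , on , rx , ry | r′ , on′ , rx′ , ry′ with XY-injective (trans rx (sym rx′)) (trans ry (trans (sym (heights x)) (sym ry′)))
        ...   | refl with meets s∈ z∈ r on on′
        ...     | inj₁ eq = eq
        ...     | inj₂ (e₁ , _) with end-at s∈ e₁
        ...       | inj₁ u = ⊥-elim (<⇒≢ a (trans (sym u) rx))
        ...       | inj₂ u = ⊥-elim (<⇒≢ b (trans (sym rx) u))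
        true≢false : true ≢ false
        true≢false ()
        rightward : X p ≡ lo L → X p ≡ lo M → i ≡ j × s ≡ z
        rightward u v with compare (hi L) (hi M)
        ... | tri< q _ _ with <-dense O.lo<hi
        ...   | x , lx , xh = common x lx xh (subst (_< x) (trans (sym u) v) lx) (<-trans xh q)
        rightward u v | tri≈ _ q _ with <-dense O.lo<hi
        ...   | x , lx , xh = common x lx xh (subst (_< x) (trans (sym u) v) lx) (subst (x <_) q xh)
        rightward u v | tri> _ _ q with <-dense Z.lo<hi
        ...   | x , lx , xh = common x (subst (_< x) (trans (sym v) u) lx) (<-trans xh q) lx xh
        leftward : X p ≡ hi L → X p ≡ hi M → i ≡ j × s ≡ z
        leftward u v with compare (lo M) (lo L)
        ... | tri< q _ _ with <-dense O.lo<hi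
        ...   | x , lx , xh = common x lx xh (<-trans q lx) (subst (x <_) (trans (sym u) v) xh)
        leftward u v | tri≈ _ q _ with <-dense O.lo<hi
        ...   | x , lx , xh = common x lx xh (subst (_< x) (sym q) lx) (subst (x <_) (trans (sym u) v) xh)
        leftward u v | tri> _ _ q with <-dense Z.lo<hi
        ...   | x , lx , xh = common x (<-trans q lx) (subst (x <_) (trans (sym v) u) xh) lx xh
        cases : i ≡ j × s ≡ z
        cases with end-at s∈ e | end-at z∈ f
        ... | inj₁ u | inj₁ v = rightward u v
        ... | inj₂ u | inj₂ v = leftward u v
        ... | inj₁ u | inj₂ v = ⊥-elim (true≢false (trans (sym (eq-yes u)) (trans (cong proj₁ d) (eq-no λ w → <⇒≢ Z.lo<hi (trans (sym w) v)))))
        ... | inj₂ u | inj₁ v = ⊥-elim (true≢false (trans (sym (eq-yes v)) (trans (sym (cong proj₁ d)) (eq-no λ w → <⇒≢ O.lo<hi (trans (sym w) u)))))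

      private
        module Order (p : Point) where
          open CyclicSuccessor {Dart n} (λ d → dir p (segment-at d)) _≺_ ≺-trans ≺-cmp ≺-irrefl public

      open CyclicSuccessor {Direction} (λ d → d) _≺_ ≺-trans ≺-cmp ≺-irrefl using (_≼_)

      precedes-true : ∀ {x y} → x ≼ y → precedes true x y ≡ true
      precedes-true (inj₁ p) = precedes-≺ true p
      precedes-true (inj₂ p) = precedes-≡ true p

      precedes-false : ∀ {x y} → y ≼ x → precedes false x y ≡ false
      precedes-false (inj₁ p) = precedes-≻ false p
      precedes-false (inj₂ p) = precedes-≡ false (sym p)

      Adjacent : Direction → Direction → Direction → Set
      Adjacent s t z = (z ≼ s × z ≺ t) ⊎ (s ≺ z × t ≼ z)

      module _ {i k s t p} (s∈ : s ∈ S i) (t∈ : t ∈ S k) (es : End p s) (et : End p t) where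

        private
          turn-at : ∀ b {j i s z} → s ∈ S i → End p s → z ∈ S j → End p z → turn b (X p) (line s) (line z) ≡ precedes b (dir p z) (dir p s)
          turn-at b {s = s} {z} s∈ es z∈ e = turn-precedes b (X p) (line s) (line z) (end-at s∈ es) (end-at z∈ e)

          turn-off : ∀ b {j} s {z} → z ∈ S j → ¬ End p z → turn b (X p) (line s) (line z) ≡ false
          turn-off b s {z} z∈ e = turn-elsewhere b (X p) (line s) (line z) (e ∘ at-end s∈ es z∈)

        end? : ∀ z → Dec (End p z)
        end? (a , b) with ×ₚ.≡-dec _≟_ _≟_ p a | ×ₚ.≡-dec _≟_ _≟_ p b
        ... | yes e | _ = yes (inj₁ e)
        ... | _ | yes e = yes (inj₂ e)
        ... | no e | no f = no λ { (inj₁ g) → e g ; (inj₂ g) → f g }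

        -- When p is passed, the last direction meets the first one through the
        -- downward vertical; all darts at p are then counted, an even number.
        corner : (∀ {j z} → z ∈ S j → End p z → Adjacent (dir p s) (dir p t) (dir p z)) ⊎
                 (∀ {j z} → z ∈ S j → End p z → dir p z ≼ dir p s × dir p t ≼ dir p z) →
                 ∀ {z} → Even z → side true p s z ≡ side false p t z
        corner (inj₁ adj) {z} ev = total-cong z λ {j} {x} x∈ → cong (under (line x) (X p) (Y p) xor_) (turns x∈ (end? x))
          where
          turns : ∀ {j x} → x ∈ S j → Dec (End p x) → turn true (X p) (line s) (line x) ≡ turn false (X p) (line t) (line x)
          turns x∈ (no e) = trans (turn-off true s x∈ e) (sym (turn-off false t x∈ e))
          turns x∈ (yes e) with adj x∈ e
          ... | inj₁ (u , v) = trans (trans (turn-at true s∈ es x∈ e) (precedes-true u)) (sym (trans (turn-at false t∈ et x∈ e) (precedes-≺ false v)))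
          ... | inj₂ (u , v) = trans (trans (turn-at true s∈ es x∈ e) (precedes-≻ true u)) (sym (trans (turn-at false t∈ et x∈ e) (precedes-false v)))
        corner (inj₂ wrap) {z} ev = begin
          total (tn true p s) z ≡⟨ total-cong z (λ {j} {x} x∈ → cong (under (line x) (X p) (Y p) xor_) (all x∈ (end? x))) ⟩
          total (λ x → under (line x) (X p) (Y p) xor (ω (proj₁ x) xor ω (proj₂ x))) z ≡⟨ total-xor (λ x → under (line x) (X p) (Y p)) (λ x → ω (proj₁ x) xor ω (proj₂ x)) z ⟩
          total (λ x → under (line x) (X p) (Y p)) z xor total (λ x → ω (proj₁ x) xor ω (proj₂ x)) z
            ≡⟨ cong (total (λ x → under (line x) (X p) (Y p)) z xor_) (total-boundary {z} ev ω) ⟩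
          total (λ x → under (line x) (X p) (Y p)) z xor false ≡⟨ xor-identityʳ _ ⟩
          total (λ x → under (line x) (X p) (Y p)) z ≡⟨ total-cong z (λ {j} {x} x∈ → sym (trans (cong (under (line x) (X p) (Y p) xor_) (none x∈ (end? x))) (xor-identityʳ _))) ⟩
          total (tn false p t) z ∎
          where
          open ≡-Reasoning
          ω : Point → Bool
          ω q = eq (X p) (X q)
          all : ∀ {j x} → x ∈ S j → Dec (End p x) → turn true (X p) (line s) (line x) ≡ ω (proj₁ x) xor ω (proj₂ x)
          all x∈ (yes e) = trans (trans (turn-at true s∈ es x∈ e) (precedes-true (proj₁ (wrap x∈ e)))) (sym (one e))
            where
            one : End p _ → _
            one (inj₁ refl) = cong₂ _xor_ (eq-yes refl) (eq-no (distinct-ends x∈))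
            one (inj₂ refl) = cong₂ _xor_ (eq-no (distinct-ends x∈ ∘ sym)) (eq-yes refl)
          all x∈ (no e) = trans (turn-off true s x∈ e) (sym (cong₂ _xor_
            (eq-no λ f → e (inj₁ (general s∈ x∈ es (inj₁ refl) f))) (eq-no λ f → e (inj₂ (general s∈ x∈ es (inj₂ refl) f)))))
          none : ∀ {j x} → x ∈ S j → Dec (End p x) → turn false (X p) (line t) (line x) ≡ false
          none x∈ (yes e) = trans (turn-at false t∈ et x∈ e) (precedes-false (proj₂ (wrap x∈ e)))
          none x∈ (no e) = turn-off false t x∈ e

        -- When only two segments end at `p`, as at a bend, each is the cyclic successor of the
        -- other.
        two-darts : (∀ {j z} → z ∈ S j → End p z → z ≡ s ⊎ z ≡ t) → ¬ (i ≡ k × s ≡ t) → ∀ {z} → Even z → side true p s z ≡ side false p t z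
        two-darts only s≢t with ≺-cmp (dir p s) (dir p t)
        ... | inj₁ lt = corner (inj₁ λ x∈ e → adj (only x∈ e))
          where
          adj : ∀ {z} → z ≡ s ⊎ z ≡ t → Adjacent (dir p s) (dir p t) (dir p z)
          adj (inj₁ refl) = inj₁ (inj₂ refl , lt)
          adj (inj₂ refl) = inj₂ (lt , inj₂ refl)
        ... | inj₂ (inj₁ e) = ⊥-elim (s≢t (overlapping s∈ t∈ es et e))
        ... | inj₂ (inj₂ gt) = corner (inj₂ λ x∈ e → wrap (only x∈ e))
          where
          wrap : ∀ {z} → z ≡ s ⊎ z ≡ t → dir p z ≼ dir p s × dir p t ≼ dir p z
          wrap (inj₁ refl) = inj₂ refl , inj₁ gt
          wrap (inj₂ refl) = inj₁ gt , inj₂ refl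

        -- Crossing `s` changes the contribution of `s` alone: a segment leaving `p` in another
        -- direction has the same turn for both flags.
        own-side : ∀ z → side false p s z xor side true p s z ≡ z i
        own-side z = trans (sym (total-xor (tn false p s) (tn true p s) z))
          (trans (⊕-single i λ j j≢i → cong (_∧ z j) (⊕ᴸ-false (S j) λ x∈ → other x∈ λ { (e , _) → j≢i (sym e) }))
            (cong (_∧ z i) (trans (⊕ᴸ-single (segments-unique i) s∈ λ x∈ x≢ → other x∈ λ { (_ , e) → x≢ (sym e) }) self)))
          where
          cancel : ∀ u a b → (u xor a) xor (u xor b) ≡ a xor b
          cancel true true b = refl
          cancel true false true = refl
          cancel true false false = refl
          cancel false a b = refl
          self : tn false p s s xor tn true p s s ≡ true
          self = trans (cancel (under (line s) (X p) (Y p)) _ _) (cong₂ _xor_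
            (trans (turn-at false s∈ es s∈ es) (precedes-≡ false {dir p s} refl)) (trans (turn-at true s∈ es s∈ es) (precedes-≡ true {dir p s} refl)))
          other : ∀ {j x} → x ∈ S j → ¬ (i ≡ j × s ≡ x) → tn false p s x xor tn true p s x ≡ false
          other {j} {x} x∈ differ = trans (cancel (under (line x) (X p) (Y p)) _ _) (turns (end? x))
            where
            turns : Dec (End p x) → turn false (X p) (line s) (line x) xor turn true (X p) (line s) (line x) ≡ false
            turns (no e) = cong₂ _xor_ (turn-off false s x∈ e) (turn-off true s x∈ e)
            turns (yes e) with ≺-cmp (dir p x) (dir p s)
            ... | inj₁ u = cong₂ _xor_ (trans (turn-at false s∈ es x∈ e) (precedes-≺ false u)) (trans (turn-at true s∈ es x∈ e) (precedes-≺ true u))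
            ... | inj₂ (inj₁ u) = ⊥-elim (differ (overlapping s∈ x∈ es e (sym u)))
            ... | inj₂ (inj₂ u) = cong₂ _xor_ (trans (turn-at false s∈ es x∈ e) (precedes-≻ false u)) (trans (turn-at true s∈ es x∈ e) (precedes-≻ true u))

      bend : ∀ {i pre a q c post} → S i ≡ pre ++ (a , q) ∷ (q , c) ∷ post → ∀ {z} → Even z → ∀ b →
        side b q (a , q) z ≡ side (not b) q (q , c) z
      bend {i} {pre} {a} {q} {c} e {z} ev b = by b
        where
        aq∈ : (a , q) ∈ S i
        aq∈ = subst (_ ∈_) (sym e) (∈-++⁺ʳ pre (here refl))
        qc∈ : (q , c) ∈ S i
        qc∈ = subst (_ ∈_) (sym e) (∈-++⁺ʳ pre (there (here refl)))
        differ : (a , q) ≢ (q , c)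
        differ f = distinct-ends aq∈ (cong (X ∘ proj₁) f)
        swap : ∀ {A B : Set} → A ⊎ B → B ⊎ A
        swap (inj₁ x) = inj₂ x
        swap (inj₂ x) = inj₁ x
        by : ∀ b → side b q (a , q) z ≡ side (not b) q (q , c) z
        by true = two-darts aq∈ qc∈ (inj₂ refl) (inj₁ refl) (λ x∈ f → bend-end {i = i} {pre = pre} e x∈ f) (λ { (_ , f) → differ f }) {z} ev
        by false = sym (two-darts qc∈ aq∈ (inj₁ refl) (inj₂ refl) (λ x∈ f → swap (bend-end {i = i} {pre = pre} e x∈ f)) (λ { (_ , f) → differ (sym f) }) {z} ev)

      -- One side of an arc is followed from end to end, alternating `transport` along a segment
      -- with the corner at a bend. The list `pre` holds the segments already passed, so that bends
      -- are located within the whole arc.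
      along : ∀ {i} a l c pre → S i ≡ pre ++ segments a l c → ∀ {z} → Even z → ∀ b →
        side b a (first-segment a l c) z ≡ side (not b) c (last-segment a l c) z
      along a [] c pre e {z} ev b = transport (subst (_ ∈_) (sym e) (∈-++⁺ʳ pre (here refl))) {z} ev b
      along {i} a (q ∷ l) c pre e {z} ev b =
        trans (transport (subst (_ ∈_) (sym e) (∈-++⁺ʳ pre (here refl))) {z} ev b)
          (trans (turn-corner l e)
            (along q l c (pre ++ (a , q) ∷ []) (trans e (sym (++-assoc pre _ _))) {z} ev b))
        where
        turn-corner : ∀ l → S i ≡ pre ++ (a , q) ∷ segments q l c →
          side (not b) q (a , q) z ≡ side b q (first-segment q l c) z
        turn-corner [] e = trans (bend {pre = pre} e {z} ev (not b)) (cong (λ b → side b q _ z) (not² b))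
        turn-corner (r ∷ l) e = trans (bend {pre = pre} e {z} ev (not b)) (cong (λ b → side b q _ z) (not² b))

      segment-at∈ : ∀ d → segment-at d ∈ S (proj₁ d)
      segment-at∈ (i , false) = first∈segments (st i) (bends i) (fin i)
      segment-at∈ (i , true) = last∈segments (st i) (bends i) (fin i)

      segment-at-end : ∀ d → End (place d) (segment-at d)
      segment-at-end (i , false) = inj₁ (sym (first-start (st i) (bends i) (fin i)))
      segment-at-end (i , true) = inj₂ (sym (last-end (st i) (bends i) (fin i)))

      along-dart : ∀ d {z} → Even z → ∀ b → side b (place d) (segment-at d) z ≡ side (not b) (place (reverse d)) (segment-at (reverse d)) z
      along-dart (i , false) {z} ev b = along (st i) (bends i) (fin i) [] refl {z} ev b
      along-dart (i , true) {z} ev b = trans (cong (λ b → side b (fin i) (segment-at (i , true)) z) (sym (not² b)))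
        (sym (along (st i) (bends i) (fin i) [] refl {z} ev (not b)))

      darts-at : Fin N → List (Dart n)
      darts-at v = filter (λ d → origin d Finₚ.≟ v) (all-darts n)

      ∈-darts-at : ∀ {v} d → origin d ≡ v → d ∈ darts-at v
      ∈-darts-at {v} d e = ∈-filter⁺ (λ d → origin d Finₚ.≟ v) (∈-all-darts d) e

      next : ∀ d → ∃[ e ] (e ∈ darts-at (origin d) × Order.Follows (place d) (darts-at (origin d)) d e)
      next d = Order.successor (place d) {darts-at (origin d)} {d} (∈-darts-at d refl)

      -- The dart counterclockwise after the reversed one at the head of `d`; this keeps the face on
      -- the right of `d`.
      φ : Dart n → Dart n
      φ d = proj₁ (next (reverse d))

      φ-origin : ∀ d → origin (φ d) ≡ origin (reverse d)
      φ-origin d = proj₂ (∈-filter⁻ (λ e → origin e Finₚ.≟ origin (reverse d)) {xs = all-darts n} (proj₁ (proj₂ (next (reverse d)))))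

      -- A dart that succeeded itself would be both first and last at its vertex. Any other dart
      -- there would then have the same direction, which `overlapping` excludes.
      φ-turns : (∀ d → ∃[ e ] (e ≢ d × origin e ≡ origin d)) → ∀ d → φ d ≢ reverse d
      φ-turns others d eq with proj₂ (proj₂ (next (reverse d))) | others (reverse d)
      ... | inj₁ adj | _ with subst (λ t → Adjacent (dir p (segment-at r)) (dir p (segment-at t)) (dir p (segment-at r))) eq (adj (∈-darts-at (reverse d) refl))
        where r = reverse d
              p = place r
      ...   | inj₁ (_ , lt) = ≺-irrefl lt
      ...   | inj₂ (lt , _) = ≺-irrefl lt
      φ-turns others d eq | inj₂ wrap | e , e≢ , oe with subst (λ t → dir p (segment-at e) ≼ dir p (segment-at r) × dir p (segment-at t) ≼ dir p (segment-at e)) eq (wrap (∈-darts-at e oe))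
        where r = reverse d
              p = place r
      ...   | le , ge with overlapping {p = place (reverse d)} (segment-at∈ e) (segment-at∈ (reverse d))
                    (subst (λ v → End (pos v) (segment-at e)) oe (segment-at-end e)) (segment-at-end (reverse d)) (≼-antisym le ge)
        where
        ≼-antisym : ∀ {x y} → x ≼ y → y ≼ x → x ≡ y
        ≼-antisym (inj₂ p) _ = p
        ≼-antisym (inj₁ p) (inj₂ q) = sym q
        ≼-antisym (inj₁ p) (inj₁ q) = ⊥-elim (≺-irrefl (≺-trans p q))
      ...     | same-index , _ = same-dart e (reverse d) same-index e≢ oe
        where
        same-dart : ∀ (e r : Dart n) → proj₁ e ≡ proj₁ r → e ≢ r → origin e ≡ origin r → ⊥
        same-dart (i , false) (i , false) refl ne _ = ne refl
        same-dart (i , true) (i , true) refl ne _ = ne refl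
        same-dart (i , false) (i , true) refl _ o = dart-segment i (cong pos o)
        same-dart (i , true) (i , false) refl _ o = dart-segment i (sym (cong pos o))

      -- The flag `false` selects the corner just before `d` counterclockwise, which lies on its
      -- right.
      w : Dart n → Fin n → Bool
      w d i = ⊕ᴸ (tn false (place d) (segment-at d)) (S i)

      -- The right side of `d` leads to the corner just after the reversed dart at its head, and
      -- this is the corner just before `φ d`.
      w-invariant : ∀ {z} → Even z → ∀ d → w (φ d) ∙ z ≡ w d ∙ z
      w-invariant {z} ev d = sym (trans (along-dart d {z} ev false) (trans
        (corner (segment-at∈ r) (segment-at∈ (φ d)) (segment-at-end r) (subst (λ v → End (pos v) (segment-at (φ d))) (φ-origin d) (segment-at-end (φ d)))
          (follows (proj₂ (proj₂ (next r)))) {z} ev)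
        (cong (λ v → side false (pos v) (segment-at (φ d)) z) (sym (φ-origin d)))))
        where
        r = reverse d
        p = place r
        follows : Order.Follows p (darts-at (origin r)) r (φ d) →
          (∀ {j x} → x ∈ S j → End p x → Adjacent (dir p (segment-at r)) (dir p (segment-at (φ d))) (dir p x)) ⊎
          (∀ {j x} → x ∈ S j → End p x → dir p x ≼ dir p (segment-at r) × dir p (segment-at (φ d)) ≼ dir p x)
        follows (inj₁ adj) = inj₁ λ {j} x∈ e → let (b , o , q) = vertex-end x∈ e in
          subst (λ x → Adjacent (dir p (segment-at r)) (dir p (segment-at (φ d))) (dir p x)) (sym q) (adj (∈-darts-at (j , b) o))
        follows (inj₂ wrap) = inj₂ λ {j} x∈ e → let (b , o , q) = vertex-end x∈ e in
          subst (λ x → dir p x ≼ dir p (segment-at r) × dir p (segment-at (φ d)) ≼ dir p x) (sym q) (wrap (∈-darts-at (j , b) o))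

      -- The right side of the reversed dart is the left side of `d`, so the two corners compared
      -- are those on both sides of one segment.
      w-sides : ∀ {z} → Even z → ∀ d → (w d ∙ z) xor (w (reverse d) ∙ z) ≡ z (proj₁ d)
      w-sides {z} ev d = trans (cong (side false (place d) (segment-at d) z xor_) (sym (along-dart d {z} ev true)))
        (own-side (segment-at∈ d) (segment-at∈ d) (segment-at-end d) (segment-at-end d) z)

      -- The faces of a plane drawing are at least E - V in number and have at
      -- least three sides each when no vertex has degree 1.
      plane-bound : (R : List (Fin N)) → Unique R → (∀ d → origin d ∈ R) →
        (∀ d → origin d ≢ origin (reverse d)) →
        (∀ d e → origin d ≡ origin e → origin (reverse d) ≡ origin (reverse e) → d ≡ e) →
        (∀ d → ∃[ e ] (e ≢ d × origin e ≡ origin d)) →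
        n ℕ.≤ 3 ℕ.* length R
      plane-bound R R! ∈R loopless simple others =
        euler-bound origin R R! ∈R φ loopless simple φ-origin (φ-turns others) w w-invariant w-sides

-- From plane drawings to the sweep.

module Drawings where

  open Segments using (ℚ-ring; compare; -≡0⇒≡; ≡⇒-≡0)
  open Shear
  open Darts using (Dart; reverse)
  open Sweep
  open import Data.Fin using (Fin)
  open import Data.List using ([]; _∷_)
  open import Data.List.Relation.Unary.All as All using (All; []; _∷_)
  open import Data.List.Relation.Unary.AllPairs using ([]; _∷_)
  open import Data.Rational using (ℚ; 0ℚ; 1ℚ; _+_; _*_; _-_; -_; 1/_; _<_; _≤_; ≢-nonZero)
  open import Data.Rational.Properties using (_≟_; ≤-refl; <-trans; <-irrefl; +-monoʳ-<; +-identityʳ; *-inverseʳ; *-identityʳ; positive⁻¹; nonNegative⁻¹)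

  0≤1 : 0ℚ ≤ 1ℚ
  0≤1 = nonNegative⁻¹ 1ℚ

  OnSegment-start : ∀ a b → OnSegment a b a
  OnSegment-start (x₁ , y₁) (x₂ , y₂) = 0ℚ , ≤-refl , 0≤1 , cong₂ _,_ (lem x₁ x₂) (lem y₁ y₂)
    where
    lem : ∀ x y → x ≡ (1ℚ - 0ℚ) * x + 0ℚ * y
    lem = solve-∀ ℚ-ring

  OnSegment-end : ∀ a b → OnSegment a b b
  OnSegment-end (x₁ , y₁) (x₂ , y₂) = 1ℚ , 0≤1 , ≤-refl , cong₂ _,_ (lem x₁ x₂) (lem y₁ y₂)
    where
    lem : ∀ x y → y ≡ (1ℚ - 1ℚ) * x + 1ℚ * y
    lem = solve-∀ ℚ-ring

  On : Point × Point → Point → Set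
  On s p = OnSegment (proj₁ s) (proj₂ s) p

  End⇒On : ∀ {p s} → End p s → On s p
  End⇒On {s = a , b} (inj₁ refl) = OnSegment-start a b
  End⇒On {s = a , b} (inj₂ refl) = OnSegment-end a b

  path : Point → List Point → Point → List Point
  path a l z = a ∷ l ++ z ∷ []

  on-path : ∀ a l z {s p} → s ∈ segments a l z → On s p → OnPath (path a l z) p
  on-path a [] z (here refl) on = inj₁ on
  on-path a (b ∷ l) z (here refl) on = inj₁ on
  on-path a (b ∷ l) z (there s∈) on = inj₂ (on-path b l z s∈ on)

  final-on-path : ∀ a l z → OnPath (path a l z) z
  final-on-path a l z = on-path a l z (last∈segments a l z) (subst (On (last-segment a l z)) (last-end a l z) (End⇒On {s = last-segment a l z} (inj₂ refl)))

  start≢final : ∀ a l z → SimplePath (path a l z) → a ≢ z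
  start≢final a [] z (a≢z , _) = a≢z
  start≢final a (b ∷ l) z (a≢b , meet , _) refl = a≢b (meet a (OnSegment-start a b) (final-on-path b l z))

  at-start : ∀ a l z → SimplePath (path a l z) → ∀ {s} → s ∈ segments a l z → On s a → s ≡ first-segment a l z
  at-start a [] z _ (here e) _ = e
  at-start a (b ∷ l) z _ (here e) _ = e
  at-start a (b ∷ l) z (a≢b , meet , _) (there s∈) on = ⊥-elim (a≢b (meet a (OnSegment-start a b) (on-path b l z s∈ on)))

  at-final : ∀ a l z → SimplePath (path a l z) → ∀ {s} → s ∈ segments a l z → On s z → s ≡ last-segment a l z
  at-final a [] z _ (here e) _ = e
  at-final a (b ∷ l) z (_ , meet , simple) (here refl) on = ⊥-elim (start≢final b l z simple (sym (meet z on (final-on-path b l z))))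
  at-final a (b ∷ l) z (_ , _ , simple) (there s∈) on = at-final b l z simple s∈ on

  first-end : ∀ a l z {s} → s ≡ first-segment a l z → End a s
  first-end a l z refl = inj₁ (sym (first-start a l z))

  last-end′ : ∀ a l z {s} → s ≡ last-segment a l z → End z s
  last-end′ a l z refl = inj₂ (sym (last-end a l z))

  path-meets : ∀ a l z → SimplePath (path a l z) → ∀ {s t p} → s ∈ segments a l z → t ∈ segments a l z → On s p → On t p →
    s ≡ t ⊎ (End p s × End p t)
  path-meets a [] z _ (here e) (here f) _ _ = inj₁ (trans e (sym f))
  path-meets a (b ∷ l) z _ (here e) (here f) _ _ = inj₁ (trans e (sym f))
  path-meets a (b ∷ l) z (_ , meet , simple) {p = p} (here refl) (there t∈) on on′ with meet p on (on-path b l z t∈ on′)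
  ... | refl = inj₂ (inj₂ refl , first-end b l z (at-start b l z simple t∈ on′))
  path-meets a (b ∷ l) z (_ , meet , simple) {p = p} (there s∈) (here refl) on on′ with meet p on′ (on-path b l z s∈ on)
  ... | refl = inj₂ (first-end b l z (at-start b l z simple s∈ on) , inj₂ refl)
  path-meets a (b ∷ l) z (_ , _ , simple) (there s∈) (there t∈) on on′ = path-meets b l z simple s∈ t∈ on on′

  -- The first segment meets the others only at its final point, where just one later segment
  -- starts. At a bend there is thus no room for a third segment of the arc.
  three-meet : ∀ a l z → SimplePath (path a l z) → ∀ {s t u p} → s ∈ segments a l z → t ∈ segments a l z → u ∈ segments a l z →
    On s p → On t p → On u p → s ≡ t ⊎ t ≡ u ⊎ s ≡ u
  three-meet a [] z _ (here e) (here f) _ _ _ _ = inj₁ (trans e (sym f))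
  three-meet a (b ∷ l) z _ (here e) (here f) _ _ _ _ = inj₁ (trans e (sym f))
  three-meet a (b ∷ l) z _ (here e) _ (here f) _ _ _ = inj₂ (inj₂ (trans e (sym f)))
  three-meet a (b ∷ l) z _ _ (here e) (here f) _ _ _ = inj₂ (inj₁ (trans e (sym f)))
  three-meet a (b ∷ l) z (_ , meet , simple) {p = p} (here refl) (there t∈) (there u∈) x y v with meet p x (on-path b l z t∈ y)
  ... | refl = inj₂ (inj₁ (trans (at-start b l z simple t∈ y) (sym (at-start b l z simple u∈ v))))
  three-meet a (b ∷ l) z (_ , meet , simple) {p = p} (there s∈) (here refl) (there u∈) x y v with meet p y (on-path b l z s∈ x)
  ... | refl = inj₂ (inj₂ (trans (at-start b l z simple s∈ x) (sym (at-start b l z simple u∈ v))))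
  three-meet a (b ∷ l) z (_ , meet , simple) {p = p} (there s∈) (there t∈) (here refl) x y v with meet p v (on-path b l z s∈ x)
  ... | refl = inj₁ (trans (at-start b l z simple s∈ x) (sym (at-start b l z simple t∈ y)))
  three-meet a (b ∷ l) z (_ , _ , simple) (there s∈) (there t∈) (there u∈) x y v = three-meet b l z simple s∈ t∈ u∈ x y v

  path-unique : ∀ a l z → SimplePath (path a l z) → Unique (segments a l z)
  path-unique a [] z _ = [] ∷ []
  path-unique a (b ∷ l) z (a≢b , meet , simple) =
    All.tabulate (λ s∈ → λ { refl → a≢b (meet a (OnSegment-start a b) (on-path b l z s∈ (OnSegment-start a b))) }) ∷ path-unique b l z simple

  segment-nondegenerate : ∀ a l z → SimplePath (path a l z) → ∀ {s} → s ∈ segments a l z → proj₁ s ≢ proj₂ s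
  segment-nondegenerate a [] z (a≢z , _) (here refl) = a≢z
  segment-nondegenerate a (b ∷ l) z (a≢b , _) (here refl) = a≢b
  segment-nondegenerate a (b ∷ l) z (_ , _ , simple) (there s∈) = segment-nondegenerate b l z simple s∈

  upper-bound : ∀ (bs : List ℚ) → ∃[ m ] ∀ {b} → b ∈ bs → b < m
  upper-bound [] = 0ℚ , λ ()
  upper-bound (b ∷ bs) with upper-bound bs
  ... | m , below with compare b m
  ...   | tri< b<m _ _ = m , λ { (here refl) → b<m ; (there x) → below x }
  ...   | tri≈ _ refl _ = b + 1ℚ , λ { (here refl) → b<b+1 ; (there x) → <-trans (below x) b<b+1 }
    where
    b<b+1 : b < b + 1ℚ
    b<b+1 = subst (_< b + 1ℚ) (+-identityʳ b) (+-monoʳ-< b (positive⁻¹ 1ℚ))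
  ...   | tri> _ _ m<b = b + 1ℚ , λ { (here refl) → b<b+1 ; (there x) → <-trans (below x) (<-trans m<b b<b+1) }
    where
    b<b+1 : b < b + 1ℚ
    b<b+1 = subst (_< b + 1ℚ) (+-identityʳ b) (+-monoʳ-< b (positive⁻¹ 1ℚ))

  -- The only shear that can give the points (x , y) and (x′ , y′) the same
  -- abscissa, when y ≢ y′.
  collision : Point × Point → ℚ
  collision ((x , y) , (x′ , y′)) with y - y′ ≟ 0ℚ
  ... | yes _ = 0ℚ
  ... | no d≢0 = (x′ - x) * (1/ (y - y′)) {{≢-nonZero d≢0}}

  collision-unique : ∀ ε p q → Y p ≢ Y q → Sheared.shear ε p ≡ Sheared.shear ε q → ε ≡ collision (p , q)
  collision-unique ε (x , y) (x′ , y′) y≢ e with y - y′ ≟ 0ℚ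
  ... | yes d≡0 = ⊥-elim (y≢ (-≡0⇒≡ d≡0))
  ... | no d≢0 = begin
    ε ≡⟨ *-identityʳ ε ⟨
    ε * 1ℚ ≡⟨ cong (ε *_) (*-inverseʳ (y - y′) {{≢-nonZero d≢0}}) ⟨
    ε * ((y - y′) * r) ≡⟨ lem₁ ε x y x′ y′ r ⟩
    ((x + ε * y) - (x′ + ε * y′) + (x′ - x)) * r ≡⟨ cong (λ t → (t + (x′ - x)) * r) (≡⇒-≡0 e) ⟩
    (0ℚ + (x′ - x)) * r ≡⟨ lem₂ (x′ - x) r ⟩
    (x′ - x) * r ∎
    where
    open ≡-Reasoning
    r = (1/ (y - y′)) {{≢-nonZero d≢0}}
    lem₁ : ∀ ε x y x′ y′ r → ε * ((y - y′) * r) ≡ ((x + ε * y) - (x′ + ε * y′) + (x′ - x)) * r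
    lem₁ = solve-∀ ℚ-ring
    lem₂ : ∀ d r → (0ℚ + d) * r ≡ d * r
    lem₂ = solve-∀ ℚ-ring

  -- Two points of different ordinate collide under one shear only, and ε exceeds all these finitely
  -- many values; distinct points of equal ordinate never collide.
  generic-shear : ∀ (Q : List Point) → ∃[ ε ] ∀ {p q} → p ∈ Q → q ∈ Q → Sheared.X ε p ≡ Sheared.X ε q → p ≡ q
  generic-shear Q with upper-bound (map collision (cartesianProduct Q Q))
  ... | ε , below = ε , λ {p} {q} p∈ q∈ e → separate p∈ q∈ (Y p ≟ Y q) e
    where
    open Sheared ε
    separate : ∀ {p q} → p ∈ Q → q ∈ Q → Dec (Y p ≡ Y q) → X p ≡ X q → p ≡ q
    separate p∈ q∈ (yes f) e = XY-injective e f
    separate {p} {q} p∈ q∈ (no f) e = ⊥-elim (<-irrefl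
      (sym (collision-unique ε p q f (trans (sym (X-def p)) (trans e (X-def q)))))
      (below (∈-map⁺ collision (∈-cartesianProduct⁺ p∈ q∈))))

  module _ {G : Graph} (D : PlaneDrawing G) {n} (E : Fin n → Graph.Edge G) (E-injective : ∀ {i j} → E i ≡ E j → i ≡ j) where

    open Graph G
    open PlaneDrawing D

    dart-origin : Dart n → Fin order
    dart-origin (i , false) = end₁ (E i)
    dart-origin (i , true)  = end₂ (E i)

    private
      corners : Fin n → List Point
      corners i = arc (E i)

      Q : List Point
      Q = concatMap corners (allFin n)

      ε = proj₁ (generic-shear Q)

    open Arcs ε pos dart-origin (bends ∘ E)

    private
      simple : ∀ i → SimplePath (path (st i) (bends (E i)) (fin i))
      simple i = arc-simple (E i)

      end-corner : ∀ a l z {s p} → s ∈ segments a l z → End p s → p ∈ path a l z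
      end-corner a [] z (here refl) (inj₁ refl) = here refl
      end-corner a [] z (here refl) (inj₂ refl) = there (here refl)
      end-corner a (b ∷ l) z (here refl) (inj₁ refl) = here refl
      end-corner a (b ∷ l) z (here refl) (inj₂ refl) = there (here refl)
      end-corner a (b ∷ l) z (there s∈) e = there (end-corner b l z s∈ e)

      end∈Q : ∀ {i s p} → s ∈ S i → End p s → p ∈ Q
      end∈Q {i} {s} {p} s∈ e = ∈-concatMap⁺ corners (lose (∈-allFin i) (end-corner (st i) (bends (E i)) (fin i) s∈ e))

      general′ : ∀ {i j s z p q} → s ∈ S i → z ∈ S j → End p s → End q z → X p ≡ X q → p ≡ q
      general′ s∈ z∈ e f = proj₂ (generic-shear Q) (end∈Q s∈ e) (end∈Q z∈ f)

      on-arc : ∀ {i s p} → s ∈ S i → On s p → OnPath (arc (E i)) p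
      on-arc {i} s∈ on = on-path (st i) (bends (E i)) (fin i) s∈ on

      vertex-segment : ∀ {i s v} → s ∈ S i → On s (pos v) → v ∈ᵉ E i → ∃[ b ] (dart-origin (i , b) ≡ v × s ≡ segment-at (i , b))
      vertex-segment {i} s∈ on (inj₁ refl) = false , refl , at-start (st i) (bends (E i)) (fin i) (simple i) s∈ on
      vertex-segment {i} s∈ on (inj₂ refl) = true , refl , at-final (st i) (bends (E i)) (fin i) (simple i) s∈ on

      segment-end : ∀ {i s b} → s ≡ segment-at (i , b) → End (pos (dart-origin (i , b))) s
      segment-end {i} {b = false} e = first-end (st i) (bends (E i)) (fin i) e
      segment-end {i} {b = true} e = last-end′ (st i) (bends (E i)) (fin i) e

      -- Within one arc by its simplicity; for two arcs through the vertex they share, which is an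
      -- end of both segments.
      meets′ : ∀ {i j s z} → s ∈ S i → z ∈ S j → ∀ p → On s p → On z p → (i ≡ j × s ≡ z) ⊎ (End p s × End p z)
      meets′ {i} {j} s∈ z∈ p on on′ with i Finₚ.≟ j
      ... | yes refl with path-meets (st i) (bends (E i)) (fin i) (simple i) s∈ z∈ on on′
      ...   | inj₁ e = inj₁ (refl , e)
      ...   | inj₂ e = inj₂ e
      meets′ {i} {j} s∈ z∈ p on on′ | no i≢j with arcs-meet (E i) (E j) (i≢j ∘ E-injective) p (on-arc s∈ on) (on-arc z∈ on′)
      ... | v , v∈ , v∈′ , refl with vertex-segment s∈ on v∈ | vertex-segment z∈ on′ v∈′
      ...   | b , o , e | b′ , o′ , e′ =
        inj₂ (subst (λ v → End (pos v) _) o (segment-end {b = b} e) , subst (λ v → End (pos v) _) o′ (segment-end {b = b′} e′))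

      bend-end′ : ∀ {i j pre a q c post z} → S i ≡ pre ++ (a , q) ∷ (q , c) ∷ post → z ∈ S j → End q z → z ≡ (a , q) ⊎ z ≡ (q , c)
      bend-end′ {i} {j} {pre} {a} {q} {c} {post} {z} e z∈ f = cases (i Finₚ.≟ j)
        where
        aq∈ : (a , q) ∈ S i
        aq∈ = subst (_ ∈_) (sym e) (∈-++⁺ʳ pre (here refl))
        qc∈ : (q , c) ∈ S i
        qc∈ = subst (_ ∈_) (sym e) (∈-++⁺ʳ pre (there (here refl)))
        a≢q : a ≢ q
        a≢q = segment-nondegenerate (st i) (bends (E i)) (fin i) (simple i) aq∈
        pick : ∀ {z} → (a , q) ≡ (q , c) ⊎ (q , c) ≡ z ⊎ (a , q) ≡ z → z ≡ (a , q) ⊎ z ≡ (q , c)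
        pick (inj₁ g) = ⊥-elim (a≢q (cong proj₁ g))
        pick (inj₂ (inj₁ g)) = inj₂ (sym g)
        pick (inj₂ (inj₂ g)) = inj₁ (sym g)
        cases : Dec (i ≡ j) → z ≡ (a , q) ⊎ z ≡ (q , c)
        cases (yes refl) = pick (three-meet (st i) (bends (E i)) (fin i) (simple i) aq∈ qc∈ z∈
          (OnSegment-end a q) (OnSegment-start q c) (End⇒On f))
        -- Another arc can reach `q` only if `q` is a vertex. Then it is the first or last point of
        -- its own arc and lies on one segment of it, not on two.
        cases (no i≢j) with arcs-meet (E i) (E j) (i≢j ∘ E-injective) q (on-arc aq∈ (OnSegment-end a q)) (on-arc z∈ (End⇒On f))
        ... | v , inj₁ refl , _ , q≡ = ⊥-elim (a≢q (cong proj₁ (trans (start-only aq∈ (OnSegment-end a q)) (sym (start-only qc∈ (OnSegment-start q c))))))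
          where
          start-only : ∀ {s} → s ∈ S i → On s q → s ≡ first-segment (st i) (bends (E i)) (fin i)
          start-only s∈ on = at-start (st i) (bends (E i)) (fin i) (simple i) s∈ (subst (On _) q≡ on)
        ... | v , inj₂ refl , _ , q≡ = ⊥-elim (a≢q (cong proj₁ (trans (final-only aq∈ (OnSegment-end a q)) (sym (final-only qc∈ (OnSegment-start q c))))))
          where
          final-only : ∀ {s} → s ∈ S i → On s q → s ≡ last-segment (st i) (bends (E i)) (fin i)
          final-only s∈ on = at-final (st i) (bends (E i)) (fin i) (simple i) s∈ (subst (On _) q≡ on)

    drawing-plane : Plane
    drawing-plane = record
      { distinct-ends = λ {i} s∈ e → segment-nondegenerate (st i) (bends (E i)) (fin i) (simple i) s∈ (general′ s∈ s∈ (inj₁ refl) (inj₂ refl) e)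
      ; general = general′
      ; meets = meets′
      ; vertex-end = λ {j} {z} {v} z∈ e → vertex-segment z∈ (End⇒On e) (vertex-on-arc (E j) v (on-arc z∈ (End⇒On e)))
      ; bend-end = λ {i} {j} {pre} → bend-end′ {i} {j} {pre}
      ; segments-unique = λ i → path-unique (st i) (bends (E i)) (fin i) (simple i)
      ; dart-segment = λ i → start≢final (st i) (bends (E i)) (fin i) (simple i)
      }

    planar-bound : (R : List Vertex) → Unique R → (∀ d → dart-origin d ∈ R) →
      (∀ d e → dart-origin d ≡ dart-origin e → dart-origin (reverse d) ≡ dart-origin (reverse e) → d ≡ e) →
      (∀ d → ∃[ e ] (e ≢ d × dart-origin e ≡ dart-origin d)) →
      n ℕ.≤ 3 ℕ.* length R
    planar-bound R R! ∈R simple others = plane-bound drawing-plane R R! ∈R loopless simple others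
      where
      loopless : ∀ d → dart-origin d ≢ dart-origin (reverse d)
      loopless (i , false) e = Finₚ.<⇒≢ (ordered (E i)) e
      loopless (i , true) e = Finₚ.<⇒≢ (ordered (E i)) (sym e)

-- Orientations of bounded out-degree.

module Orientations where

  open Darts using (unique-length)
  open import Data.Fin using (Fin; zero; suc)
  open import Data.List using ([]; _∷_)
  open import Data.List.Relation.Unary.All as All using (All; []; _∷_)
  open import Data.List.Relation.Unary.AllPairs using ([]; _∷_)
  open import Data.Nat using (ℕ; zero; suc; _+_; _≤_; _<_; z≤n)

  count : ∀ {N} → (Fin N → Bool) → ℕ
  count {zero}  f = 0
  count {suc N} f = (if f zero then 1 else 0) + count (f ∘ suc)

  count-cong : ∀ {N} {f g : Fin N → Bool} → (∀ v → f v ≡ g v) → count f ≡ count g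
  count-cong {zero} e = refl
  count-cong {suc N} e = cong₂ (λ b n → (if b then 1 else 0) + n) (e zero) (count-cong (e ∘ suc))

  count-insert : ∀ {N} {f g : Fin N → Bool} v → f v ≡ false → g v ≡ true → (∀ w → w ≢ v → g w ≡ f w) → count g ≡ suc (count f)
  count-insert {suc N} zero fv gv e rewrite fv | gv = cong suc (count-cong λ w → e (suc w) λ ())
  count-insert {suc N} {f} {g} (suc v) fv gv e rewrite e zero (λ ()) =
    trans (cong ((if f zero then 1 else 0) +_) (count-insert v fv gv λ w w≢ → e (suc w) (w≢ ∘ Finₚ.suc-injective)))
      (ℕₚ.+-suc (if f zero then 1 else 0) _)

  true≢false : true ≢ false
  true≢false ()

  module _ {N : ℕ} where

    private V = Fin N

    open DecMembership (Finₚ._≟_ {N}) using (_∈?_)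

    Relation : Set
    Relation = V → V → Bool

    assign : Relation → V → V → Bool → Relation
    assign O x y b u v with u Finₚ.≟ x | v Finₚ.≟ y
    ... | yes _ | yes _ = b
    ... | _     | _     = O u v

    assign-same : ∀ O x y b → assign O x y b x y ≡ b
    assign-same O x y b with x Finₚ.≟ x | y Finₚ.≟ y
    ... | yes _ | yes _ = refl
    ... | no p | _ = ⊥-elim (p refl)
    ... | yes _ | no p = ⊥-elim (p refl)

    assign-other : ∀ O x y b {u v} → ¬ (u ≡ x × v ≡ y) → assign O x y b u v ≡ O u v
    assign-other O x y b {u} {v} p with u Finₚ.≟ x | v Finₚ.≟ y
    ... | yes e | yes f = ⊥-elim (p (e , f))
    ... | yes _ | no _ = refl
    ... | no _ | yes _ = refl
    ... | no _ | no _ = refl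

    assign-cases : ∀ O x y b u v → (u ≡ x × v ≡ y × assign O x y b u v ≡ b) ⊎ (¬ (u ≡ x × v ≡ y) × assign O x y b u v ≡ O u v)
    assign-cases O x y b u v with (u Finₚ.≟ x) ×-dec (v Finₚ.≟ y)
    ... | yes (refl , refl) = inj₁ (refl , refl , assign-same O x y b)
    ... | no p = inj₂ (p , assign-other O x y b p)

    row-cong : ∀ (O P : Relation) u → (∀ v → O u v ≡ P u v) → count (O u) ≡ count (P u)
    row-cong O P u e = count-cong {f = O u} {g = P u} e

    module _ (A : Relation) (A-irrefl : ∀ x → A x x ≡ false) (A-sym : ∀ x y → A x y ≡ A y x) (d : ℕ) where

      Covered : Relation → V → V → Set
      Covered O u v = O u v ≡ true ⊎ O v u ≡ true

      record Oriented (O : Relation) : Set where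
        field
          inside : ∀ {u v} → O u v ≡ true → A u v ≡ true
          asym   : ∀ {u v} → O u v ≡ true → O v u ≡ false

      Bounded : Relation → Set
      Bounded O = ∀ u → count (O u) ≤ d

      -- The out-edges of R stay inside R and are d |R| + 1 in number.
      record Dense : Set where
        field
          O        : Relation
          oriented : Oriented O
          R        : List V
          unique   : Unique R
          closed   : ∀ {u v} → u ∈ R → O u v ≡ true → v ∈ R
          extra    : V
          extra∈   : extra ∈ R
          extra-degree : count (O extra) ≡ suc d
          degree   : ∀ {u} → u ∈ R → u ≢ extra → count (O u) ≡ d

      open Oriented

      irrefl : ∀ {O} → Oriented O → ∀ {u v} → O u v ≡ true → u ≢ v
      irrefl or e refl = true≢false (trans (sym (inside or e)) (A-irrefl _))

      insert-oriented : ∀ {O x y} → Oriented O → A x y ≡ true → O y x ≡ false → Oriented (assign O x y true)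
      insert-oriented {O} {x} {y} or a e .inside {u} {v} p with assign-cases O x y true u v
      ... | inj₁ (refl , refl , _) = a
      ... | inj₂ (_ , q) = inside or (trans (sym q) p)
      insert-oriented {O} {x} {y} or a e .asym {u} {v} p with assign-cases O x y true u v | assign-cases O x y true v u
      ... | inj₁ (refl , refl , _) | inj₁ (refl , refl , _) = ⊥-elim (true≢false (trans (sym a) (A-irrefl _)))
      ... | inj₁ (refl , refl , _) | inj₂ (_ , q) = trans q e
      ... | inj₂ (_ , q) | inj₁ (refl , refl , _) = ⊥-elim (true≢false (trans (sym p) (trans q e)))
      ... | inj₂ (_ , q) | inj₂ (_ , r) = trans r (asym or (trans (sym q) p))

      insert-count : ∀ {O x y} → O x y ≡ false → count (assign O x y true x) ≡ suc (count (O x))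
      insert-count {O} {x} {y} e = count-insert y e (assign-same O x y true) λ w w≢ → assign-other O x y true (w≢ ∘ proj₂)

      insert-count-other : ∀ {O x y u} → u ≢ x → count (assign O x y true u) ≡ count (O u)
      insert-count-other {O} {x} {y} {u} u≢ = row-cong (assign O x y true) O u λ w → assign-other O x y true (u≢ ∘ proj₁)

      flip : Relation → V → V → Relation
      flip O x y = assign (assign O x y false) y x true

      delete-oriented : ∀ {O x y} → Oriented O → Oriented (assign O x y false)
      delete-oriented {O} {x} {y} or .inside {u} {v} p with assign-cases O x y false u v
      ... | inj₁ (_ , _ , q) = ⊥-elim (true≢false (trans (sym p) q))
      ... | inj₂ (_ , q) = inside or (trans (sym q) p)
      delete-oriented {O} {x} {y} or .asym {u} {v} p with assign-cases O x y false u v | assign-cases O x y false v u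
      ... | inj₁ (_ , _ , q) | _ = ⊥-elim (true≢false (trans (sym p) q))
      ... | inj₂ _ | inj₁ (_ , _ , r) = r
      ... | inj₂ (_ , q) | inj₂ (_ , r) = trans r (asym or (trans (sym q) p))

      data Walk (O : Relation) (w : V) : V → List V → Set where
        stop : Walk O w w (w ∷ [])
        step : ∀ {x u p} → O x u ≡ true → Walk O w u p → Walk O w x (x ∷ p)

      walk-head : ∀ {O w x p} → Walk O w x p → x ∈ p
      walk-head stop = here refl
      walk-head (step _ _) = here refl

      Slack : Relation → V → Set
      Slack O w = count (O w) < d

      -- The result of reversing a walk from `x` to a vertex with room: the room moves to `x`. Only
      -- pairs inside `p` change, so the first arc of a longer walk is still in place when its turn
      -- comes. The two covering fields say that the underlying edges remain.
      record Freed (O : Relation) (x : V) (p : List V) : Set where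
        field
          O′       : Relation
          oriented : Oriented O′
          bounded  : Bounded O′
          slack    : Slack O′ x
          outside  : ∀ {u v} → u ∉ p ⊎ v ∉ p → O′ u v ≡ O u v
          covers   : ∀ {u v} → Covered O u v → Covered O′ u v
          covers⁻  : ∀ {u v} → Covered O′ u v → Covered O u v

      free : ∀ {O w x p} → Oriented O → Bounded O → Slack O w → Walk O w x p → Unique p → Freed O x p
      free {O} or bd sl stop _ = record
        { O′ = O ; oriented = or ; bounded = bd ; slack = sl ; outside = λ _ → refl ; covers = λ c → c ; covers⁻ = λ c → c }
      -- The rest of the walk is reversed beforehand, so that `u` has room for the arc turned around
      -- to leave it.
      free {O} {w} {x} {.x ∷ p} or bd sl (step {u = u} xu walk) (x∉ ∷ p!) = record
        { O′ = F
        ; oriented = insert-oriented (delete-oriented F₀.oriented) (trans (A-sym u x) (inside or xu)) (assign-same F₀.O′ x u false)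
        ; bounded = bounds
        ; slack = ℕₚ.≤-trans (ℕₚ.≤-reflexive row-x) (F₀.bounded x)
        ; outside = λ {a} {b} o → trans (assign-other D u x true {a} {b} (λ { (refl , refl) → neither o (there (walk-head walk)) (here refl) }))
            (trans (assign-other F₀.O′ x u false {a} {b} λ { (refl , refl) → neither o (here refl) (there (walk-head walk)) }) (F₀.outside (weaken o)))
        ; covers = λ c → to (F₀.covers c)
        ; covers⁻ = λ c → F₀.covers⁻ (from c)
        }
        where
        module F₀ = Freed (free or bd sl walk p!)
        x∉p : x ∉ p
        x∉p m = All.lookup x∉ m refl
        x≢u : x ≢ u
        x≢u = irrefl or xu
        xu′ : F₀.O′ x u ≡ true
        xu′ = trans (F₀.outside (inj₁ x∉p)) xu
        D = assign F₀.O′ x u false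
        F = flip F₀.O′ x u
        neither : ∀ {a b} → a ∉ x ∷ p ⊎ b ∉ x ∷ p → a ∈ x ∷ p → b ∈ x ∷ p → ⊥
        neither (inj₁ n) m _ = n m
        neither (inj₂ n) _ m = n m
        weaken : ∀ {a b} → a ∉ x ∷ p ⊎ b ∉ x ∷ p → a ∉ p ⊎ b ∉ p
        weaken (inj₁ n) = inj₁ (n ∘ there)
        weaken (inj₂ n) = inj₂ (n ∘ there)
        row-x : suc (count (F x)) ≡ count (F₀.O′ x)
        row-x = trans (cong suc (row-cong F D x λ v → assign-other D u x true (x≢u ∘ proj₁)))
          (sym (count-insert u (assign-same F₀.O′ x u false) xu′ λ v v≢ → sym (assign-other F₀.O′ x u false (v≢ ∘ proj₂))))
        Dux : D u x ≡ false
        Dux = trans (assign-other F₀.O′ x u false (x≢u ∘ sym ∘ proj₁)) (asym F₀.oriented xu′)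
        row-u : count (F u) ≡ suc (count (F₀.O′ u))
        row-u = trans (count-insert x Dux (assign-same D u x true) λ v v≢ → assign-other D u x true {u} {v} (v≢ ∘ proj₂))
          (cong suc (row-cong D F₀.O′ u λ v → assign-other F₀.O′ x u false (x≢u ∘ sym ∘ proj₁)))
        bounds : Bounded F
        bounds v = by (v Finₚ.≟ u) (v Finₚ.≟ x)
          where
          by : Dec (v ≡ u) → Dec (v ≡ x) → count (F v) ≤ d
          by (yes refl) _ = subst (_≤ d) (sym row-u) F₀.slack
          by (no _) (yes refl) = ℕₚ.≤-trans (ℕₚ.n≤1+n _) (ℕₚ.≤-trans (ℕₚ.≤-reflexive row-x) (F₀.bounded x))
          by (no v≢u) (no v≢x) = subst (_≤ d) (sym (row-cong F F₀.O′ v λ b → trans (assign-other D u x true (v≢u ∘ proj₁)) (assign-other F₀.O′ x u false (v≢x ∘ proj₁)))) (F₀.bounded v)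
        to₁ : ∀ a b → F₀.O′ a b ≡ true → Covered F a b
        to₁ a b e with assign-cases F₀.O′ x u false a b
        ... | inj₁ (refl , refl , _) = inj₂ (assign-same D u x true)
        ... | inj₂ (_ , q) with assign-cases D u x true a b
        ...   | inj₁ (refl , refl , r) = inj₁ r
        ...   | inj₂ (_ , r) = inj₁ (trans r (trans q e))
        to : ∀ {a b} → Covered F₀.O′ a b → Covered F a b
        to {a} {b} (inj₁ e) = to₁ a b e
        to {a} {b} (inj₂ e) with to₁ b a e
        ... | inj₁ f = inj₂ f
        ... | inj₂ f = inj₁ f
        from₁ : ∀ a b → F a b ≡ true → Covered F₀.O′ a b
        from₁ a b e with assign-cases D u x true a b
        ... | inj₁ (refl , refl , _) = inj₂ xu′
        ... | inj₂ (_ , r) with assign-cases F₀.O′ x u false a b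
        ...   | inj₁ (_ , _ , q) = ⊥-elim (true≢false (trans (sym e) (trans r q)))
        ...   | inj₂ (_ , q) = inj₁ (trans (sym q) (trans (sym r) e))
        from : ∀ {a b} → Covered F a b → Covered F₀.O′ a b
        from {a} {b} (inj₁ e) = from₁ a b e
        from {a} {b} (inj₂ e) with from₁ b a e
        ... | inj₁ f = inj₂ f
        ... | inj₂ f = inj₁ f

      record Backward (O : Relation) : Set where
        field
          B       : List V
          walks   : ∀ {x} → x ∈ B → ∃[ w ] ∃[ p ] (Slack O w × Walk O w x p × Unique p)
          slack∈  : ∀ {w} → Slack O w → w ∈ B
          absorbs : ∀ {u v} → O u v ≡ true → v ∈ B → u ∈ B

      -- Backward search from the vertices with room. A new vertex is put in front of a walk through
      -- old ones, which keeps the walks simple. The fuel exceeds the number of vertices outside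
      -- `B`, so it cannot run out.
      backward : ∀ O → Backward O
      backward O = grow (suc N) start (Uniqueₚ.filter⁺ slack? (Uniqueₚ.allFin⁺ N))
          (λ x∈ → _ , _ , proj₂ (∈-filter⁻ slack? {xs = allFin N} x∈) , stop , ([] ∷ []) , λ { (here refl) → x∈ })
          (λ sl → ∈-filter⁺ slack? (∈-allFin _) sl) (ℕₚ.m≤n+m (suc N) _)
        where
        slack? : ∀ w → Dec (Slack O w)
        slack? w = count (O w) ℕₚ.<? d
        start = filter slack? (allFin N)
        grow : ∀ k B → Unique B →
          (∀ {x} → x ∈ B → ∃[ w ] ∃[ p ] (Slack O w × Walk O w x p × Unique p × (∀ {y} → y ∈ p → y ∈ B))) →
          (∀ {w} → Slack O w → w ∈ B) → N < length B + k → Backward O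
        grow zero B B! ws sl len = ⊥-elim (ℕₚ.<⇒≱ (subst (N <_) (ℕₚ.+-identityʳ _) len) (unique-length (λ v → v) (λ e → e) B!))
        grow (suc k) B B! ws sl len with Finₚ.any? (λ u → Finₚ.any? λ v → (O u v Bool.≟ true) ×-dec ((v ∈? B) ×-dec ¬? (u ∈? B)))
        ... | no none = record
          { B = B
          ; walks = λ x∈ → let (w , p , s , walk , p! , _) = ws x∈ in w , p , s , walk , p!
          ; slack∈ = sl
          ; absorbs = absorbs }
          where
          absorbs : ∀ {u v} → O u v ≡ true → v ∈ B → u ∈ B
          absorbs {u} {v} e v∈ with u ∈? B
          ... | yes m = m
          ... | no u∉ = ⊥-elim (none (u , v , e , v∈ , u∉))
        ... | yes (u , v , e , v∈ , u∉) = grow k (u ∷ B) (All.tabulate (λ m → λ { refl → u∉ m }) ∷ B!)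
          (λ { (here refl) → let (w , p , s , walk , p! , p⊆) = ws v∈ in
                 w , u ∷ p , s , step e walk , (All.tabulate (λ m → λ { refl → u∉ (p⊆ m) }) ∷ p!) , λ { (here refl) → here refl ; (there m) → there (p⊆ m) }
             ; (there m) → let (w , p , s , walk , p! , p⊆) = ws m in w , p , s , walk , p! , there ∘ p⊆ })
          (there ∘ sl) (subst (N <_) (ℕₚ.+-suc _ k) len)

      record Extension (O : Relation) (x y : V) : Set where
        field
          O′       : Relation
          oriented : Oriented O′
          bounded  : Bounded O′
          covers   : ∀ {u v} → Covered O u v → Covered O′ u v
          new      : Covered O′ x y

      Covered-sym : ∀ O {u v} → Covered O u v → Covered O v u
      Covered-sym O (inj₁ e) = inj₂ e
      Covered-sym O (inj₂ e) = inj₁ e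

      not-true : ∀ {b} → b ≢ true → b ≡ false
      not-true = ¬-not

      push : ∀ {O u v p} → A u v ≡ true → ¬ Covered O u v → Freed O u p → Extension O u v
      push {O} {u} {v} a unc f = record
        { O′ = assign F.O′ u v true
        ; oriented = insert-oriented F.oriented a (not-true (unc′ ∘ inj₂))
        ; bounded = bounds
        ; covers = λ c → keep (F.covers c)
        ; new = inj₁ (assign-same F.O′ u v true)
        }
        where
        module F = Freed f
        unc′ : ¬ Covered F.O′ u v
        unc′ = unc ∘ F.covers⁻
        bounds : Bounded (assign F.O′ u v true)
        bounds x = by (x Finₚ.≟ u)
          where
          by : Dec (x ≡ u) → count (assign F.O′ u v true x) ≤ d
          by (yes refl) = subst (_≤ d) (sym (insert-count {F.O′} {x} {v} (not-true (unc′ ∘ inj₁)))) F.slack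
          by (no x≢u) = subst (_≤ d) (sym (insert-count-other {F.O′} {u} {v} x≢u)) (F.bounded x)
        keep₁ : ∀ a b → F.O′ a b ≡ true → assign F.O′ u v true a b ≡ true
        keep₁ a b e with assign-cases F.O′ u v true a b
        ... | inj₁ (_ , _ , q) = q
        ... | inj₂ (_ , q) = trans q e
        keep : ∀ {a b} → Covered F.O′ a b → Covered (assign F.O′ u v true) a b
        keep (inj₁ e) = inj₁ (keep₁ _ _ e)
        keep (inj₂ e) = inj₂ (keep₁ _ _ e)

      -- If `x` or `y` can reach room, reversing the walk lets the edge leave that end. Otherwise
      -- both belong to the vertices that cannot; these are closed under out-arcs and have
      -- out-degree `d`, and the new edge among them is the one too many.
      extend : ∀ {O x y} → Oriented O → Bounded O → A x y ≡ true → ¬ Covered O x y → Dense ⊎ Extension O x y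
      extend {O} {x} {y} or bd a unc = by (x ∈? B) (y ∈? B)
        where
        open Backward (backward O)
        by : Dec (x ∈ B) → Dec (y ∈ B) → Dense ⊎ Extension O x y
        by (yes x∈) _ with walks x∈
        ... | w , p , s , walk , p! = inj₂ (push a unc (free or bd s walk p!))
        by (no _) (yes y∈) with walks y∈
        ... | w , p , s , walk , p! with push (trans (A-sym y x) a) (unc ∘ Covered-sym O) (free or bd s walk p!)
        ...   | e = inj₂ (record { Extension e ; new = Covered-sym (Extension.O′ e) (Extension.new e) })
        by (no x∉) (no y∉) = inj₁ (record
          { O = assign O x y true
          ; oriented = insert-oriented or a (not-true (unc ∘ inj₂))
          ; R = R
          ; unique = Uniqueₚ.filter⁺ out? (Uniqueₚ.allFin⁺ N)
          ; closed = closed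
          ; extra = x
          ; extra∈ = out x∉
          ; extra-degree = trans (insert-count {O} {x} {y} (not-true (unc ∘ inj₁))) (cong suc (full (out x∉)))
          ; degree = λ u∈ u≢ → trans (insert-count-other {O} {x} {y} u≢) (full u∈)
          })
          where
          out? : ∀ v → Dec (v ∉ B)
          out? v = ¬? (v ∈? B)
          R = filter out? (allFin N)
          out : ∀ {v} → v ∉ B → v ∈ R
          out v∉ = ∈-filter⁺ out? (∈-allFin _) v∉
          out⁻ : ∀ {v} → v ∈ R → v ∉ B
          out⁻ v∈ = proj₂ (∈-filter⁻ out? {xs = allFin N} v∈)
          full : ∀ {u} → u ∈ R → count (O u) ≡ d
          full u∈ = ℕₚ.≤-antisym (bd _) (ℕₚ.≮⇒≥ (out⁻ u∈ ∘ slack∈))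
          closed : ∀ {u v} → u ∈ R → assign O x y true u v ≡ true → v ∈ R
          closed {u} {v} u∈ e with assign-cases O x y true u v
          ... | inj₁ (_ , refl , _) = out y∉
          ... | inj₂ (_ , q) = out λ v∈ → out⁻ u∈ (absorbs (trans (sym q) e) v∈)

      record Orientation : Set where
        field
          O        : Relation
          oriented : Oriented O
          bounded  : Bounded O
          total    : ∀ {u v} → A u v ≡ true → Covered O u v

      private
        record Progress (ps : List (V × V)) : Set where
          field
            O        : Relation
            oriented : Oriented O
            bounded  : Bounded O
            done     : ∀ {u v} → (u , v) ∈ ps → A u v ≡ true → Covered O u v

        count-none : ∀ n → count {n} (λ _ → false) ≡ 0
        count-none zero = refl
        count-none (suc n) = count-none n

        progress : ∀ ps → Dense ⊎ Progress ps
        progress [] = inj₂ (record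
          { O = λ _ _ → false ; oriented = record { inside = λ () ; asym = λ () }
          ; bounded = λ _ → subst (_≤ d) (sym (count-none N)) z≤n ; done = λ () })
        progress ((x , y) ∷ ps) with progress ps
        ... | inj₁ dense = inj₁ dense
        ... | inj₂ pr = decide (A x y Bool.≟ true) (O x y Bool.≟ true) (O y x Bool.≟ true)
          where
          open Progress pr
          keep : (A x y ≡ true → Covered O x y) → Dense ⊎ Progress ((x , y) ∷ ps)
          keep c = inj₂ (record { O = O ; oriented = oriented ; bounded = bounded ; done = λ { (here refl) a → c a ; (there m) a → done m a } })
          decide : Dec (A x y ≡ true) → Dec (O x y ≡ true) → Dec (O y x ≡ true) → Dense ⊎ Progress ((x , y) ∷ ps)
          decide (no ¬a) _ _ = keep λ a → ⊥-elim (¬a a)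
          decide _ (yes e) _ = keep λ _ → inj₁ e
          decide _ _ (yes e) = keep λ _ → inj₂ e
          decide (yes a) (no e) (no f) with extend oriented bounded a (λ { (inj₁ g) → e g ; (inj₂ g) → f g })
          ... | inj₁ dense = inj₁ dense
          ... | inj₂ ext = inj₂ (record
            { O = Extension.O′ ext ; oriented = Extension.oriented ext ; bounded = Extension.bounded ext
            ; done = λ { (here refl) _ → Extension.new ext ; (there m) a → Extension.covers ext (done m a) } })

      -- Hakimi's theorem: path reversal fails only at a set R whose vertices all
      -- have out-degree d.
      orientation-or-dense : Dense ⊎ Orientation
      orientation-or-dense with progress (cartesianProduct (allFin N) (allFin N))
      ... | inj₁ dense = inj₁ dense
      ... | inj₂ pr = inj₂ (record
        { O = Progress.O pr ; oriented = Progress.oriented pr ; bounded = Progress.bounded pr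
        ; total = Progress.done pr (∈-cartesianProduct⁺ (∈-allFin _) (∈-allFin _)) })

-- Conflict colourings from orientations, and the bound 4 for planar graphs.

module Conflicts where

  open Darts using (lookup-injective; reverse)
  open Drawings using (planar-bound; dart-origin)
  open Orientations
  open import Data.Bool using (T)
  open import Data.Fin using (Fin; zero; suc)
  open import Data.List using ([]; _∷_)
  open import Data.List.Relation.Unary.All as All using (All; []; _∷_)
  open import Data.List.Relation.Unary.AllPairs using ([]; _∷_)
  open import Data.Nat using (zero; suc; _+_; _*_; _≤_; z≤n; s≤s)

  avoid : ∀ {d} (l : List (Fin (suc d))) → length l ≤ d → ∃[ a ] a ∉ l
  avoid {d} l len with Finₚ.any? (λ a → ¬? (a ∈? l))
    where
    open DecMembership (Finₚ._≟_ {suc d}) using (_∈?_)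
    open import Relation.Nullary.Decidable using (¬?)
  ... | yes found = found
  -- If every class occurred, `index` would inject d + 1 classes into at most d positions.
  ... | no none = ⊥-elim (ℕₚ.<⇒≱ (s≤s len) (Finₚ.injective⇒≤ {f = λ a → index (all a)} λ {a} {b} e →
      trans (lookup-index (all a)) (trans (cong (lookup l) e) (sym (lookup-index (all b))))))
    where
    open DecMembership (Finₚ._≟_ {suc d}) using (_∈?_)
    all : ∀ a → a ∈ l
    all a with a ∈? l
    ... | yes m = m
    ... | no n = ⊥-elim (none (a , n))

  trues : ∀ {N} → (Fin N → Bool) → List (Fin N)
  trues {zero}  f = []
  trues {suc N} f with f zero
  ... | true  = zero ∷ map suc (trues (f ∘ suc))
  ... | false = map suc (trues (f ∘ suc))

  length-trues : ∀ {N} (f : Fin N → Bool) → length (trues f) ≡ count f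
  length-trues {zero} f = refl
  length-trues {suc N} f with f zero
  ... | true  = cong suc (trans (length-map suc (trues (f ∘ suc))) (length-trues (f ∘ suc)))
  ... | false = trans (length-map suc (trues (f ∘ suc))) (length-trues (f ∘ suc))

  ∈-trues⁺ : ∀ {N} (f : Fin N → Bool) {v} → f v ≡ true → v ∈ trues f
  ∈-trues⁺ {suc N} f {zero} e with f zero
  ∈-trues⁺ {suc N} f {zero} refl | true = here refl
  ∈-trues⁺ {suc N} f {suc v} e with f zero
  ... | true = there (∈-map⁺ suc (∈-trues⁺ (f ∘ suc) e))
  ... | false = ∈-map⁺ suc (∈-trues⁺ (f ∘ suc) e)

  ∈-trues⁻ : ∀ {N} (f : Fin N → Bool) {v} → v ∈ trues f → f v ≡ true
  ∈-trues⁻ {suc N} f m with f zero in eq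
  ∈-trues⁻ {suc N} f (here refl) | true = eq
  ∈-trues⁻ {suc N} f (there m) | true with ∈-map⁻ suc m
  ... | _ , m′ , refl = ∈-trues⁻ (f ∘ suc) m′
  ∈-trues⁻ {suc N} f m | false with ∈-map⁻ suc m
  ... | _ , m′ , refl = ∈-trues⁻ (f ∘ suc) m′

  trues-unique : ∀ {N} (f : Fin N → Bool) → Unique (trues f)
  trues-unique {zero} f = []
  trues-unique {suc N} f with f zero
  ... | true = All.tabulate (λ m e → zero∉ (subst (_∈ map suc (trues (f ∘ suc))) (sym e) m)) ∷ Uniqueₚ.map⁺ Finₚ.suc-injective (trues-unique (f ∘ suc))
    where
    zero∉ : zero ∉ map suc (trues (f ∘ suc))
    zero∉ m with ∈-map⁻ suc m
    ... | _ , _ , ()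
  ... | false = Uniqueₚ.map⁺ Finₚ.suc-injective (trues-unique (f ∘ suc))

  module _ (G : Graph) where
    open Graph G

    to-T : ∀ {b} → b ≡ true → T b
    to-T = Equivalence.from T-≡

    from-T : ∀ {b} → T b → b ≡ true
    from-T = Equivalence.to T-≡

    edge-between : ∀ u v → adj u v ≡ true → Edge
    edge-between u v a with Finₚ.<-cmp u v
    ... | tri< u<v _ _ = edge u v u<v (to-T a)
    ... | tri≈ _ refl _ = ⊥-elim (true≢false (trans (sym a) (adj-irrefl u)))
    ... | tri> _ _ v<u = edge v u v<u (to-T (trans (adj-sym v u) a))

    edge-between-ends : ∀ u v a → (end₁ (edge-between u v a) ≡ u × end₂ (edge-between u v a) ≡ v) ⊎
                                  (end₁ (edge-between u v a) ≡ v × end₂ (edge-between u v a) ≡ u)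
    edge-between-ends u v a with Finₚ.<-cmp u v
    ... | tri< _ _ _ = inj₁ (refl , refl)
    ... | tri≈ _ refl _ = ⊥-elim (true≢false (trans (sym a) (adj-irrefl u)))
    ... | tri> _ _ _ = inj₂ (refl , refl)

    edge-ext : ∀ {e f : Edge} → end₁ e ≡ end₁ f → end₂ e ≡ end₂ f → e ≡ f
    edge-ext {edge a b p q} {edge _ _ p′ q′} refl refl = cong₂ (edge a b) (ℕₚ.<-irrelevant p p′) (T-irrelevant q q′)

    adjacent₁₂ : ∀ e → adj (end₁ e) (end₂ e) ≡ true
    adjacent₁₂ e = from-T (adjacent e)

    module _ {k} (c : LocalPartition G (suc k)) where

      -- The class of the edge xy at x.
      class : Vertex → Vertex → Fin (suc k)
      class x y with Finₚ.<-cmp x y | adj x y Bool.≟ true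
      ... | tri< x<y _ _ | yes a = c x (at-end₁ (edge x y x<y (to-T a)))
      ... | tri> _ _ y<x | yes a = c x (at-end₂ (edge y x y<x (to-T (trans (adj-sym y x) a))))
      ... | _ | _ = zero

      private
        irrelevant₁ : ∀ {x y} p p′ q q′ → c x (at-end₁ (edge x y p q)) ≡ c x (at-end₁ (edge x y p′ q′))
        irrelevant₁ {x} {y} p p′ q q′ with ℕₚ.<-irrelevant p p′ | T-irrelevant q q′
        ... | refl | refl = refl

        irrelevant₂ : ∀ {x y} p p′ q q′ → c y (at-end₂ (edge x y p q)) ≡ c y (at-end₂ (edge x y p′ q′))
        irrelevant₂ {x} {y} p p′ q q′ with ℕₚ.<-irrelevant p p′ | T-irrelevant q q′
        ... | refl | refl = refl

      class₁ : ∀ e → class (end₁ e) (end₂ e) ≡ c (end₁ e) (at-end₁ e)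
      class₁ (edge x y x<y q) with Finₚ.<-cmp x y | adj x y Bool.≟ true
      ... | tri< p _ _ | yes a = irrelevant₁ p x<y _ q
      ... | tri≈ ¬p _ _ | _ = ⊥-elim (¬p x<y)
      ... | tri> ¬p _ _ | _ = ⊥-elim (¬p x<y)
      ... | tri< _ _ _ | no ¬a = ⊥-elim (¬a (from-T q))

      class₂ : ∀ e → class (end₂ e) (end₁ e) ≡ c (end₂ e) (at-end₂ e)
      class₂ (edge x y x<y q) with Finₚ.<-cmp y x | adj y x Bool.≟ true
      ... | tri> _ _ p | yes a = irrelevant₂ p x<y _ q
      ... | tri≈ _ _ ¬p | _ = ⊥-elim (¬p x<y)
      ... | tri< _ _ ¬p | _ = ⊥-elim (¬p x<y)
      ... | tri> _ _ _ | no ¬a = ⊥-elim (¬a (trans (adj-sym y x) (from-T q)))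

      conflict-colouring : (φ : Vertex → Fin (suc k)) →
        (∀ {x y} → adj x y ≡ true → ¬ (φ x ≡ class x y × φ y ≡ class y x)) → ConflictColouring G c φ
      conflict-colouring φ ok e (p , q) = ok (adjacent₁₂ e) (trans p (sym (class₁ e)) , trans q (sym (class₂ e)))

    oriented⇒conflict-colourable : ∀ {d} → Orientation adj adj-irrefl adj-sym d → ConflictColourable G (suc d)
    oriented⇒conflict-colourable {d} or c = φ , conflict-colouring c φ λ a (p , q) → ok (total a) p q
      where
      open Orientation or
      forbidden : Vertex → List (Fin (suc d))
      forbidden x = map (class c x) (trues (O x))
      choice : ∀ x → ∃[ a ] a ∉ forbidden x
      choice x = avoid (forbidden x) (subst (_≤ d) (sym (trans (length-map (class c x) (trues (O x))) (length-trues (O x)))) (bounded x))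
      φ : Vertex → Fin (suc d)
      φ x = proj₁ (choice x)
      avoids : ∀ {x y} → O x y ≡ true → φ x ≢ class c x y
      avoids {x} {y} e p = proj₂ (choice x) (subst (_∈ forbidden x) (sym p) (∈-map⁺ (class c x) (∈-trues⁺ (O x) e)))
      ok : ∀ {x y} → O x y ≡ true ⊎ O y x ≡ true → φ x ≡ class c x y → φ y ≡ class c y x → ⊥
      ok (inj₁ e) p _ = avoids e p
      ok (inj₂ e) _ q = avoids e q

  module _ {N} (O : Relation {N}) where

    out-arcs : List (Fin N) → List (Fin N × Fin N)
    out-arcs []       = []
    out-arcs (u ∷ us) = map (u ,_) (trues (O u)) ++ out-arcs us

    ∈-out-arcs⁻ : ∀ us {u v} → (u , v) ∈ out-arcs us → u ∈ us × O u v ≡ true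
    ∈-out-arcs⁻ (w ∷ us) m with ∈-++⁻ (map (w ,_) (trues (O w))) m
    ... | inj₂ m′ = there (proj₁ (∈-out-arcs⁻ us m′)) , proj₂ (∈-out-arcs⁻ us m′)
    ... | inj₁ m′ with ∈-map⁻ (w ,_) m′
    ...   | _ , v∈ , refl = here refl , ∈-trues⁻ (O w) v∈

    ∈-out-arcs⁺ : ∀ {us u v} → u ∈ us → O u v ≡ true → (u , v) ∈ out-arcs us
    ∈-out-arcs⁺ {u ∷ us} (here refl) e = ∈-++⁺ˡ (∈-map⁺ (u ,_) (∈-trues⁺ (O u) e))
    ∈-out-arcs⁺ {w ∷ us} (there m) e = ∈-++⁺ʳ (map (w ,_) (trues (O w))) (∈-out-arcs⁺ m e)

    out-arcs-unique : ∀ {us} → Unique us → Unique (out-arcs us)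
    out-arcs-unique [] = []
    out-arcs-unique {u ∷ us} (u∉ ∷ us!) = Uniqueₚ.++⁺ (Uniqueₚ.map⁺ (cong proj₂) (trues-unique (O u))) (out-arcs-unique us!) disjoint
      where
      disjoint : ∀ {x} → ¬ (x ∈ map (u ,_) (trues (O u)) × x ∈ out-arcs us)
      disjoint (p , q) with ∈-map⁻ (u ,_) p
      ... | _ , _ , refl = All.lookup u∉ (proj₁ (∈-out-arcs⁻ us q)) refl

    length-out-arcs : ∀ u us → length (out-arcs (u ∷ us)) ≡ count (O u) + length (out-arcs us)
    length-out-arcs u us = trans (length-++ (map (u ,_) (trues (O u))))
      (cong (_+ length (out-arcs us)) (trans (length-map (u ,_) (trues (O u))) (length-trues (O u))))

    length-out-arcs-regular : ∀ {d} us → (∀ {u} → u ∈ us → count (O u) ≡ d) → length (out-arcs us) ≡ length us * d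
    length-out-arcs-regular [] e = refl
    length-out-arcs-regular (u ∷ us) e = trans (length-out-arcs u us) (cong₂ _+_ (e (here refl)) (length-out-arcs-regular us (e ∘ there)))

    length-out-arcs-extra : ∀ {d x us} → Unique us → x ∈ us → count (O x) ≡ suc d →
      (∀ {u} → u ∈ us → u ≢ x → count (O u) ≡ d) → length (out-arcs us) ≡ suc (length us * d)
    length-out-arcs-extra {us = u ∷ us} (u∉ ∷ us!) (here refl) ex e =
      trans (length-out-arcs u us) (cong₂ _+_ ex (length-out-arcs-regular us λ m → e (there m) λ { refl → All.lookup u∉ m refl }))
    length-out-arcs-extra {d} {us = u ∷ us} (u∉ ∷ us!) (there x∈) ex e =
      trans (length-out-arcs u us) (trans (cong₂ _+_ (e (here refl) (All.lookup u∉ x∈)) (length-out-arcs-extra us! x∈ ex (e ∘ there))) (ℕₚ.+-suc d _))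

  -- The out-arcs of `R` are 3 |R| + 1 edges on |R| vertices, one more than a drawing admits. Every
  -- vertex of `R` has out-degree at least 3, so this subgraph has no vertex of degree 1, as the
  -- count of face sides demands.
  planar⇒¬dense : ∀ G → Planar G → ¬ Dense (Graph.adj G) (Graph.adj-irrefl G) (Graph.adj-sym G) 3
  planar⇒¬dense G D dense = ℕₚ.<⇒≱ (ℕₚ.≤-reflexive (sym size)) (ℕₚ.≤-trans bound (ℕₚ.≤-reflexive (ℕₚ.*-comm 3 (length R))))
    where
    open Graph G
    open Dense dense
    open Oriented oriented
    L = out-arcs O R
    n = length L
    L! = out-arcs-unique O unique
    size : n ≡ suc (length R * 3)
    size = length-out-arcs-extra O unique extra∈ extra-degree degree
    tail head : Fin n → Vertex
    tail i = proj₁ (lookup L i)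
    head i = proj₂ (lookup L i)
    arc-in : ∀ i → tail i ∈ R × O (tail i) (head i) ≡ true
    arc-in i = ∈-out-arcs⁻ O R (∈-lookup {xs = L} i)
    adj-i : ∀ i → adj (tail i) (head i) ≡ true
    adj-i i = inside (proj₂ (arc-in i))
    E : Fin n → Edge
    E i = edge-between G (tail i) (head i) (adj-i i)
    ends : ∀ i → (end₁ (E i) ≡ tail i × end₂ (E i) ≡ head i) ⊎ (end₁ (E i) ≡ head i × end₂ (E i) ≡ tail i)
    ends i = edge-between-ends G (tail i) (head i) (adj-i i)
    same : ∀ {i j} → tail i ≡ tail j → head i ≡ head j → i ≡ j
    same {i} {j} p q = lookup-injective L! i j (cong₂ _,_ p q)
    opposite : ∀ {i j} → tail i ≡ head j → head i ≡ tail j → ⊥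
    opposite {i} {j} p q = true≢false (trans (sym (subst₂ (λ a b → O a b ≡ true) p q (proj₂ (arc-in i)))) (asym (proj₂ (arc-in j))))
    E-injective : ∀ {i j} → E i ≡ E j → i ≡ j
    E-injective {i} {j} e with ends i | ends j
    ... | inj₁ (a , b) | inj₁ (a′ , b′) = same (trans (sym a) (trans (cong end₁ e) a′)) (trans (sym b) (trans (cong end₂ e) b′))
    ... | inj₂ (a , b) | inj₂ (a′ , b′) = same (trans (sym b) (trans (cong end₂ e) b′)) (trans (sym a) (trans (cong end₁ e) a′))
    ... | inj₁ (a , b) | inj₂ (a′ , b′) = ⊥-elim (opposite (trans (sym a) (trans (cong end₁ e) a′)) (trans (sym b) (trans (cong end₂ e) b′)))
    ... | inj₂ (a , b) | inj₁ (a′ , b′) = ⊥-elim (opposite (trans (sym b) (trans (cong end₂ e) b′)) (trans (sym a) (trans (cong end₁ e) a′)))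
    origin = dart-origin D E E-injective
    head∈ : ∀ i → head i ∈ R
    head∈ i = closed (proj₁ (arc-in i)) (proj₂ (arc-in i))
    ∈R : ∀ d → origin d ∈ R
    ∈R (i , false) with ends i
    ... | inj₁ (a , _) = subst (_∈ R) (sym a) (proj₁ (arc-in i))
    ... | inj₂ (a , _) = subst (_∈ R) (sym a) (head∈ i)
    ∈R (i , true) with ends i
    ... | inj₁ (_ , b) = subst (_∈ R) (sym b) (head∈ i)
    ... | inj₂ (_ , b) = subst (_∈ R) (sym b) (proj₁ (arc-in i))
    simple : ∀ d e → origin d ≡ origin e → origin (reverse d) ≡ origin (reverse e) → d ≡ e
    simple (i , false) (j , false) p q = cong (_, false) (E-injective (edge-ext G p q))
    simple (i , true) (j , true) p q = cong (_, true) (E-injective (edge-ext G q p))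
    simple (i , false) (j , true) p q = ⊥-elim (Finₚ.<-asym (ordered (E i)) (subst₂ Fin._<_ (sym q) (sym p) (ordered (E j))))
    simple (i , true) (j , false) p q = ⊥-elim (Finₚ.<-asym (ordered (E i)) (subst₂ Fin._<_ (sym p) (sym q) (ordered (E j))))
    two-outs : ∀ {v} → v ∈ R → ∃[ a ] ∃[ b ] (a ≢ b × O v a ≡ true × O v b ≡ true)
    two-outs {v} v∈ = two (trues (O v)) (trues-unique (O v)) (λ m → ∈-trues⁻ (O v) m) (subst (2 ≤_) (sym (length-trues (O v))) big)
      where
      big : 2 ≤ count (O v)
      big with v Finₚ.≟ extra
      ... | yes refl = subst (2 ≤_) (sym extra-degree) (s≤s (s≤s z≤n))
      ... | no v≢ = subst (2 ≤_) (sym (degree v∈ v≢)) (s≤s (s≤s z≤n))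
      two : ∀ l → Unique l → (∀ {a} → a ∈ l → O v a ≡ true) → 2 ≤ length l → ∃[ a ] ∃[ b ] (a ≢ b × O v a ≡ true × O v b ≡ true)
      two (a ∷ b ∷ l) ((a≢b ∷ _) ∷ _) f _ = a , b , a≢b , f (here refl) , f (there (here refl))
      two (a ∷ []) _ _ (s≤s ())
    dart-from : ∀ {v a} → v ∈ R → O v a ≡ true → ∃[ d ] (origin d ≡ v × tail (proj₁ d) ≡ v × head (proj₁ d) ≡ a)
    dart-from {v} {a} v∈ e with ∈-out-arcs⁺ O v∈ e
    ... | m with lookup-index m
    ...   | eq with ends (index m)
    ...     | inj₁ (p , _) = (index m , false) , trans p (sym (cong proj₁ eq)) , sym (cong proj₁ eq) , sym (cong proj₂ eq)
    ...     | inj₂ (_ , p) = (index m , true) , trans p (sym (cong proj₁ eq)) , sym (cong proj₁ eq) , sym (cong proj₂ eq)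
    others : ∀ d → ∃[ e ] (e ≢ d × origin e ≡ origin d)
    others d with two-outs (∈R d)
    ... | a , b , a≢b , oa , ob with dart-from (∈R d) oa | dart-from (∈R d) ob
    ...   | x , xo , _ , xa | y , yo , _ , yb with Finₚ._≟_ (proj₁ x) (proj₁ d)
    ...     | no x≢d = x , (λ { refl → x≢d refl }) , xo
    ...     | yes x≡d = y , (λ { refl → a≢b (trans (sym xa) (trans (cong head x≡d) yb)) }) , yo
    bound : n ≤ 3 * length R
    bound = planar-bound D E E-injective R unique ∈R simple others

  planar⇒conflict-colourable : ∀ G → Planar G → ConflictColourable G 4
  planar⇒conflict-colourable G D with orientation-or-dense (Graph.adj G) (Graph.adj-irrefl G) (Graph.adj-sym G) 3
  ... | inj₁ dense = ⊥-elim (planar⇒¬dense G D dense)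
  ... | inj₂ or = oriented⇒conflict-colourable G or

-- Subdivisions in graphs without leaves.

module Configurations where

  open Darts using (unique-length)
  open Orientations using (Relation; true≢false)
  open import Data.Bool using (T)
  open import Data.Fin using (Fin; zero; suc; #_)
  open import Data.List using ([]; _∷_; reverse)
  open import Data.List.Relation.Unary.All as All using (All; []; _∷_)
  open import Data.List.Relation.Unary.AllPairs using ([]; _∷_)
  open import Data.Nat using (ℕ; zero; suc; _+_; _≤_; _<_; z≤n; s≤s)
  open import Data.Vec as Vec using (Vec)

  -- Rearranging blocks of vertices preserves freedom from duplicates. Reversing a block is a
  -- permutation too, so reversals are stripped and the solver for commutative monoids compares what
  -- remains.
  module Rearrange (V : Set) where
    open import Algebra.Solver.CommutativeMonoid (++-commutativeMonoid {A = V}) using (Expr; prove′) renaming (var to varᴱ; _⊕_ to _⊕ᴱ_; ⟦_⟧ to ⟦_⟧ᴱ)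

    infixr 5 _⊕_
    data Lists (n : ℕ) : Set where
      var : Fin n → Lists n
      _⊕_ : Lists n → Lists n → Lists n
      rev : Lists n → Lists n

    ⟦_⟧ : ∀ {n} → Lists n → Vec (List V) n → List V
    ⟦ var i ⟧ ρ = Vec.lookup ρ i
    ⟦ e ⊕ f ⟧ ρ = ⟦ e ⟧ ρ ++ ⟦ f ⟧ ρ
    ⟦ rev e ⟧ ρ = reverse (⟦ e ⟧ ρ)

    strip : ∀ {n} → Lists n → Expr n
    strip (var i) = varᴱ i
    strip (e ⊕ f) = strip e ⊕ᴱ strip f
    strip (rev e) = strip e

    strip-↭ : ∀ {n} (e : Lists n) ρ → ⟦ e ⟧ ρ ↭ ⟦ strip e ⟧ᴱ ρ
    strip-↭ (var i) ρ = ↭-refl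
    strip-↭ (e ⊕ f) ρ = ++⁺ (strip-↭ e ρ) (strip-↭ f ρ)
    strip-↭ (rev e) ρ = ↭-trans (↭-reverse _) (strip-↭ e ρ)

    rearrange : ∀ {n} (e f : Lists n) ρ → T (is-just (prove′ (strip e) (strip f))) → Unique (⟦ e ⟧ ρ) → Unique (⟦ f ⟧ ρ)
    rearrange e f ρ ok u with prove′ (strip e) (strip f)
    ... | just p = ↭ₛ.Unique-resp-↭ (setoid V) (↭⇒↭ₛ (↭-trans (strip-↭ e ρ) (↭-trans (p ρ) (↭-sym (strip-↭ f ρ))))) u

  ++∷≢[] : ∀ {V : Set} (xs : List V) {y ys} → xs ++ y ∷ ys ≢ []
  ++∷≢[] [] ()
  ++∷≢[] (_ ∷ _) ()

  unique-prefix : ∀ {V : Set} (xs : List V) {ys} → Unique (xs ++ ys) → Unique xs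
  unique-prefix [] u = []
  unique-prefix (x ∷ xs) (x∉ ∷ u) = All.tabulate (λ m → All.lookup x∉ (∈-++⁺ˡ m)) ∷ unique-prefix xs u

  unique-suffix : ∀ {V : Set} (xs : List V) {ys} → Unique (xs ++ ys) → Unique ys
  unique-suffix [] u = u
  unique-suffix (x ∷ xs) (_ ∷ u) = unique-suffix xs u

  module Subgraphs {N} (A : Relation {N}) (A-sym : ∀ x y → A x y ≡ A y x) (A-irrefl : ∀ x → A x x ≡ false) where

    private V = Fin N
    open Rearrange V
    open DecMembership (Finₚ._≟_ {N}) using (_∈?_)
    open DecMembership (×ₚ.≡-dec (Finₚ._≟_ {N}) (Finₚ._≟_ {N})) using () renaming (_∈?_ to _∈²?_)

    irreflexive : ∀ {x y} → A x y ≡ true → x ≢ y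
    irreflexive a refl = true≢false (trans (sym a) (A-irrefl _))

    -- The list holds the inner vertices only, so a direct edge is the empty list.
    Path : V → List V → V → Set
    Path x [] y = A x y ≡ true
    Path x (w ∷ ws) y = A x w ≡ true × Path w ws y

    path-++ : ∀ {x} us {v ws y} → Path x us v → Path v ws y → Path x (us ++ v ∷ ws) y
    path-++ [] p q = p , q
    path-++ (u ∷ us) (a , p) q = a , path-++ us p q

    path-split : ∀ {x} us {v ws y} → Path x (us ++ v ∷ ws) y → Path x us v × Path v ws y
    path-split [] p = p
    path-split (u ∷ us) (a , p) = let (q , r) = path-split us p in (a , q) , r

    path-reverse : ∀ {x} ws {y} → Path x ws y → Path y (reverse ws) x
    path-reverse {x} [] {y} a = trans (A-sym y x) a
    path-reverse {x} (w ∷ ws) {y} (a , p) = subst (λ l → Path y l x) (sym (unfold-reverse w ws))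
      (path-++ (reverse ws) (path-reverse ws p) (trans (A-sym w x) a))

    steps : V → List V → V → List (V × V)
    steps x [] y = (x , y) ∷ []
    steps x (w ∷ ws) y = (x , w) ∷ steps w ws y

    steps-++ : ∀ x us v ws y → steps x (us ++ v ∷ ws) y ≡ steps x us v ++ steps v ws y
    steps-++ x [] v ws y = refl
    steps-++ x (u ∷ us) v ws y = cong ((x , u) ∷_) (steps-++ u us v ws y)

    steps-reverse : ∀ {x} ws {y a b} → (a , b) ∈ steps y (reverse ws) x → (b , a) ∈ steps x ws y
    steps-reverse [] (here refl) = here refl
    steps-reverse {x} (w ∷ ws) {y} m with ∈-++⁻ (steps y (reverse ws) w)
      (subst (_ ∈_) (trans (cong (λ l → steps y l x) (unfold-reverse w ws)) (steps-++ y (reverse ws) w [] x)) m)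
    ... | inj₁ m′ = there (steps-reverse ws m′)
    ... | inj₂ (here refl) = here refl

    Joined : List (V × V) → V → V → Set
    Joined l a b = (a , b) ∈ l ⊎ (b , a) ∈ l

    joined? : ∀ l a b → Dec (Joined l a b)
    joined? l a b = ((a , b) ∈²? l) ⊎-dec ((b , a) ∈²? l)

    -- Two direct paths with the same ends would be one edge used twice.
    NotBothEmpty : List V → List V → Set
    NotBothEmpty P Q = ¬ (P ≡ [] × Q ≡ [])

    record Theta (u v : V) (P Q R : List V) : Set where
      field
        pathP : Path u P v
        pathQ : Path u Q v
        pathR : Path u R v
        unique : Unique (u ∷ v ∷ P ++ Q ++ R)
        PQ : NotBothEmpty P Q
        PR : NotBothEmpty P R
        QR : NotBothEmpty Q R

    -- Subdivisions of the graphs of which every connected graph with at least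
    -- two more edges than vertices contains one.
    data Config : Set where
      figure-eight : ∀ v C D → Path v C v → Path v D v → Unique (v ∷ C ++ D) →
        2 ≤ length C → 2 ≤ length D → Config
      dumbbell : ∀ v C S t D → Path v C v → Path v S t → Path t D t → Unique (v ∷ t ∷ C ++ S ++ D) →
        2 ≤ length C → 2 ≤ length D → Config
      quadruple : ∀ u v P Q R W → Path u P v → Path u Q v → Path u R v → Path u W v → Unique (u ∷ v ∷ P ++ Q ++ R ++ W) →
        Q ≢ [] → R ≢ [] → W ≢ [] → Config
      tetrahedron : ∀ a v b c AV BC AB BV VC CA →
        Path a AV v → Path b BC c → Path a AB b → Path b BV v → Path v VC c → Path c CA a →
        Unique (a ∷ v ∷ b ∷ c ∷ AV ++ BC ++ AB ++ BV ++ VC ++ CA) → Config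

    length-∷-both : ∀ (P : List V) {v} Q → NotBothEmpty P Q → 2 ≤ length (P ++ v ∷ Q)
    length-∷-both [] [] ne = ⊥-elim (ne (refl , refl))
    length-∷-both [] (_ ∷ _) ne = s≤s (s≤s z≤n)
    length-∷-both (_ ∷ P) {v} Q ne = s≤s (subst (1 ≤_) (sym (trans (length-++ P) (ℕₚ.+-suc (length P) (length Q)))) (s≤s z≤n))

    short : ∀ {C₁ C₂ : List V} {p} → C₁ ≡ [] → C₂ ≡ [] → ¬ 2 ≤ length (C₁ ++ p ∷ C₂)
    short refl refl (s≤s ())

    reverse-[] : ∀ (P : List V) → reverse P ≡ [] → P ≡ []
    reverse-[] [] _ = refl
    reverse-[] (x ∷ P) e with trans (sym (length-reverse (x ∷ P))) (cong length e)
    ... | ()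

    both-reverse : ∀ P Q → NotBothEmpty P Q → NotBothEmpty P (reverse Q)
    both-reverse _ Q ne (e , f) = ne (e , reverse-[] Q f)

    swap-both : ∀ {P Q} → NotBothEmpty P Q → NotBothEmpty Q P
    swap-both ne (e , f) = ne (f , e)

    private
      infix 8 $_
      $_ : ∀ {n} → Fin n → Lists n
      $ i = var i
      [_]′ : V → List V
      [ v ]′ = v ∷ []

    module _ {u v : V} {P Q R : List V} where

      swap-PQ : Theta u v P Q R → Theta u v Q P R
      swap-PQ θ = record
        { pathP = pathQ ; pathQ = pathP ; pathR = pathR
        ; unique = rearrange ($ (# 0) ⊕ $ (# 1) ⊕ $ (# 2) ⊕ $ (# 3) ⊕ $ (# 4)) ($ (# 0) ⊕ $ (# 1) ⊕ $ (# 3) ⊕ $ (# 2) ⊕ $ (# 4))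
            ([ u ]′ Vec.∷ [ v ]′ Vec.∷ P Vec.∷ Q Vec.∷ R Vec.∷ Vec.[]) _ unique
        ; PQ = swap-both PQ ; PR = QR ; QR = PR }
        where open Theta θ

      swap-PR : Theta u v P Q R → Theta u v R Q P
      swap-PR θ = record
        { pathP = pathR ; pathQ = pathQ ; pathR = pathP
        ; unique = rearrange ($ (# 0) ⊕ $ (# 1) ⊕ $ (# 2) ⊕ $ (# 3) ⊕ $ (# 4)) ($ (# 0) ⊕ $ (# 1) ⊕ $ (# 4) ⊕ $ (# 3) ⊕ $ (# 2))
            ([ u ]′ Vec.∷ [ v ]′ Vec.∷ P Vec.∷ Q Vec.∷ R Vec.∷ Vec.[]) _ unique
        ; PQ = swap-both QR ; PR = swap-both PR ; QR = swap-both PQ }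
        where open Theta θ

      flip-θ : Theta u v P Q R → Theta v u (reverse P) (reverse Q) (reverse R)
      flip-θ θ = record
        { pathP = path-reverse P pathP ; pathQ = path-reverse Q pathQ ; pathR = path-reverse R pathR
        ; unique = rearrange ($ (# 0) ⊕ $ (# 1) ⊕ $ (# 2) ⊕ $ (# 3) ⊕ $ (# 4)) ($ (# 1) ⊕ $ (# 0) ⊕ rev ($ (# 2)) ⊕ rev ($ (# 3)) ⊕ rev ($ (# 4)))
            ([ u ]′ Vec.∷ [ v ]′ Vec.∷ P Vec.∷ Q Vec.∷ R Vec.∷ Vec.[]) _ unique
        ; PQ = both PQ ; PR = both PR ; QR = both QR }
        where
        open Theta θ
        both : ∀ {X Y} → NotBothEmpty X Y → NotBothEmpty (reverse X) (reverse Y)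
        both ne (e , f) = ne (reverse-[] _ e , reverse-[] _ f)

    NoLeaf : Set
    NoLeaf = ∀ {x y} → A x y ≡ true → ∃[ z ] (z ≢ x × A y z ≡ true)

    -- A walk leaving `Bs` at `w`, continued until a vertex repeats: it returns to `Bs`, or closes a
    -- cycle `C` behind a tail `S`. A return to `w` itself needs two inner vertices, or an edge
    -- would be walked back.
    data Excursion (Bs : List V) (w : V) : Set where
      hit  : ∀ ws z → Path w ws z → z ∈ Bs → ws ≢ [] → (z ≡ w → 2 ≤ length ws) → Unique (Bs ++ ws) → Excursion Bs w
      loop : ∀ S t C → Path w S t → Path t C t → 2 ≤ length C → Unique (Bs ++ S ++ t ∷ C) → Excursion Bs w

    module _ (no-leaf : NoLeaf) {Bs : List V} (Bs! : Unique Bs) {w : V} (w∈ : w ∈ Bs) where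

      private
        snoc-unique : ∀ {xs : List V} {z} → Unique xs → z ∉ xs → Unique (xs ++ z ∷ [])
        snoc-unique xs! z∉ = Uniqueₚ.++⁺ xs! ([] ∷ []) λ { (m , here refl) → z∉ m }

        -- The vertex before `x` is remembered so that the walk never turns back at once; the fuel
        -- bounds the number of vertices still unvisited.
        excursion : ∀ k us prev x → Path w us x → (us ≡ [] × prev ≡ w) ⊎ (∃[ us′ ] us ≡ us′ ++ prev ∷ []) → A prev x ≡ true →
          Unique (Bs ++ us ++ x ∷ []) → N < length (Bs ++ us ++ x ∷ []) + k → Excursion Bs w
        excursion zero us prev x p last a u! len =
          ⊥-elim (ℕₚ.<⇒≱ (subst (N <_) (ℕₚ.+-identityʳ _) len) (unique-length (λ v → v) (λ e → e) u!))
        excursion (suc k) us prev x p last a u! len with no-leaf a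
        ... | z , z≢prev , xz = go (z ∈? Bs) (z ∈? us)
          where
          nonempty : us ++ x ∷ [] ≢ []
          nonempty = ++∷≢[] us
          long : ∀ us → (us ≡ [] × prev ≡ w) ⊎ (∃[ us′ ] us ≡ us′ ++ prev ∷ []) → z ≡ w → 2 ≤ length (us ++ x ∷ [])
          long [] (inj₁ (_ , f)) e = ⊥-elim (z≢prev (trans e (sym f)))
          long [] (inj₂ (us′ , f)) e = ⊥-elim (++∷≢[] us′ (sym f))
          long (_ ∷ us′) _ _ = s≤s (subst (1 ≤_) (sym (trans (length-++ us′) (ℕₚ.+-comm (length us′) 1))) (s≤s z≤n))
          x-path : ∀ {z} → A x z ≡ true → Path w (us ++ x ∷ []) z
          x-path a = path-++ us p a
          us! : Unique (us ++ x ∷ [])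
          us! = unique-suffix Bs u!
          go : Dec (z ∈ Bs) → Dec (z ∈ us) → Excursion Bs w
          go (yes z∈) _ = hit (us ++ x ∷ []) z (x-path xz) z∈ nonempty (long us last) u!
          go (no _) (yes z∈) with ∈-∃++ z∈
          ... | S , C′ , refl with path-split S p
          ...   | pS , pC = loop S z (C′ ++ x ∷ []) pS (path-++ C′ pC xz) (cycle-long C′ last)
                   (subst (λ l → Unique (Bs ++ l)) (++-assoc S (z ∷ C′) (x ∷ [])) u!)
            where
            cycle-long : ∀ C′ → (S ++ z ∷ C′ ≡ [] × prev ≡ w) ⊎ (∃[ us′ ] S ++ z ∷ C′ ≡ us′ ++ prev ∷ []) → 2 ≤ length (C′ ++ x ∷ [])
            cycle-long [] (inj₁ (e , _)) = ⊥-elim (++∷≢[] S e)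
            cycle-long [] (inj₂ (us′ , e)) = ⊥-elim (z≢prev (∷ʳ-injectiveʳ S us′ e))
            cycle-long (c ∷ C″) _ = s≤s (subst (1 ≤_) (sym (trans (length-++ C″) (ℕₚ.+-comm (length C″) 1))) (s≤s z≤n))
          go (no z∉Bs) (no z∉us) = excursion k (us ++ x ∷ []) x z (x-path xz) (inj₂ (us , refl)) xz
              (subst Unique assoc (snoc-unique u! fresh)) (subst (N <_) (trans (ℕₚ.+-suc _ k) (cong (_+ k) (trans (sym (trans (length-++ (Bs ++ us ++ x ∷ []) {z ∷ []}) (ℕₚ.+-comm _ 1))) (cong length assoc)))) len)
            where
            assoc : (Bs ++ us ++ x ∷ []) ++ z ∷ [] ≡ Bs ++ (us ++ x ∷ []) ++ z ∷ []
            assoc = ++-assoc Bs (us ++ x ∷ []) (z ∷ [])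
            fresh : z ∉ Bs ++ us ++ x ∷ []
            fresh m with ∈-++⁻ Bs m
            ... | inj₁ m′ = z∉Bs m′
            ... | inj₂ m′ with ∈-++⁻ us m′
            ...   | inj₁ m″ = z∉us m″
            ...   | inj₂ (here refl) = irreflexive xz refl

      explore : ∀ {y} → y ∉ Bs → A w y ≡ true → Excursion Bs w
      explore {y} y∉ a = excursion (suc N) [] w y a (inj₁ (refl , refl)) a (snoc-unique Bs! y∉) (ℕₚ.m≤n+m (suc N) _)

    Cycle : V → List V → Set
    Cycle v C = Path v C v × Unique (v ∷ C) × 2 ≤ length C

    -- Lets a cycle begin at the vertex where an extra edge is attached.
    rotate : ∀ {v C} → Cycle v C → ∀ {p} → p ∈ v ∷ C →
      ∃[ D ] (Cycle p D × (∀ {a b} → Joined (steps p D p) a b → Joined (steps v C v) a b) × (∀ {x} → x ∈ v ∷ C → x ∈ p ∷ D))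
    rotate {v} {C} c (here refl) = C , c , (λ j → j) , λ m → m
    rotate {v} {C} (path , C! , len) {p} (there p∈) with ∈-∃++ p∈
    ... | C₁ , C₂ , refl with path-split C₁ path
    ...   | p₁ , p₂ = C₂ ++ v ∷ C₁ , (path-++ C₂ p₂ p₁ , D! , length-∷-both C₂ C₁ ne) , joined , moved
      where
      D! = rearrange ($ (# 0) ⊕ $ (# 1) ⊕ $ (# 2) ⊕ $ (# 3)) ($ (# 2) ⊕ $ (# 3) ⊕ $ (# 0) ⊕ $ (# 1))
            ([ v ]′ Vec.∷ C₁ Vec.∷ [ p ]′ Vec.∷ C₂ Vec.∷ Vec.[]) _ C!
      ne : NotBothEmpty C₂ C₁
      ne (e , f) = short f e len
      back : ∀ {x} → x ∈ steps p (C₂ ++ v ∷ C₁) p → x ∈ steps v (C₁ ++ p ∷ C₂) v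
      back m with ∈-++⁻ (steps p C₂ v) (subst (_ ∈_) (steps-++ p C₂ v C₁ p) m)
      ... | inj₁ m′ = subst (_ ∈_) (sym (steps-++ v C₁ p C₂ v)) (∈-++⁺ʳ (steps v C₁ p) m′)
      ... | inj₂ m′ = subst (_ ∈_) (sym (steps-++ v C₁ p C₂ v)) (∈-++⁺ˡ m′)
      joined : ∀ {a b} → Joined (steps p (C₂ ++ v ∷ C₁) p) a b → Joined (steps v (C₁ ++ p ∷ C₂) v) a b
      joined (inj₁ m) = inj₁ (back m)
      joined (inj₂ m) = inj₂ (back m)
      moved : ∀ {x} → x ∈ v ∷ C₁ ++ p ∷ C₂ → x ∈ p ∷ C₂ ++ v ∷ C₁
      moved (here refl) = there (∈-++⁺ʳ C₂ (here refl))
      moved (there m) with ∈-++⁻ C₁ m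
      ... | inj₁ m′ = there (∈-++⁺ʳ C₂ (there m′))
      ... | inj₂ (here refl) = here refl
      ... | inj₂ (there m′) = there (∈-++⁺ˡ m′)

    SomeTheta : Set
    SomeTheta = ∃[ u ] ∃[ v ] ∃[ P ] ∃[ Q ] ∃[ R ] Theta u v P Q R

    module _ (no-leaf : NoLeaf) where

      -- Following the extra edge, a return to another vertex of the cycle makes a theta, a return
      -- to `p` a figure eight, and a cycle closed elsewhere a dumbbell.
      cycle-ear : ∀ {p C} → Cycle p C → ∀ {q} → A p q ≡ true → ¬ Joined (steps p C p) p q → SomeTheta ⊎ Config
      cycle-ear {p} {C} (path , C! , len) {q} a nj with q ∈? C
      ... | yes q∈ with ∈-∃++ q∈
      ...   | C₁ , C₂ , refl with path-split C₁ path
      ...     | p₁ , p₂ = inj₁ (p , q , [] , C₁ , reverse C₂ , record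
        { pathP = a ; pathQ = p₁ ; pathR = path-reverse C₂ p₂
        ; unique = rearrange ($ (# 0) ⊕ $ (# 1) ⊕ $ (# 2) ⊕ $ (# 3)) ($ (# 0) ⊕ $ (# 2) ⊕ $ (# 1) ⊕ rev ($ (# 3)))
            ([ p ]′ Vec.∷ C₁ Vec.∷ [ q ]′ Vec.∷ C₂ Vec.∷ Vec.[]) _ C!
        ; PQ = λ { (_ , refl) → nj (inj₁ (here refl)) }
        ; PR = λ { (_ , e) → C₂≢[] (reverse-[] C₂ e) }
        ; QR = λ { (refl , _) → nj (inj₁ (here refl)) } })
        where
        C₂≢[] : C₂ ≢ []
        C₂≢[] refl = nj (inj₂ (subst (_ ∈_) (sym (steps-++ p C₁ q [] p)) (∈-++⁺ʳ (steps p C₁ q) (here refl))))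
      cycle-ear {p} {C} (path , C! , len) {q} a nj | no q∉ with explore no-leaf C! (here refl) {q} (λ { (here refl) → irreflexive a refl ; (there m) → q∉ m }) a
      ... | loop S t D pS pD len′ u! = inj₂ (dumbbell p C S t D path pS pD
          (rearrange ($ (# 0) ⊕ ($ (# 1) ⊕ ($ (# 2) ⊕ $ (# 3) ⊕ $ (# 4)))) ($ (# 0) ⊕ $ (# 3) ⊕ $ (# 1) ⊕ $ (# 2) ⊕ $ (# 4))
            ([ p ]′ Vec.∷ C Vec.∷ S Vec.∷ [ t ]′ Vec.∷ D Vec.∷ Vec.[]) _ u!) len len′)
      ... | hit ws .p pw (here refl) ne long u! = inj₂ (figure-eight p C ws path pw u! len (long refl))
      ... | hit ws z pw (there z∈) ne long u! with ∈-∃++ z∈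
      ...   | C₁ , C₂ , refl with path-split C₁ path
      ...     | p₁ , p₂ = inj₁ (p , z , ws , C₁ , reverse C₂ , record
        { pathP = pw ; pathQ = p₁ ; pathR = path-reverse C₂ p₂
        ; unique = rearrange ($ (# 0) ⊕ ($ (# 1) ⊕ $ (# 2) ⊕ $ (# 3)) ⊕ $ (# 4)) ($ (# 0) ⊕ $ (# 2) ⊕ $ (# 4) ⊕ $ (# 1) ⊕ rev ($ (# 3)))
            ([ p ]′ Vec.∷ C₁ Vec.∷ [ z ]′ Vec.∷ C₂ Vec.∷ ws Vec.∷ Vec.[]) _ u!
        ; PQ = λ { (e , _) → ne e }
        ; PR = λ { (e , _) → ne e }
        ; QR = λ { (e , f) → short e (reverse-[] C₂ f) len } })

    θ-vertices : V → V → List V → List V → List V → List V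
    θ-vertices u v P Q R = u ∷ v ∷ P ++ Q ++ R

    θ-steps : V → V → List V → List V → List V → List (V × V)
    θ-steps u v P Q R = steps u P v ++ steps u Q v ++ steps u R v

    data Site (u v : V) (P Q R : List V) (p : V) : Set where
      at-u : p ≡ u → Site u v P Q R p
      at-v : p ≡ v → Site u v P Q R p
      in-P : p ∈ P → Site u v P Q R p
      in-Q : p ∈ Q → Site u v P Q R p
      in-R : p ∈ R → Site u v P Q R p

    site : ∀ {u v} P Q {R p} → p ∈ θ-vertices u v P Q R → Site u v P Q R p
    site P Q (here e) = at-u e
    site P Q (there (here e)) = at-v e
    site P Q (there (there m)) with ∈-++⁻ P m
    ... | inj₁ m′ = in-P m′
    ... | inj₂ m′ with ∈-++⁻ Q m′
    ...   | inj₁ m″ = in-Q m″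
    ...   | inj₂ m″ = in-R m″

    ∈-reverse : ∀ {p : V} {P} → p ∈ P → p ∈ reverse P
    ∈-reverse {p} {P} m = ∈-resp (↭-sym (↭-reverse P)) m
      where open import Data.List.Relation.Binary.Permutation.Propositional.Properties using () renaming (∈-resp-↭ to ∈-resp)

    site-PQ : ∀ {u v P Q R p} → Site u v P Q R p → Site u v Q P R p
    site-PQ (at-u e) = at-u e
    site-PQ (at-v e) = at-v e
    site-PQ (in-P m) = in-Q m
    site-PQ (in-Q m) = in-P m
    site-PQ (in-R m) = in-R m

    site-PR : ∀ {u v P Q R p} → Site u v P Q R p → Site u v R Q P p
    site-PR (at-u e) = at-u e
    site-PR (at-v e) = at-v e
    site-PR (in-P m) = in-R m
    site-PR (in-Q m) = in-Q m
    site-PR (in-R m) = in-P m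

    site-flip : ∀ {u v P Q R p} → Site u v P Q R p → Site v u (reverse P) (reverse Q) (reverse R) p
    site-flip (at-u e) = at-v e
    site-flip (at-v e) = at-u e
    site-flip (in-P m) = in-P (∈-reverse m)
    site-flip (in-Q m) = in-Q (∈-reverse m)
    site-flip (in-R m) = in-R (∈-reverse m)

    -- The ear may be a single edge, and only then could it already belong to the theta.
    record Ear (u v : V) (P Q R : List V) (p : V) (W : List V) (z : V) : Set where
      field
        path   : Path p W z
        unique : Unique (u ∷ v ∷ P ++ Q ++ R ++ W)
        newP   : W ≡ [] → ¬ Joined (steps u P v) p z
        newQ   : W ≡ [] → ¬ Joined (steps u Q v) p z
        newR   : W ≡ [] → ¬ Joined (steps u R v) p z

    swap-joined : ∀ {l a b} → Joined l a b → Joined l b a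
    swap-joined (inj₁ m) = inj₂ m
    swap-joined (inj₂ m) = inj₁ m

    module _ {u v : V} {P Q R : List V} {p : V} {W : List V} {z : V} where

      ear-PQ : Ear u v P Q R p W z → Ear u v Q P R p W z
      ear-PQ e = record
        { path = path ; newP = newQ ; newQ = newP ; newR = newR
        ; unique = rearrange ($ (# 0) ⊕ $ (# 1) ⊕ $ (# 2) ⊕ $ (# 3) ⊕ $ (# 4) ⊕ $ (# 5)) ($ (# 0) ⊕ $ (# 1) ⊕ $ (# 3) ⊕ $ (# 2) ⊕ $ (# 4) ⊕ $ (# 5))
            ([ u ]′ Vec.∷ [ v ]′ Vec.∷ P Vec.∷ Q Vec.∷ R Vec.∷ W Vec.∷ Vec.[]) _ unique }
        where open Ear e

      ear-PR : Ear u v P Q R p W z → Ear u v R Q P p W z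
      ear-PR e = record
        { path = path ; newP = newR ; newQ = newQ ; newR = newP
        ; unique = rearrange ($ (# 0) ⊕ $ (# 1) ⊕ $ (# 2) ⊕ $ (# 3) ⊕ $ (# 4) ⊕ $ (# 5)) ($ (# 0) ⊕ $ (# 1) ⊕ $ (# 4) ⊕ $ (# 3) ⊕ $ (# 2) ⊕ $ (# 5))
            ([ u ]′ Vec.∷ [ v ]′ Vec.∷ P Vec.∷ Q Vec.∷ R Vec.∷ W Vec.∷ Vec.[]) _ unique }
        where open Ear e

      ear-flip : Ear u v P Q R p W z → Ear v u (reverse P) (reverse Q) (reverse R) p W z
      ear-flip e = record
        { path = path ; newP = λ w → newP w ∘ joined ; newQ = λ w → newQ w ∘ joined ; newR = λ w → newR w ∘ joined
        ; unique = rearrange ($ (# 0) ⊕ $ (# 1) ⊕ $ (# 2) ⊕ $ (# 3) ⊕ $ (# 4) ⊕ $ (# 5)) ($ (# 1) ⊕ $ (# 0) ⊕ rev ($ (# 2)) ⊕ rev ($ (# 3)) ⊕ rev ($ (# 4)) ⊕ $ (# 5))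
            ([ u ]′ Vec.∷ [ v ]′ Vec.∷ P Vec.∷ Q Vec.∷ R Vec.∷ W Vec.∷ Vec.[]) _ unique }
        where
        open Ear e
        joined : ∀ {X} → Joined (steps v (reverse X) u) p z → Joined (steps u X v) p z
        joined {X} (inj₁ m) = inj₂ (steps-reverse X m)
        joined {X} (inj₂ m) = inj₁ (steps-reverse X m)

      ear-reverse : Ear u v P Q R p W z → Ear u v P Q R z (reverse W) p
      ear-reverse e = record
        { path = path-reverse W path
        ; newP = λ w → newP (reverse-[] W w) ∘ swap-joined ; newQ = λ w → newQ (reverse-[] W w) ∘ swap-joined ; newR = λ w → newR (reverse-[] W w) ∘ swap-joined
        ; unique = rearrange ($ (# 0) ⊕ $ (# 1) ⊕ $ (# 2) ⊕ $ (# 3) ⊕ $ (# 4) ⊕ $ (# 5)) ($ (# 0) ⊕ $ (# 1) ⊕ $ (# 2) ⊕ $ (# 3) ⊕ $ (# 4) ⊕ rev ($ (# 5)))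
            ([ u ]′ Vec.∷ [ v ]′ Vec.∷ P Vec.∷ Q Vec.∷ R Vec.∷ W Vec.∷ Vec.[]) _ unique }
        where open Ear e

    chord-in : ∀ x us {a} vs y {b} ws → (a , b) ∈ steps a vs b → (a , b) ∈ steps x (us ++ a ∷ vs ++ b ∷ ws) y
    chord-in x us {a} vs y {b} ws m = subst (_ ∈_) (sym (trans (steps-++ x us a (vs ++ b ∷ ws) y) (cong (steps x us a ++_) (steps-++ a vs b ws y))))
      (∈-++⁺ʳ (steps x us a) (∈-++⁺ˡ m))

    -- At most one of the four paths is direct. It is moved to the front, the only place where
    -- `quadruple` admits a direct path.
    ear-u-v : ∀ {u v P Q R W} → Theta u v P Q R → Ear u v P Q R u W v → Config
    ear-u-v {u} {v} {P} {Q} {R} {W} θ e = by W P Q R refl refl refl refl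
      where
      open Theta θ
      open Ear e renaming (path to pathW; unique to unique′)
      ρ = [ u ]′ Vec.∷ [ v ]′ Vec.∷ P Vec.∷ Q Vec.∷ R Vec.∷ W Vec.∷ Vec.[]
      direct : ∀ {X} → W ≡ [] → (W ≡ [] → ¬ Joined (steps u X v) u v) → X ≢ []
      direct w new refl = new w (inj₁ (here refl))
      by : ∀ W′ P′ Q′ R′ → W ≡ W′ → P ≡ P′ → Q ≡ Q′ → R ≡ R′ → Config
      by [] _ _ _ w _ _ _ = quadruple u v W P Q R pathW pathP pathQ pathR
        (rearrange ($ (# 0) ⊕ $ (# 1) ⊕ $ (# 2) ⊕ $ (# 3) ⊕ $ (# 4) ⊕ $ (# 5)) ($ (# 0) ⊕ $ (# 1) ⊕ $ (# 5) ⊕ $ (# 2) ⊕ $ (# 3) ⊕ $ (# 4)) ρ _ unique′)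
        (direct {P} w newP) (direct {Q} w newQ) (direct {R} w newR)
      by (_ ∷ _) _ [] _ w _ q _ = quadruple u v Q P R W pathQ pathP pathR pathW
        (rearrange ($ (# 0) ⊕ $ (# 1) ⊕ $ (# 2) ⊕ $ (# 3) ⊕ $ (# 4) ⊕ $ (# 5)) ($ (# 0) ⊕ $ (# 1) ⊕ $ (# 3) ⊕ $ (# 2) ⊕ $ (# 4) ⊕ $ (# 5)) ρ _ unique′)
        (λ x → PQ (x , q)) (λ x → QR (q , x)) (λ x → ++∷≢[] [] (trans (sym w) x))
      by (_ ∷ _) _ (_ ∷ _) [] w _ q r = quadruple u v R P Q W pathR pathP pathQ pathW
        (rearrange ($ (# 0) ⊕ $ (# 1) ⊕ $ (# 2) ⊕ $ (# 3) ⊕ $ (# 4) ⊕ $ (# 5)) ($ (# 0) ⊕ $ (# 1) ⊕ $ (# 4) ⊕ $ (# 2) ⊕ $ (# 3) ⊕ $ (# 5)) ρ _ unique′)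
        (λ x → PR (x , r)) (λ x → QR (x , r)) (λ x → ++∷≢[] [] (trans (sym w) x))
      by (_ ∷ _) _ (_ ∷ _) (_ ∷ _) w _ q r = quadruple u v P Q R W pathP pathQ pathR pathW unique′
        (λ x → ++∷≢[] [] (trans (sym q) x)) (λ x → ++∷≢[] [] (trans (sym r) x)) (λ x → ++∷≢[] [] (trans (sym w) x))

    θ-cycle : ∀ {u v P Q R} → Theta u v P Q R → Path u (Q ++ v ∷ reverse R) u × 2 ≤ length (Q ++ v ∷ reverse R)
    θ-cycle {u} {v} {P} {Q} {R} θ = path-++ Q pathQ (path-reverse R pathR) , length-∷-both Q (reverse R) (both-reverse Q R QR)
      where open Theta θ

    -- The part of P up to z and the ear form one cycle, Q and R another; they share only u.
    ear-u-P : ∀ {u v} P₁ {z} P₂ {Q R W} → Theta u v (P₁ ++ z ∷ P₂) Q R → Ear u v (P₁ ++ z ∷ P₂) Q R u W z → Config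
    ear-u-P {u} {v} P₁ {z} P₂ {Q} {R} {W} θ e =
      figure-eight u (P₁ ++ z ∷ reverse W) (Q ++ v ∷ reverse R)
        (path-++ P₁ (proj₁ (path-split P₁ pathP)) (path-reverse W pathW)) (proj₁ (θ-cycle θ))
        (unique-prefix (u ∷ (P₁ ++ z ∷ reverse W) ++ Q ++ v ∷ reverse R) {P₂}
          (rearrange ($ (# 0) ⊕ $ (# 1) ⊕ ($ (# 2) ⊕ $ (# 3) ⊕ $ (# 4)) ⊕ $ (# 5) ⊕ $ (# 6) ⊕ $ (# 7))
            (($ (# 0) ⊕ ($ (# 2) ⊕ $ (# 3) ⊕ rev ($ (# 7))) ⊕ ($ (# 5) ⊕ $ (# 1) ⊕ rev ($ (# 6)))) ⊕ $ (# 4))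
            ([ u ]′ Vec.∷ [ v ]′ Vec.∷ P₁ Vec.∷ [ z ]′ Vec.∷ P₂ Vec.∷ Q Vec.∷ R Vec.∷ W Vec.∷ Vec.[]) _ unique′))
        (length-∷-both P₁ (reverse W) (both-reverse P₁ W λ { (refl , w) → newP w (inj₁ (here refl)) })) (proj₂ (θ-cycle θ))
      where
      open Theta θ
      open Ear e renaming (path to pathW; unique to unique′)

    -- The ear and the part of P between its ends form a cycle, joined by the part of P before it to
    -- the cycle of Q and R at u.
    ear-P-P : ∀ {u v} P₁ {p} P₂ {z} P₃ {Q R W} → Theta u v (P₁ ++ p ∷ P₂ ++ z ∷ P₃) Q R → Ear u v (P₁ ++ p ∷ P₂ ++ z ∷ P₃) Q R p W z → Config
    ear-P-P {u} {v} P₁ {p} P₂ {z} P₃ {Q} {R} {W} θ e =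
      dumbbell p (P₂ ++ z ∷ reverse W) (reverse P₁) u (Q ++ v ∷ reverse R)
        (path-++ P₂ (proj₁ (path-split P₂ (proj₂ (path-split P₁ pathP)))) (path-reverse W pathW))
        (path-reverse P₁ (proj₁ (path-split P₁ pathP))) (proj₁ (θ-cycle θ))
        (unique-prefix (p ∷ u ∷ (P₂ ++ z ∷ reverse W) ++ reverse P₁ ++ Q ++ v ∷ reverse R) {P₃}
          (rearrange ($ (# 0) ⊕ $ (# 1) ⊕ ($ (# 2) ⊕ $ (# 3) ⊕ $ (# 4) ⊕ $ (# 5) ⊕ $ (# 6)) ⊕ $ (# 7) ⊕ $ (# 8) ⊕ $ (# 9))
            (($ (# 3) ⊕ $ (# 0) ⊕ ($ (# 4) ⊕ $ (# 5) ⊕ rev ($ (# 9))) ⊕ rev ($ (# 2)) ⊕ ($ (# 7) ⊕ $ (# 1) ⊕ rev ($ (# 8)))) ⊕ $ (# 6))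
            ([ u ]′ Vec.∷ [ v ]′ Vec.∷ P₁ Vec.∷ [ p ]′ Vec.∷ P₂ Vec.∷ [ z ]′ Vec.∷ P₃ Vec.∷ Q Vec.∷ R Vec.∷ W Vec.∷ Vec.[]) _ unique′))
        (length-∷-both P₂ (reverse W) (both-reverse P₂ W λ { (refl , w) → newP w (inj₁ (chord-in u P₁ [] v P₃ (here refl))) })) (proj₂ (θ-cycle θ))
      where
      open Theta θ
      open Ear e renaming (path to pathW; unique to unique′)

    -- The ear becomes the edge of K₄ opposite to R; the other four edges are the pieces of P and Q.
    ear-P-Q : ∀ {u v} P₁ {p} P₂ Q₁ {z} Q₂ {R W} → Theta u v (P₁ ++ p ∷ P₂) (Q₁ ++ z ∷ Q₂) R →
      Ear u v (P₁ ++ p ∷ P₂) (Q₁ ++ z ∷ Q₂) R p W z → Config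
    ear-P-Q {u} {v} P₁ {p} P₂ Q₁ {z} Q₂ {R} {W} θ e =
      tetrahedron u v p z R W P₁ P₂ (reverse Q₂) (reverse Q₁) pathR pathW (proj₁ p±) (proj₂ p±)
        (path-reverse Q₂ (proj₂ q±)) (path-reverse Q₁ (proj₁ q±))
        (rearrange ($ (# 0) ⊕ $ (# 1) ⊕ ($ (# 2) ⊕ $ (# 3) ⊕ $ (# 4)) ⊕ ($ (# 5) ⊕ $ (# 6) ⊕ $ (# 7)) ⊕ $ (# 8) ⊕ $ (# 9))
          ($ (# 0) ⊕ $ (# 1) ⊕ $ (# 3) ⊕ $ (# 6) ⊕ $ (# 8) ⊕ $ (# 9) ⊕ $ (# 2) ⊕ $ (# 4) ⊕ rev ($ (# 7)) ⊕ rev ($ (# 5)))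
          ([ u ]′ Vec.∷ [ v ]′ Vec.∷ P₁ Vec.∷ [ p ]′ Vec.∷ P₂ Vec.∷ Q₁ Vec.∷ [ z ]′ Vec.∷ Q₂ Vec.∷ R Vec.∷ W Vec.∷ Vec.[]) _ unique′)
      where
      open Theta θ
      open Ear e renaming (path to pathW; unique to unique′)
      p± = path-split P₁ pathP
      q± = path-split Q₁ pathQ

    ear-from-u : ∀ {u v P Q R W z} → Theta u v P Q R → Ear u v P Q R u W z → u ≢ z → Site u v P Q R z → Config
    ear-from-u θ e u≢z (at-u refl) = ⊥-elim (u≢z refl)
    ear-from-u θ e u≢z (at-v refl) = ear-u-v θ e
    ear-from-u θ e u≢z (in-P m) with ∈-∃++ m
    ... | P₁ , P₂ , refl = ear-u-P P₁ P₂ θ e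
    ear-from-u θ e u≢z (in-Q m) with ∈-∃++ m
    ... | Q₁ , Q₂ , refl = ear-u-P Q₁ Q₂ (swap-PQ θ) (ear-PQ e)
    ear-from-u θ e u≢z (in-R m) with ∈-∃++ m
    ... | R₁ , R₂ , refl = ear-u-P R₁ R₂ (swap-PR θ) (ear-PR e)

    ear-from-v : ∀ {u v P Q R W z} → Theta u v P Q R → Ear u v P Q R v W z → v ≢ z → Site u v P Q R z → Config
    ear-from-v θ e v≢z s = ear-from-u (flip-θ θ) (ear-flip e) v≢z (site-flip s)

    ear-from-P : ∀ {u v P Q R p W z} → Theta u v P Q R → Ear u v P Q R p W z → p ≢ z → p ∈ P → Site u v P Q R z → Config
    ear-from-P θ e p≢z p∈ (at-u refl) = ear-from-u θ (ear-reverse e) (p≢z ∘ sym) (in-P p∈)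
    ear-from-P θ e p≢z p∈ (at-v refl) = ear-from-v θ (ear-reverse e) (p≢z ∘ sym) (in-P p∈)
    ear-from-P θ e p≢z p∈ (in-P z∈) with ∈-∃++ p∈
    ... | P₁ , P₂ , refl with ∈-++⁻ P₁ z∈
    ...   | inj₂ (here refl) = ⊥-elim (p≢z refl)
    ...   | inj₂ (there m) with ∈-∃++ m
    ...     | P₂′ , P₃ , refl = ear-P-P P₁ P₂′ P₃ θ e
    ear-from-P {u} {v} {Q = Q} {R} {p} {W} {z} θ e p≢z p∈ (in-P z∈) | P₁ , P₂ , refl | inj₁ m with ∈-∃++ m
    ... | P₀ , P₁′ , refl = ear-P-P P₀ P₁′ P₂
        (subst (λ P → Theta u v P Q R) (++-assoc P₀ (z ∷ P₁′) (p ∷ P₂)) θ)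
        (subst (λ P → Ear u v P Q R z (reverse W) p) (++-assoc P₀ (z ∷ P₁′) (p ∷ P₂)) (ear-reverse e))
    ear-from-P θ e p≢z p∈ (in-Q z∈) with ∈-∃++ p∈ | ∈-∃++ z∈
    ... | P₁ , P₂ , refl | Q₁ , Q₂ , refl = ear-P-Q P₁ P₂ Q₁ Q₂ θ e
    ear-from-P θ e p≢z p∈ (in-R z∈) with ∈-∃++ p∈ | ∈-∃++ z∈
    ... | P₁ , P₂ , refl | R₁ , R₂ , refl =
      ear-P-Q P₁ P₂ R₁ R₂ (swap-PQ (swap-PR (swap-PQ θ))) (ear-PQ (ear-PR (ear-PQ e)))

    ear-config : ∀ {u v P Q R p W z} → Theta u v P Q R → Ear u v P Q R p W z → p ≢ z → Site u v P Q R p → Site u v P Q R z → Config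
    ear-config θ e p≢z (at-u refl) s = ear-from-u θ e p≢z s
    ear-config θ e p≢z (at-v refl) s = ear-from-v θ e p≢z s
    ear-config θ e p≢z (in-P m) s = ear-from-P θ e p≢z m s
    ear-config θ e p≢z (in-Q m) s = ear-from-P (swap-PQ θ) (ear-PQ e) p≢z m (site-PQ s)
    ear-config θ e p≢z (in-R m) s = ear-from-P (swap-PR θ) (ear-PR e) p≢z m (site-PR s)

    -- Uniqueness is stated for an arbitrary continuation `W`, so that the cycle can be combined
    -- with any excursion from `Θ`.
    CycleThrough : V → List V → Set
    CycleThrough p Θ = ∃[ C ] (Path p C p × 2 ≤ length C × (∀ W → Unique (Θ ++ W) → Unique (p ∷ C ++ W)))

    cycle-at-u : ∀ {u v P Q R} → Theta u v P Q R → CycleThrough u (θ-vertices u v P Q R)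
    cycle-at-u {u} {v} {P} {Q} {R} θ = Q ++ v ∷ reverse R , proj₁ (θ-cycle θ) , proj₂ (θ-cycle θ) , λ W u! →
      unique-prefix (u ∷ (Q ++ v ∷ reverse R) ++ W) {P}
        (rearrange (($ (# 0) ⊕ $ (# 1) ⊕ $ (# 2) ⊕ $ (# 3) ⊕ $ (# 4)) ⊕ $ (# 5)) (($ (# 0) ⊕ ($ (# 3) ⊕ $ (# 1) ⊕ rev ($ (# 4))) ⊕ $ (# 5)) ⊕ $ (# 2))
          ([ u ]′ Vec.∷ [ v ]′ Vec.∷ P Vec.∷ Q Vec.∷ R Vec.∷ W Vec.∷ Vec.[]) _ u!)

    cycle-in-P : ∀ {u v} P₁ {p} P₂ {Q R} → Theta u v (P₁ ++ p ∷ P₂) Q R → CycleThrough p (θ-vertices u v (P₁ ++ p ∷ P₂) Q R)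
    cycle-in-P {u} {v} P₁ {p} P₂ {Q} {R} θ =
      P₂ ++ v ∷ reverse Q ++ u ∷ P₁ , path-++ P₂ (proj₂ p±) (path-++ (reverse Q) (path-reverse Q pathQ) (proj₁ p±)) ,
      length-∷-both P₂ (reverse Q ++ u ∷ P₁) (λ { (_ , e) → ++∷≢[] (reverse Q) e }) , λ W u! →
      unique-prefix (p ∷ (P₂ ++ v ∷ reverse Q ++ u ∷ P₁) ++ W) {R}
        (rearrange (($ (# 0) ⊕ $ (# 1) ⊕ ($ (# 2) ⊕ $ (# 3) ⊕ $ (# 4)) ⊕ $ (# 5) ⊕ $ (# 6)) ⊕ $ (# 7))
          (($ (# 3) ⊕ ($ (# 4) ⊕ $ (# 1) ⊕ rev ($ (# 5)) ⊕ $ (# 0) ⊕ $ (# 2)) ⊕ $ (# 7)) ⊕ $ (# 6))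
          ([ u ]′ Vec.∷ [ v ]′ Vec.∷ P₁ Vec.∷ [ p ]′ Vec.∷ P₂ Vec.∷ Q Vec.∷ R Vec.∷ W Vec.∷ Vec.[]) _ u!)
      where
      open Theta θ
      p± = path-split P₁ pathP

    through-resp : ∀ {p Θ Θ′} → (∀ W → Unique (Θ′ ++ W) → Unique (Θ ++ W)) → CycleThrough p Θ → CycleThrough p Θ′
    through-resp f (C , path , len , u!) = C , path , len , λ W w! → u! W (f W w!)

    cycle-through : ∀ {u v P Q R p} → Theta u v P Q R → Site u v P Q R p → CycleThrough p (θ-vertices u v P Q R)
    cycle-through θ (at-u refl) = cycle-at-u θ
    cycle-through {u} {v} {P} {Q} {R} θ (at-v refl) = through-resp
      (λ W → rearrange (($ (# 0) ⊕ $ (# 1) ⊕ $ (# 2) ⊕ $ (# 3) ⊕ $ (# 4)) ⊕ $ (# 5)) (($ (# 1) ⊕ $ (# 0) ⊕ rev ($ (# 2)) ⊕ rev ($ (# 3)) ⊕ rev ($ (# 4))) ⊕ $ (# 5))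
        ([ u ]′ Vec.∷ [ v ]′ Vec.∷ P Vec.∷ Q Vec.∷ R Vec.∷ W Vec.∷ Vec.[]) _) (cycle-at-u (flip-θ θ))
    cycle-through θ (in-P m) with ∈-∃++ m
    ... | P₁ , P₂ , refl = cycle-in-P P₁ P₂ θ
    cycle-through {u} {v} {P} {_} {R} θ (in-Q m) with ∈-∃++ m
    ... | Q₁ , Q₂ , refl = through-resp
      (λ W → rearrange (($ (# 0) ⊕ $ (# 1) ⊕ $ (# 2) ⊕ $ (# 3) ⊕ $ (# 4)) ⊕ $ (# 5)) (($ (# 0) ⊕ $ (# 1) ⊕ $ (# 3) ⊕ $ (# 2) ⊕ $ (# 4)) ⊕ $ (# 5))
        ([ u ]′ Vec.∷ [ v ]′ Vec.∷ P Vec.∷ (Q₁ ++ _ ∷ Q₂) Vec.∷ R Vec.∷ W Vec.∷ Vec.[]) _) (cycle-in-P Q₁ Q₂ (swap-PQ θ))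
    cycle-through {u} {v} {P} {Q} {_} θ (in-R m) with ∈-∃++ m
    ... | R₁ , R₂ , refl = through-resp
      (λ W → rearrange (($ (# 0) ⊕ $ (# 1) ⊕ $ (# 2) ⊕ $ (# 3) ⊕ $ (# 4)) ⊕ $ (# 5)) (($ (# 0) ⊕ $ (# 1) ⊕ $ (# 4) ⊕ $ (# 3) ⊕ $ (# 2)) ⊕ $ (# 5))
        ([ u ]′ Vec.∷ [ v ]′ Vec.∷ P Vec.∷ Q Vec.∷ (R₁ ++ _ ∷ R₂) Vec.∷ W Vec.∷ Vec.[]) _) (cycle-in-P R₁ R₂ (swap-PR θ))

    -- Such a part has no further edges and can be removed without touching the rest of the graph.
    Closed : List V → List (V × V) → Set
    Closed vs es = ∀ {x y} → x ∈ vs → A x y ≡ true → Joined es x y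

    module _ (no-leaf : NoLeaf) where

      -- As for cycles, with `cycle-through` supplying the first cycle of a dumbbell or figure
      -- eight. If the ear has distinct ends on the theta, their places decide which configuration
      -- arises.
      θ-ear : ∀ {u v P Q R} → Theta u v P Q R → ∀ {p q} → p ∈ θ-vertices u v P Q R → A p q ≡ true →
        ¬ Joined (θ-steps u v P Q R) p q → Config
      θ-ear {u} {v} {P} {Q} {R} θ {p} {q} p∈ a nj with q ∈? θ-vertices u v P Q R
      ... | yes q∈ = ear-config θ (record
          { path = a
          ; unique = subst (λ R → Unique (u ∷ v ∷ P ++ Q ++ R)) (sym (++-identityʳ R)) (Theta.unique θ)
          ; newP = λ _ → nj ∘ inP ; newQ = λ _ → nj ∘ inQ ; newR = λ _ → nj ∘ inR })
        (irreflexive a) (site P Q p∈) (site P Q q∈)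
        where
        inP : Joined (steps u P v) p q → Joined (θ-steps u v P Q R) p q
        inP (inj₁ m) = inj₁ (∈-++⁺ˡ m)
        inP (inj₂ m) = inj₂ (∈-++⁺ˡ m)
        inQ : Joined (steps u Q v) p q → Joined (θ-steps u v P Q R) p q
        inQ (inj₁ m) = inj₁ (∈-++⁺ʳ (steps u P v) (∈-++⁺ˡ m))
        inQ (inj₂ m) = inj₂ (∈-++⁺ʳ (steps u P v) (∈-++⁺ˡ m))
        inR : Joined (steps u R v) p q → Joined (θ-steps u v P Q R) p q
        inR (inj₁ m) = inj₁ (∈-++⁺ʳ (steps u P v) (∈-++⁺ʳ (steps u Q v) m))
        inR (inj₂ m) = inj₂ (∈-++⁺ʳ (steps u P v) (∈-++⁺ʳ (steps u Q v) m))
      ... | no q∉ with explore no-leaf (Theta.unique θ) p∈ q∉ a | cycle-through θ (site P Q p∈)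
      ...   | loop S t D pS pD len u! | C , pC , lenC , C! = dumbbell p C S t D pC pS pD
          (rearrange ($ (# 0) ⊕ $ (# 1) ⊕ $ (# 2) ⊕ $ (# 3) ⊕ $ (# 4)) ($ (# 0) ⊕ $ (# 3) ⊕ $ (# 1) ⊕ $ (# 2) ⊕ $ (# 4))
            ([ p ]′ Vec.∷ C Vec.∷ S Vec.∷ [ t ]′ Vec.∷ D Vec.∷ Vec.[]) _ (C! (S ++ t ∷ D) u!)) lenC len
      ...   | hit W z pW z∈ ne long u! | C , pC , lenC , C! with p Finₚ.≟ z
      ...     | yes refl = figure-eight p C W pC pW (C! W u!) lenC (long refl)
      ...     | no p≢z = ear-config θ (record
          { path = pW
          ; unique = rearrange (($ (# 0) ⊕ $ (# 1) ⊕ $ (# 2) ⊕ $ (# 3) ⊕ $ (# 4)) ⊕ $ (# 5)) ($ (# 0) ⊕ $ (# 1) ⊕ $ (# 2) ⊕ $ (# 3) ⊕ $ (# 4) ⊕ $ (# 5))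
              ([ u ]′ Vec.∷ [ v ]′ Vec.∷ P Vec.∷ Q Vec.∷ R Vec.∷ W Vec.∷ Vec.[]) _ u!
          ; newP = λ w _ → ne w ; newQ = λ w _ → ne w ; newR = λ w _ → ne w })
        p≢z (site P Q p∈) (site P Q z∈)

      data Shape : Set where
        closed-cycle : ∀ v C → Cycle v C → Closed (v ∷ C) (steps v C v) → Shape
        closed-theta : ∀ u v P Q R → Theta u v P Q R → Closed (θ-vertices u v P Q R) (θ-steps u v P Q R) → Shape
        config       : Config → Shape

      private
        closed? : ∀ vs es → Closed vs es ⊎ (∃[ p ] ∃[ q ] (p ∈ vs × A p q ≡ true × ¬ Joined es p q))
        closed? vs es with Finₚ.any? (λ p → Finₚ.any? λ q → (p ∈? vs) ×-dec ((A p q Bool.≟ true) ×-dec ¬? (joined? es p q)))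
        ... | yes (p , q , found) = inj₂ (p , q , found)
        ... | no none = inj₁ closed
          where
          closed : Closed vs es
          closed {x} {y} x∈ a with joined? es x y
          ... | yes j = j
          ... | no nj = ⊥-elim (none (x , y , x∈ , a , nj))

        from-theta : SomeTheta → Shape
        from-theta (u , v , P , Q , R , θ) with closed? (θ-vertices u v P Q R) (θ-steps u v P Q R)
        ... | inj₁ closed = closed-theta u v P Q R θ closed
        ... | inj₂ (p , q , p∈ , a , nj) = config (θ-ear θ p∈ a nj)

        from-cycle : ∀ {v C} → Cycle v C → Shape
        from-cycle {v} {C} c with closed? (v ∷ C) (steps v C v)
        ... | inj₁ closed = closed-cycle v C c closed
        ... | inj₂ (p , q , p∈ , a , nj) with rotate c p∈
        ...   | D , d , joined , _ with cycle-ear no-leaf d a (nj ∘ joined)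
        ...     | inj₁ θ = from-theta θ
        ...     | inj₂ cf = config cf

      -- From a single vertex the excursion can only find a cycle. Any extra edge enlarges the cycle
      -- to a theta or yields a configuration, and any extra edge at a theta yields one.
      shape : ∀ {x y} → A x y ≡ true → Shape
      shape {x} {y} a with explore no-leaf {x ∷ []} ([] ∷ []) (here refl) {y} (λ { (here refl) → irreflexive a refl }) a
      ... | hit ws .x p (here refl) _ long u! = from-cycle (p , u! , long refl)
      ... | loop S t C _ p len u! = from-cycle (p , unique-suffix S (unique-suffix (x ∷ []) u!) , len)

-- Bad lists of size 2 along subdivided graphs.

module ListSchemes where

  open Configurations
  open Conflicts using (edge-between; edge-between-ends; adjacent₁₂)
  open import Data.Fin using (toℕ)
  open import Data.List using ([]; _∷_)
  open import Data.List.Relation.Unary.All as All using (All; []; _∷_)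
  open import Data.List.Relation.Unary.AllPairs as AllPairs using (AllPairs; []; _∷_)
  open import Data.Nat using (ℕ; suc; _+_; _*_; _⊔_; _≤_; _<_; z≤n; s≤s)

  open DecMembership ℕₚ._≟_ using (_∈?_)

  -- Turns lists into an edge colouring. Bad lists for adapted colourings are arranged so that the
  -- colour in conflict is the largest common one.
  max-common : List ℕ → List ℕ → ℕ
  max-common [] m = 0
  max-common (c ∷ l) m with c ∈? m
  ... | yes _ = c ⊔ max-common l m
  ... | no _  = max-common l m

  max-common-≥ : ∀ l {m d} → d ∈ l → d ∈ m → d ≤ max-common l m
  max-common-≥ (c ∷ l) {m} d∈ d∈m with c ∈? m
  max-common-≥ (c ∷ l) (here refl) d∈m | yes _ = ℕₚ.m≤m⊔n c _
  max-common-≥ (c ∷ l) (there d∈) d∈m | yes _ = ℕₚ.≤-trans (max-common-≥ l d∈ d∈m) (ℕₚ.m≤n⊔m c _)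
  max-common-≥ (c ∷ l) (here refl) d∈m | no c∉ = ⊥-elim (c∉ d∈m)
  max-common-≥ (c ∷ l) (there d∈) d∈m | no _ = max-common-≥ l d∈ d∈m

  max-common-≤ : ∀ l {m d} → (∀ {c} → c ∈ l → c ∈ m → c ≤ d) → max-common l m ≤ d
  max-common-≤ [] h = z≤n
  max-common-≤ (c ∷ l) {m} h with c ∈? m
  ... | yes c∈ = ℕₚ.⊔-lub (h (here refl) c∈) (max-common-≤ l (h ∘ there))
  ... | no _ = max-common-≤ l (h ∘ there)

  Pair : Set
  Pair = ℕ × ℕ

  -- Two sets of size 2 share at most one element exactly when they are different sets, so
  -- separation comes down to this.
  Diff : Pair → Pair → Set
  Diff (s , t) (s′ , t′) = ¬ ((s ≡ s′ × t ≡ t′) ⊎ (s ≡ t′ × t ≡ s′))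

  Diff-sym : ∀ {p q} → Diff p q → Diff q p
  Diff-sym d (inj₁ (refl , refl)) = d (inj₁ (refl , refl))
  Diff-sym d (inj₂ (refl , refl)) = d (inj₂ (refl , refl))

  Below : ℕ → Pair → Set
  Below b (s , t) = s < b × t < b

  Reaches : ℕ → Pair → Set
  Reaches b (s , t) = b ≤ s ⊎ b ≤ t

  -- Colours are handed out in increasing order; a list with a colour not yet in use when the other
  -- was made cannot equal it.
  diff-by-bound : ∀ {b p q} → Below b p → Reaches b q → Diff p q
  diff-by-bound (s< , t<) (inj₁ b≤) (inj₁ (refl , refl)) = ℕₚ.<⇒≱ s< b≤
  diff-by-bound (s< , t<) (inj₂ b≤) (inj₁ (refl , refl)) = ℕₚ.<⇒≱ t< b≤
  diff-by-bound (s< , t<) (inj₁ b≤) (inj₂ (refl , refl)) = ℕₚ.<⇒≱ t< b≤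
  diff-by-bound (s< , t<) (inj₂ b≤) (inj₂ (refl , refl)) = ℕₚ.<⇒≱ s< b≤

  colours : Pair → List ℕ
  colours (s , t) = s ∷ t ∷ []

  filter-pair : ∀ {P : ℕ → Set} (P? : ∀ x → Dec (P x)) s t → ¬ (P s × P t) → length (filter P? (s ∷ t ∷ [])) ≤ 1
  filter-pair P? s t not-both with P? s
  filter-pair P? s t not-both | no _ with P? t
  ... | yes _ = ℕₚ.≤-refl
  ... | no _ = z≤n
  filter-pair P? s t not-both | yes p with P? t
  ... | no _ = ℕₚ.≤-refl
  ... | yes q = ⊥-elim (not-both (p , q))

  ∩-diff : ∀ p q → proj₁ p ≢ proj₂ p → Diff p q → ∣ colours p ∩ colours q ∣ ≤ 1
  ∩-diff (s , t) (s′ , t′) s≢t d = filter-pair (_∈? (s′ ∷ t′ ∷ [])) s t λ (s∈ , t∈) → both s∈ t∈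
    where
    both : s ∈ s′ ∷ t′ ∷ [] → t ∈ s′ ∷ t′ ∷ [] → ⊥
    both (here e) (here f) = s≢t (trans e (sym f))
    both (here e) (there (here f)) = d (inj₁ (e , f))
    both (there (here e)) (here f) = d (inj₂ (e , f))
    both (there (here e)) (there (here f)) = s≢t (trans e (sym f))

  module Chains (V : Set) where

    Entry : Set
    Entry = V × Pair

    -- Lists along the inner vertices of a path, linking the colour α of its
    -- source to the colour γ of its target: consecutive vertices share one
    -- colour, and the colours n, n + 1, … are used nowhere else.
    assignment : ℕ → ℕ → List V → ℕ → List Entry
    assignment n α []            γ = []
    assignment n α (w ∷ [])      γ = (w , α , γ) ∷ []
    assignment n α (w ∷ w′ ∷ ws) γ = (w , α , n) ∷ assignment (suc n) n (w′ ∷ ws) γ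

    conflicts : ℕ → V → ℕ → List V → ℕ → V → List (V × V × ℕ)
    conflicts n x α []            γ y = (x , y , α) ∷ []
    conflicts n x α (w ∷ [])      γ y = (x , w , α) ∷ (w , y , γ) ∷ []
    conflicts n x α (w ∷ w′ ∷ ws) γ y = (x , w , α) ∷ conflicts (suc n) w n (w′ ∷ ws) γ y

    assignment-keys : ∀ n α ws γ → map proj₁ (assignment n α ws γ) ≡ ws
    assignment-keys n α [] γ = refl
    assignment-keys n α (w ∷ []) γ = refl
    assignment-keys n α (w ∷ w′ ∷ ws) γ = cong (w ∷_) (assignment-keys (suc n) n (w′ ∷ ws) γ)

    From : (V → ℕ) → Entry → Set
    From φ (w , s , t) = φ w ≡ s ⊎ φ w ≡ t

    Avoids : (V → ℕ) → V × V × ℕ → Set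
    Avoids φ (a , b , d) = ¬ (φ a ≡ d × φ b ≡ d)

    -- Each inner vertex is denied the colour it shares with its predecessor and must take the one
    -- shared with its successor; the last is left with γ, in conflict with `y`.
    chain : ∀ φ n x α ws γ y → (ws ≡ [] → α ≡ γ) →
      (∀ {e} → e ∈ assignment n α ws γ → From φ e) → (∀ {c} → c ∈ conflicts n x α ws γ y → Avoids φ c) →
      φ x ≡ α → φ y ≡ γ → ⊥
    chain φ n x α [] γ y direct from avoids p q = avoids (here refl) (p , trans q (sym (direct refl)))
    chain φ n x α (w ∷ []) γ y direct from avoids p q with from (here refl)
    ... | inj₁ e = avoids (here refl) (p , e)
    ... | inj₂ e = avoids (there (here refl)) (e , q)
    chain φ n x α (w ∷ w′ ∷ ws) γ y direct from avoids p q =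
      [ (λ e → avoids (here refl) (p , e)) , (λ e → chain φ (suc n) w n (w′ ∷ ws) γ y (λ ()) (from ∘ there) (avoids ∘ there) e q) ]′ (from (here refl))

    assignment-below : ∀ n α ws γ {m} → n + length ws ≤ suc m → α < m → γ < m →
      ∀ {e} → e ∈ assignment n α ws γ → Below m (proj₂ e)
    assignment-below n α (w ∷ []) γ le a g (here refl) = a , g
    assignment-below n α (w ∷ w′ ∷ ws) γ {m} le a g (here refl) = a , n<m
      where
      n<m : n < m
      n<m = ℕₚ.≤-pred (ℕₚ.≤-trans (ℕₚ.≤-trans (s≤s (s≤s (ℕₚ.m≤m+n n (length ws)))) (ℕₚ.≤-reflexive (sym (trans (ℕₚ.+-suc n (suc (length ws))) (cong suc (ℕₚ.+-suc n (length ws))))))) le)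
    assignment-below n α (w ∷ w′ ∷ ws) γ {m} le a g (there e∈) =
      assignment-below (suc n) n (w′ ∷ ws) γ (ℕₚ.≤-trans (ℕₚ.≤-reflexive (sym (ℕₚ.+-suc n (suc (length ws))))) le)
        (ℕₚ.≤-pred (ℕₚ.≤-trans (ℕₚ.≤-trans (s≤s (s≤s (ℕₚ.m≤m+n n (length ws)))) (ℕₚ.≤-reflexive (sym (trans (ℕₚ.+-suc n (suc (length ws))) (cong suc (ℕₚ.+-suc n (length ws))))))) le)) g e∈

    assignment-reaches : ∀ n s ws γ → s ≤ n → ∀ {e} → e ∈ assignment n s ws γ → Reaches s (proj₂ e)
    assignment-reaches n s (w ∷ []) γ le (here refl) = inj₁ ℕₚ.≤-refl
    assignment-reaches n s (w ∷ w′ ∷ ws) γ le (here refl) = inj₁ ℕₚ.≤-refl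
    assignment-reaches n s (w ∷ w′ ∷ ws) γ le (there e∈) =
      Sum.map (ℕₚ.≤-trans le) (ℕₚ.≤-trans le) (assignment-reaches (suc n) n (w′ ∷ ws) γ (ℕₚ.n≤1+n n) e∈)

    DiffE : Entry → Entry → Set
    DiffE e f = Diff (proj₂ e) (proj₂ f)

    -- Colours below 8 belong to the branch vertices and those from `n` on are fresh. Only a chain
    -- of two vertices, with lists {α, n} and {n, γ}, could repeat a list.
    assignment-diff : ∀ n α ws γ → α < n → γ < 8 → 8 ≤ n → (length ws ≡ 2 → α ≢ γ) → AllPairs DiffE (assignment n α ws γ)
    assignment-diff n α [] γ a g n≥ ne = []
    assignment-diff n α (w ∷ []) γ a g n≥ ne = [] ∷ []
    assignment-diff n α (w ∷ w′ ∷ ws) γ a g n≥ ne =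
      All.tabulate (λ e∈ → first ws ne e∈) ∷ assignment-diff (suc n) n (w′ ∷ ws) γ ℕₚ.≤-refl g (ℕₚ.m≤n⇒m≤1+n n≥) (λ _ e → ℕₚ.<⇒≢ (ℕₚ.≤-trans g n≥) (sym e))
      where
      first : ∀ ws → (suc (suc (length ws)) ≡ 2 → α ≢ γ) → ∀ {e} → e ∈ assignment (suc n) n (w′ ∷ ws) γ → Diff (α , n) (proj₂ e)
      first [] ne (here refl) (inj₁ (e , _)) = ℕₚ.<⇒≢ a e
      first [] ne (here refl) (inj₂ (e , _)) = ne refl e
      first (w″ ∷ ws) ne (here refl) = diff-by-bound {suc n} (ℕₚ.m≤n⇒m≤1+n a , ℕₚ.≤-refl) (inj₂ ℕₚ.≤-refl)
      first (w″ ∷ ws) ne (there e∈) = diff-by-bound {suc n} (ℕₚ.m≤n⇒m≤1+n a , ℕₚ.≤-refl) (assignment-reaches (suc (suc n)) (suc n) (w″ ∷ ws) γ (ℕₚ.n≤1+n _) e∈)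

  module Schemes (G : Graph) where
    open Graph G
    open Chains Vertex
    open Subgraphs adj adj-sym adj-irrefl using (Path; irreflexive)

    table : List Entry → (Vertex → Pair) → Vertex → Pair
    table [] d x = d x
    table ((y , p) ∷ T) d x with x Finₚ.≟ y
    ... | yes _ = p
    ... | no _  = table T d x

    table-∈ : ∀ {T d x p} → Unique (map proj₁ T) → (x , p) ∈ T → table T d x ≡ p
    table-∈ {(y , q) ∷ T} {d} {x} (y∉ ∷ u) m with x Finₚ.≟ y
    table-∈ {(y , q) ∷ T} (y∉ ∷ u) (here refl) | yes _ = refl
    table-∈ {(y , q) ∷ T} (y∉ ∷ u) (there m) | yes refl = ⊥-elim (All.lookup y∉ (∈-map⁺ proj₁ m) refl)
    table-∈ {(y , q) ∷ T} (y∉ ∷ u) (here refl) | no x≢ = ⊥-elim (x≢ refl)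
    table-∈ {(y , q) ∷ T} (y∉ ∷ u) (there m) | no _ = table-∈ u m

    table-cases : ∀ T d x → (x , table T d x) ∈ T ⊎ table T d x ≡ d x
    table-cases [] d x = inj₂ refl
    table-cases ((y , p) ∷ T) d x with x Finₚ.≟ y
    ... | yes refl = inj₁ (here refl)
    ... | no _ with table-cases T d x
    ...   | inj₁ m = inj₁ (there m)
    ...   | inj₂ e = inj₂ e

    -- A path from src to tgt forbidding the colours α and γ at its ends, whose
    -- lists are {α , o} and {γ , o′}.
    record Link : Set where
      constructor link
      field
        src : Vertex
        α o : ℕ
        inner : List Vertex
        tgt : Vertex
        γ o′ : ℕ

    open Link

    assignments : ℕ → List Link → List Entry
    assignments n []       = []
    assignments n (l ∷ ls) = assignment n (α l) (inner l) (γ l) ++ assignments (n + length (inner l)) ls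

    final : ℕ → List Link → ℕ
    final n []       = n
    final n (l ∷ ls) = final (n + length (inner l)) ls

    inners : List Link → List Vertex
    inners []       = []
    inners (l ∷ ls) = inner l ++ inners ls

    assignments-keys : ∀ n ls → map proj₁ (assignments n ls) ≡ inners ls
    assignments-keys n [] = refl
    assignments-keys n (l ∷ ls) = trans (map-++ proj₁ (assignment n (α l) (inner l) (γ l)) _)
      (cong₂ _++_ (assignment-keys n (α l) (inner l) (γ l)) (assignments-keys (n + length (inner l)) ls))

    Listed : List Entry → Vertex → ℕ → ℕ → Set
    Listed Bs x a b = (x , a , b) ∈ Bs ⊎ (x , b , a) ∈ Bs

    -- A single inner vertex is the only one along a link whose list contains no fresh colour.
    mid : Link → List Entry
    mid (link _ a _ (w ∷ []) _ c _) = (w , a , c) ∷ []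
    mid _ = []

    mids : List Link → List Entry
    mids []       = []
    mids (l ∷ ls) = mid l ++ mids ls

    -- Adjacency is that of the whole graph: equal lists do no harm at vertices that are not
    -- adjacent, but edges outside the subdivision count.
    DiffAdj : Entry → Entry → Set
    DiffAdj (x , p) (y , q) = adj x y ≡ true → Diff p q

    -- Makes the linking colour the largest common one on links with at most one inner vertex. On
    -- longer links the fresh colours, increasing along the path, achieve it by themselves.
    AdaptedOk : Link → Set
    AdaptedOk l = (inner l ≡ [] → o l ≢ o′ l ⊎ o l ≤ α l) ×
      (length (inner l) ≡ 1 → (o l ≢ γ l ⊎ o l ≤ α l) × (α l ≢ o′ l ⊎ α l ≤ γ l))

    -- A direct link is a conflict in one colour, whereas a single inner vertex has the list {α, γ},
    -- which must have two elements.
    LinkOk : List Entry → Link → Set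
    LinkOk Bs l = Path (src l) (inner l) (tgt l) × Listed Bs (src l) (α l) (o l) × Listed Bs (tgt l) (γ l) (o′ l) ×
      (inner l ≡ [] → α l ≡ γ l) × (length (inner l) ≡ 1 → α l ≢ γ l)

    -- The contradiction is reduced to the branch vertices: `unsat` mentions only their colours and
    -- the pairs that links forbid.
    record Scheme : Set where
      field
        Bs     : List Entry
        Ls     : List Link
        unique : Unique (map proj₁ Bs ++ inners Ls)
        small  : ∀ {b} → b ∈ Bs → Below 8 (proj₂ b) × proj₁ (proj₂ b) ≢ proj₂ (proj₂ b)
        links  : ∀ {l} → l ∈ Ls → LinkOk Bs l
        unsat  : ∀ φ → (∀ {b} → b ∈ Bs → From φ b) → (∀ {l} → l ∈ Ls → ¬ (φ (src l) ≡ α l × φ (tgt l) ≡ γ l)) → ⊥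

    module Colourings (S : Scheme) where
      open Scheme S

      M : ℕ
      M = final 8 Ls

      T : List Entry
      T = Bs ++ assignments 8 Ls

      private
        -- Vertices outside the subdivision get two colours of their own, beyond all colours used on
        -- it.
        fallback : Vertex → Pair
        fallback x = M + 2 * toℕ x , suc (M + 2 * toℕ x)

      pair : Vertex → Pair
      pair = table T fallback

      L : Vertex → List Colour
      L x = colours (pair x)

      T-unique : Unique (map proj₁ T)
      T-unique = subst Unique (sym (trans (map-++ proj₁ Bs _) (cong (map proj₁ Bs ++_) (assignments-keys 8 Ls)))) unique

      pair-∈ : ∀ {x p} → (x , p) ∈ T → pair x ≡ p
      pair-∈ = table-∈ T-unique

      link-small : ∀ {l} → l ∈ Ls → Below 8 (α l , o l) × Below 8 (γ l , o′ l)
      link-small l∈ with links l∈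
      ... | _ , p , q , _ = by p , by q
        where
        by : ∀ {x a b} → Listed Bs x a b → Below 8 (a , b)
        by (inj₁ m) = proj₁ (small m)
        by (inj₂ m) = proj₂ (proj₁ (small m)) , proj₁ (proj₁ (small m))

      data At : ℕ → Link → Set where
        at : ∀ {n l} → (∀ {e} → e ∈ assignment n (α l) (inner l) (γ l) → e ∈ T) → 8 ≤ n → At n l

      start : ∀ {l} → l ∈ Ls → ∃[ n ] At n l
      start = go 8 Ls (∈-++⁺ʳ Bs) ℕₚ.≤-refl
        where
        go : ∀ n ls → (∀ {e} → e ∈ assignments n ls → e ∈ T) → 8 ≤ n → ∀ {l} → l ∈ ls → ∃[ m ] At m l
        go n (l ∷ ls) inT n≥ (here refl) = n , at (inT ∘ ∈-++⁺ˡ) n≥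
        go n (l ∷ ls) inT n≥ (there m) = go (n + length (inner l)) ls (inT ∘ ∈-++⁺ʳ (assignment n (α l) (inner l) (γ l))) (ℕₚ.≤-trans n≥ (ℕₚ.m≤m+n n _)) m

      conflict-adjacent : ∀ n x α ws γ y → Path x ws y → ∀ {a b d} → (a , b , d) ∈ conflicts n x α ws γ y → adj a b ≡ true
      conflict-adjacent n x α [] γ y p (here refl) = p
      conflict-adjacent n x α (w ∷ []) γ y (p , q) (here refl) = p
      conflict-adjacent n x α (w ∷ []) γ y (p , q) (there (here refl)) = q
      conflict-adjacent n x α (w ∷ w′ ∷ ws) γ y (p , q) (here refl) = p
      conflict-adjacent n x α (w ∷ w′ ∷ ws) γ y (p , q) (there m) = conflict-adjacent (suc n) w n (w′ ∷ ws) γ y q m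

      uncolourable : ∀ φ → (∀ x → φ x ∈ L x) →
        (∀ {l} → (l∈ : l ∈ Ls) → ∀ {a b d} → (a , b , d) ∈ conflicts (proj₁ (start l∈)) (src l) (α l) (inner l) (γ l) (tgt l) →
          adj a b ≡ true → ¬ (φ a ≡ d × φ b ≡ d)) → ⊥
      uncolourable φ from avoids = unsat φ (λ {b} m → fromT (∈-++⁺ˡ m)) forbid
        where
        fromT : ∀ {e} → e ∈ T → From φ e
        fromT {x , s , t} m with subst (λ p → φ x ∈ colours p) (pair-∈ m) (from x)
        ... | here e = inj₁ e
        ... | there (here e) = inj₂ e
        forbid : ∀ {l} → l ∈ Ls → ¬ (φ (src l) ≡ α l × φ (tgt l) ≡ γ l)
        forbid {l} l∈ (p , q) with start l∈ | avoids l∈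
        ... | n , at inT _ | av = let (path , _ , _ , direct , _) = links l∈ in
          chain φ n (src l) (α l) (inner l) (γ l) (tgt l) direct (fromT ∘ inT)
            (λ c∈ → av c∈ (conflict-adjacent n (src l) (α l) (inner l) (γ l) (tgt l) path c∈)) p q

      pair-distinct : ∀ x → proj₁ (pair x) ≢ proj₂ (pair x)
      pair-distinct x with table-cases T fallback x
      ... | inj₂ e = λ f → ℕₚ.<⇒≢ ℕₚ.≤-refl (trans (sym (cong proj₁ e)) (trans f (cong proj₂ e)))
      ... | inj₁ m with ∈-++⁻ Bs m
      ...   | inj₁ m′ = proj₂ (small m′)
      ...   | inj₂ m′ = go 8 Ls ℕₚ.≤-refl (λ {l} l∈ → let (_ , _ , _ , _ , ne) = links l∈ in (proj₁ (proj₁ (link-small l∈))) , (proj₁ (proj₂ (link-small l∈))) , ne) m′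
        where
        inside : ∀ n α ws γ → α < n → γ < 8 → 8 ≤ n → (length ws ≡ 1 → α ≢ γ) → ∀ {e} → e ∈ assignment n α ws γ → proj₁ (proj₂ e) ≢ proj₂ (proj₂ e)
        inside n α (w ∷ []) γ a g n≥ ne (here refl) = ne refl
        inside n α (w ∷ w′ ∷ ws) γ a g n≥ ne (here refl) = ℕₚ.<⇒≢ a
        inside n α (w ∷ w′ ∷ ws) γ a g n≥ ne (there m) = inside (suc n) n (w′ ∷ ws) γ ℕₚ.≤-refl g (ℕₚ.m≤n⇒m≤1+n n≥) (λ _ e → ℕₚ.<⇒≢ (ℕₚ.≤-trans g n≥) (sym e)) m
        go : ∀ n ls → 8 ≤ n → (∀ {l} → l ∈ ls → α l < 8 × γ l < 8 × (length (inner l) ≡ 1 → α l ≢ γ l)) →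
          ∀ {e} → e ∈ assignments n ls → proj₁ (proj₂ e) ≢ proj₂ (proj₂ e)
        go n (l ∷ ls) n≥ ok m with ∈-++⁻ (assignment n (α l) (inner l) (γ l)) m
        ... | inj₁ m′ = let (a , g , ne) = ok (here refl) in inside n (α l) (inner l) (γ l) (ℕₚ.≤-trans a n≥) g n≥ ne m′
        ... | inj₂ m′ = go (n + length (inner l)) ls (ℕₚ.≤-trans n≥ (ℕₚ.m≤m+n n _)) (ok ∘ there) m′

      two-set : ListAssignment G 2 L
      two-set x = (pair-distinct x ∷ []) ∷ [] ∷ [] , refl

      Two : Vertex → ℕ → ℕ → Set
      Two x a b = pair x ≡ (a , b) ⊎ pair x ≡ (b , a)

      lists-two : ∀ {x a b} → Listed Bs x a b → Two x a b
      lists-two (inj₁ m) = inj₁ (pair-∈ (∈-++⁺ˡ m))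
      lists-two (inj₂ m) = inj₂ (pair-∈ (∈-++⁺ˡ m))

      two-∈ : ∀ {x a b} → Two x a b → a ∈ L x
      two-∈ {x} (inj₁ e) = subst (λ p → _ ∈ colours p) (sym e) (here refl)
      two-∈ {x} (inj₂ e) = subst (λ p → _ ∈ colours p) (sym e) (there (here refl))

      ∈-two : ∀ {x a b c} → Two x a b → c ∈ L x → c ≡ a ⊎ c ≡ b
      ∈-two (inj₁ e) m with subst (λ p → _ ∈ colours p) e m
      ... | here f = inj₁ f
      ... | there (here f) = inj₂ f
      ∈-two (inj₂ e) m with subst (λ p → _ ∈ colours p) e m
      ... | here f = inj₂ f
      ... | there (here f) = inj₁ f

      Max : Vertex → Vertex → ℕ → Set
      Max x y d = max-common (L x) (L y) ≡ d × max-common (L y) (L x) ≡ d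

      max-two : ∀ {x y d o o′} → Two x d o → Two y d o′ → o ≢ o′ ⊎ o ≤ d → Max x y d
      max-two {x} {y} {d} {o} {o′} p q cond =
        ℕₚ.≤-antisym (max-common-≤ (L x) bound) (max-common-≥ (L x) (two-∈ p) (two-∈ q)) ,
        ℕₚ.≤-antisym (max-common-≤ (L y) λ c∈ c∈′ → bound c∈′ c∈) (max-common-≥ (L y) (two-∈ q) (two-∈ p))
        where
        bound : ∀ {c} → c ∈ L x → c ∈ L y → c ≤ d
        bound {c} c∈ c∈′ = by (∈-two p c∈) (∈-two q c∈′) cond
          where
          by : c ≡ d ⊎ c ≡ o → c ≡ d ⊎ c ≡ o′ → o ≢ o′ ⊎ o ≤ d → c ≤ d
          by (inj₁ e) _ _ = ℕₚ.≤-reflexive e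
          by (inj₂ _) (inj₁ e) _ = ℕₚ.≤-reflexive e
          by (inj₂ e) (inj₂ f) (inj₁ ne) = ⊥-elim (ne (trans (sym e) f))
          by (inj₂ e) (inj₂ _) (inj₂ le) = ℕₚ.≤-trans (ℕₚ.≤-reflexive e) le

      private
        -- Shared colours increase along the link, so `s` is at least the colour `prev` shared one
        -- step earlier. The last inner vertex shares only γ with `y`, whose other colour is below
        -- 8.
        max-inner : ∀ m w s prev w′ ws γ o′ y → Two w s prev → prev ≤ s → s ≤ m → 8 ≤ s → Two y γ o′ → o′ < 8 →
          (∀ {e} → e ∈ assignment m s (w′ ∷ ws) γ → e ∈ T) →
          ∀ {a b d} → (a , b , d) ∈ conflicts m w s (w′ ∷ ws) γ y → Max a b d
        max-inner m w s prev w′ [] γ o′ y tw le sm s≥ ty o< inT (here refl) = max-two tw (inj₁ (pair-∈ (inT (here refl)))) (inj₂ le)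
        max-inner m w s prev w′ [] γ o′ y tw le sm s≥ ty o< inT (there (here refl)) =
          max-two (inj₂ (pair-∈ (inT (here refl)))) ty (inj₁ λ e → ℕₚ.<⇒≢ (ℕₚ.≤-trans o< s≥) (sym e))
        max-inner m w s prev w′ (w″ ∷ ws) γ o′ y tw le sm s≥ ty o< inT (here refl) = max-two tw (inj₁ (pair-∈ (inT (here refl)))) (inj₂ le)
        max-inner m w s prev w′ (w″ ∷ ws) γ o′ y tw le sm s≥ ty o< inT (there c∈) =
          max-inner (suc m) w′ m s w″ ws γ o′ y (inj₂ (pair-∈ (inT (here refl)))) sm (ℕₚ.n≤1+n m) (ℕₚ.≤-trans s≥ sm) ty o< (inT ∘ there) c∈

        max-link : ∀ n x α o ws γ o′ y → 8 ≤ n → Two x α o → Two y γ o′ → α < 8 → o < 8 → o′ < 8 → (ws ≡ [] → α ≡ γ) →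
          (ws ≡ [] → o ≢ o′ ⊎ o ≤ α) → (length ws ≡ 1 → (o ≢ γ ⊎ o ≤ α) × (α ≢ o′ ⊎ α ≤ γ)) →
          (∀ {e} → e ∈ assignment n α ws γ → e ∈ T) → ∀ {a b d} → (a , b , d) ∈ conflicts n x α ws γ y → Max a b d
        max-link n x α o [] γ o′ y n≥ tx ty α< o< o′< direct c₀ c₁ inT (here refl) with direct refl
        ... | refl = max-two tx ty (c₀ refl)
        max-link n x α o (w ∷ []) γ o′ y n≥ tx ty α< o< o′< direct c₀ c₁ inT (here refl) =
          max-two tx (inj₁ (pair-∈ (inT (here refl)))) (proj₁ (c₁ refl))
        max-link n x α o (w ∷ []) γ o′ y n≥ tx ty α< o< o′< direct c₀ c₁ inT (there (here refl)) =
          max-two (inj₂ (pair-∈ (inT (here refl)))) ty (proj₂ (c₁ refl))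
        max-link n x α o (w ∷ w′ ∷ ws) γ o′ y n≥ tx ty α< o< o′< direct c₀ c₁ inT (here refl) =
          max-two tx (inj₁ (pair-∈ (inT (here refl)))) (inj₁ (ℕₚ.<⇒≢ (ℕₚ.≤-trans o< n≥)))
        max-link n x α o (w ∷ w′ ∷ ws) γ o′ y n≥ tx ty α< o< o′< direct c₀ c₁ inT (there c∈) =
          max-inner (suc n) w n α w′ ws γ o′ y (inj₂ (pair-∈ (inT (here refl)))) (ℕₚ.<⇒≤ (ℕₚ.≤-trans α< n≥)) (ℕₚ.n≤1+n n) n≥ ty o′< (inT ∘ there) c∈

      not-adaptable : (∀ {l} → l ∈ Ls → AdaptedOk l) → ¬ AdaptablyChoosable G 2
      not-adaptable ok ch with ch (λ e → max-common (L (end₁ e)) (L (end₂ e))) L two-set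
      ... | φ , adapted , from = uncolourable φ from avoids
        where
        avoids : ∀ {l} → (l∈ : l ∈ Ls) → ∀ {a b d} → (a , b , d) ∈ conflicts (proj₁ (start l∈)) (src l) (α l) (inner l) (γ l) (tgt l) →
          adj a b ≡ true → ¬ (φ a ≡ d × φ b ≡ d)
        avoids {l} l∈ {a} {b} {d} c∈ ab (p , q) with start l∈
        ... | n , at inT n≥ = by (edge-between-ends G a b ab)
          where
          lk = links l∈
          mx : Max a b d
          mx = let (_ , sx , sy , direct , _) = lk in
            max-link n (src l) (α l) (o l) (inner l) (γ l) (o′ l) (tgt l) n≥ (lists-two sx) (lists-two sy)
              (proj₁ (proj₁ (link-small l∈))) (proj₂ (proj₁ (link-small l∈))) (proj₂ (proj₂ (link-small l∈)))
              direct (proj₁ (ok l∈)) (proj₂ (ok l∈)) inT c∈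
          e = edge-between G a b ab
          by : (end₁ e ≡ a × end₂ e ≡ b) ⊎ (end₁ e ≡ b × end₂ e ≡ a) → ⊥
          by (inj₁ (f , g)) = adapted e (trans (cong φ f) (trans p (trans (sym q) (cong φ (sym g)))) ,
            trans (cong φ g) (trans q (sym (trans (cong₂ (λ x y → max-common (L x) (L y)) f g) (proj₁ mx)))))
          by (inj₂ (f , g)) = adapted e (trans (cong φ f) (trans q (trans (sym p) (cong φ (sym g)))) ,
            trans (cong φ g) (trans p (sym (trans (cong₂ (λ x y → max-common (L x) (L y)) f g) (proj₂ mx)))))

      private
        SmallLink : Link → Set
        SmallLink l = α l < 8 × γ l < 8

        one-kind : ∀ n l → 8 ≤ n → ∀ {e} → e ∈ assignment n (α l) (inner l) (γ l) → e ∈ mid l ⊎ Reaches n (proj₂ e)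
        one-kind n (link x a _ (w ∷ []) y c _) n≥ (here refl) = inj₁ (here refl)
        one-kind n (link x a _ (w ∷ w′ ∷ ws) y c _) n≥ (here refl) = inj₂ (inj₂ ℕₚ.≤-refl)
        one-kind n (link x a _ (w ∷ w′ ∷ ws) y c _) n≥ (there m) = inj₂ (assignment-reaches (suc n) n (w′ ∷ ws) c (ℕₚ.n≤1+n n) m)

        kind : ∀ n ls → 8 ≤ n → ∀ {e} → e ∈ assignments n ls → e ∈ mids ls ⊎ Reaches n (proj₂ e)
        kind n (l ∷ ls) n≥ m with ∈-++⁻ (assignment n (α l) (inner l) (γ l)) m
        ... | inj₁ m′ = Sum.map₁ ∈-++⁺ˡ (one-kind n l n≥ m′)
        ... | inj₂ m′ = Sum.map (∈-++⁺ʳ (mid l)) (Sum.map (ℕₚ.≤-trans (ℕₚ.m≤m+n n _)) (ℕₚ.≤-trans (ℕₚ.m≤m+n n _)))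
                          (kind (n + length (inner l)) ls (ℕₚ.≤-trans n≥ (ℕₚ.m≤m+n n _)) m′)

        mid-below : ∀ ls → (∀ {l} → l ∈ ls → SmallLink l) → ∀ {e} → e ∈ mids ls → Below 8 (proj₂ e)
        mid-below (l ∷ ls) sm m with ∈-++⁻ (mid l) m
        ... | inj₂ m′ = mid-below ls (sm ∘ there) m′
        ... | inj₁ m′ = one l (sm (here refl)) m′
          where
          one : ∀ l → SmallLink l → ∀ {e} → e ∈ mid l → Below 8 (proj₂ e)
          one (link _ a _ (w ∷ []) _ c _) s (here refl) = s

        one-below : ∀ n l → 8 ≤ n → SmallLink l → ∀ {e} → e ∈ assignment n (α l) (inner l) (γ l) → Below (n + length (inner l)) (proj₂ e)
        one-below n l n≥ (a , c) = assignment-below n (α l) (inner l) (γ l) (ℕₚ.n≤1+n _) (big a) (big c)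
          where
          big : ∀ {x} → x < 8 → x < n + length (inner l)
          big x< = ℕₚ.≤-trans x< (ℕₚ.≤-trans n≥ (ℕₚ.m≤m+n n _))

        pairs : ∀ n ls → 8 ≤ n → (∀ {l} → l ∈ ls → SmallLink l × (length (inner l) ≡ 2 → α l ≢ γ l)) →
          (∀ {e f} → e ∈ mids ls → f ∈ mids ls → DiffAdj e f) → AllPairs DiffAdj (assignments n ls)
        pairs n [] n≥ sm md = []
        pairs n (l ∷ ls) n≥ sm md = AllPairsₚ.++⁺
          (AllPairs.map (λ d _ → d) (assignment-diff n (α l) (inner l) (γ l) (ℕₚ.≤-trans (proj₁ (proj₁ (sm (here refl)))) n≥) (proj₂ (proj₁ (sm (here refl)))) n≥ (proj₂ (sm (here refl)))))
          (pairs (n + length (inner l)) ls n′≥ (sm ∘ there) (λ p q → md (∈-++⁺ʳ (mid l) p) (∈-++⁺ʳ (mid l) q)))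
          (All.tabulate λ e∈ → All.tabulate λ f∈ → cross e∈ f∈)
          where
          n′≥ = ℕₚ.≤-trans n≥ (ℕₚ.m≤m+n n (length (inner l)))
          cross : ∀ {e f} → e ∈ assignment n (α l) (inner l) (γ l) → f ∈ assignments (n + length (inner l)) ls → DiffAdj e f
          cross e∈ f∈ with kind (n + length (inner l)) ls n′≥ f∈
          ... | inj₂ r = λ _ → diff-by-bound (one-below n l n≥ (proj₁ (sm (here refl))) e∈) r
          ... | inj₁ fm with one-kind n l n≥ e∈
          ...   | inj₁ em = md (∈-++⁺ˡ em) (∈-++⁺ʳ (mid l) fm)
          ...   | inj₂ r = λ _ → Diff-sym (diff-by-bound (mid-below ls (proj₁ ∘ sm ∘ there) fm) (Sum.map (ℕₚ.≤-trans n≥) (ℕₚ.≤-trans n≥) r))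

        all-pairs : ∀ {R : Entry → Entry → Set} xs → (∀ {e f} → e ∈ xs → f ∈ xs → R e f) → AllPairs R xs
        all-pairs [] h = []
        all-pairs (x ∷ xs) h = All.tabulate (λ m → h (here refl) (there m)) ∷ all-pairs xs (λ p q → h (there p) (there q))

        pairs-lookup : ∀ {R : Entry → Entry → Set} {xs e f} → AllPairs R xs → e ∈ xs → f ∈ xs → e ≡ f ⊎ R e f ⊎ R f e
        pairs-lookup (r ∷ rs) (here refl) (here refl) = inj₁ refl
        pairs-lookup (r ∷ rs) (here refl) (there q) = inj₂ (inj₁ (All.lookup r q))
        pairs-lookup (r ∷ rs) (there p) (here refl) = inj₂ (inj₂ (All.lookup r p))
        pairs-lookup (r ∷ rs) (there p) (there q) = pairs-lookup rs p q

        final-≥ : ∀ n ls → n ≤ final n ls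
        final-≥ n [] = ℕₚ.≤-refl
        final-≥ n (l ∷ ls) = ℕₚ.≤-trans (ℕₚ.m≤m+n n _) (final-≥ (n + length (inner l)) ls)

        below-mono : ∀ {a b p} → a ≤ b → Below a p → Below b p
        below-mono le (x , y) = ℕₚ.≤-trans x le , ℕₚ.≤-trans y le

        below-final : ∀ n ls → 8 ≤ n → (∀ {l} → l ∈ ls → SmallLink l) → ∀ {e} → e ∈ assignments n ls → Below (final n ls) (proj₂ e)
        below-final n (l ∷ ls) n≥ sm m with ∈-++⁻ (assignment n (α l) (inner l) (γ l)) m
        ... | inj₁ m′ = below-mono (final-≥ (n + length (inner l)) ls) (one-below n l n≥ (sm (here refl)) m′)
        ... | inj₂ m′ = below-final (n + length (inner l)) ls (ℕₚ.≤-trans n≥ (ℕₚ.m≤m+n n _)) (sm ∘ there) m′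

      small-from-pairs : AllPairs DiffAdj (Bs ++ mids Ls) → ∀ {e f} → e ∈ Bs ++ mids Ls → f ∈ Bs ++ mids Ls → DiffAdj e f
      small-from-pairs ps p q a with pairs-lookup ps p q
      ... | inj₁ e = ⊥-elim (irreflexive a (cong proj₁ e))
      ... | inj₂ (inj₁ d) = d a
      ... | inj₂ (inj₂ d) = Diff-sym (d (trans (adj-sym _ _) a))

      module _ (short : ∀ {l} → l ∈ Ls → length (inner l) ≡ 2 → α l ≢ γ l)
               (small-diff : ∀ {e f} → e ∈ Bs ++ mids Ls → f ∈ Bs ++ mids Ls → DiffAdj e f) where

        private
          sl : ∀ {l} → l ∈ Ls → SmallLink l
          sl l∈ = proj₁ (proj₁ (link-small l∈)) , proj₁ (proj₂ (link-small l∈))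

          -- A list with a fresh colour differs from all others by the order of assignment;
          -- `small-diff` covers the branch vertices and single inner vertices.
          T-pairs : AllPairs DiffAdj T
          T-pairs = AllPairsₚ.++⁺ (all-pairs Bs λ p q → small-diff (∈-++⁺ˡ p) (∈-++⁺ˡ q))
            (pairs 8 Ls ℕₚ.≤-refl (λ l∈ → sl l∈ , short l∈) λ p q → small-diff (∈-++⁺ʳ Bs p) (∈-++⁺ʳ Bs q))
            (All.tabulate λ e∈ → All.tabulate λ f∈ → cross e∈ (kind 8 Ls ℕₚ.≤-refl f∈))
            where
            cross : ∀ {e f} → e ∈ Bs → f ∈ mids Ls ⊎ Reaches 8 (proj₂ f) → DiffAdj e f
            cross e∈ (inj₁ fm) = small-diff (∈-++⁺ˡ e∈) (∈-++⁺ʳ Bs fm)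
            cross e∈ (inj₂ r) = λ _ → diff-by-bound (proj₁ (small e∈)) r

          T-below : ∀ {e} → e ∈ T → Below M (proj₂ e)
          T-below m with ∈-++⁻ Bs m
          ... | inj₁ m′ = below-mono (final-≥ 8 Ls) (proj₁ (small m′))
          ... | inj₂ m′ = below-final 8 Ls ℕₚ.≤-refl sl m′

          fallback-reaches : ∀ x → Reaches M (fallback x)
          fallback-reaches x = inj₁ (ℕₚ.m≤m+n M _)

          adjacent-diff : ∀ x y → adj x y ≡ true → Diff (pair x) (pair y)
          adjacent-diff x y a with table-cases T fallback x | table-cases T fallback y
          ... | inj₁ p | inj₂ f = diff-by-bound (T-below p) (subst (Reaches M) (sym f) (fallback-reaches y))
          ... | inj₂ e | inj₁ q = Diff-sym (diff-by-bound (T-below q) (subst (Reaches M) (sym e) (fallback-reaches x)))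
          -- The pair M + 2 x, M + 2 x + 1 determines x; a crosswise coincidence would equate an
          -- even and an odd number.
          ... | inj₂ e | inj₂ f = subst₂ Diff (sym e) (sym f) λ
            { (inj₁ (g , _)) → irreflexive a (Finₚ.toℕ-injective (ℕₚ.*-cancelˡ-≡ _ _ 2 (ℕₚ.+-cancelˡ-≡ M _ _ g)))
            ; (inj₂ (g , _)) → ℕₚ.even≢odd (toℕ x) (toℕ y) (ℕₚ.+-cancelˡ-≡ M _ _ (trans g (sym (ℕₚ.+-suc M _)))) }
          ... | inj₁ p | inj₁ q with pairs-lookup T-pairs p q
          ...   | inj₁ e = ⊥-elim (irreflexive a (cong proj₁ e))
          ...   | inj₂ (inj₁ d) = d a
          ...   | inj₂ (inj₂ d) = Diff-sym (d (trans (adj-sym y x) a))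

        not-separable : ¬ SepChoosable G 2
        not-separable ch with ch L two-set (λ e → ∩-diff (pair (end₁ e)) (pair (end₂ e)) (pair-distinct (end₁ e)) (adjacent-diff (end₁ e) (end₂ e) (adjacent₁₂ G e)))
        ... | φ , proper , from = uncolourable φ from avoids
          where
          avoids : ∀ {l} → (l∈ : l ∈ Ls) → ∀ {a b d} → (a , b , d) ∈ conflicts (proj₁ (start l∈)) (src l) (α l) (inner l) (γ l) (tgt l) →
            adj a b ≡ true → ¬ (φ a ≡ d × φ b ≡ d)
          avoids l∈ {a} {b} c∈ ab (p , q) with edge-between-ends G a b ab
          ... | inj₁ (f , g) = proper (edge-between G a b ab) (trans (cong φ f) (trans p (trans (sym q) (cong φ (sym g)))))
          ... | inj₂ (f , g) = proper (edge-between G a b ab) (trans (cong φ f) (trans q (trans (sym p) (cong φ (sym g)))))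

-- The four obstructions and their bad lists.

module Obstructions where

  open Orientations using (Relation; true≢false)
  open Configurations
  open ListSchemes
  open import Data.Fin using (Fin; zero; suc; toℕ; #_)
  open import Data.List using ([]; _∷_; reverse)
  open import Data.List.Relation.Unary.All using (All; []; _∷_)
  open import Data.List.Relation.Unary.AllPairs as AllPairs using (AllPairs; []; _∷_)
  open import Data.Nat using (ℕ; zero; suc; _≤_; _<_; z≤n; s≤s; _≡ᵇ_)
  open import Data.Vec as Vec using (Vec)

  ∧-left : ∀ {a b} → a ∧ b ≡ true → a ≡ true
  ∧-left {true} e = refl

  ∧-right : ∀ {a b} → a ∧ b ≡ true → b ≡ true
  ∧-right {true} e = e

  ∨-split : ∀ a {b} → a ∨ b ≡ true → a ≡ true ⊎ b ≡ true
  ∨-split true e = inj₁ refl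
  ∨-split false e = inj₂ e

  -- Evaluation on all flag vectors, by which finite claims are settled with `refl`.
  everywhere : ∀ n → (Vec Bool n → Bool) → Bool
  everywhere zero    f = f Vec.[]
  everywhere (suc n) f = everywhere n (λ v → f (true Vec.∷ v)) ∧ everywhere n (λ v → f (false Vec.∷ v))

  everywhere-sound : ∀ n f → everywhere n f ≡ true → ∀ v → f v ≡ true
  everywhere-sound zero f e Vec.[] = e
  everywhere-sound (suc n) f e (true Vec.∷ v) = everywhere-sound n _ (∧-left e) v
  everywhere-sound (suc n) f e (false Vec.∷ v) = everywhere-sound n _ (∧-right {everywhere n (λ v → f (true Vec.∷ v))} e) v

  empty single : ∀ {V : Set} → List V → Bool
  empty []      = true
  empty (_ ∷ _) = false
  single (_ ∷ []) = true
  single _        = false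

  empty-reverse : ∀ {V : Set} (ws : List V) → empty (reverse ws) ≡ empty ws
  empty-reverse ws = trans (by-length (reverse ws)) (trans (cong (_≡ᵇ 0) (length-reverse ws)) (sym (by-length ws)))
    where
    by-length : ∀ ws → empty ws ≡ (length ws ≡ᵇ 0)
    by-length [] = refl
    by-length (_ ∷ _) = refl

  single-reverse : ∀ {V : Set} (ws : List V) → single (reverse ws) ≡ single ws
  single-reverse ws = trans (by-length (reverse ws)) (trans (cong (_≡ᵇ 1) (length-reverse ws)) (sym (by-length ws)))
    where
    by-length : ∀ ws → single ws ≡ (length ws ≡ᵇ 1)
    by-length [] = refl
    by-length (_ ∷ []) = refl
    by-length (_ ∷ _ ∷ _) = refl

  same : Pair → Pair → Bool
  same (s , t) (s′ , t′) = ((s ≡ᵇ s′) ∧ (t ≡ᵇ t′)) ∨ ((s ≡ᵇ t′) ∧ (t ≡ᵇ s′))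

  ≡ᵇ-complete : ∀ {m n} → m ≡ n → (m ≡ᵇ n) ≡ true
  ≡ᵇ-complete {zero} refl = refl
  ≡ᵇ-complete {suc m} refl = ≡ᵇ-complete {m} refl

  ≡ᵇ-sound : ∀ m n → (m ≡ᵇ n) ≡ true → m ≡ n
  ≡ᵇ-sound zero zero _ = refl
  ≡ᵇ-sound (suc m) (suc n) e = cong suc (≡ᵇ-sound m n e)

  ∨-true : ∀ a {b} → b ≡ true → a ∨ b ≡ true
  ∨-true true _ = refl
  ∨-true false e = e

  diff-sound : ∀ p q → not (same p q) ≡ true → Diff p q
  diff-sound (s , t) (s′ , t′) e d = true≢false (trans (sym e) (cong not (yes-same d)))
    where
    yes-same : (s ≡ s′ × t ≡ t′) ⊎ (s ≡ t′ × t ≡ s′) → same (s , t) (s′ , t′) ≡ true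
    yes-same (inj₁ (f , g)) rewrite ≡ᵇ-complete f | ≡ᵇ-complete g = refl
    yes-same (inj₂ (f , g)) = ∨-true _ (trans (cong₂ _∧_ (≡ᵇ-complete f) (≡ᵇ-complete g)) refl)

  differs-from : Pair → List Pair → Bool
  differs-from p []      = true
  differs-from p (q ∷ l) = not (same p q) ∧ differs-from p l

  all-different : List Pair → Bool
  all-different []      = true
  all-different (p ∷ l) = differs-from p l ∧ all-different l

  differs-from-sound : ∀ p l → differs-from p l ≡ true → All (Diff p) l
  differs-from-sound p [] e = []
  differs-from-sound p (q ∷ l) e = diff-sound p q (∧-left e) ∷ differs-from-sound p l (∧-right {not (same p q)} e)

  all-different-sound : ∀ l → all-different l ≡ true → AllPairs Diff l
  all-different-sound [] e = []
  all-different-sound (p ∷ l) e = differs-from-sound p l (∧-left e) ∷ all-different-sound l (∧-right {differs-from p l} e)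

  -- Names for the colours on a 4-cycle of linked vertices, equal at the ends of
  -- a direct edge and distinct at the ends of longer links; they exist unless
  -- exactly three of the links are direct.
  cycle-names : Bool → Bool → Bool → Bool → Fin 4 × Fin 4 × Fin 4 × Fin 4
  cycle-names e₁ e₂ true  true  = # 0 , (if e₁ ∨ e₂ then # 0 else # 1) , # 0 , # 0
  cycle-names e₁ e₂ e₃ e₄ =
    # 0 , b , v , (if e₃ then v else if e₄ then # 0 else # 3)
    where
    b v : Fin 4
    b = if e₁ then # 0 else # 1
    v = if e₂ then b else # 2

  matches : Bool → ℕ → ℕ → Bool
  matches true  x y = x ≡ᵇ y
  matches false x y = not (x ≡ᵇ y)

  -- The lists at a, v, b, c are {4, xa}, {yv, xv}, {6, xb}, {wc, xc}. The x colours conflict along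
  -- the 4-cycle a b v c, the pairs 4, yv and 6, wc along the opposite edges av and bc. Hence a or v
  -- takes its x colour and so does b or c, but these two are consecutive on the cycle.
  record Names : Set where
    constructor names
    field
      xa xb xv xc yv wc : ℕ

  tetra-names : (av bc ab bv vc ca : Bool) → Names
  tetra-names av bc ab bv vc ca =
    names (toℕ (proj₁ x)) (toℕ (proj₁ (proj₂ x))) (toℕ (proj₁ (proj₂ (proj₂ x)))) (toℕ (proj₂ (proj₂ (proj₂ x))))
      (if av then 4 else 5) (if bc then 6 else 7)
    where x = cycle-names ab bv vc ca

  consistent : (av bc ab bv vc ca : Bool) → Bool
  consistent av bc ab bv vc ca = matches ab xa xb ∧ matches bv xb xv ∧ matches vc xv xc ∧ matches ca xc xa
    where open Names (tetra-names av bc ab bv vc ca)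

  only : Bool → Pair → List Pair
  only b p = if b then p ∷ [] else []

  -- The lists without fresh colours; here the flags mark links with a single inner vertex.
  small-pairs : Names → (av bc ab bv vc ca : Bool) → List Pair
  small-pairs (names xa xb xv xc yv wc) av bc ab bv vc ca =
    (4 , xa) ∷ (yv , xv) ∷ (6 , xb) ∷ (wc , xc) ∷
    only av (4 , yv) ++ only bc (6 , wc) ++ only ab (xa , xb) ++ only bv (xb , xv) ++ only vc (xv , xc) ++ only ca (xc , xa) ++ []

  Flags : Set
  Flags = Vec Bool 6

  consistent′ : Flags → Bool
  consistent′ (av Vec.∷ bc Vec.∷ ab Vec.∷ bv Vec.∷ vc Vec.∷ ca Vec.∷ Vec.[]) = consistent av bc ab bv vc ca

  separated′ : Flags → Flags → Bool
  separated′ e@(av Vec.∷ bc Vec.∷ ab Vec.∷ bv Vec.∷ vc Vec.∷ ca Vec.∷ Vec.[]) (av′ Vec.∷ bc′ Vec.∷ ab′ Vec.∷ bv′ Vec.∷ vc′ Vec.∷ ca′ Vec.∷ Vec.[]) =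
    consistent′ e ∧ all-different (small-pairs (tetra-names av bc ab bv vc ca) av′ bc′ ab′ bv′ vc′ ca′)

  -- The three ways of choosing the pair of opposite edges left out of the 4-cycle.
  second third : Flags → Flags
  second (av Vec.∷ bc Vec.∷ ab Vec.∷ bv Vec.∷ vc Vec.∷ ca Vec.∷ Vec.[]) = ab Vec.∷ vc Vec.∷ av Vec.∷ bv Vec.∷ bc Vec.∷ ca Vec.∷ Vec.[]
  third  (av Vec.∷ bc Vec.∷ ab Vec.∷ bv Vec.∷ vc Vec.∷ ca Vec.∷ Vec.[]) = ca Vec.∷ bv Vec.∷ ab Vec.∷ bc Vec.∷ vc Vec.∷ av Vec.∷ Vec.[]

  -- Each link lies on two of the three 4-cycles, so the numbers of direct links on them have an
  -- even sum and cannot all be 3.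
  some-consistent : ∀ e → consistent′ e ≡ true ⊎ consistent′ (second e) ≡ true ⊎ consistent′ (third e) ≡ true
  some-consistent e with ∨-split (consistent′ e) (everywhere-sound 6 (λ e → consistent′ e ∨ (consistent′ (second e) ∨ consistent′ (third e))) refl e)
  ... | inj₁ p = inj₁ p
  ... | inj₂ p = inj₂ (∨-split (consistent′ (second e)) p)

  lonely : Bool → Bool → Bool → Bool → Bool
  lonely s t u v = (s xor t) ∧ (s xor u) ∧ (s xor v)

  module _ (sa sv sb sc : Bool) where

    odd-flags : Flags
    odd-flags = (sa xor sv) Vec.∷ (sb xor sc) Vec.∷ (sa xor sb) Vec.∷ (sb xor sv) Vec.∷ (sv xor sc) Vec.∷ (sc xor sa) Vec.∷ Vec.[]

    direct-flags single-flags : Flags → Flags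
    direct-flags m = Vec.zipWith _∧_ odd-flags m
    single-flags m = Vec.zipWith (λ o m → not o ∧ m) odd-flags m

    -- In a bipartite graph a link between opposite sides never has a single inner vertex, and one
    -- between equal sides is never direct, so one flag per link describes both. The only pattern
    -- that may escape the three 4-cycles has a branch vertex opposite to the three others, linked
    -- directly to them, and single inner vertices between these: the cube without a vertex.
    some-separated? : Flags → Bool
    some-separated? m = separated′ d s ∨ separated′ (second d) (second s) ∨ separated′ (third d) (third s) ∨
      (Vec.foldr (λ _ → Bool) _∧_ true m ∧
        (lonely sa sv sb sc ∨ lonely sv sa sb sc ∨ lonely sb sa sv sc ∨ lonely sc sa sv sb))
      where
      d = direct-flags m
      s = single-flags m

  some-separated : ∀ sa sv sb sc m → some-separated? sa sv sb sc m ≡ true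
  some-separated sa sv sb sc m = everywhere-sound 6 (some-separated? sa sv sb sc)
    (everywhere-sound 4 (λ { (sa Vec.∷ sv Vec.∷ sb Vec.∷ sc Vec.∷ Vec.[]) → everywhere 6 (some-separated? sa sv sb sc) }) refl
      (sa Vec.∷ sv Vec.∷ sb Vec.∷ sc Vec.∷ Vec.[])) m

  matches-direct : ∀ {V : Set} (ws : List V) {x y} → matches (empty ws) x y ≡ true → (ws ≡ [] → x ≡ y) × (length ws ≡ 1 → x ≢ y)
  matches-direct [] e = (λ _ → ≡ᵇ-sound _ _ e) , λ ()
  matches-direct (_ ∷ _) {x} {y} e = (λ ()) , λ _ f → true≢false (trans (sym e) (cong not (≡ᵇ-complete f)))

  matches-nonempty : ∀ {V : Set} (ws : List V) {x y} → matches (empty ws) x y ≡ true → length ws ≡ 2 → x ≢ y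
  matches-nonempty (_ ∷ _) e _ f = true≢false (trans (sym e) (cong not (≡ᵇ-complete f)))

  <4⇒≢ : ∀ {x} n → x < 4 → x ≢ suc (suc (suc (suc n)))
  <4⇒≢ n (s≤s (s≤s (s≤s (s≤s ())))) refl

  -- The configuration lives in the subgraph `B`, while lists are given to all of `G` and separation
  -- refers to all its edges.
  module BadConfigs (G : Graph) (B : Relation {Graph.order G}) (B⊆ : ∀ {x y} → B x y ≡ true → Graph.adj G x y ≡ true)
    (B-sym : ∀ x y → B x y ≡ B y x) (B-irrefl : ∀ x → B x x ≡ false) where

    open Graph G
    open Schemes G
    open Chains Vertex using (Entry; From; DiffE)
    open Subgraphs B B-sym B-irrefl
    open Subgraphs adj adj-sym adj-irrefl using () renaming (Path to PathG)
    open Rearrange Vertex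

    private
      infix 8 $_
      $_ : ∀ {n} → Fin n → Lists n
      $ i = var i
      [_]′ : Vertex → List Vertex
      [ v ]′ = v ∷ []

    on-G : ∀ x ws y → Path x ws y → PathG x ws y
    on-G x [] y a = B⊆ a
    on-G x (w ∷ ws) y (a , p) = B⊆ a , on-G w ws y p

    record BadAdapted : Set where
      field
        scheme  : Scheme
        adapted : ∀ {l} → l ∈ Scheme.Ls scheme → AdaptedOk l

    bad-adapted : BadAdapted → ¬ AdaptablyChoosable G 2
    bad-adapted b = Colourings.not-adaptable (BadAdapted.scheme b) (BadAdapted.adapted b)

    private
      no-adapted-issue : ∀ l → 2 ≤ length (Link.inner l) → AdaptedOk l
      no-adapted-issue (link _ _ _ (_ ∷ []) _ _ _) (s≤s ())
      no-adapted-issue (link _ _ _ (_ ∷ _ ∷ _) _ _ _) _ = (λ ()) , λ ()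

      long-ends : ∀ {ws : List Vertex} {α γ : ℕ} → 2 ≤ length ws → (ws ≡ [] → α ≡ γ) × (length ws ≡ 1 → α ≢ γ)
      long-ends {[]} ()
      long-ends {_ ∷ []} (s≤s ())
      long-ends {_ ∷ _ ∷ _} _ = (λ ()) , λ ()

    -- One cycle forbids the colour 0 at v, the other forbids 1.
    module FigureEight v C D (pC : PathG v C v) (pD : PathG v D v) (u! : Unique (v ∷ C ++ D)) (lenC : 2 ≤ length C) (lenD : 2 ≤ length D) where

      scheme : Scheme
      scheme = record
        { Bs = (v , 0 , 1) ∷ []
        ; Ls = link v 0 1 C v 0 1 ∷ link v 1 0 D v 1 0 ∷ []
        ; unique = subst (λ l → Unique (v ∷ C ++ l)) (sym (++-identityʳ D)) u!
        ; small = λ { (here refl) → (s≤s z≤n , s≤s (s≤s z≤n)) , λ () }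
        ; links = λ { (here refl) → pC , inj₁ (here refl) , inj₁ (here refl) , long-ends lenC
                    ; (there (here refl)) → pD , inj₂ (here refl) , inj₂ (here refl) , long-ends lenD }
        ; unsat = λ φ from forbid → case-v φ (from (here refl)) (forbid (here refl)) (forbid (there (here refl)))
        }
        where
        case-v : ∀ φ → φ v ≡ 0 ⊎ φ v ≡ 1 → ¬ (φ v ≡ 0 × φ v ≡ 0) → ¬ (φ v ≡ 1 × φ v ≡ 1) → ⊥
        case-v φ (inj₁ e) f g = f (e , e)
        case-v φ (inj₂ e) f g = g (e , e)

      bad : BadAdapted
      bad = record { scheme = scheme ; adapted = λ { (here refl) → no-adapted-issue (link v 0 1 C v 0 1) lenC ; (there (here refl)) → no-adapted-issue (link v 1 0 D v 1 0) lenD } }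

      -- A triangle would give the same list to its two inner vertices.
      bad-separated : 3 ≤ length C → 3 ≤ length D → ¬ SepChoosable G 2
      bad-separated lC lD = Colourings.not-separable scheme
        (λ { (here refl) e → ⊥-elim (not-two lC e) ; (there (here refl)) e → ⊥-elim (not-two lD e) })
        (Colourings.small-from-pairs scheme (subst (AllPairs DiffAdj) (cong ((v , 0 , 1) ∷_) (sym (cong₂ _++_ (no-mid v 0 1 C v 0 1 lC) (cong₂ _++_ (no-mid v 1 0 D v 1 0 lD) refl)))) ([] ∷ [])))
        where
        not-two : ∀ {n} → 3 ≤ n → n ≢ 2
        not-two (s≤s (s≤s (s≤s _))) ()
        no-mid : ∀ x α o ws y γ o′ → 3 ≤ length ws → mid (link x α o ws y γ o′) ≡ []
        no-mid x α o (_ ∷ []) y γ o′ (s≤s ())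
        no-mid x α o (_ ∷ _ ∷ _) y γ o′ _ = refl

    module Dumbbell v C S t D (pC : PathG v C v) (pS : PathG v S t) (pD : PathG t D t) (u! : Unique (v ∷ t ∷ C ++ S ++ D))
      (lenC : 2 ≤ length C) (lenD : 2 ≤ length D) where

      -- The cycles leave v only the colour 1 and t only τ, and the path S forbids this combination.
      -- A direct link needs equal colours at its ends, a longer one takes different ones.
      τ : ℕ
      τ = if empty S then 1 else 2

      private
        τ-ends : ∀ (S : List Vertex) → (S ≡ [] → 1 ≡ (if empty S then 1 else 2)) × (length S ≡ 1 → 1 ≢ (if empty S then 1 else 2))
        τ-ends [] = (λ _ → refl) , λ ()
        τ-ends (_ ∷ _) = (λ ()) , λ _ ()
        τ-small : ∀ b → (if b then 1 else 2) < 8 × (if b then 1 else 2) ≢ 3 × (if b then 1 else 2) ≢ 0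
        τ-small true = s≤s (s≤s z≤n) , (λ ()) , λ ()
        τ-small false = s≤s (s≤s (s≤s z≤n)) , (λ ()) , λ ()

      scheme : Scheme
      scheme = record
        { Bs = (v , 0 , 1) ∷ (t , τ , 3) ∷ []
        ; Ls = link v 0 1 C v 0 1 ∷ link v 1 0 S t τ 3 ∷ link t 3 τ D t 3 τ ∷ []
        ; unique = subst (λ l → Unique (v ∷ t ∷ C ++ S ++ l)) (sym (++-identityʳ D)) u!
        ; small = λ { (here refl) → (s≤s z≤n , s≤s (s≤s z≤n)) , λ () ; (there (here refl)) → (proj₁ (τ-small (empty S)) , s≤s (s≤s (s≤s (s≤s z≤n)))) , proj₁ (proj₂ (τ-small (empty S))) }
        ; links = λ { (here refl) → pC , inj₁ (here refl) , inj₁ (here refl) , long-ends lenC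
                    ; (there (here refl)) → pS , inj₂ (here refl) , inj₁ (there (here refl)) , τ-ends S
                    ; (there (there (here refl))) → pD , inj₂ (there (here refl)) , inj₂ (there (here refl)) , long-ends lenD }
        ; unsat = λ φ from forbid → cases φ (from (here refl)) (from (there (here refl))) (forbid (here refl)) (forbid (there (here refl))) (forbid (there (there (here refl))))
        }
        where
        cases : ∀ φ → φ v ≡ 0 ⊎ φ v ≡ 1 → φ t ≡ τ ⊎ φ t ≡ 3 → ¬ (φ v ≡ 0 × φ v ≡ 0) → ¬ (φ v ≡ 1 × φ t ≡ τ) → ¬ (φ t ≡ 3 × φ t ≡ 3) → ⊥
        cases φ (inj₁ e) _ f g h = f (e , e)
        cases φ (inj₂ e) (inj₁ e′) f g h = g (e , e′)
        cases φ (inj₂ e) (inj₂ e′) f g h = h (e′ , e′)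

      bad : BadAdapted
      bad = record { scheme = scheme ; adapted = λ { (here refl) → no-adapted-issue (link v 0 1 C v 0 1) lenC
        ; (there (here refl)) → (λ _ → inj₁ λ ()) , λ _ → inj₁ (λ e → proj₂ (proj₂ (τ-small (empty S))) (sym e)) , inj₁ λ ()
        ; (there (there (here refl))) → no-adapted-issue (link t 3 τ D t 3 τ) lenD } }

      bad-separated : 3 ≤ length C → 3 ≤ length D → ¬ SepChoosable G 2
      bad-separated lC lD = Colourings.not-separable scheme
        (λ { (here refl) e → ⊥-elim (not-two lC e) ; (there (here refl)) e → two-S S e ; (there (there (here refl))) e → ⊥-elim (not-two lD e) })
        (Colourings.small-from-pairs scheme (AllPairs.map (λ d _ → d) (AllPairsₚ.map⁻ {R = Diff} {f = proj₂}
          (subst (AllPairs Diff) (sym (eq C S D lC lD)) (pairs S)))))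
        where
        not-two : ∀ {n} → 3 ≤ n → n ≢ 2
        not-two (s≤s (s≤s (s≤s _))) ()
        two-S : ∀ (S : List Vertex) → length S ≡ 2 → 1 ≢ (if empty S then 1 else 2)
        two-S (_ ∷ _) _ ()
        eq : ∀ C S D → 3 ≤ length C → 3 ≤ length D → map proj₂ ((v , 0 , 1) ∷ (t , (if empty S then 1 else 2) , 3) ∷
          mids (link v 0 1 C v 0 1 ∷ link v 1 0 S t (if empty S then 1 else 2) 3 ∷ link t 3 τ D t 3 τ ∷ []))
          ≡ (0 , 1) ∷ ((if empty S then 1 else 2) , 3) ∷ only (single S) (1 , 2)
        eq (_ ∷ _ ∷ _) [] (_ ∷ _ ∷ _) _ _ = refl
        eq (_ ∷ _ ∷ _) (_ ∷ []) (_ ∷ _ ∷ _) _ _ = refl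
        eq (_ ∷ _ ∷ _) (_ ∷ _ ∷ _) (_ ∷ _ ∷ _) _ _ = refl
        eq (_ ∷ []) _ _ (s≤s ()) _
        eq (_ ∷ _ ∷ _) [] (_ ∷ []) _ (s≤s ())
        eq (_ ∷ _ ∷ _) (_ ∷ []) (_ ∷ []) _ (s≤s ())
        eq (_ ∷ _ ∷ _) (_ ∷ _ ∷ _) (_ ∷ []) _ (s≤s ())
        pairs : ∀ (S : List Vertex) → AllPairs Diff ((0 , 1) ∷ ((if empty S then 1 else 2) , 3) ∷ only (single S) (1 , 2))
        pairs [] = all-different-sound _ refl
        pairs (_ ∷ []) = all-different-sound _ refl
        pairs (_ ∷ _ ∷ _) = all-different-sound _ refl

    module Quadruple u v P Q R W (pP : PathG u P v) (pQ : PathG u Q v) (pR : PathG u R v) (pW : PathG u W v)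
      (u! : Unique (u ∷ v ∷ P ++ Q ++ R ++ W)) (neQ : Q ≢ []) (neR : R ≢ []) (neW : W ≢ []) where

      -- The four paths forbid the four combinations of {0, 2} at u with {γ₀, 3} at v. If P is a
      -- single edge it can only forbid equal colours, hence γ₀ = 0.
      γ₀ : ℕ
      γ₀ = if empty P then 0 else 1

      private
        γ-ends : ∀ (P : List Vertex) → (P ≡ [] → 0 ≡ (if empty P then 0 else 1)) × (length P ≡ 1 → 0 ≢ (if empty P then 0 else 1))
        γ-ends [] = (λ _ → refl) , λ ()
        γ-ends (_ ∷ _) = (λ ()) , λ _ ()
        γ-facts : ∀ b → (if b then 0 else 1) < 8 × (if b then 0 else 1) ≢ 3 × (if b then 0 else 1) ≢ 2
        γ-facts true = s≤s z≤n , (λ ()) , λ ()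
        γ-facts false = s≤s (s≤s z≤n) , (λ ()) , λ ()
        γ<8 = proj₁ (γ-facts (empty P))
        γ≢3 = proj₁ (proj₂ (γ-facts (empty P)))
        γ≢2 = proj₂ (proj₂ (γ-facts (empty P)))
        2<8 : 2 < 8
        2<8 = s≤s (s≤s (s≤s z≤n))
        3<8 : 3 < 8
        3<8 = s≤s (s≤s (s≤s (s≤s z≤n)))

      scheme : Scheme
      scheme = record
        { Bs = (u , 0 , 2) ∷ (v , γ₀ , 3) ∷ []
        ; Ls = link u 0 2 P v γ₀ 3 ∷ link u 0 2 Q v 3 γ₀ ∷ link u 2 0 R v γ₀ 3 ∷ link u 2 0 W v 3 γ₀ ∷ []
        ; unique = subst (λ l → Unique (u ∷ v ∷ P ++ Q ++ R ++ l)) (sym (++-identityʳ W)) u!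
        ; small = λ { (here refl) → (s≤s z≤n , 2<8) , λ () ; (there (here refl)) → (γ<8 , 3<8) , γ≢3 }
        ; links = λ
            { (here refl) → pP , inj₁ (here refl) , inj₁ (there (here refl)) , γ-ends P
            ; (there (here refl)) → pQ , inj₁ (here refl) , inj₂ (there (here refl)) , (λ e → ⊥-elim (neQ e)) , λ _ ()
            ; (there (there (here refl))) → pR , inj₂ (here refl) , inj₁ (there (here refl)) , (λ e → ⊥-elim (neR e)) , λ _ e → γ≢2 (sym e)
            ; (there (there (there (here refl)))) → pW , inj₂ (here refl) , inj₂ (there (here refl)) , (λ e → ⊥-elim (neW e)) , λ _ () }
        ; unsat = λ φ from forbid → cases φ (from (here refl)) (from (there (here refl))) (forbid (here refl)) (forbid (there (here refl)))
            (forbid (there (there (here refl)))) (forbid (there (there (there (here refl)))))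
        }
        where
        cases : ∀ φ → φ u ≡ 0 ⊎ φ u ≡ 2 → φ v ≡ γ₀ ⊎ φ v ≡ 3 → ¬ (φ u ≡ 0 × φ v ≡ γ₀) → ¬ (φ u ≡ 0 × φ v ≡ 3) →
          ¬ (φ u ≡ 2 × φ v ≡ γ₀) → ¬ (φ u ≡ 2 × φ v ≡ 3) → ⊥
        cases φ (inj₁ e) (inj₁ e′) f g h i = f (e , e′)
        cases φ (inj₁ e) (inj₂ e′) f g h i = g (e , e′)
        cases φ (inj₂ e) (inj₁ e′) f g h i = h (e , e′)
        cases φ (inj₂ e) (inj₂ e′) f g h i = i (e , e′)

      bad : BadAdapted
      bad = record { scheme = scheme ; adapted = λ
        { (here refl) → (λ _ → inj₁ λ ()) , λ _ → inj₁ (λ e → γ≢2 (sym e)) , inj₁ λ ()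
        ; (there (here refl)) → (λ e → ⊥-elim (neQ e)) , λ _ → inj₁ (λ ()) , inj₂ z≤n
        ; (there (there (here refl))) → (λ e → ⊥-elim (neR e)) , λ _ → inj₂ z≤n , inj₁ λ ()
        ; (there (there (there (here refl)))) → (λ e → ⊥-elim (neW e)) , λ _ → inj₂ z≤n , inj₁ (λ e → γ≢2 (sym e)) } }

      -- When γ₀ = 0, a single inner vertex of Q would repeat the list {0, 3} of its neighbour v,
      -- and one of R the list {0, 2} of u.
      bad-separated : (P ≡ [] → single Q ≡ false × single R ≡ false × single W ≡ false) → ¬ SepChoosable G 2
      bad-separated par = Colourings.not-separable scheme
        (λ { (here refl) e → two-P P e ; (there (here refl)) _ () ; (there (there (here refl))) _ e → γ≢2 (sym e) ; (there (there (there (here refl)))) _ () })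
        (Colourings.small-from-pairs scheme (AllPairs.map (λ d _ → d) (AllPairsₚ.map⁻ {R = Diff} {f = proj₂}
          (subst (AllPairs Diff) (sym (cong (λ l → (0 , 2) ∷ (γ₀ , 3) ∷ l) mids-eq)) (pairs P par)))))
        where
        two-P : ∀ (P : List Vertex) → length P ≡ 2 → 0 ≢ (if empty P then 0 else 1)
        two-P (_ ∷ _) _ ()
        mid-eq : ∀ x α o ws y γ o′ → map proj₂ (mid (link x α o ws y γ o′)) ≡ only (single ws) (α , γ)
        mid-eq x α o [] y γ o′ = refl
        mid-eq x α o (_ ∷ []) y γ o′ = refl
        mid-eq x α o (_ ∷ _ ∷ _) y γ o′ = refl
        mids-eq : map proj₂ (mids (Scheme.Ls scheme)) ≡
          only (single P) (0 , γ₀) ++ only (single Q) (0 , 3) ++ only (single R) (2 , γ₀) ++ only (single W) (2 , 3) ++ []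
        mids-eq = trans (map-++ proj₂ (mid (link u 0 2 P v γ₀ 3)) _) (cong₂ _++_ (mid-eq u 0 2 P v γ₀ 3)
          (trans (map-++ proj₂ (mid (link u 0 2 Q v 3 γ₀)) _) (cong₂ _++_ (mid-eq u 0 2 Q v 3 γ₀)
          (trans (map-++ proj₂ (mid (link u 2 0 R v γ₀ 3)) _) (cong₂ _++_ (mid-eq u 2 0 R v γ₀ 3)
          (trans (map-++ proj₂ (mid (link u 2 0 W v 3 γ₀)) _) (cong₂ _++_ (mid-eq u 2 0 W v 3 γ₀) refl)))))))
        test : Vec Bool 4 → Bool
        test (p Vec.∷ q Vec.∷ r Vec.∷ w Vec.∷ Vec.[]) =
          all-different ((0 , 2) ∷ (1 , 3) ∷ only p (0 , 1) ++ only q (0 , 3) ++ only r (2 , 1) ++ only w (2 , 3) ++ [])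
        pairs : ∀ (P : List Vertex) → (P ≡ [] → single Q ≡ false × single R ≡ false × single W ≡ false) →
          AllPairs Diff ((0 , 2) ∷ ((if empty P then 0 else 1) , 3) ∷ only (single P) (0 , (if empty P then 0 else 1)) ++
            only (single Q) (0 , 3) ++ only (single R) (2 , (if empty P then 0 else 1)) ++ only (single W) (2 , 3) ++ [])
        pairs [] par rewrite proj₁ (par refl) | proj₁ (proj₂ (par refl)) | proj₂ (proj₂ (par refl)) = all-different-sound ((0 , 2) ∷ (0 , 3) ∷ []) refl
        pairs P@(_ ∷ _) par = all-different-sound _
          (everywhere-sound 4 test refl (single P Vec.∷ single Q Vec.∷ single R Vec.∷ single W Vec.∷ Vec.[]))

    record Tetra (a v b c : Vertex) (AV BC AB BV VC CA : List Vertex) : Set where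
      field
        pAV : Path a AV v
        pBC : Path b BC c
        pAB : Path a AB b
        pBV : Path b BV v
        pVC : Path v VC c
        pCA : Path c CA a
        unique : Unique (a ∷ v ∷ b ∷ c ∷ AV ++ BC ++ AB ++ BV ++ VC ++ CA)

      ρ : Vec (List Vertex) 10
      ρ = [ a ]′ Vec.∷ [ v ]′ Vec.∷ [ b ]′ Vec.∷ [ c ]′ Vec.∷ AV Vec.∷ BC Vec.∷ AB Vec.∷ BV Vec.∷ VC Vec.∷ CA Vec.∷ Vec.[]

    tetra-lists : Lists 10
    tetra-lists = $ (# 0) ⊕ $ (# 1) ⊕ $ (# 2) ⊕ $ (# 3) ⊕ $ (# 4) ⊕ $ (# 5) ⊕ $ (# 6) ⊕ $ (# 7) ⊕ $ (# 8) ⊕ $ (# 9)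

    module _ {a v b c AV BC AB BV VC CA} (t : Tetra a v b c AV BC AB BV VC CA) where
      open Tetra t

      -- Brings AB and VC into the position of the opposite pair left out of the 4-cycle; `relabel₃`
      -- does this for CA and BV.
      relabel₂ : Tetra a b v c AB VC AV (reverse BV) BC CA
      relabel₂ = record { pAV = pAB ; pBC = pVC ; pAB = pAV ; pBV = path-reverse BV pBV ; pVC = pBC ; pCA = pCA
        ; unique = rearrange tetra-lists ($ (# 0) ⊕ $ (# 2) ⊕ $ (# 1) ⊕ $ (# 3) ⊕ $ (# 6) ⊕ $ (# 8) ⊕ $ (# 4) ⊕ rev ($ (# 7)) ⊕ $ (# 5) ⊕ $ (# 9)) ρ _ unique }

      relabel₃ : Tetra a c b v (reverse CA) BV AB BC (reverse VC) (reverse AV)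
      relabel₃ = record { pAV = path-reverse CA pCA ; pBC = pBV ; pAB = pAB ; pBV = pBC ; pVC = path-reverse VC pVC ; pCA = path-reverse AV pAV
        ; unique = rearrange tetra-lists ($ (# 0) ⊕ $ (# 3) ⊕ $ (# 2) ⊕ $ (# 1) ⊕ rev ($ (# 9)) ⊕ $ (# 7) ⊕ $ (# 6) ⊕ $ (# 5) ⊕ rev ($ (# 8)) ⊕ rev ($ (# 4))) ρ _ unique }

      -- Swaps the ends of the first link. Together with the relabellings, it brings any branch
      -- vertex to the first place.
      exchange : Tetra v a b c (reverse AV) BC (reverse BV) (reverse AB) (reverse CA) (reverse VC)
      exchange = record { pAV = path-reverse AV pAV ; pBC = pBC ; pAB = path-reverse BV pBV ; pBV = path-reverse AB pAB
        ; pVC = path-reverse CA pCA ; pCA = path-reverse VC pVC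
        ; unique = rearrange tetra-lists ($ (# 1) ⊕ $ (# 0) ⊕ $ (# 2) ⊕ $ (# 3) ⊕ rev ($ (# 4)) ⊕ $ (# 5) ⊕ rev ($ (# 7)) ⊕ rev ($ (# 6)) ⊕ rev ($ (# 9)) ⊕ rev ($ (# 8))) ρ _ unique }

    module TetraScheme {a v b c AV BC AB BV VC CA} (t : Tetra a v b c AV BC AB BV VC CA)
      (ok : consistent (empty AV) (empty BC) (empty AB) (empty BV) (empty VC) (empty CA) ≡ true) where
      open Tetra t
      open Names (tetra-names (empty AV) (empty BC) (empty AB) (empty BV) (empty VC) (empty CA))

      private
        y-match : ∀ b → matches b 4 (if b then 4 else 5) ≡ true
        y-match true = refl
        y-match false = refl
        w-match : ∀ b → matches b 6 (if b then 6 else 7) ≡ true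
        w-match true = refl
        w-match false = refl
        y-cases : ∀ b → (if b then 4 else 5) ≡ 4 ⊎ (if b then 4 else 5) ≡ 5
        y-cases true = inj₁ refl
        y-cases false = inj₂ refl
        w-cases : ∀ b → (if b then 6 else 7) ≡ 6 ⊎ (if b then 6 else 7) ≡ 7
        w-cases true = inj₁ refl
        w-cases false = inj₂ refl

        mAB : matches (empty AB) xa xb ≡ true
        mAB = ∧-left ok
        mBV : matches (empty BV) xb xv ≡ true
        mBV = ∧-left (∧-right {matches (empty AB) xa xb} ok)
        mVC : matches (empty VC) xv xc ≡ true
        mVC = ∧-left (∧-right {matches (empty BV) xb xv} (∧-right {matches (empty AB) xa xb} ok))
        mCA : matches (empty CA) xc xa ≡ true
        mCA = ∧-right {matches (empty VC) xv xc} (∧-right {matches (empty BV) xb xv} (∧-right {matches (empty AB) xa xb} ok))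

        x<4 : (i : Fin 4) → toℕ i < 4
        x<4 = Finₚ.toℕ<n

        xa< : xa < 4
        xa< = x<4 _
        xb< : xb < 4
        xb< = x<4 _
        xv< : xv < 4
        xv< = x<4 _
        xc< : xc < 4
        xc< = x<4 _

        <4⇒<8 : ∀ {x} → x < 4 → x < 8
        <4⇒<8 p = ℕₚ.≤-trans p (ℕₚ.m≤m+n 4 4)

        y≢x : ∀ {x} → x < 4 → yv ≢ x
        y≢x p e with y-cases (empty AV)
        ... | inj₁ f = <4⇒≢ 0 p (trans (sym e) f)
        ... | inj₂ f = <4⇒≢ 1 p (trans (sym e) f)
        w≢x : ∀ {x} → x < 4 → wc ≢ x
        w≢x p e with w-cases (empty BC)
        ... | inj₁ f = <4⇒≢ 2 p (trans (sym e) f)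
        ... | inj₂ f = <4⇒≢ 3 p (trans (sym e) f)
        y<8 : yv < 8
        y<8 with y-cases (empty AV)
        ... | inj₁ f = subst (_< 8) (sym f) (ℕₚ.m≤m+n 5 3)
        ... | inj₂ f = subst (_< 8) (sym f) (ℕₚ.m≤m+n 6 2)
        w<8 : wc < 8
        w<8 with w-cases (empty BC)
        ... | inj₁ f = subst (_< 8) (sym f) (ℕₚ.m≤m+n 7 1)
        ... | inj₂ f = subst (_< 8) (sym f) ℕₚ.≤-refl
        y≢w : yv ≢ wc
        y≢w e with y-cases (empty AV) | w-cases (empty BC)
        ... | inj₁ f | inj₁ g with trans (sym f) (trans e g)
        ...   | ()
        y≢w e | inj₁ f | inj₂ g with trans (sym f) (trans e g)
        ...   | ()
        y≢w e | inj₂ f | inj₁ g with trans (sym f) (trans e g)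
        ...   | ()
        y≢w e | inj₂ f | inj₂ g with trans (sym f) (trans e g)
        ...   | ()
        y≢6 : yv ≢ 6
        y≢6 e with y-cases (empty AV)
        ... | inj₁ f with trans (sym f) e
        ...   | ()
        y≢6 e | inj₂ f with trans (sym f) e
        ...   | ()
        w≢4 : wc ≢ 4
        w≢4 e with w-cases (empty BC)
        ... | inj₁ f with trans (sym f) e
        ...   | ()
        w≢4 e | inj₂ f with trans (sym f) e
        ...   | ()

      links : List Link
      links = link a 4 xa AV v yv xv ∷ link b 6 xb BC c wc xc ∷ link a xa 4 AB b xb 6 ∷ link b xb 6 BV v xv yv ∷
        link v xv yv VC c xc wc ∷ link c xc wc CA a xa 4 ∷ []

      branches : List Entry
      branches = (a , 4 , xa) ∷ (v , yv , xv) ∷ (b , 6 , xb) ∷ (c , wc , xc) ∷ []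

      scheme : Scheme
      scheme = record
        { Bs = branches ; Ls = links
        ; unique = subst (λ l → Unique (a ∷ v ∷ b ∷ c ∷ AV ++ BC ++ AB ++ BV ++ VC ++ l)) (sym (++-identityʳ CA)) unique
        ; small = λ { (here refl) → (ℕₚ.m≤m+n 5 3 , <4⇒<8 xa<) , λ e → <4⇒≢ 0 xa< (sym e)
                    ; (there (here refl)) → (y<8 , <4⇒<8 xv<) , y≢x xv<
                    ; (there (there (here refl))) → (ℕₚ.m≤m+n 7 1 , <4⇒<8 xb<) , λ e → <4⇒≢ 2 xb< (sym e)
                    ; (there (there (there (here refl)))) → (w<8 , <4⇒<8 xc<) , w≢x xc< }
        ; links = λ
            { (here refl) → on-G a AV v pAV , inj₁ A , inj₁ V , matches-direct AV (y-match (empty AV))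
            ; (there (here refl)) → on-G b BC c pBC , inj₁ B′ , inj₁ C , matches-direct BC (w-match (empty BC))
            ; (there (there (here refl))) → on-G a AB b pAB , inj₂ A , inj₂ B′ , matches-direct AB mAB
            ; (there (there (there (here refl)))) → on-G b BV v pBV , inj₂ B′ , inj₂ V , matches-direct BV mBV
            ; (there (there (there (there (here refl))))) → on-G v VC c pVC , inj₂ V , inj₂ C , matches-direct VC mVC
            ; (there (there (there (there (there (here refl)))))) → on-G c CA a pCA , inj₂ C , inj₂ A , matches-direct CA mCA }
        ; unsat = λ φ from forbid → cases φ (from A) (from V) (from B′) (from C) (forbid (here refl)) (forbid (there (here refl)))
            (forbid (there (there (here refl)))) (forbid (there (there (there (here refl))))) (forbid (there (there (there (there (here refl))))))
            (forbid (there (there (there (there (there (here refl)))))))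
        }
        where
        A : (a , 4 , xa) ∈ branches
        A = here refl
        V : (v , yv , xv) ∈ branches
        V = there (here refl)
        B′ : (b , 6 , xb) ∈ branches
        B′ = there (there (here refl))
        C : (c , wc , xc) ∈ branches
        C = there (there (there (here refl)))
        cases : ∀ φ → φ a ≡ 4 ⊎ φ a ≡ xa → φ v ≡ yv ⊎ φ v ≡ xv → φ b ≡ 6 ⊎ φ b ≡ xb → φ c ≡ wc ⊎ φ c ≡ xc →
          ¬ (φ a ≡ 4 × φ v ≡ yv) → ¬ (φ b ≡ 6 × φ c ≡ wc) → ¬ (φ a ≡ xa × φ b ≡ xb) → ¬ (φ b ≡ xb × φ v ≡ xv) →
          ¬ (φ v ≡ xv × φ c ≡ xc) → ¬ (φ c ≡ xc × φ a ≡ xa) → ⊥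
        cases φ (inj₁ p) (inj₁ q) _ _ f g h i j k = f (p , q)
        cases φ (inj₁ p) (inj₂ q) (inj₂ r) _ f g h i j k = i (r , q)
        cases φ (inj₁ p) (inj₂ q) (inj₁ r) (inj₂ s) f g h i j k = j (q , s)
        cases φ (inj₁ p) (inj₂ q) (inj₁ r) (inj₁ s) f g h i j k = g (r , s)
        cases φ (inj₂ p) _ (inj₂ r) _ f g h i j k = h (p , r)
        cases φ (inj₂ p) _ (inj₁ r) (inj₂ s) f g h i j k = k (s , p)
        cases φ (inj₂ p) _ (inj₁ r) (inj₁ s) f g h i j k = g (r , s)

      bad : BadAdapted
      bad = record { scheme = scheme ; adapted = λ
        { (here refl) → (λ _ → inj₂ (ℕₚ.<⇒≤ xa<)) , λ _ → inj₂ (ℕₚ.<⇒≤ xa<) , inj₁ (λ e → <4⇒≢ 0 xv< (sym e))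
        ; (there (here refl)) → (λ _ → inj₂ (ℕₚ.≤-trans (ℕₚ.<⇒≤ xb<) (ℕₚ.m≤m+n 4 2))) , λ _ → inj₂ (ℕₚ.≤-trans (ℕₚ.<⇒≤ xb<) (ℕₚ.m≤m+n 4 2)) , inj₁ (λ e → <4⇒≢ 2 xc< (sym e))
        ; (there (there (here refl))) → (λ _ → inj₁ λ ()) , λ _ → inj₁ (λ e → <4⇒≢ 0 xb< (sym e)) , inj₁ (<4⇒≢ 2 xa<)
        ; (there (there (there (here refl)))) → (λ _ → inj₁ (y≢6 ∘ sym)) , λ _ → inj₁ (λ e → <4⇒≢ 2 xv< (sym e)) , inj₁ (y≢x xb< ∘ sym)
        ; (there (there (there (there (here refl))))) → (λ _ → inj₁ y≢w) , λ _ → inj₁ (y≢x xc<) , inj₁ (w≢x xv< ∘ sym)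
        ; (there (there (there (there (there (here refl)))))) → (λ _ → inj₁ w≢4) , λ _ → inj₁ (w≢x xa<) , inj₁ (<4⇒≢ 0 xc<) } }

      not-two : ∀ {l} → l ∈ links → length (Link.inner l) ≡ 2 → Link.α l ≢ Link.γ l
      not-two (here refl) = matches-nonempty AV (y-match (empty AV))
      not-two (there (here refl)) = matches-nonempty BC (w-match (empty BC))
      not-two (there (there (here refl))) = matches-nonempty AB mAB
      not-two (there (there (there (here refl)))) = matches-nonempty BV mBV
      not-two (there (there (there (there (here refl))))) = matches-nonempty VC mVC
      not-two (there (there (there (there (there (here refl)))))) = matches-nonempty CA mCA

      bad-separated : AllPairs DiffAdj (branches ++ mids links) → ¬ SepChoosable G 2
      bad-separated ps = Colourings.not-separable scheme not-two (Colourings.small-from-pairs scheme ps)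

      pairs-eq : map proj₂ (branches ++ mids links) ≡ small-pairs (tetra-names (empty AV) (empty BC) (empty AB) (empty BV) (empty VC) (empty CA))
        (single AV) (single BC) (single AB) (single BV) (single VC) (single CA)
      pairs-eq = cong (λ l → (4 , xa) ∷ (yv , xv) ∷ (6 , xb) ∷ (wc , xc) ∷ l) (go links)
        where
        expected : List Link → List Pair
        expected [] = []
        expected (l ∷ ls) = only (single (Link.inner l)) (Link.α l , Link.γ l) ++ expected ls
        one : ∀ l → map proj₂ (mid l) ≡ only (single (Link.inner l)) (Link.α l , Link.γ l)
        one (link _ _ _ [] _ _ _) = refl
        one (link _ _ _ (_ ∷ []) _ _ _) = refl
        one (link _ _ _ (_ ∷ _ ∷ _) _ _ _) = refl
        go : ∀ ls → map proj₂ (mids ls) ≡ expected ls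
        go [] = refl
        go (l ∷ ls) = trans (map-++ proj₂ (mid l) (mids ls)) (cong₂ _++_ (one l) (go ls))

    empties singles : List Vertex → List Vertex → List Vertex → List Vertex → List Vertex → List Vertex → Flags
    empties AV BC AB BV VC CA = empty AV Vec.∷ empty BC Vec.∷ empty AB Vec.∷ empty BV Vec.∷ empty VC Vec.∷ empty CA Vec.∷ Vec.[]
    singles AV BC AB BV VC CA = single AV Vec.∷ single BC Vec.∷ single AB Vec.∷ single BV Vec.∷ single VC Vec.∷ single CA Vec.∷ Vec.[]

    tetra-bad : ∀ {a v b c AV BC AB BV VC CA} → Tetra a v b c AV BC AB BV VC CA → BadAdapted
    tetra-bad {AV = AV} {BC} {AB} {BV} {VC} {CA} t with some-consistent (empties AV BC AB BV VC CA)
    ... | inj₁ ok = TetraScheme.bad t ok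
    ... | inj₂ (inj₁ ok) = TetraScheme.bad (relabel₂ t) (trans (cong (λ e → consistent (empty AB) (empty VC) (empty AV) e (empty BC) (empty CA)) (empty-reverse BV)) ok)
    ... | inj₂ (inj₂ ok) = TetraScheme.bad (relabel₃ t) (trans (cong₂ (λ e f → consistent e (empty BV) (empty AB) (empty BC) f (empty (reverse AV))) (empty-reverse CA) (empty-reverse VC))
        (trans (cong (consistent (empty CA) (empty BV) (empty AB) (empty BC) (empty VC)) (empty-reverse AV)) ok))

    config-bad : Config → BadAdapted
    config-bad (figure-eight v C D pC pD u! lC lD) = FigureEight.bad v C D (on-G v C v pC) (on-G v D v pD) u! lC lD
    config-bad (dumbbell v C S t D pC pS pD u! lC lD) = Dumbbell.bad v C S t D (on-G v C v pC) (on-G v S t pS) (on-G t D t pD) u! lC lD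
    config-bad (quadruple u v P Q R W pP pQ pR pW u! q r w) =
      Quadruple.bad u v P Q R W (on-G u P v pP) (on-G u Q v pQ) (on-G u R v pR) (on-G u W v pW) u! q r w
    config-bad (tetrahedron a v b c AV BC AB BV VC CA p q r s t u u!) =
      tetra-bad (record { pAV = p ; pBC = q ; pAB = r ; pBV = s ; pVC = t ; pCA = u ; unique = u! })

    module Bipartite (side : Vertex → Bool) (bipartite : ∀ {x y} → B x y ≡ true → side x xor side y ≡ true) where

      even : ℕ → Bool
      even zero    = true
      even (suc n) = not (even n)

      private
        xor-trans : ∀ a b c → (a xor b) xor (b xor c) ≡ a xor c
        xor-trans true true c = refl
        xor-trans true false c = refl
        xor-trans false true true = refl
        xor-trans false true false = refl
        xor-trans false false c = refl

        xor-self : ∀ a → a xor a ≡ false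
        xor-self true = refl
        xor-self false = refl

        xor-sym : ∀ a b → a xor b ≡ b xor a
        xor-sym true true = refl
        xor-sym true false = refl
        xor-sym false true = refl
        xor-sym false false = refl

      -- A path has one more edge than inner vertices and changes sides at every edge.
      parity : ∀ x ws y → Path x ws y → side x xor side y ≡ even (length ws)
      parity x [] y a = bipartite a
      parity x (w ∷ ws) y (a , p) = trans (sym (xor-trans (side x) (side w) (side y))) (cong₂ _xor_ (bipartite a) (parity w ws y p))

      closed-long : ∀ v C → Path v C v → 2 ≤ length C → 3 ≤ length C
      closed-long v (_ ∷ []) p (s≤s ())
      closed-long v (_ ∷ _ ∷ _ ∷ _) p _ = s≤s (s≤s (s≤s z≤n))
      closed-long v C@(_ ∷ _ ∷ []) p _ = ⊥-elim (true≢false (trans (sym (parity v C v p)) (xor-self (side v))))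

      mark : Bool → List Vertex → Bool
      mark o ws = if o then empty ws else single ws

      empty-mark : ∀ x ws y → Path x ws y → (side x xor side y) ∧ mark (side x xor side y) ws ≡ empty ws
      empty-mark x ws y p with side x xor side y | parity x ws y p
      ... | true  | _ = refl
      empty-mark x (_ ∷ _) y p | false | _ = refl

      single-mark : ∀ x ws y → Path x ws y → not (side x xor side y) ∧ mark (side x xor side y) ws ≡ single ws
      single-mark x ws y p with side x xor side y | parity x ws y p
      ... | false | _ = refl
      single-mark x [] y p | true | _ = refl
      single-mark x (_ ∷ _ ∷ _) y p | true | _ = refl

      flags-≡ : ∀ {p q r s t u p′ q′ r′ s′ t′ u′ : Bool} → p ≡ p′ → q ≡ q′ → r ≡ r′ → s ≡ s′ → t ≡ t′ → u ≡ u′ →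
        _≡_ {A = Flags} (p Vec.∷ q Vec.∷ r Vec.∷ s Vec.∷ t Vec.∷ u Vec.∷ Vec.[]) (p′ Vec.∷ q′ Vec.∷ r′ Vec.∷ s′ Vec.∷ t′ Vec.∷ u′ Vec.∷ Vec.[])
      flags-≡ refl refl refl refl refl refl = refl

      separated-bad : ∀ {a v b c AV BC AB BV VC CA} → Tetra a v b c AV BC AB BV VC CA →
        ∀ {d s} → d ≡ empties AV BC AB BV VC CA → s ≡ singles AV BC AB BV VC CA → separated′ d s ≡ true → ¬ SepChoosable G 2
      separated-bad {AV = AV} {BC} {AB} {BV} {VC} {CA} t refl refl e = TetraScheme.bad-separated t (∧-left e)
        (AllPairs.map (λ d _ → d) (AllPairsₚ.map⁻ {R = Diff} {f = proj₂} (subst (AllPairs Diff) (sym (TetraScheme.pairs-eq t (∧-left e)))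
          (all-different-sound _ (∧-right {consistent (empty AV) (empty BC) (empty AB) (empty BV) (empty VC) (empty CA)} e)))))

      Marked : Vertex → List Vertex → Vertex → Set
      Marked x ws y = mark (side x xor side y) ws ≡ true

      marked-reverse : ∀ x ws y → Marked x ws y → Marked y (reverse ws) x
      marked-reverse x ws y e rewrite xor-sym (side y) (side x) with side x xor side y
      ... | true = trans (empty-reverse ws) e
      ... | false = trans (single-reverse ws) e

      record AllMarked (a v b c : Vertex) (AV BC AB BV VC CA : List Vertex) : Set where
        field
          mAV : Marked a AV v
          mBC : Marked b BC c
          mAB : Marked a AB b
          mBV : Marked b BV v
          mVC : Marked v VC c
          mCA : Marked c CA a

      -- The cube minus a vertex, with m₁, m₂, m₃ the neighbours of the missing one.
      module _ {a v b c m₁ m₂ m₃} (t : Tetra a v b c [] (m₃ ∷ []) [] (m₁ ∷ []) (m₂ ∷ []) []) where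
        open Tetra t

        apart-bad : adj m₁ m₂ ≡ false → ¬ SepChoosable G 2
        apart-bad apart = TetraScheme.bad-separated t refl
         ((D e1 e2 refl ∷ D e1 e3 refl ∷ D e1 e4 refl ∷ D e1 e5 refl ∷ D e1 e6 refl ∷ D e1 e7 refl ∷ []) ∷
          (D e2 e3 refl ∷ D e2 e4 refl ∷ D e2 e5 refl ∷ D e2 e6 refl ∷ D e2 e7 refl ∷ []) ∷
          (D e3 e4 refl ∷ D e3 e5 refl ∷ D e3 e6 refl ∷ D e3 e7 refl ∷ []) ∷
          (D e4 e5 refl ∷ D e4 e6 refl ∷ D e4 e7 refl ∷ []) ∷
          (D e5 e6 refl ∷ D e5 e7 refl ∷ []) ∷
          -- Here m₁ and m₂ both have the list {0, 2}, which is harmless only because they are not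
          -- adjacent in G.
          ((λ m → ⊥-elim (true≢false (trans (sym m) apart))) ∷ []) ∷
          [] ∷
          [])
          where
          e1 = (a , 4 , 0)
          e2 = (v , 4 , 2)
          e3 = (b , 6 , 0)
          e4 = (c , 7 , 0)
          e5 = (m₃ , 6 , 7)
          e6 = (m₁ , 0 , 2)
          e7 = (m₂ , 2 , 0)
          D : ∀ (e f : Entry) → not (same (proj₂ e) (proj₂ f)) ≡ true → DiffAdj e f
          D (_ , p) (_ , q) e _ = diff-sound p q e

        -- The edges among the m's lie outside the bipartite subgraph. With two of them, the
        -- 4-cycles m₁ b a v and m₁ m₂ c m₃ share only m₁.
        triangle-bad : adj m₁ m₂ ≡ true → adj m₃ m₁ ≡ true → ¬ SepChoosable G 2
        triangle-bad m₁m₂ m₃m₁ = FigureEight.bad-separated m₁ (b ∷ a ∷ v ∷ []) (m₂ ∷ c ∷ m₃ ∷ [])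
          (trans (adj-sym m₁ b) (B⊆ (proj₁ pBV)) , trans (adj-sym b a) (B⊆ pAB) , B⊆ pAV , trans (adj-sym v m₁) (B⊆ (proj₂ pBV)))
          (m₁m₂ , B⊆ (proj₂ pVC) , trans (adj-sym c m₃) (B⊆ (proj₂ pBC)) , m₃m₁)
          (rearrange ($ (# 0) ⊕ $ (# 1) ⊕ $ (# 2) ⊕ $ (# 3) ⊕ $ (# 4) ⊕ $ (# 5) ⊕ $ (# 6)) ($ (# 5) ⊕ ($ (# 2) ⊕ $ (# 0) ⊕ $ (# 1)) ⊕ $ (# 6) ⊕ $ (# 3) ⊕ $ (# 4))
            ([ a ]′ Vec.∷ [ v ]′ Vec.∷ [ b ]′ Vec.∷ [ c ]′ Vec.∷ [ m₃ ]′ Vec.∷ [ m₁ ]′ Vec.∷ [ m₂ ]′ Vec.∷ Vec.[]) _ unique)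
          (s≤s (s≤s z≤n)) (s≤s (s≤s z≤n)) (s≤s (s≤s (s≤s z≤n))) (s≤s (s≤s (s≤s z≤n)))

      -- If m₁ is not adjacent to m₂ or to m₃, the 4-cycle is chosen so that the equal lists fall on
      -- such a pair.
      cube-bad : ∀ {a v b c m₁ m₂ m₃} → Tetra a v b c [] (m₃ ∷ []) [] (m₁ ∷ []) (m₂ ∷ []) [] → ¬ SepChoosable G 2
      cube-bad {m₁ = m₁} {m₂} {m₃} t with adj m₁ m₂ in e₁₂ | adj m₁ m₃ in e₁₃
      ... | false | _ = apart-bad t e₁₂
      ... | true | false = apart-bad (relabel₂ t) e₁₃
      ... | true | true = triangle-bad t e₁₂ (trans (adj-sym m₃ m₁) e₁₃)

      lonely-bad : ∀ {a v b c AV BC AB BV VC CA} → Tetra a v b c AV BC AB BV VC CA → AllMarked a v b c AV BC AB BV VC CA →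
        side a xor side v ≡ true → side a xor side b ≡ true → side a xor side c ≡ true → ¬ SepChoosable G 2
      lonely-bad {a} {v} {b} {c} {AV} {BC} {AB} {BV} {VC} {CA} t m av ab ac =
        shapes (direct AV (side a) (side v) mAV av) (direct AB (side a) (side b) mAB ab) (direct CA (side c) (side a) mCA (trans (xor-sym (side c) (side a)) ac))
          (one BC (side b) (side c) mBC (peer (side a) ab ac)) (one BV (side b) (side v) mBV (peer (side a) ab av)) (one VC (side v) (side c) mVC (peer (side a) av ac))
        where
        open AllMarked m
        peer : ∀ s {t u} → s xor t ≡ true → s xor u ≡ true → t xor u ≡ false
        peer true {false} {false} _ _ = refl
        peer false {true} {true} _ _ = refl
        direct : ∀ ws s t → mark (s xor t) ws ≡ true → s xor t ≡ true → ws ≡ []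
        direct ws s t m e rewrite e with ws
        ... | [] = refl
        one : ∀ ws s t → mark (s xor t) ws ≡ true → s xor t ≡ false → ∃[ w ] ws ≡ w ∷ []
        one ws s t m e rewrite e with ws
        ... | w ∷ [] = w , refl
        shapes : AV ≡ [] → AB ≡ [] → CA ≡ [] → ∃[ m₃ ] BC ≡ m₃ ∷ [] → ∃[ m₁ ] BV ≡ m₁ ∷ [] → ∃[ m₂ ] VC ≡ m₂ ∷ [] → ¬ SepChoosable G 2
        shapes refl refl refl (_ , refl) (_ , refl) (_ , refl) = cube-bad t

      exchange-marked : ∀ {a v b c AV BC AB BV VC CA} → AllMarked a v b c AV BC AB BV VC CA →
        AllMarked v a b c (reverse AV) BC (reverse BV) (reverse AB) (reverse CA) (reverse VC)
      exchange-marked {a} {v} {b} {c} {AV} {BC} {AB} {BV} {VC} {CA} m = record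
        { mAV = marked-reverse a AV v mAV ; mBC = mBC ; mAB = marked-reverse b BV v mBV ; mBV = marked-reverse a AB b mAB
        ; mVC = marked-reverse c CA a mCA ; mCA = marked-reverse v VC c mVC }
        where open AllMarked m

      tetra-separated : ∀ {a v b c AV BC AB BV VC CA} → Tetra a v b c AV BC AB BV VC CA → ¬ SepChoosable G 2
      tetra-separated {a} {v} {b} {c} {AV} {BC} {AB} {BV} {VC} {CA} t = first (some-separated (side a) (side v) (side b) (side c) m)
        where
        open Tetra t
        m D₀ S₀ : Flags
        m = mark (side a xor side v) AV Vec.∷ mark (side b xor side c) BC Vec.∷ mark (side a xor side b) AB Vec.∷
            mark (side b xor side v) BV Vec.∷ mark (side v xor side c) VC Vec.∷ mark (side c xor side a) CA Vec.∷ Vec.[]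
        D₀ = direct-flags (side a) (side v) (side b) (side c) m
        S₀ = single-flags (side a) (side v) (side b) (side c) m
        D₀≡ : D₀ ≡ empties AV BC AB BV VC CA
        D₀≡ = flags-≡ (empty-mark a AV v pAV) (empty-mark b BC c pBC) (empty-mark a AB b pAB) (empty-mark b BV v pBV) (empty-mark v VC c pVC) (empty-mark c CA a pCA)
        S₀≡ : S₀ ≡ singles AV BC AB BV VC CA
        S₀≡ = flags-≡ (single-mark a AV v pAV) (single-mark b BC c pBC) (single-mark a AB b pAB) (single-mark b BV v pBV) (single-mark v VC c pVC) (single-mark c CA a pCA)
        last : Vec.foldr (λ _ → Bool) _∧_ true m ≡ true → AllMarked a v b c AV BC AB BV VC CA
        last e = record { mAV = ∧-left e ; mBC = ∧-left e₁ ; mAB = ∧-left e₂ ; mBV = ∧-left e₃ ; mVC = ∧-left e₄ ; mCA = ∧-left (∧-right {mark (side v xor side c) VC} e₄) }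
          where
          e₁ = ∧-right {mark (side a xor side v) AV} e
          e₂ = ∧-right {mark (side b xor side c) BC} e₁
          e₃ = ∧-right {mark (side a xor side b) AB} e₂
          e₄ = ∧-right {mark (side b xor side v) BV} e₃
        lonely-parts : ∀ o p q r → lonely o p q r ≡ true → o xor p ≡ true × o xor q ≡ true × o xor r ≡ true
        lonely-parts o p q r e = ∧-left e , ∧-left (∧-right {o xor p} e) , ∧-right {o xor q} (∧-right {o xor p} e)
        second-t = relabel₂ t
        third-t = relabel₃ t
        -- Brings the lonely branch vertex to the first place, where `lonely-bad` expects it.
        centre : AllMarked a v b c AV BC AB BV VC CA →
          lonely (side a) (side v) (side b) (side c) ∨ lonely (side v) (side a) (side b) (side c) ∨
          lonely (side b) (side a) (side v) (side c) ∨ lonely (side c) (side a) (side v) (side b) ≡ true → ¬ SepChoosable G 2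
        centre am e with ∨-split (lonely (side a) (side v) (side b) (side c)) e
        ... | inj₁ l = let (p , q , r) = lonely-parts (side a) (side v) (side b) (side c) l in lonely-bad t am p q r
        ... | inj₂ e′ with ∨-split (lonely (side v) (side a) (side b) (side c)) e′
        ...   | inj₁ l = let (p , q , r) = lonely-parts (side v) (side a) (side b) (side c) l in lonely-bad (exchange t) (exchange-marked am) p q r
        ...   | inj₂ e″ with ∨-split (lonely (side b) (side a) (side v) (side c)) e″
        ...     | inj₁ l = let (p , q , r) = lonely-parts (side b) (side a) (side v) (side c) l in lonely-bad (exchange second-t) (exchange-marked (record
                  { mAV = mAB ; mBC = mVC ; mAB = mAV ; mBV = marked-reverse b BV v mBV ; mVC = mBC ; mCA = mCA })) p q r
                  where open AllMarked am
        ...     | inj₂ l = let (p , q , r) = lonely-parts (side c) (side a) (side v) (side b) l in lonely-bad (exchange third-t) (exchange-marked (record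
                  { mAV = marked-reverse c CA a mCA ; mBC = mBV ; mAB = mAB ; mBV = mBC ; mVC = marked-reverse v VC c mVC ; mCA = marked-reverse a AV v mAV })) p r q
                  where open AllMarked am
        first : some-separated? (side a) (side v) (side b) (side c) m ≡ true → ¬ SepChoosable G 2
        first e with ∨-split (separated′ D₀ S₀) e
        ... | inj₁ f = separated-bad t D₀≡ S₀≡ f
        ... | inj₂ e′ with ∨-split (separated′ (second D₀) (second S₀)) e′
        ...   | inj₁ f = separated-bad second-t (trans (cong second D₀≡) (flags-≡ refl refl refl (sym (empty-reverse BV)) refl refl))
                  (trans (cong second S₀≡) (flags-≡ refl refl refl (sym (single-reverse BV)) refl refl)) f
        ...   | inj₂ e″ with ∨-split (separated′ (third D₀) (third S₀)) e″
        ...     | inj₁ f = separated-bad third-t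
                  (trans (cong third D₀≡) (flags-≡ (sym (empty-reverse CA)) refl refl refl (sym (empty-reverse VC)) (sym (empty-reverse AV))))
                  (trans (cong third S₀≡) (flags-≡ (sym (single-reverse CA)) refl refl refl (sym (single-reverse VC)) (sym (single-reverse AV)))) f
        ...     | inj₂ f = centre (last (∧-left f)) (∧-right {Vec.foldr (λ _ → Bool) _∧_ true m} f)

      config-separated : Config → ¬ SepChoosable G 2
      config-separated (figure-eight v C D pC pD u! lC lD) =
        FigureEight.bad-separated v C D (on-G v C v pC) (on-G v D v pD) u! lC lD (closed-long v C pC lC) (closed-long v D pD lD)
      config-separated (dumbbell v C S t D pC pS pD u! lC lD) =
        Dumbbell.bad-separated v C S t D (on-G v C v pC) (on-G v S t pS) (on-G t D t pD) u! lC lD (closed-long v C pC lC) (closed-long t D pD lD)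
      config-separated (quadruple u v P Q R W pP pQ pR pW u! q r w) =
        -- If P is a single edge, u and v lie on opposite sides, and no other path between them has
        -- just one inner vertex.
        Quadruple.bad-separated u v P Q R W (on-G u P v pP) (on-G u Q v pQ) (on-G u R v pR) (on-G u W v pW) u! q r w λ { refl →
          not-single Q pQ (bipartite pP) , not-single R pR (bipartite pP) , not-single W pW (bipartite pP) }
        where
        not-single : ∀ ws → Path u ws v → side u xor side v ≡ true → single ws ≡ false
        not-single [] _ _ = refl
        not-single ws@(_ ∷ []) p e = ⊥-elim (true≢false (trans (sym e) (parity u ws v p)))
        not-single (_ ∷ _ ∷ _) _ _ = refl
      config-separated (tetrahedron a v b c AV BC AB BV VC CA p q r s t u u!) =
        tetra-separated (record { pAV = p ; pBC = q ; pAB = r ; pBV = s ; pVC = t ; pCA = u ; unique = u! })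

-- Graphs without the four subdivisions: two classes suffice, and edges are few.

module TwoClasses where

  open Orientations using (Relation; true≢false; count)
  open Conflicts using (length-trues; ∈-trues⁺)
  open Configurations
  open import Data.Fin using (Fin; zero; suc; #_)
  open import Data.List using ([]; _∷_)
  open import Data.List.Relation.Unary.All as All using (All; []; _∷_)
  open import Data.List.Relation.Unary.AllPairs using ([]; _∷_)
  open import Data.Nat using (zero; suc; _+_; _*_; _≤_; _<_; z≤n; s≤s)
  open import Data.Nat.Tactic.RingSolver using () renaming (solve-∀ to ℕ-solve-∀)
  open import Data.Product using (swap)
  open import Data.Vec as Vec using (Vec)
  open Darts using (lookup-injective)

  unique-⊆-length : ∀ {A : Set} {xs ys : List A} → Unique xs → (∀ {x} → x ∈ xs → x ∈ ys) → length xs ≤ length ys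
  unique-⊆-length {xs = xs} {ys} u sub = Finₚ.injective⇒≤ {f = f} λ {i} {j} e →
    lookup-injective u i j (trans (lookup-index (sub (∈-lookup {xs = xs} i))) (trans (cong (lookup ys) e) (sym (lookup-index (sub (∈-lookup {xs = xs} j))))))
    where
    f : Fin (length xs) → Fin (length ys)
    f i = index (sub (∈-lookup {xs = xs} i))

  count-≤ : ∀ {N} {f g : Fin N → Bool} → (∀ v → f v ≡ true → g v ≡ true) → count f ≤ count g
  count-≤ {zero} h = z≤n
  count-≤ {suc N} {f} {g} h with f zero in ef | g zero in eg
  ... | true  | true  = s≤s (count-≤ (h ∘ suc))
  ... | true  | false = ⊥-elim (true≢false (trans (sym (h zero ef)) eg))
  ... | false | true  = ℕₚ.m≤n⇒m≤1+n (count-≤ (h ∘ suc))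
  ... | false | false = count-≤ (h ∘ suc)

  count-< : ∀ {N} {f g : Fin N → Bool} v → f v ≡ false → g v ≡ true → (∀ v → f v ≡ true → g v ≡ true) → count f < count g
  count-< {suc N} {f} {g} zero fv gv h rewrite fv | gv = s≤s (count-≤ (h ∘ suc))
  count-< {suc N} {f} {g} (suc v) fv gv h with f zero in ef | g zero in eg
  ... | true  | true  = s≤s (count-< v fv gv (h ∘ suc))
  ... | true  | false = ⊥-elim (true≢false (trans (sym (h zero ef)) eg))
  ... | false | true  = ℕₚ.m≤n⇒m≤1+n (count-< v fv gv (h ∘ suc))
  ... | false | false = count-< v fv gv (h ∘ suc)

  module Restriction {N} (A : Relation {N}) (A-sym : ∀ x y → A x y ≡ A y x) (A-irrefl : ∀ x → A x x ≡ false) where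

    private V = Fin N
    open DecMembership (Finₚ._≟_ {N}) using (_∈?_)

    -- Vertices are deleted by shrinking a predicate on a fixed vertex type, so nothing is ever
    -- renumbered.
    restrict : (V → Bool) → Relation {N}
    restrict U x y = A x y ∧ (U x ∧ U y)

    restrict⁻ : ∀ {U x y} → restrict U x y ≡ true → A x y ≡ true × U x ≡ true × U y ≡ true
    restrict⁻ {U} {x} {y} e with A x y | U x | U y
    ... | true | true | true = refl , refl , refl

    restrict⁺ : ∀ {U x y} → A x y ≡ true → U x ≡ true → U y ≡ true → restrict U x y ≡ true
    restrict⁺ a b c rewrite a | b | c = refl

    restrict-sym : ∀ U x y → restrict U x y ≡ restrict U y x
    restrict-sym U x y rewrite A-sym x y with A y x | U x | U y
    ... | false | _ | _ = refl
    ... | true | true | true = refl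
    ... | true | true | false = refl
    ... | true | false | true = refl
    ... | true | false | false = refl

    restrict-irrefl : ∀ U x → restrict U x x ≡ false
    restrict-irrefl U x rewrite A-irrefl x = refl

    remove : (V → Bool) → List V → V → Bool
    remove U vs x with x ∈? vs
    ... | yes _ = false
    ... | no _  = U x

    remove-∈ : ∀ U {vs x} → x ∈ vs → remove U vs x ≡ false
    remove-∈ U {vs} {x} m with x ∈? vs
    ... | yes _ = refl
    ... | no n = ⊥-elim (n m)

    remove-∉ : ∀ U {vs x} → x ∉ vs → remove U vs x ≡ U x
    remove-∉ U {vs} {x} m with x ∈? vs
    ... | yes n = ⊥-elim (m n)
    ... | no _ = refl

    remove⁻ : ∀ U {vs x} → remove U vs x ≡ true → x ∉ vs × U x ≡ true
    remove⁻ U {vs} {x} e with x ∈? vs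
    ... | no n = n , e

    count-remove : ∀ U {vs x} → x ∈ vs → U x ≡ true → count (remove U vs) < count U
    count-remove U {vs} {x} m e = count-< x (remove-∈ U m) e λ v f → proj₂ (remove⁻ U {vs} f)

    restrict-remove : ∀ {U vs x y} → restrict U x y ≡ true → x ∉ vs → y ∉ vs → restrict (remove U vs) x y ≡ true
    restrict-remove {U} {vs} a x∉ y∉ = let (e , f , g) = restrict⁻ {U} a in restrict⁺ {remove U vs} e (trans (remove-∉ U {vs} x∉) f) (trans (remove-∉ U {vs} y∉) g)

    module Sub (U : V → Bool) = Subgraphs (restrict U) (restrict-sym U) (restrict-irrefl U)

    -- Leaves go one at a time. Once there are none, `shape` supplies a closed cycle or theta, a
    -- whole component that is removed at once.
    module Induction
      (P : (V → Bool) → Set)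
      (no-config : ∀ U → ¬ Sub.Config U)
      (base  : ∀ U → (∀ {x y} → restrict U x y ≢ true) → P U)
      (leaf  : ∀ U {x y} → restrict U x y ≡ true → (∀ {z} → restrict U y z ≡ true → z ≡ x) → P (remove U (y ∷ [])) → P U)
      (cycle : ∀ U {v C} → Sub.Cycle U v C → Sub.Closed U (v ∷ C) (Sub.steps U v C v) → P (remove U (v ∷ C)) → P U)
      (theta : ∀ U {u v Q R S} → Sub.Theta U u v Q R S → Sub.Closed U (u ∷ v ∷ Q ++ R ++ S) (Sub.θ-steps U u v Q R S) →
                 P (remove U (u ∷ v ∷ Q ++ R ++ S)) → P U)
      where

      private
        induct : ∀ n U → count U < n → P U
        induct (suc n) U (s≤s le) with Finₚ.any? (λ x → Finₚ.any? λ y → restrict U x y Bool.≟ true)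
        ... | no none = base U λ {x} {y} e → none (x , y , e)
        ... | yes (x , y , xy) with Finₚ.any? (λ x → Finₚ.any? λ y → (restrict U x y Bool.≟ true) ×-dec
                ¬? (Finₚ.any? λ z → ¬? (z Finₚ.≟ x) ×-dec (restrict U y z Bool.≟ true)))
        ...   | yes (a , b , ab , lone) = leaf U ab only (induct n _ (ℕₚ.≤-trans (count-remove U (here refl) (proj₂ (proj₂ (restrict⁻ {U} ab)))) le))
          where
          only : ∀ {z} → restrict U b z ≡ true → z ≡ a
          only {z} e with z Finₚ.≟ a
          ... | yes p = p
          ... | no p = ⊥-elim (lone (z , p , e))
        ...   | no none = by (Sub.shape U no-leaf xy)
          where
          no-leaf : Sub.NoLeaf U
          no-leaf {a} {b} ab with Finₚ.any? (λ z → ¬? (z Finₚ.≟ a) ×-dec (restrict U b z Bool.≟ true))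
          ... | yes found = found
          ... | no lone = ⊥-elim (none (a , b , ab , lone))
          path-start : ∀ x ws y → Sub.Path U x ws y → U x ≡ true
          path-start x [] y p = proj₁ (proj₂ (restrict⁻ {U} p))
          path-start x (w ∷ ws) y (p , _) = proj₁ (proj₂ (restrict⁻ {U} p))
          by : Sub.Shape U no-leaf → P U
          by (Subgraphs.closed-cycle v C c cl) = cycle U c cl
            (induct n _ (ℕₚ.≤-trans (count-remove U (here refl) (path-start v C v (proj₁ c))) le))
          by (Subgraphs.closed-theta u v Q R S θ cl) = theta U θ cl
            (induct n _ (ℕₚ.≤-trans (count-remove U (here refl) (path-start u Q v (Sub.Theta.pathP θ))) le))
          by (Subgraphs.config cf) = ⊥-elim (no-config U cf)

      all : ∀ U → P U
      all U = induct (suc (count U)) U ℕₚ.≤-refl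

    module _ (U : V → Bool) where
      open Sub U

      steps-heads : ∀ x ws y → map proj₂ (steps x ws y) ≡ ws ++ y ∷ []
      steps-heads x [] y = refl
      steps-heads x (w ∷ ws) y = cong (w ∷_) (steps-heads w ws y)

      -- The reversed steps of a path except the one at `x`, for colouring from `y` back towards
      -- `x`.
      back : V → List V → V → List (V × V)
      back x [] y = []
      back x (w ∷ []) y = (y , w) ∷ []
      back x (w ∷ w′ ∷ ws) y = (w′ , w) ∷ back w (w′ ∷ ws) y

      back-heads : ∀ x ws y → map proj₂ (back x ws y) ≡ ws
      back-heads x [] y = refl
      back-heads x (w ∷ []) y = refl
      back-heads x (w ∷ w′ ∷ ws) y = cong (w ∷_) (back-heads w (w′ ∷ ws) y)

      first : List V → V → V
      first [] y = y
      first (w ∷ _) y = w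

      step-cases : ∀ x ws y {a b} → (a , b) ∈ steps x ws y → (a ≡ x × b ≡ first ws y) ⊎ (b , a) ∈ back x ws y
      step-cases x [] y (here refl) = inj₁ (refl , refl)
      step-cases x (w ∷ ws) y (here refl) = inj₁ (refl , refl)
      step-cases x (w ∷ []) y (there (here refl)) = inj₂ (here refl)
      step-cases x (w ∷ w′ ∷ ws) y (there m) with step-cases w (w′ ∷ ws) y m
      ... | inj₁ (refl , refl) = inj₂ (here refl)
      ... | inj₂ m′ = inj₂ (there m′)

      path-members : ∀ x ws y → Path x ws y → ∀ {w} → w ∈ ws → U w ≡ true
      path-members x (w ∷ ws) y (a , p) (here refl) = proj₂ (proj₂ (restrict⁻ {U} a))
      path-members x (w ∷ ws) y (a , p) (there m) = path-members w ws y p m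

      path-source : ∀ x ws y → Path x ws y → U x ≡ true
      path-source x [] y a = proj₁ (proj₂ (restrict⁻ {U} a))
      path-source x (w ∷ ws) y (a , _) = proj₁ (proj₂ (restrict⁻ {U} a))

      path-target : ∀ x ws y → Path x ws y → U y ≡ true
      path-target x [] y a = proj₂ (proj₂ (restrict⁻ {U} a))
      path-target x (w ∷ ws) y (_ , p) = path-target w ws y p

      length-steps : ∀ x ws y → length (steps x ws y) ≡ suc (length ws)
      length-steps x [] y = refl
      length-steps x (w ∷ ws) y = cong suc (length-steps w ws y)

    module Colouring (class : V → V → Fin 2) where

      other : Fin 2 → Fin 2
      other zero = suc zero
      other (suc zero) = zero

      other-≢ : ∀ i → other i ≢ i
      other-≢ zero ()
      other-≢ (suc zero) ()

      Colours : (V → Bool) → (V → Fin 2) → Set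
      Colours U φ = ∀ {x y} → restrict U x y ≡ true → ¬ (φ x ≡ class x y × φ y ≡ class y x)

      Colourable : (V → Bool) → Set
      Colourable U = ∃[ φ ] Colours U φ

      -- Each head y of a pair (x , y) avoids its conflict with x.
      paint : List (V × V) → (V → Fin 2) → V → Fin 2
      paint [] φ z = φ z
      paint ((x , y) ∷ l) φ z with z Finₚ.≟ y
      ... | yes _ = other (class y x)
      ... | no _  = paint l φ z

      paint-∈ : ∀ {l φ x y} → Unique (map proj₂ l) → (x , y) ∈ l → paint l φ y ≡ other (class y x)
      paint-∈ {(a , b) ∷ l} {φ} {x} {y} (b∉ ∷ u) m with y Finₚ.≟ b
      paint-∈ {(a , b) ∷ l} (b∉ ∷ u) (here refl) | yes _ = refl
      paint-∈ {(a , b) ∷ l} (b∉ ∷ u) (there m) | yes refl = ⊥-elim (All.lookup b∉ (∈-map⁺ proj₂ m) refl)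
      paint-∈ {(a , b) ∷ l} (b∉ ∷ u) (here refl) | no n = ⊥-elim (n refl)
      paint-∈ {(a , b) ∷ l} (b∉ ∷ u) (there m) | no _ = paint-∈ u m

      paint-∉ : ∀ {l φ z} → z ∉ map proj₂ l → paint l φ z ≡ φ z
      paint-∉ {[]} n = refl
      paint-∉ {(a , b) ∷ l} {φ} {z} n with z Finₚ.≟ b
      ... | yes e = ⊥-elim (n (here e))
      ... | no _ = paint-∉ (n ∘ there)

      Settled : (V → Fin 2) → V → V → Set
      Settled φ x y = ¬ (φ x ≡ class x y × φ y ≡ class y x)

      settled-sym : ∀ {φ x y} → Settled φ x y → Settled φ y x
      settled-sym s (p , q) = s (q , p)

      settled-head : ∀ {φ x y} → φ y ≡ other (class y x) → Settled φ x y
      settled-head {φ} {x} {y} e (_ , q) = other-≢ _ (trans (sym e) q)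

      -- Only `S` is recoloured, in such a way that all edges at it are settled, including those
      -- leading out of it.
      glue : ∀ U S {φ ψ} → (∀ {x y} → x ∈ S → restrict U x y ≡ true → Settled ψ x y) → (∀ {x} → x ∉ S → ψ x ≡ φ x) →
        Colours (remove U S) φ → Colours U ψ
      glue U S {φ} {ψ} inS outS col {x} {y} a with x ∈? S | y ∈? S
      ... | yes x∈ | _ = inS x∈ a
      ... | no _ | yes y∈ = settled-sym {ψ} (inS y∈ (trans (restrict-sym U y x) a))
      ... | no x∉ | no y∉ = λ (p , q) → col (restrict-remove {U} a x∉ y∉) (trans (sym (outS x∉)) p , trans (sym (outS y∉)) q)

      leaf : ∀ U {x y} → restrict U x y ≡ true → (∀ {z} → restrict U y z ≡ true → z ≡ x) → Colourable (remove U (y ∷ [])) → Colourable U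
      leaf U {x} {y} a only (φ , col) = paint ((x , y) ∷ []) φ , glue U (y ∷ []) inS (λ z∉ → paint-∉ z∉) col
        where
        inS : ∀ {z w} → z ∈ y ∷ [] → restrict U z w ≡ true → Settled (paint ((x , y) ∷ []) φ) z w
        inS (here refl) b with only b
        ... | refl = settled-sym {paint ((x , y) ∷ []) φ} (settled-head {paint ((x , y) ∷ []) φ} (paint-∈ ([] ∷ []) (here refl)))

      -- Once around the cycle, each vertex avoids its conflict with the one before. Every vertex is
      -- the head of just one step, so no choice is overwritten.
      cycle : ∀ U {v C} → Sub.Cycle U v C → Sub.Closed U (v ∷ C) (Sub.steps U v C v) → Colourable (remove U (v ∷ C)) → Colourable U
      cycle U {v} {C} (_ , C! , _) closed (φ , col) = ψ , glue U (v ∷ C) inS outS col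
        where
        l = Sub.steps U v C v
        ψ = paint l φ
        heads! : Unique (map proj₂ l)
        heads! = subst Unique (sym (steps-heads U v C v)) (Rearrange.rearrange V (Rearrange._⊕_ (Rearrange.var (# 0)) (Rearrange.var (# 1))) (Rearrange._⊕_ (Rearrange.var (# 1)) (Rearrange.var (# 0)))
          ((v ∷ []) Vec.∷ C Vec.∷ Vec.[]) _ C!)
        inS : ∀ {x y} → x ∈ v ∷ C → restrict U x y ≡ true → Settled ψ x y
        inS x∈ a with closed x∈ a
        ... | inj₁ m = settled-head {ψ} (paint-∈ heads! m)
        ... | inj₂ m = settled-sym {ψ} (settled-head {ψ} (paint-∈ heads! m))
        outS : ∀ {x} → x ∉ v ∷ C → ψ x ≡ φ x
        outS {x} x∉ = paint-∉ λ m → x∉ (back′ (∈-++⁻ C (subst (x ∈_) (steps-heads U v C v) m)))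
          where
          back′ : x ∈ C ⊎ x ∈ v ∷ [] → x ∈ v ∷ C
          back′ (inj₁ m) = there m
          back′ (inj₂ (here e)) = here e

      module _ (U : V → Bool) where
        open Sub U

        JoinedBy : V → V → List V → V → V → Set
        JoinedBy u v X x y = Joined (steps u X v) x y

        -- The colour `i` settles the first edges of Q and R at u. Painting along P to v and from
        -- there back along Q and R settles every other edge at its head.
        θ-colour : ∀ {u v P Q R} → Theta u v P Q R →
          (∀ {x y} → x ∈ u ∷ v ∷ P ++ Q ++ R → restrict U x y ≡ true → JoinedBy u v P x y ⊎ JoinedBy u v Q x y ⊎ JoinedBy u v R x y) →
          ∀ i → class u (first U Q v) ≢ i → class u (first U R v) ≢ i → Colourable (remove U (u ∷ v ∷ P ++ Q ++ R)) → Colourable U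
        θ-colour {u} {v} {P} {Q} {R} θ closed i Q-free R-free (φ , col) = ψ , glue U (u ∷ v ∷ P ++ Q ++ R) inS outS col
          where
          open Theta θ
          l = steps u P v ++ back U u Q v ++ back U u R v
          ψ : V → Fin 2
          ψ z with z Finₚ.≟ u
          ... | yes _ = i
          ... | no _  = paint l φ z
          heads : map proj₂ l ≡ (P ++ v ∷ []) ++ Q ++ R
          heads = trans (map-++ proj₂ (steps u P v) _) (cong₂ _++_ (steps-heads U u P v)
            (trans (map-++ proj₂ (back U u Q v) _) (cong₂ _++_ (back-heads U u Q v) (back-heads U u R v))))
          u-heads! : Unique (u ∷ (P ++ v ∷ []) ++ Q ++ R)
          u-heads! = rearrange (var (# 0) ⊕ var (# 1) ⊕ var (# 2) ⊕ var (# 3) ⊕ var (# 4)) (var (# 0) ⊕ (var (# 2) ⊕ var (# 1)) ⊕ var (# 3) ⊕ var (# 4))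
            ((u ∷ []) Vec.∷ (v ∷ []) Vec.∷ P Vec.∷ Q Vec.∷ R Vec.∷ Vec.[]) _ unique
            where open Rearrange V
          heads! : Unique (map proj₂ l)
          heads! = subst Unique (sym heads) (unique-suffix (u ∷ []) u-heads!)
          u∉heads : u ∉ map proj₂ l
          u∉heads m = All.lookup (head-all u-heads!) (subst (u ∈_) heads m) refl
            where
            head-all : ∀ {z : V} {zs} → Unique (z ∷ zs) → All (z ≢_) zs
            head-all (p ∷ _) = p
          ψ-u : ψ u ≡ i
          ψ-u with u Finₚ.≟ u
          ... | yes _ = refl
          ... | no n = ⊥-elim (n refl)
          ψ-other : ∀ {z} → z ≢ u → ψ z ≡ paint l φ z
          ψ-other {z} z≢ with z Finₚ.≟ u
          ... | yes e = ⊥-elim (z≢ e)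
          ... | no _ = refl
          painted : ∀ {x y} → (x , y) ∈ l → Settled ψ x y
          painted {x} {y} m = settled-head {ψ} (trans (ψ-other λ { refl → u∉heads (∈-map⁺ proj₂ m) }) (paint-∈ heads! m))
          u-settled : ∀ {y} → class u y ≢ i → Settled ψ u y
          u-settled free (p , _) = free (trans (sym p) ψ-u)
          onP : ∀ {x y} → (x , y) ∈ steps u P v → Settled ψ x y
          onP m = painted (∈-++⁺ˡ m)
          onQ : ∀ {x y} → (x , y) ∈ steps u Q v → Settled ψ x y
          onQ m with step-cases U u Q v m
          ... | inj₁ (refl , refl) = u-settled Q-free
          ... | inj₂ m′ = settled-sym {ψ} (painted (∈-++⁺ʳ (steps u P v) (∈-++⁺ˡ m′)))
          onR : ∀ {x y} → (x , y) ∈ steps u R v → Settled ψ x y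
          onR m with step-cases U u R v m
          ... | inj₁ (refl , refl) = u-settled R-free
          ... | inj₂ m′ = settled-sym {ψ} (painted (∈-++⁺ʳ (steps u P v) (∈-++⁺ʳ (back U u Q v) m′)))
          inS : ∀ {x y} → x ∈ u ∷ v ∷ P ++ Q ++ R → restrict U x y ≡ true → Settled ψ x y
          inS x∈ a with closed x∈ a
          ... | inj₁ (inj₁ m) = onP m
          ... | inj₁ (inj₂ m) = settled-sym {ψ} (onP m)
          ... | inj₂ (inj₁ (inj₁ m)) = onQ m
          ... | inj₂ (inj₁ (inj₂ m)) = settled-sym {ψ} (onQ m)
          ... | inj₂ (inj₂ (inj₁ m)) = onR m
          ... | inj₂ (inj₂ (inj₂ m)) = settled-sym {ψ} (onR m)
          outS : ∀ {x} → x ∉ u ∷ v ∷ P ++ Q ++ R → ψ x ≡ φ x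
          outS {x} x∉ = trans (ψ-other λ { refl → x∉ (here refl) }) (paint-∉ λ m → x∉ (inside (subst (x ∈_) heads m)))
            where
            inside : x ∈ (P ++ v ∷ []) ++ Q ++ R → x ∈ u ∷ v ∷ P ++ Q ++ R
            inside m with ∈-++⁻ (P ++ v ∷ []) m
            ... | inj₂ m′ = there (there (∈-++⁺ʳ P m′))
            ... | inj₁ m′ with ∈-++⁻ P m′
            ...   | inj₁ m″ = there (there (∈-++⁺ˡ m″))
            ...   | inj₂ (here e) = there (here e)

        -- Some class occurs at most once among three, so two of them avoid it.
        minority : ∀ (a b c : Fin 2) → ∃[ i ] ((b ≢ i × c ≢ i) ⊎ (a ≢ i × c ≢ i) ⊎ (b ≢ i × a ≢ i))
        minority a zero zero = suc zero , inj₁ ((λ ()) , λ ())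
        minority a (suc zero) (suc zero) = zero , inj₁ ((λ ()) , λ ())
        minority zero zero (suc zero) = suc zero , inj₂ (inj₂ ((λ ()) , λ ()))
        minority (suc zero) zero (suc zero) = zero , inj₂ (inj₁ ((λ ()) , λ ()))
        minority zero (suc zero) zero = suc zero , inj₂ (inj₁ ((λ ()) , λ ()))
        minority (suc zero) (suc zero) zero = zero , inj₂ (inj₂ ((λ ()) , λ ()))

        split-joined : ∀ {u v P Q R x y} → Joined (θ-steps u v P Q R) x y → JoinedBy u v P x y ⊎ JoinedBy u v Q x y ⊎ JoinedBy u v R x y
        split-joined {u} {v} {P} {Q} {R} (inj₁ m) with ∈-++⁻ (steps u P v) m
        ... | inj₁ m′ = inj₁ (inj₁ m′)
        ... | inj₂ m′ with ∈-++⁻ (steps u Q v) m′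
        ...   | inj₁ m″ = inj₂ (inj₁ (inj₁ m″))
        ...   | inj₂ m″ = inj₂ (inj₂ (inj₁ m″))
        split-joined {u} {v} {P} {Q} {R} (inj₂ m) with ∈-++⁻ (steps u P v) m
        ... | inj₁ m′ = inj₁ (inj₂ m′)
        ... | inj₂ m′ with ∈-++⁻ (steps u Q v) m′
        ...   | inj₁ m″ = inj₂ (inj₁ (inj₂ m″))
        ...   | inj₂ m″ = inj₂ (inj₂ (inj₂ m″))

      remove-resp : ∀ U vs ws → (∀ {x} → x ∈ vs → x ∈ ws) → Colourable (remove U vs) → Colourable (remove U ws)
      remove-resp U vs ws sub (φ , col) = φ , λ {x} {y} a →
        let (e , f , g) = restrict⁻ {remove U ws} {x} {y} a in col (restrict⁺ {remove U vs} {x} {y} e (weaken x f) (weaken y g))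
        where
        weaken : ∀ x → remove U ws x ≡ true → remove U vs x ≡ true
        weaken x e = let (n , f) = remove⁻ U {ws} {x} e in trans (remove-∉ U {vs} {x} (n ∘ sub)) f

      -- Some colour of u is in conflict on at most one of its three edges; colour
      -- that path away from u, and then the two others back from v.
      theta : ∀ U {u v P Q R} → Sub.Theta U u v P Q R → Sub.Closed U (u ∷ v ∷ P ++ Q ++ R) (Sub.θ-steps U u v P Q R) →
        Colourable (remove U (u ∷ v ∷ P ++ Q ++ R)) → Colourable U
      theta U {u} {v} {P} {Q} {R} θ closed rest with minority U (class u (first U P v)) (class u (first U Q v)) (class u (first U R v))
      ... | i , inj₁ (q , r) = θ-colour U θ (λ x∈ a → split-joined U (closed x∈ a)) i q r rest
      ... | i , inj₂ (inj₁ (p , r)) = θ-colour U (Sub.swap-PQ U θ) (λ x∈ a → turn (split-joined U (closed (perm x∈) a))) i p r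
          (remove-resp U (u ∷ v ∷ P ++ Q ++ R) (u ∷ v ∷ Q ++ P ++ R) perm⁻ rest)
        where
        turn : ∀ {X Y Z : Set} → X ⊎ Y ⊎ Z → Y ⊎ X ⊎ Z
        turn (inj₁ x) = inj₂ (inj₁ x)
        turn (inj₂ (inj₁ y)) = inj₁ y
        turn (inj₂ (inj₂ z)) = inj₂ (inj₂ z)
        swap-∈ : ∀ {x : V} (X Y : List V) {Z} → x ∈ X ++ Y ++ Z → x ∈ Y ++ X ++ Z
        swap-∈ X Y m with ∈-++⁻ X m
        ... | inj₁ m′ = ∈-++⁺ʳ Y (∈-++⁺ˡ m′)
        ... | inj₂ m′ with ∈-++⁻ Y m′
        ...   | inj₁ m″ = ∈-++⁺ˡ m″
        ...   | inj₂ m″ = ∈-++⁺ʳ Y (∈-++⁺ʳ X m″)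
        perm : ∀ {x} → x ∈ u ∷ v ∷ Q ++ P ++ R → x ∈ u ∷ v ∷ P ++ Q ++ R
        perm (here e) = here e
        perm (there (here e)) = there (here e)
        perm (there (there m)) = there (there (swap-∈ Q P m))
        perm⁻ : ∀ {x} → x ∈ u ∷ v ∷ P ++ Q ++ R → x ∈ u ∷ v ∷ Q ++ P ++ R
        perm⁻ (here e) = here e
        perm⁻ (there (here e)) = there (here e)
        perm⁻ (there (there m)) = there (there (swap-∈ P Q m))
      ... | i , inj₂ (inj₂ (q , p)) = θ-colour U (Sub.swap-PR U θ) (λ x∈ a → turn (split-joined U (closed (perm x∈) a))) i q p
          (remove-resp U (u ∷ v ∷ P ++ Q ++ R) (u ∷ v ∷ R ++ Q ++ P) perm⁻ rest)
        where
        turn : ∀ {X Y Z : Set} → X ⊎ Y ⊎ Z → Z ⊎ Y ⊎ X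
        turn (inj₁ x) = inj₂ (inj₂ x)
        turn (inj₂ (inj₁ y)) = inj₂ (inj₁ y)
        turn (inj₂ (inj₂ z)) = inj₁ z
        swap-∈ : ∀ {x : V} (X Y : List V) {Z} → x ∈ X ++ Y ++ Z → x ∈ Z ++ Y ++ X
        swap-∈ X Y {Z} m with ∈-++⁻ X m
        ... | inj₁ m′ = ∈-++⁺ʳ Z (∈-++⁺ʳ Y m′)
        ... | inj₂ m′ with ∈-++⁻ Y m′
        ...   | inj₁ m″ = ∈-++⁺ʳ Z (∈-++⁺ˡ m″)
        ...   | inj₂ m″ = ∈-++⁺ˡ m″
        perm : ∀ {x} → x ∈ u ∷ v ∷ R ++ Q ++ P → x ∈ u ∷ v ∷ P ++ Q ++ R
        perm (here e) = here e
        perm (there (here e)) = there (here e)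
        perm (there (there m)) = there (there (swap-∈ R Q m))
        perm⁻ : ∀ {x} → x ∈ u ∷ v ∷ P ++ Q ++ R → x ∈ u ∷ v ∷ R ++ Q ++ P
        perm⁻ (here e) = here e
        perm⁻ (there (here e)) = there (here e)
        perm⁻ (there (there m)) = there (there (swap-∈ P Q m))

      colourable : (∀ U → ¬ Sub.Config U) → ∀ U → Colourable U
      colourable no-config = Induction.all Colourable no-config
        (λ U none → (λ _ → zero) , λ a → ⊥-elim (none a)) leaf cycle theta

    -- A connected graph without a configuration has at most one more edge than
    -- vertices; every edge counts as two arcs.
    module Sparse where

      -- Connectedness tested by two-valued functions constant along edges. They are compared at
      -- ends of edges only, so isolated vertices do not matter.
      Connected : (V → Bool) → Set
      Connected U = ∀ (p : V → Bool) → (∀ {x y} → restrict U x y ≡ true → p x ≡ p y) →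
        ∀ {x y a b} → restrict U x y ≡ true → restrict U a b ≡ true → p x ≡ p a

      ArcsIn : (V → Bool) → List (V × V) → Set
      ArcsIn U L = ∀ {a} → a ∈ L → restrict U (proj₁ a) (proj₂ a) ≡ true

      Sparse : (V → Bool) → Set
      Sparse U = Connected U → ∀ L → Unique L → ArcsIn U L → length L ≤ 2 * count U + 2

      empty-sparse : ∀ U → (∀ {x y} → restrict U x y ≢ true) → Sparse U
      empty-sparse U none _ [] _ _ = z≤n
      empty-sparse U none _ (a ∷ L) _ arcs = ⊥-elim (none (arcs (here refl)))

      -- A leaf takes with it one vertex and the two arcs of its edge. Connectedness survives, since
      -- a function on the rest extends to y by its value at x.
      leaf-sparse : ∀ U {x y} → restrict U x y ≡ true → (∀ {z} → restrict U y z ≡ true → z ≡ x) → Sparse (remove U (y ∷ [])) → Sparse U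
      leaf-sparse U {x} {y} xy only rec conn L L! arcs = begin
        length L                                       ≤⟨ unique-⊆-length L! split ⟩
        2 + length L′                                  ≤⟨ ℕₚ.+-monoʳ-≤ 2 (rec conn′ L′ (Uniqueₚ.filter⁺ off? L!) arcs′) ⟩
        2 + (2 * count (remove U (y ∷ [])) + 2)        ≡⟨ lem (count (remove U (y ∷ []))) ⟩
        2 * suc (count (remove U (y ∷ []))) + 2        ≤⟨ ℕₚ.+-monoˡ-≤ 2 (ℕₚ.*-monoʳ-≤ 2 (count-remove U {y ∷ []} (here refl) (proj₂ (proj₂ (restrict⁻ {U} xy))))) ⟩
        2 * count U + 2                                ∎
        where
        open ℕₚ.≤-Reasoning
        lem : ∀ c → 2 + (2 * c + 2) ≡ 2 * suc c + 2
        lem = ℕ-solve-∀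
        x≢y : x ≢ y
        x≢y refl = true≢false (trans (sym xy) (restrict-irrefl U x))
        off? : ∀ (a : V × V) → Dec (proj₁ a ≢ y × proj₂ a ≢ y)
        off? (a , b) = ¬? (a Finₚ.≟ y) ×-dec ¬? (b Finₚ.≟ y)
        L′ = filter off? L
        split : ∀ {a} → a ∈ L → a ∈ (x , y) ∷ (y , x) ∷ L′
        split {a , b} m with a Finₚ.≟ y | b Finₚ.≟ y
        ... | yes refl | _ with only (arcs m)
        ...   | refl = there (here refl)
        split {a , b} m | no _ | yes refl with only (trans (restrict-sym U b a) (arcs m))
        ...   | refl = here refl
        split {a , b} m | no p | no q = there (there (∈-filter⁺ off? m (p , q)))
        arcs′ : ArcsIn (remove U (y ∷ [])) L′
        arcs′ {a , b} m = let (m′ , p , q) = ∈-filter⁻ off? {xs = L} m in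
          restrict-remove {U} {y ∷ []} (arcs m′) (λ { (here e) → p e }) (λ { (here e) → q e })
        back-to-U : ∀ {a b} → restrict (remove U (y ∷ [])) a b ≡ true → a ≢ y × b ≢ y × restrict U a b ≡ true
        back-to-U {a} {b} e = let (f , g , h) = restrict⁻ {remove U (y ∷ [])} {a} {b} e
                                  (n , g′) = remove⁻ U {y ∷ []} {a} g ; (m , h′) = remove⁻ U {y ∷ []} {b} h in
          (λ q → n (here q)) , (λ q → m (here q)) , restrict⁺ {U} f g′ h′
        conn′ : Connected (remove U (y ∷ []))
        conn′ p resp {a} {b} {c} {d} ab cd = let (a≢ , _ , ab′) = back-to-U ab ; (c≢ , _ , cd′) = back-to-U cd in
          trans (sym (p′-other a≢)) (trans (conn p′ resp′ ab′ cd′) (p′-other c≢))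
          where
          p′ : V → Bool
          p′ z with z Finₚ.≟ y
          ... | yes _ = p x
          ... | no _  = p z
          p′-other : ∀ {z} → z ≢ y → p′ z ≡ p z
          p′-other {z} n with z Finₚ.≟ y
          ... | yes e = ⊥-elim (n e)
          ... | no _ = refl
          p′-y : p′ y ≡ p x
          p′-y with y Finₚ.≟ y
          ... | yes _ = refl
          ... | no n = ⊥-elim (n refl)
          resp′ : ∀ {a b} → restrict U a b ≡ true → p′ a ≡ p′ b
          resp′ {a} {b} e = by (a Finₚ.≟ y) (b Finₚ.≟ y)
            where
            by : Dec (a ≡ y) → Dec (b ≡ y) → p′ a ≡ p′ b
            by (yes refl) _ = trans p′-y (sym (trans (cong p′ (only e)) (p′-other x≢y)))
            by (no _) (yes refl) = trans (trans (cong p′ (only (trans (restrict-sym U b a) e))) (p′-other x≢y)) (sym p′-y)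
            by (no n) (no m) = trans (p′-other n) (trans (resp (restrict-remove {U} {y ∷ []} e (λ { (here q) → n q }) (λ { (here q) → m q }))) (sym (p′-other m)))

      -- By connectedness all arcs start in `S`, so they are the edges of `es` in both directions; a
      -- cycle or theta has at most |S| + 1 of these edges.
      closed-sparse : ∀ U {S es} → Sub.Closed U S es → (∀ {x} → x ∈ S → U x ≡ true) → Unique S → length es ≤ suc (length S) →
        ∀ {s t} → s ∈ S → restrict U s t ≡ true → (∀ {x y} → (x , y) ∈ es → x ∈ S × y ∈ S) → Sparse U
      closed-sparse U {S} {es} closed alive S! len {s} {t} s∈ st inside conn L L! arcs = begin
        length L                        ≤⟨ unique-⊆-length L! covered ⟩
        length (es ++ map swap es)      ≡⟨ trans (length-++ es) (cong (length es +_) (length-map swap es)) ⟩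
        length es + length es           ≤⟨ ℕₚ.+-mono-≤ len len ⟩
        suc (length S) + suc (length S) ≤⟨ ℕₚ.+-mono-≤ (s≤s small) (s≤s small) ⟩
        suc (count U) + suc (count U)   ≡⟨ lem (count U) ⟩
        2 * count U + 2                 ∎
        where
        open ℕₚ.≤-Reasoning
        lem : ∀ c → suc c + suc c ≡ 2 * c + 2
        lem = ℕ-solve-∀
        small : length S ≤ count U
        small = subst (length S ≤_) (length-trues U) (unique-⊆-length S! (λ m → ∈-trues⁺ U (alive m)))
        in? : V → Bool
        in? x with x ∈? S
        ... | yes _ = true
        ... | no _  = false
        in-yes : ∀ {x} → x ∈ S → in? x ≡ true
        in-yes {x} m with x ∈? S
        ... | yes _ = refl
        ... | no n = ⊥-elim (n m)
        in-yes⁻ : ∀ {x} → in? x ≡ true → x ∈ S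
        in-yes⁻ {x} e with x ∈? S
        ... | yes m = m
        neighbour : ∀ {x y} → x ∈ S → restrict U x y ≡ true → y ∈ S
        neighbour x∈ a with closed x∈ a
        ... | inj₁ m = proj₂ (inside m)
        ... | inj₂ m = proj₁ (inside m)
        in-resp : ∀ {x y} → restrict U x y ≡ true → in? x ≡ in? y
        in-resp {x} {y} a = by (x ∈? S) (y ∈? S)
          where
          no-in : ∀ {z} → z ∉ S → in? z ≡ false
          no-in {z} n with z ∈? S
          ... | yes m = ⊥-elim (n m)
          ... | no _ = refl
          by : Dec (x ∈ S) → Dec (y ∈ S) → in? x ≡ in? y
          by (yes m) _ = trans (in-yes m) (sym (in-yes (neighbour m a)))
          by (no n) (yes m) = ⊥-elim (n (neighbour m (trans (restrict-sym U y x) a)))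
          by (no n) (no m) = trans (no-in n) (sym (no-in m))
        covered : ∀ {a} → a ∈ L → a ∈ es ++ map swap es
        covered {x , y} m with closed (in-yes⁻ (trans (sym (conn in? in-resp st (arcs m))) (in-yes s∈))) (arcs m)
        ... | inj₁ e = ∈-++⁺ˡ e
        ... | inj₂ e = ∈-++⁺ʳ es (∈-map⁺ swap e)

      steps-inside : ∀ U x ws y {a b} → (a , b) ∈ Sub.steps U x ws y → a ∈ x ∷ ws × b ∈ ws ++ y ∷ []
      steps-inside U x [] y (here refl) = here refl , here refl
      steps-inside U x (w ∷ ws) y (here refl) = here refl , here refl
      steps-inside U x (w ∷ ws) y (there m) = let (p , q) = steps-inside U w ws y m in there p , there q

      cycle-sparse : ∀ U {v C} → Sub.Cycle U v C → Sub.Closed U (v ∷ C) (Sub.steps U v C v) → Sparse (remove U (v ∷ C)) → Sparse U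
      cycle-sparse U {v} {C} (p , C! , _) closed _ = closed-sparse U closed
        (λ { (here refl) → path-source U v C v p ; (there m) → path-members U v C v p m }) C!
        (ℕₚ.≤-trans (ℕₚ.≤-reflexive (length-steps U v C v)) (ℕₚ.n≤1+n _)) (here refl) (proj₂ (edge C p))
        λ m → let (q , r) = steps-inside U v C v m in q , back′ (∈-++⁻ C r)
        where
        edge : ∀ C → Sub.Path U v C v → ∃[ t ] restrict U v t ≡ true
        edge [] p = v , p
        edge (c ∷ _) (p , _) = c , p
        back′ : ∀ {x} → x ∈ C ⊎ x ∈ v ∷ [] → x ∈ v ∷ C
        back′ (inj₁ m) = there m
        back′ (inj₂ (here e)) = here e

      theta-sparse : ∀ U {u v P Q R} → Sub.Theta U u v P Q R → Sub.Closed U (u ∷ v ∷ P ++ Q ++ R) (Sub.θ-steps U u v P Q R) →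
        Sparse (remove U (u ∷ v ∷ P ++ Q ++ R)) → Sparse U
      theta-sparse U {u} {v} {P} {Q} {R} θ closed _ = closed-sparse U closed alive unique size (here refl) (proj₂ (edge P pathP)) inside
        where
        open Sub.Theta U θ
        alive : ∀ {x} → x ∈ u ∷ v ∷ P ++ Q ++ R → U x ≡ true
        alive (here refl) = path-source U u P v pathP
        alive (there (here refl)) = path-target U u P v pathP
        alive (there (there m)) with ∈-++⁻ P m
        ... | inj₁ m′ = path-members U u P v pathP m′
        ... | inj₂ m′ with ∈-++⁻ Q m′
        ...   | inj₁ m″ = path-members U u Q v pathQ m″
        ...   | inj₂ m″ = path-members U u R v pathR m″
        edge : ∀ P → Sub.Path U u P v → ∃[ t ] restrict U u t ≡ true
        edge [] p = v , p
        edge (c ∷ _) (p , _) = c , p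
        size : length (Sub.θ-steps U u v P Q R) ≤ suc (length (u ∷ v ∷ P ++ Q ++ R))
        size = ℕₚ.≤-reflexive (trans (length-++ (Sub.steps U u P v)) (trans (cong₂ _+_ (length-steps U u P v)
          (trans (length-++ (Sub.steps U u Q v)) (cong₂ _+_ (length-steps U u Q v) (length-steps U u R v))))
          (trans (lem (length P) (length Q) (length R)) (cong (3 +_) (sym (trans (length-++ P) (cong (length P +_) (length-++ Q))))))))
          where
          lem : ∀ p q r → suc p + (suc q + suc r) ≡ 3 + (p + (q + r))
          lem = ℕ-solve-∀
        ends : ∀ {X} → (∀ {x} → x ∈ X → x ∈ P ++ Q ++ R) → ∀ {x y} → (x , y) ∈ Sub.steps U u X v → x ∈ u ∷ v ∷ P ++ Q ++ R × y ∈ u ∷ v ∷ P ++ Q ++ R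
        ends {X} sub m with steps-inside U u X v m
        ... | p , q = source p , target (∈-++⁻ X q)
          where
          source : ∀ {x} → x ∈ u ∷ X → x ∈ u ∷ v ∷ P ++ Q ++ R
          source (here e) = here e
          source (there m) = there (there (sub m))
          target : ∀ {x} → x ∈ X ⊎ x ∈ v ∷ [] → x ∈ u ∷ v ∷ P ++ Q ++ R
          target (inj₁ m) = there (there (sub m))
          target (inj₂ (here e)) = there (here e)
        inside : ∀ {x y} → (x , y) ∈ Sub.θ-steps U u v P Q R → x ∈ u ∷ v ∷ P ++ Q ++ R × y ∈ u ∷ v ∷ P ++ Q ++ R
        inside m with ∈-++⁻ (Sub.steps U u P v) m
        ... | inj₁ m′ = ends ∈-++⁺ˡ m′
        ... | inj₂ m′ with ∈-++⁻ (Sub.steps U u Q v) m′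
        ...   | inj₁ m″ = ends (∈-++⁺ʳ P ∘ ∈-++⁺ˡ) m″
        ...   | inj₂ m″ = ends (∈-++⁺ʳ P ∘ ∈-++⁺ʳ Q) m″

      sparse : (∀ U → ¬ Sub.Config U) → ∀ U → Sparse U
      sparse no-config = Induction.all Sparse no-config empty-sparse leaf-sparse cycle-sparse theta-sparse

-- A bipartite graph with many edges inside a dense set.

module Growing where

  open Orientations
  open Conflicts using (trues; length-trues; ∈-trues⁻; out-arcs; out-arcs-unique; ∈-out-arcs⁻; length-out-arcs-extra)
  open Obstructions using (module BadConfigs)
  open TwoClasses
  open import Data.List using ([]; _∷_)
  open import Data.List.Relation.Unary.All as All using (All; []; _∷_)
  open import Data.List.Relation.Unary.AllPairs using ([]; _∷_)
  open import Data.Nat using (ℕ; zero; suc; _+_; _*_; _≤_; _<_; z≤n; s≤s)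
  open import Data.Nat.Tactic.RingSolver using () renaming (solve-∀ to ℕ-solve-∀)
  open Darts using (unique-length)

  module _ (G : Graph) (dense : Dense (Graph.adj G) (Graph.adj-irrefl G) (Graph.adj-sym G) 2) where
    open Graph G
    open Dense dense
    open Oriented oriented
    open DecMembership (Finₚ._≟_ {order}) using (_∈?_)

    private
      V = Vertex

      -- The underlying graph of the dense orientation, whose edges the count refers to; it may be
      -- smaller than `adj`.
      H : V → V → Bool
      H x y = O x y ∨ O y x

      H-sym : ∀ x y → H x y ≡ H y x
      H-sym x y = ∨-comm (O x y) (O y x)

      O⇒H : ∀ {x y} → O x y ≡ true → H x y ≡ true
      O⇒H e rewrite e = refl

      H⇒O : ∀ {x y} → H x y ≡ true → O x y ≡ true ⊎ O y x ≡ true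
      H⇒O {x} {y} e with O x y
      ... | true = inj₁ refl
      ... | false = inj₂ e

      H⇒adj : ∀ {x y} → H x y ≡ true → adj x y ≡ true
      H⇒adj {x} {y} e with H⇒O {x} {y} e
      ... | inj₁ o = inside o
      ... | inj₂ o = trans (adj-sym x y) (inside o)

      O-irrefl : ∀ {x y} → O x y ≡ true → x ≢ y
      O-irrefl o refl = true≢false (trans (sym (inside o)) (adj-irrefl _))

      H? : ∀ v u → Dec (H v u ≡ true)
      H? v u = H v u Bool.≟ true

    neighbours : V → List V → List V
    neighbours v D = filter (H? v) D

    -- A connected bipartite graph on D with arcs L, such that there are at most
    -- |L| - s edges of H inside D.
    record Grown (s : ℕ) (D : List V) : Set where
      field
        unique   : Unique D
        in-R     : ∀ {x} → x ∈ D → x ∈ R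
        side     : V → Bool
        L        : List (V × V)
        L-unique : Unique L
        L-arcs   : ∀ {x y} → (x , y) ∈ L → x ∈ D × y ∈ D × H x y ≡ true × side x xor side y ≡ true
        bound    : ∀ K → Unique K → (∀ {x y} → (x , y) ∈ K → O x y ≡ true × x ∈ D × y ∈ D) → length K + s ≤ length L
        conn     : ∀ (p : V → Bool) → (∀ {x y} → (x , y) ∈ L → p x ≡ p y) → ∀ {a b} → a ∈ D → b ∈ D → p a ≡ p b

    seed : Grown 0 (extra ∷ [])
    seed = record
      { unique = [] ∷ [] ; in-R = λ { (here refl) → extra∈ } ; side = λ _ → true ; L = [] ; L-unique = [] ; L-arcs = λ ()
      ; bound = none ; conn = λ { p resp (here refl) (here refl) → refl } }
      where
      none : ∀ K → Unique K → (∀ {x y} → (x , y) ∈ K → O x y ≡ true × x ∈ extra ∷ [] × y ∈ extra ∷ []) → length K + 0 ≤ 0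
      none [] _ _ = z≤n
      none ((x , y) ∷ K) _ h with h (here refl)
      ... | o , here refl , here refl = ⊥-elim (O-irrefl o refl)

    -- The new vertex goes opposite to the larger part `X` of its neighbours `M`. At least half of
    -- its edges are kept, each as two arcs, so the surplus `s` does not drop.
    module Step {s D} (g : Grown s D) {v} (v∈R : v ∈ R) (v∉ : v ∉ D) where
      open Grown g renaming (unique to D!)

      M : List V
      M = neighbours v D

      on : Bool → List V
      on b = filter (λ u → side u Bool.≟ b) M

      M-split : length M ≤ length (on true) + length (on false)
      M-split = ℕₚ.≤-trans (unique-⊆-length (Uniqueₚ.filter⁺ (H? v) D!) split) (ℕₚ.≤-reflexive (length-++ (on true)))
        where
        split : ∀ {u} → u ∈ M → u ∈ on true ++ on false
        split {u} m with side u in e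
        ... | true = ∈-++⁺ˡ (∈-filter⁺ (λ u → side u Bool.≟ true) m e)
        ... | false = ∈-++⁺ʳ (on true) (∈-filter⁺ (λ u → side u Bool.≟ false) m e)

      larger : ∃[ b ] length M ≤ 2 * length (on b)
      larger with ℕₚ.≤-total (length (on true)) (length (on false))
      ... | inj₁ le = false , ℕₚ.≤-trans M-split (ℕₚ.≤-trans (ℕₚ.+-monoˡ-≤ (length (on false)) le) (ℕₚ.≤-reflexive (lem (length (on false)))))
        where
        lem : ∀ n → n + n ≡ 2 * n
        lem = ℕ-solve-∀
      ... | inj₂ le = true , ℕₚ.≤-trans M-split (ℕₚ.≤-trans (ℕₚ.+-monoʳ-≤ (length (on true)) le) (ℕₚ.≤-reflexive (lem (length (on true)))))
        where
        lem : ∀ n → n + n ≡ 2 * n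
        lem = ℕ-solve-∀

      b : Bool
      b = proj₁ larger

      X : List V
      X = on b

      X⁻ : ∀ {u} → u ∈ X → u ∈ D × H v u ≡ true × side u ≡ b
      X⁻ m with ∈-filter⁻ (λ u → side u Bool.≟ b) {xs = M} m
      ... | m′ , e with ∈-filter⁻ (H? v) {xs = D} m′
      ...   | u∈ , h = u∈ , h , e

      side′ : V → Bool
      side′ u with u Finₚ.≟ v
      ... | yes _ = not b
      ... | no _  = side u

      side′-v : side′ v ≡ not b
      side′-v with v Finₚ.≟ v
      ... | yes _ = refl
      ... | no n = ⊥-elim (n refl)

      side′-D : ∀ {u} → u ∈ D → side′ u ≡ side u
      side′-D {u} u∈ with u Finₚ.≟ v
      ... | yes refl = ⊥-elim (v∉ u∈)
      ... | no _ = refl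

      L′ : List (V × V)
      L′ = L ++ map (v ,_) X ++ map (_, v) X

      X! : Unique X
      X! = Uniqueₚ.filter⁺ (λ u → side u Bool.≟ b) (Uniqueₚ.filter⁺ (H? v) D!)

      L′-unique : Unique L′
      L′-unique = Uniqueₚ.++⁺ L-unique (Uniqueₚ.++⁺ (Uniqueₚ.map⁺ (cong proj₂) X!) (Uniqueₚ.map⁺ (cong proj₁) X!) disjoint₂) disjoint₁
        where
        disjoint₂ : ∀ {a} → ¬ (a ∈ map (v ,_) X × a ∈ map (_, v) X)
        disjoint₂ (p , q) with ∈-map⁻ (v ,_) p | ∈-map⁻ (_, v) q
        ... | _ , x∈ , refl | _ , y∈ , refl = v∉ (proj₁ (X⁻ x∈))
        disjoint₁ : ∀ {a} → ¬ (a ∈ L × a ∈ map (v ,_) X ++ map (_, v) X)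
        disjoint₁ (p , q) with ∈-++⁻ (map (v ,_) X) q
        ... | inj₁ q′ with ∈-map⁻ (v ,_) q′
        ...   | _ , _ , refl = v∉ (proj₁ (L-arcs p))
        disjoint₁ (p , q) | inj₂ q′ with ∈-map⁻ (_, v) q′
        ...   | _ , _ , refl = v∉ (proj₁ (proj₂ (L-arcs p)))

      xor-not : ∀ b → not b xor b ≡ true
      xor-not true = refl
      xor-not false = refl

      xor-not′ : ∀ b → b xor not b ≡ true
      xor-not′ true = refl
      xor-not′ false = refl

      L′-arcs : ∀ {x y} → (x , y) ∈ L′ → x ∈ v ∷ D × y ∈ v ∷ D × H x y ≡ true × side′ x xor side′ y ≡ true
      L′-arcs m with ∈-++⁻ L m
      ... | inj₁ m′ = let (x∈ , y∈ , h , e) = L-arcs m′ in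
        there x∈ , there y∈ , h , trans (cong₂ _xor_ (side′-D x∈) (side′-D y∈)) e
      ... | inj₂ m′ with ∈-++⁻ (map (v ,_) X) m′
      ...   | inj₁ m″ with ∈-map⁻ (v ,_) m″
      ...     | u , u∈ , refl = let (d , h , e) = X⁻ u∈ in
        here refl , there d , h , trans (cong₂ _xor_ side′-v (trans (side′-D d) e)) (xor-not b)
      L′-arcs m | inj₂ m′ | inj₂ m″ with ∈-map⁻ (_, v) m″
      ...     | u , u∈ , refl = let (d , h , e) = X⁻ u∈ in
        there d , here refl , trans (H-sym u v) h , trans (cong₂ _xor_ (trans (side′-D d) e) side′-v) (xor-not′ b)

      -- The arc of `O` between v and its neighbour u; hence at most |M| arcs of `K` are new.
      orient : V → V × V
      orient u = if O v u then (v , u) else (u , v)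

      bound′ : ∀ K → Unique K → (∀ {x y} → (x , y) ∈ K → O x y ≡ true × x ∈ v ∷ D × y ∈ v ∷ D) → length K + s ≤ length L + length M
      bound′ K K! h = begin
        length K + s                          ≤⟨ ℕₚ.+-monoˡ-≤ s (unique-⊆-length K! cover) ⟩
        length (K₀ ++ map orient M) + s       ≡⟨ cong (_+ s) (trans (length-++ K₀) (cong (length K₀ +_) (length-map orient M))) ⟩
        length K₀ + length M + s              ≡⟨ lem (length K₀) (length M) s ⟩
        length K₀ + s + length M              ≤⟨ ℕₚ.+-monoˡ-≤ (length M) (bound K₀ (Uniqueₚ.filter⁺ off? K!) inner) ⟩
        length L + length M                   ∎
        where
        open ℕₚ.≤-Reasoning
        lem : ∀ k m s → k + m + s ≡ k + s + m
        lem = ℕ-solve-∀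
        off? : ∀ (a : V × V) → Dec (proj₁ a ≢ v × proj₂ a ≢ v)
        off? (x , y) = ¬? (x Finₚ.≟ v) ×-dec ¬? (y Finₚ.≟ v)
        K₀ = filter off? K
        drop : ∀ {x} → x ≢ v → x ∈ v ∷ D → x ∈ D
        drop n (here e) = ⊥-elim (n e)
        drop n (there m) = m
        inner : ∀ {x y} → (x , y) ∈ K₀ → O x y ≡ true × x ∈ D × y ∈ D
        inner m = let (m′ , p , q) = ∈-filter⁻ off? {xs = K} m ; (o , x∈ , y∈) = h m′ in o , drop p x∈ , drop q y∈
        cover : ∀ {a} → a ∈ K → a ∈ K₀ ++ map orient M
        cover {x , y} m with x Finₚ.≟ v | y Finₚ.≟ v | h m
        ... | no p | no q | _ = ∈-++⁺ˡ (∈-filter⁺ off? m (p , q))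
        ... | yes refl | _ | o , _ , y∈ = ∈-++⁺ʳ K₀ (subst (_∈ map orient M) oriented-y (∈-map⁺ orient y∈M))
          where
          y∈M : y ∈ M
          y∈M = ∈-filter⁺ (H? x) (drop (O-irrefl o ∘ sym) y∈) (O⇒H o)
          oriented-y : orient y ≡ (x , y)
          oriented-y rewrite o = refl
        ... | no p | yes refl | o , x∈ , _ = ∈-++⁺ʳ K₀ (subst (_∈ map orient M) oriented-x (∈-map⁺ orient x∈M))
          where
          x∈M : x ∈ M
          x∈M = ∈-filter⁺ (H? y) (drop p x∈) (trans (H-sym y x) (O⇒H o))
          oriented-x : orient x ≡ (x , y)
          oriented-x rewrite asym o = refl

      length-L′ : length L′ ≡ length L + 2 * length X
      length-L′ = trans (length-++ L) (cong (length L +_) (trans (length-++ (map (v ,_) X))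
        (trans (cong₂ _+_ (length-map (v ,_) X) (length-map (_, v) X)) (lem (length X)))))
        where
        lem : ∀ n → n + n ≡ 2 * n
        lem = ℕ-solve-∀

      grow : ∀ s′ → 1 ≤ length M → s′ + length M ≤ s + 2 * length X → Grown s′ (v ∷ D)
      grow s′ M≥1 le = record
        { unique = All.tabulate (λ m → λ { refl → v∉ m }) ∷ D!
        ; in-R = λ { (here refl) → v∈R ; (there m) → in-R m }
        ; side = side′ ; L = L′ ; L-unique = L′-unique ; L-arcs = L′-arcs
        ; bound = λ K K! h → final K (bound′ K K! h)
        ; conn = conn′ }
        where
        final : ∀ K → length K + s ≤ length L + length M → length K + s′ ≤ length L′
        final K h = ℕₚ.+-cancelʳ-≤ (s + length M) _ _ (begin
          length K + s′ + (s + length M)                 ≡⟨ lem₁ (length K) s′ s (length M) ⟩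
          (length K + s) + (s′ + length M)               ≤⟨ ℕₚ.+-mono-≤ h le ⟩
          (length L + length M) + (s + 2 * length X)     ≡⟨ lem₂ (length L) (length M) s (length X) ⟩
          length L + 2 * length X + (s + length M)       ≡⟨ cong (_+ (s + length M)) length-L′ ⟨
          length L′ + (s + length M)                     ∎)
          where
          open ℕₚ.≤-Reasoning
          lem₁ : ∀ k s′ s m → k + s′ + (s + m) ≡ (k + s) + (s′ + m)
          lem₁ = ℕ-solve-∀
          lem₂ : ∀ l m s x → (l + m) + (s + 2 * x) ≡ l + 2 * x + (s + m)
          lem₂ = ℕ-solve-∀
        member : ∀ (l : List V) → 1 ≤ 2 * length l → ∃[ x ] x ∈ l
        member (x ∷ l) _ = x , here refl
        conn′ : ∀ (p : V → Bool) → (∀ {x y} → (x , y) ∈ L′ → p x ≡ p y) → ∀ {a b} → a ∈ v ∷ D → b ∈ v ∷ D → p a ≡ p b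
        conn′ p resp = all
          where
          m = member X (ℕₚ.≤-trans M≥1 (proj₂ larger))
          inD : ∀ {a b} → a ∈ D → b ∈ D → p a ≡ p b
          inD = conn p (resp ∘ ∈-++⁺ˡ)
          v-D : ∀ {a} → a ∈ D → p v ≡ p a
          v-D a∈ = trans (resp (∈-++⁺ʳ L (∈-++⁺ˡ (∈-map⁺ (v ,_) (proj₂ m))))) (inD (proj₁ (X⁻ (proj₂ m))) a∈)
          all : ∀ {a b} → a ∈ v ∷ D → b ∈ v ∷ D → p a ≡ p b
          all (here refl) (here refl) = refl
          all (here refl) (there q) = v-D q
          all (there q) (here refl) = sym (v-D q)
          all (there q) (there r) = inD q r

      -- An odd number of neighbours leaves one to spare.
      grow-odd : ∀ k → length M ≡ suc (2 * k) → Grown (suc s) (v ∷ D)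
      grow-odd k e = grow (suc s) (ℕₚ.≤-trans (s≤s z≤n) (ℕₚ.≤-reflexive (sym e))) (begin
        suc s + length M    ≡⟨ cong (suc s +_) e ⟩
        suc s + suc (2 * k) ≡⟨ lem s k ⟩
        s + 2 * suc k       ≤⟨ ℕₚ.+-monoʳ-≤ s (ℕₚ.*-monoʳ-≤ 2 (half (length X) (subst (_≤ 2 * length X) e (proj₂ larger)))) ⟩
        s + 2 * length X    ∎)
        where
        open ℕₚ.≤-Reasoning
        lem : ∀ s k → suc s + suc (2 * k) ≡ s + 2 * suc k
        lem = ℕ-solve-∀
        half : ∀ x → suc (2 * k) ≤ 2 * x → suc k ≤ x
        half x h = ℕₚ.*-cancelˡ-< 2 k x h

      grow-even : 1 ≤ length M → Grown s (v ∷ D)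
      grow-even M≥1 = grow s M≥1 (ℕₚ.+-monoʳ-≤ s (proj₂ larger))

    private
      neighbours-∈ : ∀ {v D u} → u ∈ D → H u v ≡ true → 1 ≤ length (neighbours v D)
      neighbours-∈ {v} {D} {u} u∈ h = nonempty (∈-filter⁺ (H? v) u∈ (trans (H-sym v u) h))
        where
        nonempty : ∀ {l : List V} → u ∈ l → 1 ≤ length l
        nonempty (here _) = s≤s z≤n
        nonempty (there _) = s≤s z≤n

      H-true : ∀ {x y} → O x y ≡ true → H y x ≡ true
      H-true {x} {y} o = trans (H-sym y x) (O⇒H o)

      hit : ∀ {v u D n} → H v u ≡ true → length (neighbours v D) ≡ n → length (neighbours v (u ∷ D)) ≡ suc n
      hit {v} h e = trans (cong length (filter-accept (H? v) h)) (cong suc e)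

      miss : ∀ {v u D n} → H v u ≢ true → length (neighbours v D) ≡ n → length (neighbours v (u ∷ D)) ≡ n
      miss {v} h e = trans (cong length (filter-reject (H? v) h)) e

    -- The neighbours of extra are a triangle, or two of them are not adjacent.
    start : ∃[ D ] (Grown 2 D × extra ∈ D)
    start = go (trues (O extra)) (trues-unique′) (λ m → ∈-trues⁻ (O extra) m) (trans (length-trues (O extra)) extra-degree)
      where
      open Conflicts using (trues-unique)
      trues-unique′ = trues-unique (O extra)
      go : ∀ l → Unique l → (∀ {a} → a ∈ l → O extra a ≡ true) → length l ≡ 3 → ∃[ D ] (Grown 2 D × extra ∈ D)
      go (a ∷ b ∷ c ∷ []) ((a≢b ∷ a≢c ∷ []) ∷ (b≢c ∷ []) ∷ [] ∷ []) out _ = by (H a b Bool.≟ true) (H a c Bool.≟ true) (H b c Bool.≟ true)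
        where
        e = extra
        e≢ : ∀ {x} → O e x ≡ true → x ≢ e
        e≢ o = O-irrefl o ∘ sym
        oa = out (here refl)
        ob = out (there (here refl))
        oc = out (there (there (here refl)))
        one : ∀ x → O e x ≡ true → Grown 1 (x ∷ e ∷ [])
        one x o = Step.grow-odd seed (closed extra∈ o) (λ { (here f) → e≢ o f }) 0 count-1
          where
          count-1 : length (neighbours x (e ∷ [])) ≡ 1
          count-1 = hit (H-true o) refl
        path : ∀ x y → O e x ≡ true → O e y ≡ true → x ≢ y → H x y ≢ true → ∃[ D ] (Grown 2 D × extra ∈ D)
        path x y ox oy x≢y h = y ∷ x ∷ e ∷ [] , Step.grow-odd (one x ox) (closed extra∈ oy) (λ { (here f) → x≢y (sym f) ; (there (here f)) → e≢ oy f }) 0 count-1 , there (there (here refl))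
          where
          count-1 : length (neighbours y (x ∷ e ∷ [])) ≡ 1
          count-1 = miss (h ∘ trans (H-sym x y)) (hit (H-true oy) refl)
        by : Dec (H a b ≡ true) → Dec (H a c ≡ true) → Dec (H b c ≡ true) → ∃[ D ] (Grown 2 D × extra ∈ D)
        by (no n) _ _ = path a b oa ob a≢b n
        by _ (no n) _ = path a c oa oc a≢c n
        by _ _ (no n) = path b c ob oc b≢c n
        by (yes ab) (yes ac) (yes bc) = c ∷ b ∷ a ∷ e ∷ [] , Step.grow-odd two (closed extra∈ oc)
            (λ { (here f) → b≢c (sym f) ; (there (here f)) → a≢c (sym f) ; (there (there (here f))) → e≢ oc f }) 1 count-3 , there (there (there (here refl)))
          where
          two : Grown 1 (b ∷ a ∷ e ∷ [])
          two = Step.grow-even (one a oa) (closed extra∈ ob) (λ { (here f) → a≢b (sym f) ; (there (here f)) → e≢ ob f }) (neighbours-∈ (here refl) ab)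
          count-3 : length (neighbours c (b ∷ a ∷ e ∷ [])) ≡ 3
          count-3 = hit (trans (H-sym c b) bc) (hit (trans (H-sym c a) ac) (hit (H-true oc) refl))

    -- With the surplus at 2, vertices are added until `D` contains all neighbours of its members in
    -- `R`; then all out-arcs of `D` stay in `D` and can be counted exactly.
    closure : ∀ k D → Grown 2 D → extra ∈ D → order < length D + k →
      ∃[ D ] (Grown 2 D × extra ∈ D × (∀ {u v} → u ∈ D → v ∈ R → H u v ≡ true → v ∈ D))
    closure zero D g e∈ len = ⊥-elim (ℕₚ.<⇒≱ (subst (order <_) (ℕₚ.+-identityʳ _) len) (unique-length (λ v → v) (λ e → e) (Grown.unique g)))
    closure (suc k) D g e∈ len with Finₚ.any? (λ u → Finₚ.any? λ v → (u ∈? D) ×-dec ((v ∈? R) ×-dec ((H u v Bool.≟ true) ×-dec ¬? (v ∈? D))))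
    ... | yes (u , v , u∈ , v∈ , h , v∉) = closure k (v ∷ D) (Step.grow-even g v∈ v∉ (neighbours-∈ u∈ h)) (there e∈) (subst (order <_) (ℕₚ.+-suc _ k) len)
    ... | no none = D , g , e∈ , λ {u} {v} u∈ v∈ h → maximal u v u∈ v∈ h
      where
      maximal : ∀ u v → u ∈ D → v ∈ R → H u v ≡ true → v ∈ D
      maximal u v u∈ v∈ h with v ∈? D
      ... | yes m = m
      ... | no n = ⊥-elim (none (u , v , u∈ , v∈ , h , n))

    dense⇒¬separable : ¬ SepChoosable G 2
    dense⇒¬separable sep with closure (suc order) (proj₁ start) (proj₁ (proj₂ start)) (proj₂ (proj₂ start)) (ℕₚ.m≤n+m (suc order) _)
    ... | D , g , e∈ , maximal = ℕₚ.<⇒≱ many few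
      where
      open Grown g renaming (unique to D!)
      B : V → V → Bool
      B x y = adj x y ∧ (side x xor side y)
      xor-sym : ∀ a b → a xor b ≡ b xor a
      xor-sym true true = refl
      xor-sym true false = refl
      xor-sym false true = refl
      xor-sym false false = refl
      B-sym : ∀ x y → B x y ≡ B y x
      B-sym x y = cong₂ _∧_ (adj-sym x y) (xor-sym (side x) (side y))
      B-irrefl : ∀ x → B x x ≡ false
      B-irrefl x rewrite adj-irrefl x = refl
      B⁻ : ∀ {x y} → B x y ≡ true → adj x y ≡ true × side x xor side y ≡ true
      B⁻ {x} {y} e with adj x y | side x xor side y
      ... | true | true = refl , refl
      open Restriction B B-sym B-irrefl
      no-config : ∀ U → ¬ Sub.Config U
      no-config U cf = BadConfigs.Bipartite.config-separated G (restrict U) (λ {x} {y} e → proj₁ (B⁻ (proj₁ (restrict⁻ {U} {x} {y} e))))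
        (restrict-sym U) (restrict-irrefl U) side (λ {x} {y} e → proj₂ (B⁻ (proj₁ (restrict⁻ {U} {x} {y} e)))) cf sep
      U : V → Bool
      U x with x ∈? D
      ... | yes _ = true
      ... | no _  = false
      U⁺ : ∀ {x} → x ∈ D → U x ≡ true
      U⁺ {x} m with x ∈? D
      ... | yes _ = refl
      ... | no n = ⊥-elim (n m)
      U⁻ : ∀ {x} → U x ≡ true → x ∈ D
      U⁻ {x} e with x ∈? D
      ... | yes m = m
      arcs : ∀ {x y} → (x , y) ∈ L → restrict U x y ≡ true
      arcs m = let (x∈ , y∈ , h , e) = L-arcs m in restrict⁺ {U} (cong₂ _∧_ (H⇒adj h) e) (U⁺ x∈) (U⁺ y∈)
      connected : Sparse.Connected U
      connected p resp {x} {y} {a} {b} xy ab =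
        conn p (resp ∘ arcs) (U⁻ (proj₁ (proj₂ (restrict⁻ {U} {x} {y} xy)))) (U⁻ (proj₁ (proj₂ (restrict⁻ {U} {a} {b} ab))))
      few : length L ≤ 2 * length D + 2
      few = ℕₚ.≤-trans (Sparse.sparse no-config U connected L L-unique arcs)
        (ℕₚ.+-monoˡ-≤ 2 (ℕₚ.*-monoʳ-≤ 2 (subst (_≤ length D) (length-trues U) (unique-⊆-length (trues-unique U) (λ m → U⁻ (∈-trues⁻ U m))))))
        where open Conflicts using (trues-unique)
      K = out-arcs O D
      size : length K ≡ suc (length D * 2)
      size = length-out-arcs-extra O D! e∈ extra-degree λ u∈ u≢ → degree (in-R u∈) u≢
      many : 2 * length D + 2 < length L
      many = ℕₚ.≤-trans (ℕₚ.≤-reflexive (trans (lem (length D)) (cong (_+ 2) (sym size))))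
        (bound K (out-arcs-unique O D!) λ m → let (u∈ , o) = ∈-out-arcs⁻ O D m in o , u∈ , maximal u∈ (closed (in-R u∈) o) (O⇒H o))
        where
        lem : ∀ d → suc (2 * d + 2) ≡ suc (d * 2) + 2
        lem = ℕ-solve-∀

  sep-choosable⇒conflict-colourable : ∀ G → SepChoosable G 2 → ConflictColourable G 3
  sep-choosable⇒conflict-colourable G sep with orientation-or-dense (Graph.adj G) (Graph.adj-irrefl G) (Graph.adj-sym G) 2
  ... | inj₁ dense = ⊥-elim (dense⇒¬separable G dense sep)
  ... | inj₂ or = oriented⇒conflict-colourable G or
    where open Conflicts using (oriented⇒conflict-colourable)

  adaptable⇒conflict-colourable : ∀ G → AdaptablyChoosable G 2 → ConflictColourable G 2
  adaptable⇒conflict-colourable G ad c = proj₁ colouring , conflict-colouring G c (proj₁ colouring) λ {x} {y} a →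
      proj₂ colouring {x} {y} (restrict⁺ {λ _ → true} a refl refl)
    where
    open Graph G
    open Conflicts using (conflict-colouring; class)
    open Restriction adj adj-sym adj-irrefl
    no-config : ∀ U → ¬ Sub.Config U
    no-config U cf = BadConfigs.bad-adapted G (restrict U) B⊆ (restrict-sym U) (restrict-irrefl U)
      (BadConfigs.config-bad G (restrict U) B⊆ (restrict-sym U) (restrict-irrefl U) cf) ad
      where
      B⊆ : ∀ {x y} → restrict U x y ≡ true → adj x y ≡ true
      B⊆ {x} {y} e = proj₁ (restrict⁻ {U} {x} {y} e)
    colouring = Colouring.colourable (class G c) no-config (λ _ → true)

-- The example graphs and their drawings.

module Fans where

  open Segments using (ℚ-ring)
  open Obstructions using (∧-left; ∧-right)
  open Conflicts using (edge-ext; adjacent₁₂)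
  open Drawings using (OnSegment-end)
  open import Data.Fin as Fin using (Fin; zero; suc; toℕ; remQuot; combine; _≟_)
  open import Data.List using ([]; _∷_)
  open import Data.Nat as ℕ using (ℕ; zero; suc)
  open import Data.Rational using (ℚ; mkℚ; 0ℚ; 1ℚ; _+_; _*_; _-_; -_; _≤_; *≤*; nonNegative; ≢-nonZero; 1/_)
  open import Data.Rational.Properties

    using (≤-refl; ≤-antisym; ≤-trans; ≤-reflexive; +-mono-≤; +-monoʳ-≤; neg-antimono-≤; *-monoˡ-≤-nonNeg; *-inverseˡ; *-assoc; *-identityˡ; *-zeroˡ; mkℚ-injective; drop-*≤*)
    renaming (_≟_ to _≟ℚ_)

  private
    sign : Bool → ℚ
    sign false = - 1ℚ
    sign true  = 1ℚ

    level : ℕ → ℚ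
    level n = mkℚ (ℤ.+ suc n) 0 (Coprimality.sym (Coprimality.1-coprimeTo (suc n)))

    level-injective : ∀ {m n} → level m ≡ level n → m ≡ n
    level-injective e = ℕₚ.suc-injective (ℤₚ.+-injective (proj₁ (mkℚ-injective e)))

    level-cancel-≤ : ∀ {m n} → level m ≤ level n → m ℕ.≤ n
    level-cancel-≤ {m} {n} le = ℕₚ.≤-pred (ℤₚ.drop‿+≤+ (subst₂ ℤ._≤_ (ℤₚ.*-identityʳ (ℤ.+ suc m)) (ℤₚ.*-identityʳ (ℤ.+ suc n)) (drop-*≤* le)))

    level-mono-≤ : ∀ {m n} → m ℕ.≤ n → level m ≤ level n
    level-mono-≤ {m} {n} le = *≤* (subst₂ ℤ._≤_ (sym (ℤₚ.*-identityʳ (ℤ.+ suc m))) (sym (ℤₚ.*-identityʳ (ℤ.+ suc n))) (ℤ.+≤+ (ℕ.s≤s le)))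

    sign≢0 : ∀ s → sign s ≢ 0ℚ
    sign≢0 false ()
    sign≢0 true ()

    sign-square : ∀ s → sign s * sign s ≡ 1ℚ
    sign-square false = refl
    sign-square true = refl

    cancel : ∀ {a b c} → a ≢ 0ℚ → a * b ≡ a * c → b ≡ c
    cancel {a} {b} {c} n e = trans (sym (back b)) (trans (cong ((1/ a) {{nz}} *_) e) (back c))
      where
      nz = ≢-nonZero n
      back : ∀ b → (1/ a) {{nz}} * (a * b) ≡ b
      back b = trans (sym (*-assoc ((1/ a) {{nz}}) a b)) (trans (cong (_* b) (*-inverseˡ a {{nz}})) (*-identityˡ b))

    0≤- : ∀ {x y} → x ≤ y → 0ℚ ≤ y - x
    0≤- {x} {y} le = subst (_≤ y - x) (lem x) (+-mono-≤ le (≤-refl { - x}))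
      where
      lem : ∀ x → x - x ≡ 0ℚ
      lem = solve-∀ ℚ-ring

    0≤-⁻¹ : ∀ {x y} → 0ℚ ≤ y - x → x ≤ y
    0≤-⁻¹ {x} {y} le = subst₂ _≤_ (lem₁ x) (lem₂ x y) (+-monoʳ-≤ x le)
      where
      lem₁ : ∀ x → x + 0ℚ ≡ x
      lem₁ = solve-∀ ℚ-ring
      lem₂ : ∀ x y → x + (y - x) ≡ y
      lem₂ = solve-∀ ℚ-ring

    0≤* : ∀ {x y} → 0ℚ ≤ x → 0ℚ ≤ y → 0ℚ ≤ x * y
    0≤* {x} {y} p q = subst (_≤ x * y) (lem x) (*-monoˡ-≤-nonNeg x {{nonNegative p}} q)
      where
      lem : ∀ x → x * 0ℚ ≡ 0ℚ
      lem = solve-∀ ℚ-ring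

    -- The segment from the hub (±1, 0) to (0, h) by equations: x · sign s is the distance r from
    -- the axis, and the height is (1 - r) h.
    record OnArm (s : Bool) (h : ℚ) (p : Point) : Set where
      constructor on-arm
      field
        outward : 0ℚ ≤ proj₁ p * sign s
        height  : proj₂ p ≡ (1ℚ - proj₁ p * sign s) * h

    arm⁻ : ∀ {s h p} → OnSegment (sign s , 0ℚ) (0ℚ , h) p → OnArm s h p
    arm⁻ {s} {h} (t , 0≤t , t≤1 , refl) = on-arm (subst (0ℚ ≤_) (sym (r≡ (sign s) (sign-square s))) (0≤- t≤1))
        (trans (lem₁ t h) (cong (_* h) (trans (lem₂ t) (cong (λ z → 1ℚ - z) (sym (r≡ (sign s) (sign-square s)))))))
      where
      lem : ∀ t σ → ((1ℚ - t) * σ + t * 0ℚ) * σ ≡ (1ℚ - t) * (σ * σ)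
      lem = solve-∀ ℚ-ring
      unit : ∀ x → x * 1ℚ ≡ x
      unit = solve-∀ ℚ-ring
      r≡ : ∀ σ → σ * σ ≡ 1ℚ → ((1ℚ - t) * σ + t * 0ℚ) * σ ≡ 1ℚ - t
      r≡ σ e = trans (lem t σ) (trans (cong ((1ℚ - t) *_) e) (unit (1ℚ - t)))
      lem₁ : ∀ t h → (1ℚ - t) * 0ℚ + t * h ≡ t * h
      lem₁ = solve-∀ ℚ-ring
      lem₂ : ∀ t → t ≡ 1ℚ - (1ℚ - t)
      lem₂ = solve-∀ ℚ-ring

    record OnBar (a b : ℚ) (p : Point) : Set where
      constructor on-bar
      field
        upright : proj₁ p ≡ 0ℚ
        above   : a ≤ proj₂ p
        below   : proj₂ p ≤ b

    bar⁻ : ∀ {a b p} → a ≤ b → OnSegment (0ℚ , a) (0ℚ , b) p → OnBar a b p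
    bar⁻ {a} {b} a≤b (t , 0≤t , t≤1 , refl) = on-bar (lem₀ t)
        (0≤-⁻¹ (subst (0ℚ ≤_) (lem₁ t a b) (0≤* 0≤t (0≤- a≤b))))
        (0≤-⁻¹ (subst (0ℚ ≤_) (lem₂ t a b) (0≤* (0≤- t≤1) (0≤- a≤b))))
      where
      lem₀ : ∀ t → (1ℚ - t) * 0ℚ + t * 0ℚ ≡ 0ℚ
      lem₀ = solve-∀ ℚ-ring
      lem₁ : ∀ t a b → t * (b - a) ≡ (1ℚ - t) * a + t * b - a
      lem₁ = solve-∀ ℚ-ring
      lem₂ : ∀ t a b → (1ℚ - t) * (b - a) ≡ b - ((1ℚ - t) * a + t * b)
      lem₂ = solve-∀ ℚ-ring

    tip : ∀ {s h p} → OnArm s h p → proj₁ p ≡ 0ℚ → p ≡ (0ℚ , h)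
    tip {s} {h} {p} (on-arm _ e) refl = cong (0ℚ ,_) (trans e (lem (sign s) h))
      where
      lem : ∀ σ h → (1ℚ - 0ℚ * σ) * h ≡ h
      lem = solve-∀ ℚ-ring

    sign-square-cancel : ∀ s x → x * sign s ≡ 1ℚ → x ≡ sign s
    sign-square-cancel s x e = trans (lem₁ x) (trans (cong (x *_) (sym (sign-square s))) (trans (lem₂ x (sign s)) (trans (cong (_* sign s) e) (lem₃ (sign s)))))
      where
      lem₁ : ∀ x → x ≡ x * 1ℚ
      lem₁ = solve-∀ ℚ-ring
      lem₂ : ∀ x σ → x * (σ * σ) ≡ x * σ * σ
      lem₂ = solve-∀ ℚ-ring
      lem₃ : ∀ σ → 1ℚ * σ ≡ σ
      lem₃ = solve-∀ ℚ-ring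

    -- From (1 - r) h = (1 - r) h′ with h ≠ h′ follows r = 1, which is the hub.
    arms-same-side : ∀ {s h h′ p} → OnArm s h p → OnArm s h′ p → h ≢ h′ → p ≡ (sign s , 0ℚ)
    arms-same-side {s} {h} {h′} {x , y} (on-arm _ e) (on-arm _ e′) h≢h′ with (1ℚ - x * sign s) ≟ℚ 0ℚ
    ... | no n = ⊥-elim (h≢h′ (cancel n (trans (sym e) e′)))
    ... | yes z = cong₂ _,_ (sign-square-cancel s x (trans (lem (x * sign s)) (trans (cong (λ z → 1ℚ - z) z) refl))) (trans e (trans (cong (_* h) z) (*-zeroˡ h)))
      where
      lem : ∀ a → a ≡ 1ℚ - (1ℚ - a)
      lem = solve-∀ ℚ-ring

    arms-opposite : ∀ {h h′ p} → OnArm false h p → OnArm true h′ p → proj₁ p ≡ 0ℚ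
    arms-opposite {h} {h′} {x , y} (on-arm o _) (on-arm o′ _) =
      ≤-antisym (0≤-⁻¹ (subst (0ℚ ≤_) (lem₁ x) o)) (subst (0ℚ ≤_) (lem₂ x) o′)
      where
      lem₁ : ∀ x → x * (- 1ℚ) ≡ 0ℚ - x
      lem₁ = solve-∀ ℚ-ring
      lem₂ : ∀ x → x * 1ℚ ≡ x
      lem₂ = solve-∀ ℚ-ring

  -- Two hubs, the first of which is joined to all spokes; the flags tell whether
  -- the second one is as well, and whether the spokes are joined in pairs.
  module _ (h : ℕ) (second paired : Bool) where

    private
      V = Fin (2 ℕ.+ h ℕ.* 2)

    hub : Bool → V
    hub false = zero
    hub true  = suc zero

    spoke : Fin (h ℕ.* 2) → V
    spoke i = suc (suc i)

    -- Partners have the same quotient by 2, so they are the spokes 2 q and 2 q + 1.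
    rung : Fin (h ℕ.* 2) → Fin (h ℕ.* 2) → Bool
    rung i j = does (proj₁ (remQuot {h} 2 i) ≟ proj₁ (remQuot {h} 2 j)) ∧ not (does (i ≟ j))

    fan-adj : V → V → Bool
    fan-adj zero          (suc (suc _)) = true
    fan-adj (suc (suc _)) zero          = true
    fan-adj (suc zero)    (suc (suc _)) = second
    fan-adj (suc (suc _)) (suc zero)    = second
    fan-adj (suc (suc i)) (suc (suc j)) = paired ∧ rung i j
    fan-adj _             _             = false

    private
      does-sym : ∀ {n} (i j : Fin n) → does (i ≟ j) ≡ does (j ≟ i)
      does-sym i j with i ≟ j | j ≟ i
      ... | yes _ | yes _ = refl
      ... | no _ | no _ = refl
      ... | yes p | no n = ⊥-elim (n (sym p))
      ... | no n | yes p = ⊥-elim (n (sym p))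

      fan-sym : ∀ x y → fan-adj x y ≡ fan-adj y x
      fan-sym zero zero = refl
      fan-sym zero (suc zero) = refl
      fan-sym zero (suc (suc _)) = refl
      fan-sym (suc zero) zero = refl
      fan-sym (suc zero) (suc zero) = refl
      fan-sym (suc zero) (suc (suc _)) = refl
      fan-sym (suc (suc _)) zero = refl
      fan-sym (suc (suc _)) (suc zero) = refl
      fan-sym (suc (suc i)) (suc (suc j)) = cong (paired ∧_) (cong₂ (λ a b → a ∧ not b) (does-sym (proj₁ (remQuot {h} 2 i)) (proj₁ (remQuot {h} 2 j))) (does-sym i j))

      fan-irrefl : ∀ x → fan-adj x x ≡ false
      fan-irrefl zero = refl
      fan-irrefl (suc zero) = refl
      fan-irrefl (suc (suc i)) = off paired (does (proj₁ (remQuot {h} 2 i) ≟ proj₁ (remQuot {h} 2 i))) (dec-true (i ≟ i) refl)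
        where
        off : ∀ a b {c} → c ≡ true → a ∧ (b ∧ not c) ≡ false
        off false _ _ = refl
        off true false _ = refl
        off true true refl = refl

    fan : Graph
    fan = record { order = 2 ℕ.+ h ℕ.* 2 ; adj = fan-adj ; adj-sym = fan-sym ; adj-irrefl = fan-irrefl }

    lower : Fin h → Fin (h ℕ.* 2)
    lower q = combine q zero

    upper : Fin h → Fin (h ℕ.* 2)
    upper q = combine q (suc zero)

    -- Edges with the smaller end first.
    data View : V → V → Set where
      arm : ∀ s i → (s ≡ true → second ≡ true) → View (hub s) (spoke i)
      bar : ∀ q → paired ≡ true → View (spoke (lower q)) (spoke (upper q))

    upper-value : ∀ q → toℕ (upper q) ≡ suc (toℕ (lower q))
    upper-value q = trans (Finₚ.toℕ-combine q (suc zero)) (trans (ℕₚ.+-suc (2 ℕ.* toℕ q) 0) (cong suc (sym (Finₚ.toℕ-combine q zero))))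

    upper≢lower : ∀ q → upper q ≢ lower q
    upper≢lower q e = ℕₚ.1+n≢n (trans (sym (upper-value q)) (cong toℕ e))

    bar-adjacent : ∀ q → paired ≡ true → fan-adj (spoke (lower q)) (spoke (upper q)) ≡ true
    bar-adjacent q refl = both (dec-true (proj₁ (remQuot {h} 2 (lower q)) ≟ proj₁ (remQuot {h} 2 (upper q))) (trans (cong proj₁ (Finₚ.remQuot-combine {h} {2} q zero)) (sym (cong proj₁ (Finₚ.remQuot-combine {h} {2} q (suc zero))))))
        (dec-false (lower q ≟ upper q) (upper≢lower q ∘ sym))
      where
      both : ∀ {a b} → a ≡ true → b ≡ false → a ∧ not b ≡ true
      both refl refl = refl

    private
      does⇒≡ : ∀ {n} (i j : Fin n) → does (i ≟ j) ≡ true → i ≡ j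
      does⇒≡ i j e with i ≟ j
      ... | yes p = p

      view-bar : ∀ i j → i Fin.< j → proj₁ (remQuot {h} 2 i) ≡ proj₁ (remQuot {h} 2 j) → paired ≡ true → View (spoke i) (spoke j)
      view-bar i j i<j e on with Finₚ.combine-surjective {h} i | Finₚ.combine-surjective {h} j
      ... | q , r , refl | q′ , r′ , refl = go q≡ r r′ (subst₂ ℕ._<_ (Finₚ.toℕ-combine q r) (Finₚ.toℕ-combine q′ r′) i<j)
        where
        q≡ : q ≡ q′
        q≡ = trans (cong proj₁ (sym (Finₚ.remQuot-combine {h} {2} q r))) (trans e (cong proj₁ (Finₚ.remQuot-combine {h} {2} q′ r′)))
        go : ∀ {q q′} → q ≡ q′ → ∀ r r′ → 2 ℕ.* toℕ q ℕ.+ toℕ r ℕ.< 2 ℕ.* toℕ q′ ℕ.+ toℕ r′ → View (spoke (combine q r)) (spoke (combine q′ r′))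
        go {q} refl r r′ lt with ℕₚ.+-cancelˡ-< (2 ℕ.* toℕ q) (toℕ r) (toℕ r′) lt
        go {q} refl zero (suc zero) _ | _ = bar q on
        go {q} refl (suc zero) (suc zero) _ | ℕ.s≤s ()

    view : ∀ x y → x Fin.< y → fan-adj x y ≡ true → View x y
    view zero (suc (suc i)) _ a = arm false i λ ()
    view (suc zero) (suc (suc i)) _ a = arm true i λ _ → a
    view (suc (suc i)) (suc zero) (ℕ.s≤s ()) a
    view (suc (suc i)) (suc (suc j)) i<j a = view-bar i j (ℕₚ.≤-pred (ℕₚ.≤-pred i<j))
      (does⇒≡ _ _ (∧-left {does (proj₁ (remQuot {h} 2 i) ≟ proj₁ (remQuot {h} 2 j))} (∧-right {paired} a))) (∧-left {paired} a)

    view-edge : ∀ (e : Graph.Edge fan) → View (Graph.end₁ e) (Graph.end₂ e)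
    view-edge e = view _ _ (Graph.Edge.ordered e) (adjacent₁₂ fan e)

    -- Hubs to the left and right, spokes one above another on the axis between. Partners are
    -- consecutive, so the bar between them passes no other spoke.
    place : V → Point
    place zero          = sign false , 0ℚ
    place (suc zero)    = sign true , 0ℚ
    place (suc (suc i)) = 0ℚ , level (toℕ i)

    private
      place-hub : ∀ s → place (hub s) ≡ (sign s , 0ℚ)
      place-hub false = refl
      place-hub true = refl

      place-injective : ∀ {x y} → place x ≡ place y → x ≡ y
      place-injective {zero} {zero} _ = refl
      place-injective {suc zero} {suc zero} _ = refl
      place-injective {suc (suc i)} {suc (suc j)} e = cong spoke (Finₚ.toℕ-injective (level-injective (cong proj₂ e)))
      place-injective {zero} {suc zero} ()
      place-injective {zero} {suc (suc _)} ()
      place-injective {suc zero} {zero} ()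
      place-injective {suc zero} {suc (suc _)} ()
      place-injective {suc (suc _)} {zero} ()
      place-injective {suc (suc _)} {suc zero} ()

      height-of : Fin (h ℕ.* 2) → ℚ
      height-of i = level (toℕ i)

      data Drawn : V → V → Point → Set where
        along-arm : ∀ s i {p} → OnArm s (height-of i) p → Drawn (hub s) (spoke i) p
        along-bar : ∀ q {p} → OnBar (height-of (lower q)) (height-of (upper q)) p → Drawn (spoke (lower q)) (spoke (upper q)) p

      drawn : ∀ {x y} → View x y → ∀ {p} → OnSegment (place x) (place y) p → Drawn x y p
      drawn (arm s i _) {p} on = along-arm s i (arm⁻ (subst (λ o → OnSegment o (0ℚ , height-of i) p) (place-hub s) on))
      drawn (bar q _) on = along-bar q (bar⁻ (level-mono-≤ (subst (toℕ (lower q) ℕ.≤_) (sym (upper-value q)) (ℕₚ.n≤1+n _))) on)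

      on-bar-spoke : ∀ q i → OnBar (height-of (lower q)) (height-of (upper q)) (place (spoke i)) → i ≡ lower q ⊎ i ≡ upper q
      on-bar-spoke q i (on-bar _ a b) with ℕₚ.m≤n⇒m<n∨m≡n (level-cancel-≤ a)
      ... | inj₂ e = inj₁ (Finₚ.toℕ-injective (sym e))
      ... | inj₁ lt = inj₂ (Finₚ.toℕ-injective (ℕₚ.≤-antisym (level-cancel-≤ b) (subst (ℕ._≤ toℕ i) (sym (upper-value q)) lt)))

      On : V → V → V → Set
      On x y v = v ≡ x ⊎ v ≡ y

      vertex-on : ∀ {x y} v {p} → p ≡ place v → Drawn x y p → On x y v
      vertex-on zero refl (along-arm false i _) = inj₁ refl
      vertex-on (suc zero) refl (along-arm true i _) = inj₁ refl
      vertex-on (suc zero) refl (along-arm false i (on-arm (*≤* ()) _))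
      vertex-on zero refl (along-arm true i (on-arm (*≤* ()) _))
      vertex-on (suc (suc j)) refl (along-arm s i d) = inj₂ (cong spoke (Finₚ.toℕ-injective (level-injective (cong proj₂ (tip d refl)))))
      vertex-on zero refl (along-bar q d) = ⊥-elim (sign≢0 false (OnBar.upright d))
      vertex-on (suc zero) refl (along-bar q d) = ⊥-elim (sign≢0 true (OnBar.upright d))
      vertex-on (suc (suc i)) refl (along-bar q d) with on-bar-spoke q i d
      ... | inj₁ refl = inj₁ refl
      ... | inj₂ refl = inj₂ refl

      arms-meet : ∀ s s′ {i j p} → ¬ (hub s ≡ hub s′ × spoke i ≡ spoke j) → OnArm s (height-of i) p → OnArm s′ (height-of j) p →
        p ≡ place (hub s) ⊎ p ≡ place (spoke i)
      arms-meet false false n d d′ = inj₁ (arms-same-side d d′ λ e → n (refl , cong spoke (Finₚ.toℕ-injective (level-injective e))))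
      arms-meet true true n d d′ = inj₁ (arms-same-side d d′ λ e → n (refl , cong spoke (Finₚ.toℕ-injective (level-injective e))))
      arms-meet false true n d d′ = inj₂ (tip d (arms-opposite d d′))
      arms-meet true false n d d′ = inj₂ (tip d (arms-opposite d′ d))

      bars-meet : ∀ {q q′ p} → lower q Fin.< lower q′ → OnBar (height-of (lower q)) (height-of (upper q)) p →
        OnBar (height-of (lower q′)) (height-of (upper q′)) p → p ≡ place (spoke (upper q))
      bars-meet {q} {q′} lt d d′ = cong₂ _,_ (OnBar.upright d) (≤-antisym (OnBar.below d)
        (≤-trans (level-mono-≤ (subst (ℕ._≤ toℕ (lower q′)) (sym (upper-value q)) lt)) (OnBar.above d′)))

      -- It suffices to see that a common point is some vertex; `vertex-on` then makes it an end of
      -- both edges.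
      meeting-point : ∀ {x y x′ y′ p} → ¬ (x ≡ x′ × y ≡ y′) → Drawn x y p → Drawn x′ y′ p → ∃[ v ] p ≡ place v
      meeting-point n (along-arm s i d) (along-arm s′ j d′) = [ (hub s ,_) , (spoke i ,_) ]′ (arms-meet s s′ n d d′)
      meeting-point n (along-arm s i d) (along-bar q d′) = spoke i , tip d (OnBar.upright d′)
      meeting-point n (along-bar q d) (along-arm s i d′) = spoke i , tip d′ (OnBar.upright d)
      meeting-point n (along-bar q d) (along-bar q′ d′) with Finₚ.<-cmp (lower q) (lower q′)
      ... | tri< lt _ _ = spoke (upper q) , bars-meet lt d d′
      ... | tri> _ _ gt = spoke (upper q′) , bars-meet gt d′ d
      ... | tri≈ _ e _ = ⊥-elim (n (cong spoke e , cong (spoke ∘ upper) (Finₚ.combine-injectiveˡ q zero q′ zero e)))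

      on-segment : ∀ a b {p} → OnPath (a ∷ b ∷ []) p → OnSegment a b p
      on-segment a b (inj₁ on) = on
      on-segment a b (inj₂ refl) = OnSegment-end a b

      drawn-edge : ∀ e {p} → OnPath (place (Graph.end₁ e) ∷ place (Graph.end₂ e) ∷ []) p → Drawn (Graph.end₁ e) (Graph.end₂ e) p
      drawn-edge e on = drawn (view-edge e) (on-segment _ _ on)

      ordered≢ : ∀ (e : Graph.Edge fan) → place (Graph.end₁ e) ≢ place (Graph.end₂ e)
      ordered≢ e eq = ℕₚ.<-irrefl (cong toℕ (place-injective eq)) (Graph.Edge.ordered e)

    fan-planar : Planar fan
    fan-planar = record
      { pos = place ; bends = λ _ → [] ; pos-injective = place-injective
      ; arc-simple = λ e → ordered≢ e , (λ p _ on → on) , _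
      ; vertex-on-arc = λ e v on → vertex-on v refl (drawn-edge e on)
      ; arcs-meet = λ e f e≢f p on on′ →
          let (v , eq) = meeting-point (λ (p , q) → e≢f (edge-ext fan p q)) (drawn-edge e on) (drawn-edge f on′)
          in v , vertex-on v eq (drawn-edge e on) , vertex-on v eq (drawn-edge f on′) , eq }

-- Comparing the three invariants.

module Comparison where

  open Darts using (lookup-injective)
  open ListSchemes using (max-common; max-common-≥; max-common-≤)
  open import Data.Fin using (Fin; zero; suc; cast)
  open import Data.List using ([]; _∷_)
  open import Data.List.Relation.Unary.All using ([])
  open import Data.List.Relation.Unary.AllPairs using ([]; _∷_)
  open import Data.Nat using (ℕ; zero; suc; _≤_; s≤s; z≤n)

  open DecMembership ℕₚ._≟_ using (_∈?_)

  common-unique : ∀ {l m : List ℕ} {a b} → ∣ l ∩ m ∣ ≤ 1 → a ∈ l → a ∈ m → b ∈ l → b ∈ m → a ≡ b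
  common-unique {m = m} le a∈l a∈m b∈l b∈m = single le (∈-filter⁺ (_∈? m) a∈l a∈m) (∈-filter⁺ (_∈? m) b∈l b∈m)
    where
    single : ∀ {a b} {l : List ℕ} → length l ≤ 1 → a ∈ l → b ∈ l → a ≡ b
    single {l = _ ∷ []} _ (here p) (here q) = trans p (sym q)
    single {l = _ ∷ _ ∷ _} (s≤s ()) _ _

  module _ (G : Graph) where
    open Graph G

    -- The list {0} at every vertex is separated and makes any edge monochromatic.
    sep-choosable-1⇒edgeless : SepChoosable G 1 → ¬ Edge
    sep-choosable-1⇒edgeless sep e with sep (λ _ → 0 ∷ []) (λ _ → ([] ∷ []) , refl) (λ _ → s≤s z≤n)
    ... | c , proper , from = proper e (trans (is-0 (from (end₁ e))) (sym (is-0 (from (end₂ e)))))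
      where
      is-0 : ∀ {a} → a ∈ 0 ∷ [] → a ≡ 0
      is-0 (here p) = p

    edgeless⇒conflict-colourable-1 : ¬ Edge → ConflictColourable G 1
    edgeless⇒conflict-colourable-1 none c = (λ _ → zero) , λ e → ⊥-elim (none e)

    -- If two lists share at most one colour, an edge labelled with it is adapted only when its ends
    -- differ.
    adaptable⇒sep-choosable : ∀ {k} → AdaptablyChoosable G k → SepChoosable G k
    adaptable⇒sep-choosable ad L isList sep with ad (λ e → max-common (L (end₁ e)) (L (end₂ e))) L isList
    ... | c , adapted , from = c , (λ e eq → adapted e (eq , largest e eq)) , from
      where
      largest : ∀ e → c (end₁ e) ≡ c (end₂ e) → c (end₂ e) ≡ max-common (L (end₁ e)) (L (end₂ e))
      largest e eq = ℕₚ.≤-antisym (max-common-≥ (L (end₁ e)) in₁ in₂)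
        (max-common-≤ (L (end₁ e)) λ p q → ℕₚ.≤-reflexive (common-unique (sep e) p q in₁ in₂))
        where
        in₁ = subst (_∈ L (end₁ e)) eq (from (end₁ e))
        in₂ = from (end₂ e)

    -- Positions in the lists serve as classes.
    conflict-colourable⇒adaptable : ∀ {k} → ConflictColourable G (suc k) → AdaptablyChoosable G (suc k)
    conflict-colourable⇒adaptable {k} conf f L isList = colour , adapted , λ v → ∈-lookup {xs = L v} (at v (φ v))
      where
      at : ∀ v → Fin (suc k) → Fin (length (L v))
      at v = cast (sym (proj₂ (isList v)))
      position : ∀ v a → ∃[ i ] (a ∈ L v → lookup (L v) (at v i) ≡ a)
      position v a with a ∈? L v
      -- A colour outside the list is never taken at v, so its class may be arbitrary.
      ... | no a∉ = zero , λ a∈ → ⊥-elim (a∉ a∈)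
      ... | yes a∈ = cast (proj₂ (isList v)) (index a∈) , λ _ → trans (cong (lookup (L v)) (back (index a∈))) (sym (lookup-index a∈))
        where
        back : ∀ i → at v (cast (proj₂ (isList v)) i) ≡ i
        back i = Finₚ.cast-involutive (sym (proj₂ (isList v))) (proj₂ (isList v)) i
      solution = conf λ v (e , _) → proj₁ (position v (f e))
      φ = proj₁ solution
      colour : Vertex → ℕ
      colour v = lookup (L v) (at v (φ v))
      at-position : ∀ v a → colour v ≡ a → φ v ≡ proj₁ (position v a)
      at-position v a eq = trans (sym (back (φ v))) (trans (cong (cast (proj₂ (isList v))) same) (back (proj₁ (position v a))))
        where
        back : ∀ i → cast (proj₂ (isList v)) (at v i) ≡ i
        back i = Finₚ.cast-involutive (proj₂ (isList v)) (sym (proj₂ (isList v))) i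
        same : at v (φ v) ≡ at v (proj₁ (position v a))
        same = lookup-injective (proj₁ (isList v)) _ _ (trans eq (sym (proj₂ (position v a) (subst (_∈ L v) eq (∈-lookup {xs = L v} (at v (φ v)))))))
      adapted : Adapted G f colour
      adapted e (p , q) = proj₂ solution e (at-position (end₁ e) (f e) (trans p q) , at-position (end₂ e) (f e) q)

-- Upper and lower bounds for the examples.

module Examples where

  open Obstructions using (module BadConfigs)
  open Comparison
  open Fans
  open Orientations using (count; Orientation)
  open TwoClasses using (unique-⊆-length)
  open import Data.Fin as Fin using (Fin; zero; suc; toℕ; remQuot; combine)
  open import Data.List using ([]; _∷_)
  open import Data.List.Relation.Unary.All as All using ([]; _∷_)
  open import Data.List.Relation.Unary.AllPairs using ([]; _∷_)
  open import Data.Nat as ℕ using (ℕ; zero; suc; _+_; _≤_; _<_; z≤n; s≤s)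

  open DecMembership ℕₚ._≟_ using (_∈?_)

  spare : ∀ {l} F → Unique l → length F < length l → ∃[ a ] a ∈ l × a ∉ F
  spare {l} F l! lt with Any.any? (λ a → ¬? (a ∈? F)) l
  ... | yes some = find some
    where open import Data.List.Membership.Propositional using (find)
  ... | no none = ⊥-elim (ℕₚ.<⇒≱ lt (unique-⊆-length l! covered))
    where
    covered : ∀ {a} → a ∈ l → a ∈ F
    covered {a} m with a ∈? F
    ... | yes m′ = m′
    ... | no n = ⊥-elim (none (Any.map (λ { refl → n }) m))

  -- Inclusion and exclusion inside `F`.
  ∩-large : ∀ {l m F} → Unique l → Unique m → (∀ {a} → a ∈ l → a ∈ F) → (∀ {a} → a ∈ m → a ∈ F) →
    length l + length m ≤ ∣ l ∩ m ∣ + length F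
  ∩-large {l} {m} {F} l! m! l⊆ m⊆ = begin
    length l + length m                              ≤⟨ ℕₚ.+-monoˡ-≤ (length m) (unique-⊆-length l! split) ⟩
    length (filter (_∈? m) l ++ rest) + length m     ≡⟨ cong (_+ length m) (length-++ (filter (_∈? m) l)) ⟩
    ∣ l ∩ m ∣ + length rest + length m               ≡⟨ ℕₚ.+-assoc ∣ l ∩ m ∣ (length rest) (length m) ⟩
    ∣ l ∩ m ∣ + (length rest + length m)             ≡⟨ cong (∣ l ∩ m ∣ +_) (length-++ rest) ⟨
    ∣ l ∩ m ∣ + length (rest ++ m)                   ≤⟨ ℕₚ.+-monoʳ-≤ ∣ l ∩ m ∣ (unique-⊆-length (Uniqueₚ.++⁺ (Uniqueₚ.filter⁺ ∉? l!) m! disjoint) union) ⟩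
    ∣ l ∩ m ∣ + length F                             ∎
    where
    open ℕₚ.≤-Reasoning
    ∉? = λ a → ¬? (a ∈? m)
    rest = filter ∉? l
    split : ∀ {a} → a ∈ l → a ∈ filter (_∈? m) l ++ rest
    split {a} p with a ∈? m
    ... | yes q = ∈-++⁺ˡ (∈-filter⁺ (_∈? m) p q)
    ... | no q = ∈-++⁺ʳ (filter (_∈? m) l) (∈-filter⁺ ∉? p q)
    disjoint : ∀ {a} → ¬ (a ∈ rest × a ∈ m)
    disjoint (p , q) = proj₂ (∈-filter⁻ ∉? {xs = l} p) q
    union : ∀ {a} → a ∈ rest ++ m → a ∈ F
    union p with ∈-++⁻ rest p
    ... | inj₁ q = l⊆ (proj₁ (∈-filter⁻ ∉? {xs = l} q))
    ... | inj₂ q = m⊆ q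

  -- Take some b in l outside F. If neither b nor another choice worked, both lists would lie in b ∷
  -- F, which has at most k elements; they would then share at least k ≥ 2 colours.
  spare-pair : ∀ {k l m} F → IsKSet k l → IsKSet k m → ∣ l ∩ m ∣ ≤ 1 → 2 ≤ k → length F < k →
    ∃[ b ] ∃[ c ] b ∈ l × c ∈ m × b ∉ F × c ∉ F × b ≢ c
  spare-pair {k} {l} {m} F (l! , refl) (m! , m≡) few 2≤k lt with spare F l! lt
  ... | b , b∈ , b∉ with All.all? (_∈? (b ∷ F)) m
  ...   | no n = let (c , c∈ , c∉) = find (¬All⇒Any¬ (_∈? (b ∷ F)) m n) in b , c , b∈ , c∈ , b∉ , c∉ ∘ there , λ e → c∉ (here (sym e))
    where
    open import Data.List.Membership.Propositional using (find)
    open import Data.List.Relation.Unary.All.Properties using (¬All⇒Any¬)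
  ...   | yes m⊆ with All.all? (_∈? (b ∷ F)) l
  ...     | yes l⊆ = ⊥-elim (ℕₚ.<⇒≱ 2≤k (ℕₚ.+-cancelʳ-≤ (length l) _ _ (begin
      length l + length l            ≡⟨ cong (length l +_) m≡ ⟨
      length l + length m            ≤⟨ ∩-large l! m! (All.lookup l⊆) (All.lookup m⊆) ⟩
      ∣ l ∩ m ∣ + length (b ∷ F)     ≤⟨ ℕₚ.+-mono-≤ few lt ⟩
      1 + length l                   ∎)))
    where open ℕₚ.≤-Reasoning
  ...     | no n with spare F m! (subst (length F <_) (sym m≡) lt) | find (¬All⇒Any¬ (_∈? (b ∷ F)) l n)
    where
    open import Data.List.Membership.Propositional using (find)
    open import Data.List.Relation.Unary.All.Properties using (¬All⇒Any¬)
  ...       | c , c∈ , c∉ | b′ , b′∈ , b′∉ = b′ , c , b′∈ , c∈ , b′∉ ∘ there , c∉ , differ (All.lookup m⊆ c∈)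
    where
    differ : c ∈ b ∷ F → b′ ≢ c
    differ (here e) e′ = b′∉ (here (trans e′ e))
    differ (there c∈F) _ = c∉ c∈F

  module _ (h : ℕ) (second : Bool) where

    private
      G = fan h second true
      V = Graph.Vertex G
      low = lower h second true
      upp = upper h second true

    -- Hubs may be coloured arbitrarily. Partners then avoid the colours of the hubs joined to them,
    -- fewer than k, and each other.
    fan-sep-choosable : ∀ k → 2 ≤ k → (if second then 2 else 1) < k → SepChoosable G k
    fan-sep-choosable k 2≤k enough L isList sep = φ , (λ e → proper (view-edge h second true e)) , from
      where
      at-hub : ∀ v → ∃[ a ] a ∈ L v × a ∉ []
      at-hub v = spare [] (proj₁ (isList v)) (subst (0 <_) (sym (proj₂ (isList v))) (ℕₚ.<-trans (s≤s z≤n) 2≤k))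
      hub-colour : Bool → ℕ
      hub-colour s = proj₁ (at-hub (hub h second true s))
      taken : Bool → List ℕ
      taken true  = hub-colour false ∷ hub-colour true ∷ []
      taken false = hub-colour false ∷ []
      F = taken second
      F-length : ∀ s → length (taken s) ≡ (if s then 2 else 1)
      F-length true = refl
      F-length false = refl
      at : Fin h × Fin 2 → V
      at (q , r) = spoke h second true (combine q r)
      pair : ∀ q → ∃[ b ] ∃[ c ] b ∈ L (at (q , zero)) × c ∈ L (at (q , suc zero)) × b ∉ F × c ∉ F × b ≢ c
      pair q = spare-pair F (isList _) (isList _) (sep (Graph.edge _ _ ordered (Equivalence.from T-≡ (bar-adjacent h second true q refl)))) 2≤k (subst (_< k) (sym (F-length second)) enough)
        where
        ordered : at (q , zero) Fin.< at (q , suc zero)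
        ordered = s≤s (s≤s (ℕₚ.≤-reflexive (sym (upper-value h second true q))))
      col : Fin h × Fin 2 → ℕ
      col (q , zero) = proj₁ (pair q)
      col (q , suc zero) = proj₁ (proj₂ (pair q))
      col-from : ∀ p → col p ∈ L (at p)
      col-from (q , zero) = proj₁ (proj₂ (proj₂ (pair q)))
      col-from (q , suc zero) = proj₁ (proj₂ (proj₂ (proj₂ (pair q))))
      col∉ : ∀ p → col p ∉ F
      col∉ (q , zero) = proj₁ (proj₂ (proj₂ (proj₂ (proj₂ (pair q)))))
      col∉ (q , suc zero) = proj₁ (proj₂ (proj₂ (proj₂ (proj₂ (proj₂ (pair q))))))
      φ : V → ℕ
      φ zero = hub-colour false
      φ (suc zero) = hub-colour true
      φ (suc (suc i)) = col (remQuot {h} 2 i)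
      from : ∀ v → φ v ∈ L v
      from zero = proj₁ (proj₂ (at-hub (hub h second true false)))
      from (suc zero) = proj₁ (proj₂ (at-hub (hub h second true true)))
      from (suc (suc i)) = subst (λ j → col (remQuot {h} 2 i) ∈ L (spoke h second true j)) (Finₚ.combine-remQuot {h} 2 i) (col-from (remQuot {h} 2 i))
      hub∈ : ∀ s {b} → (s ≡ true → b ≡ true) → φ (hub h second true s) ∈ taken b
      hub∈ false {true} _ = here refl
      hub∈ false {false} _ = here refl
      hub∈ true joined rewrite joined refl = there (here refl)
      proper : ∀ {x y} → View h second true x y → φ x ≢ φ y
      proper (arm s i joined) e = col∉ (remQuot {h} 2 i) (subst (_∈ F) e (hub∈ s joined))
      proper (bar q _) e = proj₂ (proj₂ (proj₂ (proj₂ (proj₂ (proj₂ (pair q)))))) (begin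
        col (q , zero)                    ≡⟨ cong col (Finₚ.remQuot-combine {h} {2} q zero) ⟨
        col (remQuot {h} 2 (low q))       ≡⟨ e ⟩
        col (remQuot {h} 2 (upp q))       ≡⟨ cong col (Finₚ.remQuot-combine {h} {2} q (suc zero)) ⟩
        col (q , suc zero)                ∎)
        where open ≡-Reasoning

  -- Four spokes are single inner vertices of four paths between the hubs.
  fan-not-sep-choosable : ∀ h paired → ¬ SepChoosable (fan (2 + h) true paired) 2
  fan-not-sep-choosable h paired = BadConfigs.Quadruple.bad-separated G (Graph.adj G) (λ a → a) (Graph.adj-sym G) (Graph.adj-irrefl G)
      zero (suc zero) (spokes zero) (spokes (suc zero)) (spokes (suc (suc zero))) (spokes (suc (suc (suc zero))))
      (refl , refl) (refl , refl) (refl , refl) (refl , refl)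
      (((λ ()) ∷ (λ ()) ∷ (λ ()) ∷ (λ ()) ∷ (λ ()) ∷ []) ∷ ((λ ()) ∷ (λ ()) ∷ (λ ()) ∷ (λ ()) ∷ []) ∷ ((λ ()) ∷ (λ ()) ∷ (λ ()) ∷ []) ∷ ((λ ()) ∷ (λ ()) ∷ []) ∷ ((λ ()) ∷ []) ∷ [] ∷ [])
      (λ ()) (λ ()) (λ ()) (λ ())
    where
    G = fan (2 + h) true paired
    spokes : Fin (4 + h ℕ.* 2) → List (Graph.Vertex G)
    spokes i = suc (suc i) ∷ []

  -- The figure eight consists of triangles. Partners receive equal lists, which adapted colourings
  -- allow and separation would not.
  bowtie-not-adaptable : ¬ AdaptablyChoosable (fan 2 false true) 2
  bowtie-not-adaptable = bad-adapted (FigureEight.bad zero (x zero ∷ x (suc zero) ∷ []) (x (suc (suc zero)) ∷ x (suc (suc (suc zero))) ∷ [])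
      (refl , refl , refl) (refl , refl , refl)
      (((λ ()) ∷ (λ ()) ∷ (λ ()) ∷ (λ ()) ∷ []) ∷ ((λ ()) ∷ (λ ()) ∷ (λ ()) ∷ []) ∷ ((λ ()) ∷ (λ ()) ∷ []) ∷ ((λ ()) ∷ []) ∷ [] ∷ [])
      ℕₚ.≤-refl ℕₚ.≤-refl)
    where
    G = fan 2 false true
    open BadConfigs G (Graph.adj G) (λ a → a) (Graph.adj-sym G) (Graph.adj-irrefl G)
    x : Fin 4 → Graph.Vertex G
    x = spoke 2 false true

  -- The pairs of spokes correspond to the pairs of colours at the two hubs.
  fan-not-adaptable : ¬ AdaptablyChoosable (fan 9 true true) 3
  fan-not-adaptable ad = proj₁ (proj₂ solution) barred (trans (sixes zero) (sym (sixes (suc zero))) , sixes (suc zero))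
    where
    G = fan 9 true true
    open Graph G using (Vertex; Edge; edge; end₁; end₂)
    goal : Fin 18 → Fin 3 × Fin 3
    goal i = remQuot {3} 3 (proj₁ (remQuot {9} 2 i))
    -- An edge from a hub bars the hub colour that the spoke stands for, and the edge between
    -- partners bars 6. The partners that stand for the actual colours of both hubs are left with 6
    -- alone.
    mark : Vertex → Vertex → ℕ
    mark zero       (suc (suc i)) = toℕ (proj₁ (goal i))
    mark (suc zero) (suc (suc i)) = 3 + toℕ (proj₂ (goal i))
    mark _          _             = 6
    colours : Fin 3 × Fin 3 → List ℕ
    colours (a , b) = toℕ a ∷ 3 + toℕ b ∷ 6 ∷ []
    L : Vertex → List ℕ
    L zero          = 0 ∷ 1 ∷ 2 ∷ []
    L (suc zero)    = 3 ∷ 4 ∷ 5 ∷ []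
    L (suc (suc i)) = colours (goal i)
    distinct : ∀ p → Unique (colours p)
    distinct (a , b) = (ℕₚ.<⇒≢ (ℕₚ.<-≤-trans (Finₚ.toℕ<n a) (ℕₚ.m≤m+n 3 (toℕ b))) ∷ ℕₚ.<⇒≢ (ℕₚ.<-trans (Finₚ.toℕ<n a) (ℕₚ.m≤m+n 4 2)) ∷ []) ∷
      (ℕₚ.<⇒≢ (ℕₚ.+-monoʳ-< 3 (Finₚ.toℕ<n b)) ∷ []) ∷ [] ∷ []
    isList : ∀ v → IsKSet 3 (L v)
    isList zero = (((λ ()) ∷ (λ ()) ∷ []) ∷ ((λ ()) ∷ []) ∷ [] ∷ []) , refl
    isList (suc zero) = (((λ ()) ∷ (λ ()) ∷ []) ∷ ((λ ()) ∷ []) ∷ [] ∷ []) , refl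
    isList (suc (suc i)) = distinct (goal i) , refl
    solution = ad (λ e → mark (end₁ e) (end₂ e)) L isList
    c = proj₁ solution
    first : c zero ∈ L zero → ∃[ a ] c zero ≡ toℕ {3} a
    first (here e) = zero , e
    first (there (here e)) = suc zero , e
    first (there (there (here e))) = suc (suc zero) , e
    other : c (suc zero) ∈ L (suc zero) → ∃[ b ] c (suc zero) ≡ 3 + toℕ {3} b
    other (here e) = zero , e
    other (there (here e)) = suc zero , e
    other (there (there (here e))) = suc (suc zero) , e
    first-hub = first (proj₂ (proj₂ solution) zero)
    second-hub = other (proj₂ (proj₂ solution) (suc zero))
    q : Fin 9
    q = combine (proj₁ first-hub) (proj₁ second-hub)
    x : Fin 2 → Vertex
    x r = suc (suc (combine q r))
    goal-x : ∀ r → goal (combine q r) ≡ (proj₁ first-hub , proj₁ second-hub)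
    goal-x r = trans (cong (remQuot {3} 3 ∘ proj₁) (Finₚ.remQuot-combine q r)) (Finₚ.remQuot-combine (proj₁ first-hub) (proj₁ second-hub))
    six : ∀ r → c (x r) ∈ colours (goal (combine q r)) → c (x r) ≡ 6
    six r (here e) = ⊥-elim (proj₁ (proj₂ solution) (edge zero (x r) (s≤s z≤n) _)
      (trans (proj₂ first-hub) (sym (trans e (cong (toℕ ∘ proj₁) (goal-x r)))) , e))
    six r (there (here e)) = ⊥-elim (proj₁ (proj₂ solution) (edge (suc zero) (x r) (s≤s (s≤s z≤n)) _)
      (trans (proj₂ second-hub) (sym (trans e (cong (λ p → 3 + toℕ (proj₂ p)) (goal-x r)))) , e))
    six r (there (there (here e))) = e
    sixes : ∀ r → c (x r) ≡ 6
    sixes r = six r (proj₂ (proj₂ solution) (x r))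
    barred : Edge
    barred = edge (x zero) (x (suc zero)) (s≤s (s≤s (ℕₚ.≤-reflexive (sym (upper-value 9 true true q))))) (Equivalence.from T-≡ (bar-adjacent 9 true true q refl))

  -- Without rungs every edge joins a spoke to a hub, so the out-degree of a spoke is the number of
  -- hubs joined to it.
  spokes-outward : ∀ h second → Orientation (fan-adj h second false) (Graph.adj-irrefl (fan h second false)) (Graph.adj-sym (fan h second false)) (if second then 2 else 1)
  spokes-outward h second = record { O = O ; oriented = record { inside = λ {u} {v} → inside u v ; asym = λ {u} {v} → asym u v } ; bounded = bounded ; total = λ {u} {v} → total u v }
    where
    V = Graph.Vertex (fan h second false)
    O : V → V → Bool
    O (suc (suc _)) zero       = true
    O (suc (suc _)) (suc zero) = second
    O _             _          = false
    inside : ∀ u v → O u v ≡ true → fan-adj h second false u v ≡ true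
    inside (suc (suc _)) zero e = e
    inside (suc (suc _)) (suc zero) e = e
    asym : ∀ u v → O u v ≡ true → O v u ≡ false
    asym (suc (suc _)) zero e = refl
    asym (suc (suc _)) (suc zero) e = refl
    count-none : ∀ n → count {n} (λ _ → false) ≡ 0
    count-none zero = refl
    count-none (suc n) = count-none n
    two : ∀ b → suc ((if b then 1 else 0) + 0) ≤ (if b then 2 else 1)
    two true = ℕₚ.≤-refl
    two false = ℕₚ.≤-refl
    bounded : ∀ u → count (O u) ≤ (if second then 2 else 1)
    bounded zero = subst (_≤ (if second then 2 else 1)) (sym (count-none (h ℕ.* 2))) z≤n
    bounded (suc zero) = subst (_≤ (if second then 2 else 1)) (sym (count-none (h ℕ.* 2))) z≤n
    bounded (suc (suc i)) = subst (λ n → suc ((if second then 1 else 0) + n) ≤ (if second then 2 else 1)) (sym (count-none (h ℕ.* 2))) (two second)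
    total : ∀ u v → fan-adj h second false u v ≡ true → O u v ≡ true ⊎ O v u ≡ true
    total zero (suc (suc _)) e = inj₂ refl
    total (suc zero) (suc (suc _)) e = inj₂ e
    total (suc (suc _)) zero e = inj₁ refl
    total (suc (suc _)) (suc zero) e = inj₁ e

-- The possible triples and their realisations.

module Classification where

  open Comparison
  open Conflicts using (oriented⇒conflict-colourable; planar⇒conflict-colourable)
  open Fans
  open Examples
  open Growing using (sep-choosable⇒conflict-colourable; adaptable⇒conflict-colourable)
  open import Data.Fin using (zero; suc)
  open import Data.List using ([]; _∷_)
  open import Data.Nat using (ℕ; zero; suc; _+_; _≤_; z≤n; s≤s)

  -- All that the classification uses about a planar graph; from here on only arithmetic is left.
  record Bounds (i j k : ℕ) : Set where
    field
      i≤j     : i ≤ j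
      j≤k     : j ≤ k
      k≤4     : k ≤ 4
      i≡1⇒k≤1 : i ≡ 1 → k ≤ 1
      i≡2⇒k≤3 : i ≡ 2 → k ≤ 3
      j≡2⇒k≤2 : j ≡ 2 → k ≤ 2

  bounds : ∀ {i j k} G → Planar G → IsSepChoosability G i → IsAdaptableChoosability G j → IsSingleConflictNumber G k → Bounds i j k
  bounds G planar (1≤i , sep , i-least) (1≤j , ad , j-least) (s≤s z≤n , conf , k-least) = record
    { i≤j = i-least _ 1≤j (adaptable⇒sep-choosable G ad)
    ; j≤k = j-least _ (s≤s z≤n) (conflict-colourable⇒adaptable G conf)
    ; k≤4 = k-least 4 (s≤s z≤n) (planar⇒conflict-colourable G planar)
    ; i≡1⇒k≤1 = λ { refl → k-least 1 (s≤s z≤n) (edgeless⇒conflict-colourable-1 G (sep-choosable-1⇒edgeless G sep)) }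
    ; i≡2⇒k≤3 = λ { refl → k-least 3 (s≤s z≤n) (sep-choosable⇒conflict-colourable G sep) }
    ; j≡2⇒k≤2 = λ { refl → k-least 2 (s≤s z≤n) (adaptable⇒conflict-colourable G ad) } }

  Triples : ℕ × ℕ × ℕ → Set
  Triples t = t ∈ (1 , 1 , 1) ∷ (2 , 2 , 2) ∷ (2 , 3 , 3) ∷ (3 , 3 , 3) ∷ (3 , 4 , 4) ∷ []

  -- For i ≥ 3 the triple is a monotone sequence of values 3 and 4. There are four of them, and two
  -- are excluded.
  classify : ∀ i j k → 1 ≤ i → Bounds i j k → (i , j , k) ∉ ((3 , 3 , 4) ∷ (4 , 4 , 4) ∷ []) → Triples (i , j , k)
  classify 1 j k _ b n with Bounds.i≤j b | Bounds.j≤k b | Bounds.i≡1⇒k≤1 b refl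
  ... | s≤s z≤n | s≤s z≤n | s≤s z≤n = here refl
  classify 2 2 k _ b n with Bounds.j≤k b | Bounds.j≡2⇒k≤2 b refl
  ... | s≤s (s≤s z≤n) | s≤s (s≤s z≤n) = there (here refl)
  classify 2 (suc (suc (suc j))) k _ b n with Bounds.j≤k b | Bounds.i≡2⇒k≤3 b refl
  ... | s≤s (s≤s (s≤s z≤n)) | s≤s (s≤s (s≤s z≤n)) = there (there (here refl))
  classify 2 1 k _ b n with Bounds.i≤j b
  ... | s≤s ()
  classify (suc (suc (suc i))) (suc (suc (suc j))) (suc (suc (suc k))) _ b n =
    above (drop (Bounds.i≤j b)) (drop (Bounds.j≤k b)) (drop (Bounds.k≤4 b)) n
    where
    drop : ∀ {a b} → 3 + a ≤ 3 + b → a ≤ b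
    drop (s≤s (s≤s (s≤s p))) = p
    above : ∀ {i j k} → i ≤ j → j ≤ k → k ≤ 1 → (3 + i , 3 + j , 3 + k) ∉ ((3 , 3 , 4) ∷ (4 , 4 , 4) ∷ []) → Triples (3 + i , 3 + j , 3 + k)
    above z≤n       z≤n       z≤n       n = there (there (there (here refl)))
    above z≤n       z≤n       (s≤s z≤n) n = ⊥-elim (n (here refl))
    above z≤n       (s≤s z≤n) (s≤s z≤n) n = there (there (there (there (here refl))))
    above (s≤s z≤n) (s≤s z≤n) (s≤s z≤n) n = ⊥-elim (n (there (here refl)))
  classify (suc (suc (suc i))) 0 k _ b n with Bounds.i≤j b
  ... | ()
  classify (suc (suc (suc i))) 1 k _ b n with Bounds.i≤j b
  ... | s≤s ()
  classify (suc (suc (suc i))) 2 k _ b n with Bounds.i≤j b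
  ... | s≤s (s≤s ())
  classify (suc (suc (suc i))) (suc (suc (suc j))) 0 _ b n with Bounds.j≤k b
  ... | ()
  classify (suc (suc (suc i))) (suc (suc (suc j))) 1 _ b n with Bounds.j≤k b
  ... | s≤s ()
  classify (suc (suc (suc i))) (suc (suc (suc j))) 2 _ b n with Bounds.j≤k b
  ... | s≤s (s≤s ())

  Realised : ℕ × ℕ × ℕ → Set
  Realised (i , j , k) = ∃[ G ] (Planar G × IsSepChoosability G i × IsAdaptableChoosability G j × IsSingleConflictNumber G k)

  -- The last two entries agree in all five triples, so an upper bound for the conflict number and a
  -- lower bound for adaptable choosability determine both.
  realised : ∀ {i j} G → Planar G →
    SepChoosable G (suc i) → (∀ m → 1 ≤ m → SepChoosable G m → suc i ≤ m) →
    ConflictColourable G (suc j) → (∀ m → 1 ≤ m → AdaptablyChoosable G m → suc j ≤ m) →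
    Realised (suc i , suc j , suc j)
  realised G planar sep sep-least conf ad-least = G , planar , (s≤s z≤n , sep , sep-least) ,
    (s≤s z≤n , conflict-colourable⇒adaptable G conf , ad-least) ,
    (s≤s z≤n , conf , λ { (suc m) _ c → ad-least (suc m) (s≤s z≤n) (conflict-colourable⇒adaptable G c) })

  module _ {P : ℕ → Set} where

    at-least-2 : ¬ P 1 → ∀ m → 1 ≤ m → P m → 2 ≤ m
    at-least-2 ¬1 1 _ p = ⊥-elim (¬1 p)
    at-least-2 _ (suc (suc m)) _ _ = s≤s (s≤s z≤n)

    at-least-3 : ¬ P 1 → ¬ P 2 → ∀ m → 1 ≤ m → P m → 3 ≤ m
    at-least-3 ¬1 ¬2 1 _ p = ⊥-elim (¬1 p)
    at-least-3 ¬1 ¬2 2 _ p = ⊥-elim (¬2 p)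
    at-least-3 _ _ (suc (suc (suc m))) _ _ = s≤s (s≤s (s≤s z≤n))

    at-least-4 : ¬ P 1 → ¬ P 2 → ¬ P 3 → ∀ m → 1 ≤ m → P m → 4 ≤ m
    at-least-4 ¬1 ¬2 ¬3 1 _ p = ⊥-elim (¬1 p)
    at-least-4 ¬1 ¬2 ¬3 2 _ p = ⊥-elim (¬2 p)
    at-least-4 ¬1 ¬2 ¬3 3 _ p = ⊥-elim (¬3 p)
    at-least-4 _ _ _ (suc (suc (suc (suc m)))) _ _ = s≤s (s≤s (s≤s (s≤s z≤n)))

  fan-has-edge : ∀ h second paired → Graph.Edge (fan (suc h) second paired)
  fan-has-edge h second paired = Graph.edge zero (suc (suc zero)) (s≤s z≤n) _

  ¬sep-1 : ∀ h second paired → ¬ SepChoosable (fan (suc h) second paired) 1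
  ¬sep-1 h second paired sep = sep-choosable-1⇒edgeless (fan (suc h) second paired) sep (fan-has-edge h second paired)

  realise : ∀ {t} → Triples t → Realised t
  -- Two isolated vertices.
  realise (here refl) = realised G (fan-planar 0 false false) (adaptable⇒sep-choosable G (conflict-colourable⇒adaptable G conf)) (λ _ 1≤m _ → 1≤m)
      conf (λ _ 1≤m _ → 1≤m)
    where
    G = fan 0 false false
    none : ∀ {x y} → ¬ View 0 false false x y
    none (arm _ () _)
    none (bar () _)
    conf : ConflictColourable G 1
    conf = edgeless⇒conflict-colourable-1 G λ e → none (view-edge 0 false false e)
  -- A path with two edges and an isolated vertex.
  realise (there (here refl)) = realised G (fan-planar 1 false false) (adaptable⇒sep-choosable G (conflict-colourable⇒adaptable G conf)) (at-least-2 (¬sep-1 0 false false))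
      conf (at-least-2 (¬sep-1 0 false false ∘ adaptable⇒sep-choosable G))
    where
    G = fan 1 false false
    conf : ConflictColourable G 2
    conf = oriented⇒conflict-colourable G (spokes-outward 1 false)
  -- The bowtie, two triangles sharing a hub, and an isolated vertex.
  realise (there (there (here refl))) = realised G (fan-planar 2 false true) sep (at-least-2 (¬sep-1 1 false true))
      (sep-choosable⇒conflict-colourable G sep) (at-least-3 (¬sep-1 1 false true ∘ adaptable⇒sep-choosable G) bowtie-not-adaptable)
    where
    G = fan 2 false true
    sep : SepChoosable G 2
    sep = fan-sep-choosable 2 false 2 (s≤s (s≤s z≤n)) (s≤s (s≤s z≤n))
  -- The complete bipartite graph with parts of size 2 and 4.
  realise (there (there (there (here refl)))) = realised G (fan-planar 2 true false) (adaptable⇒sep-choosable G (conflict-colourable⇒adaptable G conf)) (at-least-3 (¬sep-1 1 true false) ¬sep-2)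
      conf (at-least-3 (¬sep-1 1 true false ∘ adaptable⇒sep-choosable G) (¬sep-2 ∘ adaptable⇒sep-choosable G))
    where
    G = fan 2 true false
    ¬sep-2 = fan-not-sep-choosable 0 false
    conf : ConflictColourable G 3
    conf = oriented⇒conflict-colourable G (spokes-outward 2 true)
  -- Nine pairs of partners, one for each pair of colours at the hubs when lists have size 3.
  realise (there (there (there (there (here refl))))) = realised G (fan-planar 9 true true)
      (fan-sep-choosable 9 true 3 (s≤s (s≤s z≤n)) (s≤s (s≤s (s≤s z≤n)))) (at-least-3 (¬sep-1 8 true true) ¬sep-2)
      (planar⇒conflict-colourable G (fan-planar 9 true true))
      (at-least-4 (¬sep-1 8 true true ∘ adaptable⇒sep-choosable G) (¬sep-2 ∘ adaptable⇒sep-choosable G) fan-not-adaptable)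
    where
    G = fan 9 true true
    ¬sep-2 = fan-not-sep-choosable 7 true

open Classification using (classify; bounds; realise)
open import Data.List using ([]; _∷_)
open import Data.Nat using (ℕ; _≤_)

corollary4p8 : ∀ (i j k : ℕ) → 1 ≤ i → 1 ≤ j → 1 ≤ k →
  (i , j , k) ∉ ((3 , 3 , 4) ∷ (4 , 4 , 4) ∷ []) →
  (∃[ G ] (Planar G × IsSepChoosability G i × IsAdaptableChoosability G j × IsSingleConflictNumber G k))
    ⇔
  ((i , j , k) ∈ ((1 , 1 , 1) ∷ (2 , 2 , 2) ∷ (2 , 3 , 3) ∷ (3 , 3 , 3) ∷ (3 , 4 , 4) ∷ []))
corollary4p8 i j k 1≤i _ _ n = mk⇔ (λ { (G , planar , sep , ad , conf) → classify i j k 1≤i (bounds G planar sep ad conf) n }) realise
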